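{- Let $S$ be a set of four points chosen independently and uniformly at random from the unit square $[0,1]\times[0,1]$. Join every pair of points of $S$ with a straight line segment (an edge). Color each such edge red if it has positive slope and blue otherwise. Then the probability that $S$ defines a pair of crossing edges of the same color is equal to $1/4$.
   Context: Two edges cross if they intersect in their interiors. With the coloring convention used, horizontal edges (slope $0$) and vertical edges (undefined slope) are blue. -}

module Defs where

open import Algebra.Bundles using (CommutativeRing)
open import Data.Fin.Base as Fin using (Fin; toℕ)
open import Data.Nat.Base as ℕ using (ℕ)
open import Data.Product.Base using (Σ-syntax; ∃-syntax; _×_; _,_)
open import Data.Vec.Functional using (Vector)
open import Level using (0ℓ)
open import Relation.Binary.Core using (Rel)
open import Relation.Binary.PropositionalEquality.Core using (_≢_)
open import Relation.Binary.Structures using (IsStrictTotalOrder)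
open import Relation.Nullary.Negation.Core using (¬_)
open import Relation.Unary using (Pred; _∈_; _≐_; _≬_; U; ∁; ⋃; ⋂; _⊢_; Satisfiable)

import Algebra.Definitions.RawMonoid as RawMonoidDefs
import Relation.Binary.Construct.StrictToNonStrict as StrictToNonStrict

-- The real numbers, given by the axioms that determine them up to isomorphism
-- in classical mathematics.
record CompleteOrderedField : Set₁ where
  infix  8 _⁻¹
  infix  4 _<_
  field
    commutativeRing : CommutativeRing 0ℓ 0ℓ

  open CommutativeRing commutativeRing public

  field
    -- Total, with an unspecified value at 0#.
    _⁻¹                : Carrier → Carrier
    *-inverseʳ         : ∀ {x} → ¬ (x ≈ 0#) → x * x ⁻¹ ≈ 1#
    _<_                : Rel Carrier 0ℓ
    isStrictTotalOrder : IsStrictTotalOrder _≈_ _<_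
    0<1                : 0# < 1#
    +-monoˡ-<          : ∀ {x y} z → x < y → x + z < y + z
    *-pos              : ∀ {x y} → 0# < x → 0# < y → 0# < x * y

  open StrictToNonStrict _≈_ _<_ public using (_≤_)

  UpperBound : Pred Carrier 0ℓ → Pred Carrier 0ℓ
  UpperBound A b = ∀ x → x ∈ A → x ≤ b

  field
    supremum : (A : Pred Carrier 0ℓ) → Satisfiable A → Satisfiable (UpperBound A) →
               ∃[ s ] (UpperBound A s × (∀ b → UpperBound A b → s ≤ b))

  ∑ ∏ : ∀ {n} → Vector Carrier n → Carrier
  ∑ = RawMonoidDefs.sum +-rawMonoid
  ∏ = RawMonoidDefs.sum *-rawMonoid

  _⟶_ : (ℕ → Carrier) → Carrier → Set
  s ⟶ l = ∀ ε → 0# < ε → ∃[ N ] ∀ n → N ℕ.≤ n → (l - ε < s n) × (s n < l + ε)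

  ¼ : Carrier
  ¼ = (1# + 1# + 1# + 1#) ⁻¹

module Plane (ℝ : CompleteOrderedField) where
  open CompleteOrderedField ℝ

  Point : Set
  Point = Carrier × Carrier

  infix 4 _≈ₚ_
  _≈ₚ_ : Rel Point 0ℓ
  (x , y) ≈ₚ (x′ , y′) = (x ≈ x′) × (y ≈ y′)

  Rectangle : (a b c d : Carrier) → Pred Point 0ℓ
  Rectangle a b c d (x , y) = ((a ≤ x) × (x ≤ b)) × ((c ≤ y) × (y ≤ d))

  data Borel : Pred Point 0ℓ → Set₁ where
    rectangle  : ∀ a b c d → Borel (Rectangle a b c d)
    complement : ∀ {B} → Borel B → Borel (∁ B)
    union      : {B : ℕ → Pred Point 0ℓ} → (∀ n → Borel (B n)) → Borel (⋃ ℕ B)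
    resp       : ∀ {B C} → B ≐ C → Borel B → Borel C

  Interior : Point → Point → Pred Point 0ℓ
  Interior (x₁ , y₁) (x₂ , y₂) z =
    ∃[ t ] (0# < t) × (t < 1#) ×
           (z ≈ₚ (x₁ + t * (x₂ - x₁) , y₁ + t * (y₂ - y₁)))

  PositiveSlope : Rel Point 0ℓ
  PositiveSlope (x₁ , y₁) (x₂ , y₂) =
    ¬ (x₁ ≈ x₂) × (0# < (y₂ - y₁) * (x₂ - x₁) ⁻¹)

  data Colour : Set where
    red blue : Colour

  HasColour : Colour → Rel Point 0ℓ
  HasColour red  p q = PositiveSlope p q
  HasColour blue p q = ¬ PositiveSlope p q

  -- Each unordered pair of indices, listed once.
  Edge : ℕ → Set
  Edge n = Σ[ i ∈ Fin n ] Σ[ j ∈ Fin n ] (i Fin.< j)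

  module _ {n} (p : Vector Point n) where

    Cross : Rel (Edge n) 0ℓ
    Cross (i , j , _) (k , l , _) = Interior (p i) (p j) ≬ Interior (p k) (p l)

    SameColour : Rel (Edge n) 0ℓ
    SameColour (i , j , _) (k , l , _) =
      ∃[ c ] HasColour c (p i) (p j) × HasColour c (p k) (p l)

    HasMonochromaticCrossing : Set
    HasMonochromaticCrossing = ∃[ e ] ∃[ f ] (e ≢ f) × Cross e f × SameColour e f

record ProbabilitySpace (ℝ : CompleteOrderedField) : Set₂ where
  open CompleteOrderedField ℝ
  field
    Ω          : Set
    Measurable : Pred Ω 0ℓ → Set₁
    resp       : ∀ {A B} → A ≐ B → Measurable A → Measurable B
    whole      : Measurable U
    complement : ∀ {A} → Measurable A → Measurable (∁ A)
    union      : {A : ℕ → Pred Ω 0ℓ} → (∀ n → Measurable (A n)) → Measurable (⋃ ℕ A)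

    ℙ          : ∀ {A} → Measurable A → Carrier
    ℙ-cong     : ∀ {A B} (a : Measurable A) (b : Measurable B) → A ≐ B → ℙ a ≈ ℙ b
    ℙ-nonNeg   : ∀ {A} (a : Measurable A) → 0# ≤ ℙ a
    ℙ-whole    : ℙ whole ≈ 1#
    ℙ-union    : {A : ℕ → Pred Ω 0ℓ} (a : ∀ n → Measurable (A n)) →
                 (∀ {m n} → m ≢ n → ¬ (A m ≬ A n)) →
                 (λ n → ∑ {n} (λ i → ℙ (a (toℕ i)))) ⟶ ℙ (union a)

module Random {ℝ : CompleteOrderedField} (𝓟 : ProbabilitySpace ℝ) where
  open CompleteOrderedField ℝ
  open Plane ℝ
  open ProbabilitySpace 𝓟

  record RandomPoint : Set₁ where
    field
      value      : Ω → Point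
      measurable : ∀ {B} → Borel B → Measurable (value ⊢ B)

  open RandomPoint public

  -- The joint event is always measurable classically, and ℙ does not depend on
  -- the proof (ℙ-cong), so quantifying over m adds nothing.  Subfamilies are
  -- covered by taking some of the B i to be the whole plane.
  Independent : ∀ {n} → Vector RandomPoint n → Set₁
  Independent {n} Z =
    (B : Fin n → Pred Point 0ℓ) (b : ∀ i → Borel (B i))
    (m : Measurable (⋂ (Fin n) (λ i → value (Z i) ⊢ B i))) →
    ℙ m ≈ ∏ (λ i → ℙ (measurable (Z i) (b i)))

  -- The law is Lebesgue measure on [0,1]²: it is determined by its values on
  -- the closed subrectangles, a π-system containing the square itself and
  -- generating its Borel sets.
  UniformOnUnitSquare : RandomPoint → Set
  UniformOnUnitSquare Z =
    ∀ a b c d → 0# ≤ a → a ≤ b → b ≤ 1# → 0# ≤ c → c ≤ d → d ≤ 1# →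
    ℙ (measurable Z (rectangle a b c d)) ≈ (b - a) * (d - c)

  MonochromaticCrossing : ∀ {n} → Vector RandomPoint n → Pred Ω 0ℓ
  MonochromaticCrossing Z ω = HasMonochromaticCrossing (λ i → value (Z i) ω)

{-# OPTIONS --safe #-}

-- Cut the unit square into n² cells.  By independence and the union bound, the
-- probability of an event is at most n⁻⁸ times the number of quadruples of
-- cells that it meets; applied to the event and to its complement, this gives
-- the probability up to the proportion of quadruples on which the event is not
-- constant.  Such quadruples contain an almost collinear triple or a pair in
-- neighbouring rows or columns, and their proportion tends to 0, so it remains
-- to count the crossing quadruples of the grid asymptotically.
--
-- A pair of edges of one colour and its crossing are described by the signs of
-- the coordinate differences and orientations of the four points; at most one
-- of the three pairings crosses.  By symmetry, suppose that PQ and RS are red,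
-- and sort the four abscissae and the four ordinates.  With gaps a, b, c and
-- A, B, C, the crossing condition is, depending on the relative order of the
-- points, void, impossible, or of one of three kinds:
--   * the slopes A/a, B/b, C/c are monotone;
--   * A/a and C/c lie on one side of (A+B+C)/(a+b+c);
--   * A/(A+B) < a/(a+b+c), up to renaming.
-- Permuting the gaps cyclically shows that the first two have density 1/3,
-- because of three nonzero numbers that are not all of one sign exactly one
-- pair has equal signs.  For the third, A is equidistributed for given A + B,
-- and the three values of the right-hand side add up to 1.

module Submission where

open import Defs
open import Axiom.ExcludedMiddle using (ExcludedMiddle)
import Algebra.Properties.AbelianGroup as AbelianGroupProperties
import Algebra.Properties.Ring as RingProperties
import Algebra.Properties.Semiring.Exp.TCOptimised as ExpProperties
import Algebra.Properties.Semiring.Mult as MultProperties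
import Algebra.Properties.Semiring.Mult.TCOptimised as MultTCProperties
open import Data.Bool.Base using (Bool; true; false)
open import Data.Empty using (⊥; ⊥-elim)
open import Data.Fin.Base as Fin using (Fin)
open import Data.Fin.Patterns using (0F; 1F; 2F; 3F)
open import Data.Integer.Base as ℤ using (ℤ)
import Data.Integer.Properties as ℤₚ
open import Data.Maybe.Base using (nothing)
import Data.Nat.Base as Nat
open import Data.Nat.Base as ℕ using (ℕ; zero; suc; z≤n; s≤s; _^_)
import Data.Nat.Properties as ℕₚ
open import Data.Nat.Tactic.RingSolver using (solve-∀)
open import Data.Product.Base using (Σ-syntax; ∃-syntax; _×_; _,_; proj₁; proj₂)
open import Data.Sum.Base using (_⊎_; inj₁; inj₂; [_,_]′)
open import Data.Vec.Base using (Vec)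
open import Data.Vec.Functional using (Vector; []; _∷_)
open import Function.Base using (_∘_; id)
open import Level using (0ℓ)
open import Relation.Binary.Definitions using (tri<; tri≈; tri>)
open import Relation.Binary.PropositionalEquality as ≡ using (_≡_; _≢_)
open import Relation.Binary.Structures using (IsStrictTotalOrder)
open import Relation.Nullary.Decidable.Core using (Dec; yes; no)
open import Relation.Nullary.Negation.Core using (¬_)
open import Relation.Unary using (Pred; _≐_; _≬_; U; ∁; ⋃; ⋂; _⊢_; _∪_; _∩_; _⊆_; ∅)
import Relation.Binary.Construct.StrictToNonStrict as StrictToNonStrict
import Relation.Binary.Reasoning.Setoid as SetoidReasoning
import Relation.Binary.Reflection as Reflection
open import Tactic.RingSolver.Core.AlmostCommutativeRing using (fromCommutativeRing)
open import Tactic.RingSolver.Core.Expression using (Expr; Κ; Ι; _⊕_; _⊗_; ⊝_; _⊛_; module Eval)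
import Tactic.RingSolver.Core.Polynomial.Base as PolynomialBase
import Tactic.RingSolver.Core.Polynomial.Homomorphism as PolynomialHomomorphism
open import Tactic.RingSolver.Core.Polynomial.Parameters using (Homomorphism)
import Tactic.RingSolver.Core.Polynomial.Semantics as PolynomialSemantics

-- The probability space is not assumed complete, so the event has to be shown measurable with all
-- its degenerate configurations: coincident points, axis-parallel edges, collinear edges that
-- overlap. A transversal crossing is a condition on the signs of polynomials; parallel edges that
-- meet also do so at a rational parameter of one of them, which leaves a countable union.
--
-- No integral is formed. The hypotheses give the probabilities of products of closed rectangles,
-- and the union bound asks for no more. The densities are those of lattice quadruples, counted in
-- natural numbers with explicit errors.
--
-- The value arises as follows. For one pairing there are 8 symmetries in the abscissae and 2 in the
-- ordinates. Up to these, and apart from edges of different colours or with disjoint projections,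
-- eight joint orders remain: six of density 1/3, one that never crosses and one that always does, 3
-- in all. Each joint order makes up asymptotically 1/24² of the quadruples, so a pairing has
-- density 16 · 3/576 = 1/12, and three exclusive pairings give 1/4.

-- Polynomial identities with integer coefficients

-- The library's ring solver takes its coefficients from the ring itself, where
-- 1 − 1 does not compute to 0; here the coefficients are integers.
module IntegerRingSolver (ℝ : CompleteOrderedField) where
  open CompleteOrderedField ℝ
  open import Data.Integer.Base using (+_; -[1+_]; +[1+_])
  open AbelianGroupProperties +-abelianGroup using (⁻¹-∙-comm; ε⁻¹≈ε; ⁻¹-involutive)
  open RingProperties ring using (-‿distribˡ-*; -‿distribʳ-*)
  open SetoidReasoning setoid
  private module × = MultTCProperties semiring

  -- The type-checking-optimised multiple makes `fromℤ (+ 1)` reduce to `1#` and `fromℤ (+ 0)` to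
  -- `0#`, so that `:1` and `:0` stand for these constants definitionally in the calls of `solve`.
  fromℤ : ℤ → Carrier
  fromℤ (+ n)    = n ×.× 1#
  fromℤ -[1+ n ] = - (suc n ×.× 1#)

  private
    cancel-step : ∀ x y → (1# + x) - (1# + y) ≈ x - y
    cancel-step x y = begin
      (1# + x) - (1# + y)       ≈⟨ +-cong (+-comm 1# x) (sym (⁻¹-∙-comm 1# y)) ⟩
      (x + 1#) + (- 1# + - y)   ≈⟨ +-assoc x 1# _ ⟩
      x + (1# + (- 1# + - y))   ≈⟨ +-congˡ (sym (+-assoc 1# (- 1#) (- y))) ⟩
      x + ((1# - 1#) + - y)     ≈⟨ +-congˡ (+-congʳ (-‿inverseʳ 1#)) ⟩
      x + (0# + - y)            ≈⟨ +-congˡ (+-identityˡ _) ⟩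
      x - y                     ∎

    fromℤ-⊖ : ∀ m n → fromℤ (m ℤ.⊖ n) ≈ m ×.× 1# - n ×.× 1#
    fromℤ-⊖ zero zero = sym (-‿inverseʳ 0#)
    fromℤ-⊖ zero (suc n) = sym (+-identityˡ _)
    fromℤ-⊖ (suc m) zero = sym (trans (+-congˡ ε⁻¹≈ε) (+-identityʳ _))
    fromℤ-⊖ (suc m) (suc n) = begin
      fromℤ (suc m ℤ.⊖ suc n)              ≡⟨ ≡.cong fromℤ (ℤₚ.[1+m]⊖[1+n]≡m⊖n m n) ⟩
      fromℤ (m ℤ.⊖ n)                      ≈⟨ fromℤ-⊖ m n ⟩
      m ×.× 1# - n ×.× 1#                  ≈⟨ cancel-step _ _ ⟨
      (1# + m ×.× 1#) - (1# + n ×.× 1#)    ≈⟨ +-cong (×.1+× m 1#) (-‿cong (×.1+× n 1#)) ⟨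
      suc m ×.× 1# - suc n ×.× 1#          ∎

    fromℤ-neg : ∀ i → fromℤ (ℤ.- i) ≈ - fromℤ i
    fromℤ-neg (+ zero)  = sym ε⁻¹≈ε
    fromℤ-neg +[1+ n ]  = refl
    fromℤ-neg -[1+ n ]  = sym (⁻¹-involutive _)

    fromℤ-+ : ∀ i j → fromℤ (i ℤ.+ j) ≈ fromℤ i + fromℤ j
    fromℤ-+ (+ m)    (+ n)    = ×.×-homo-+ 1# m n
    fromℤ-+ (+ m)    -[1+ n ] = fromℤ-⊖ m (suc n)
    fromℤ-+ -[1+ m ] (+ n)    = trans (fromℤ-⊖ n (suc m)) (+-comm _ _)
    fromℤ-+ -[1+ m ] -[1+ n ] = begin
      - (suc (suc (m ℕ.+ n)) ×.× 1#)       ≡⟨ ≡.cong (λ k → - (suc k ×.× 1#)) (ℕₚ.+-suc m n) ⟨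
      - ((suc m ℕ.+ suc n) ×.× 1#)         ≈⟨ -‿cong (×.×-homo-+ 1# (suc m) (suc n)) ⟩
      - (suc m ×.× 1# + suc n ×.× 1#)      ≈⟨ ⁻¹-∙-comm _ _ ⟨
      - (suc m ×.× 1#) + - (suc n ×.× 1#)  ∎

    fromℤ-*-pos : ∀ m n → fromℤ (+ m ℤ.* + n) ≈ fromℤ (+ m) * fromℤ (+ n)
    fromℤ-*-pos m n = trans (reflexive (≡.cong fromℤ (≡.sym (ℤₚ.pos-* m n)))) (×.×1-homo-* m n)

    fromℤ-* : ∀ i j → fromℤ (i ℤ.* j) ≈ fromℤ i * fromℤ j
    fromℤ-* (+ m) (+ n) = fromℤ-*-pos m n
    fromℤ-* (+ m) -[1+ n ] = begin
      fromℤ (+ m ℤ.* -[1+ n ])          ≡⟨ ≡.cong fromℤ (ℤₚ.neg-distribʳ-* (+ m) +[1+ n ]) ⟨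
      fromℤ (ℤ.- (+ m ℤ.* +[1+ n ]))    ≈⟨ fromℤ-neg (+ m ℤ.* +[1+ n ]) ⟩
      - fromℤ (+ m ℤ.* +[1+ n ])        ≈⟨ -‿cong (fromℤ-*-pos m (suc n)) ⟩
      - (fromℤ (+ m) * fromℤ +[1+ n ])  ≈⟨ -‿distribʳ-* _ _ ⟩
      fromℤ (+ m) * fromℤ -[1+ n ]      ∎
    fromℤ-* -[1+ m ] (+ n) = begin
      fromℤ (-[1+ m ] ℤ.* + n)          ≡⟨ ≡.cong fromℤ (ℤₚ.neg-distribˡ-* +[1+ m ] (+ n)) ⟨
      fromℤ (ℤ.- (+[1+ m ] ℤ.* + n))    ≈⟨ fromℤ-neg (+[1+ m ] ℤ.* + n) ⟩
      - fromℤ (+[1+ m ] ℤ.* + n)        ≈⟨ -‿cong (fromℤ-*-pos (suc m) n) ⟩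
      - (fromℤ +[1+ m ] * fromℤ (+ n))  ≈⟨ -‿distribˡ-* _ _ ⟩
      fromℤ -[1+ m ] * fromℤ (+ n)      ∎
    fromℤ-* -[1+ m ] -[1+ n ] = begin
      fromℤ (+[1+ m ] ℤ.* +[1+ n ])            ≈⟨ fromℤ-*-pos (suc m) (suc n) ⟩
      fromℤ +[1+ m ] * fromℤ +[1+ n ]          ≈⟨ *-cong (⁻¹-involutive _) refl ⟨
      - (- fromℤ +[1+ m ]) * fromℤ +[1+ n ]    ≈⟨ -‿distribˡ-* _ _ ⟨
      - (- fromℤ +[1+ m ] * fromℤ +[1+ n ])    ≈⟨ -‿distribʳ-* _ _ ⟩
      fromℤ -[1+ m ] * fromℤ -[1+ n ]          ∎

    isZero : ℤ → Bool
    isZero (+ zero) = true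
    isZero _        = false

    homomorphism : Homomorphism 0ℓ 0ℓ 0ℓ 0ℓ
    homomorphism = record
      { from     = record { rawRing = record
          { _≈_ = _≡_ ; _+_ = ℤ._+_ ; _*_ = ℤ._*_ ; -_ = ℤ.-_ ; 0# = + 0 ; 1# = + 1 }
          ; isZero = isZero }
      ; to       = fromCommutativeRing commutativeRing (λ _ → nothing)
      ; morphism = record
          { ⟦_⟧ = fromℤ ; +-homo = fromℤ-+ ; *-homo = fromℤ-* ; -‿homo = fromℤ-neg
          ; 0-homo = refl ; 1-homo = refl }
      ; Zero-C⟶Zero-R = λ { (+ zero) _ → refl }
      }

    open Homomorphism homomorphism using (from)
    open Eval rawRing fromℤ renaming (⟦_⟧ to eval)
    open PolynomialBase from
    open PolynomialSemantics homomorphism renaming (⟦_⟧ to ⟦_⟧ₚ)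
    open PolynomialHomomorphism homomorphism
    open ExpProperties semiring using (^-congˡ)

    norm : ∀ {n} → Expr ℤ n → Poly n
    norm (Κ x)   = κ x
    norm (Ι x)   = ι x
    norm (x ⊕ y) = norm x ⊞ norm y
    norm (x ⊗ y) = norm x ⊠ norm y
    norm (⊝ x)   = ⊟ norm x
    norm (x ⊛ i) = norm x ⊡ i

    evalNorm : ∀ {n} → Expr ℤ n → Vec Carrier n → Carrier
    evalNorm e = ⟦ norm e ⟧ₚ

    correct : ∀ {n} (e : Expr ℤ n) ρ → evalNorm e ρ ≈ eval e ρ
    correct (Κ x)   ρ = κ-hom x ρ
    correct (Ι x)   ρ = ι-hom x ρ
    correct (x ⊕ y) ρ = trans (⊞-hom (norm x) (norm y) ρ) (+-cong (correct x ρ) (correct y ρ))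
    correct (x ⊗ y) ρ = trans (⊠-hom (norm x) (norm y) ρ) (*-cong (correct x ρ) (correct y ρ))
    correct (⊝ x)   ρ = trans (⊟-hom (norm x) ρ) (-‿cong (correct x ρ))
    correct (x ⊛ i) ρ = trans (⊡-hom (norm x) i ρ) (^-congˡ i (correct x ρ))

  open Reflection setoid Ι eval evalNorm correct public using (solve) renaming (_⊜_ to _:=_)

  infixl 6 _⊖_
  _⊖_ : ∀ {n} → Expr ℤ n → Expr ℤ n → Expr ℤ n
  x ⊖ y = x ⊕ ⊝ y

  :0 :1 : ∀ {n} → Expr ℤ n
  :0 = Κ (+ 0)
  :1 = Κ (+ 1)

-- Order, signs and natural numbers in the field

module FieldProperties (ℝ : CompleteOrderedField) where
  open CompleteOrderedField ℝ
  open IntegerRingSolver ℝ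
  open IsStrictTotalOrder isStrictTotalOrder public
    using (compare; irrefl; <-respʳ-≈; <-respˡ-≈; <-resp-≈)
    renaming (trans to <-trans; asym to <-asym)
  private
    module Nonstrict = StrictToNonStrict _≈_ _<_
    module × = MultProperties semiring

  ≤-trans : ∀ {x y z} → x ≤ y → y ≤ z → x ≤ z
  ≤-trans = Nonstrict.trans isEquivalence <-resp-≈ <-trans

  <-≤-trans : ∀ {x y z} → x < y → y ≤ z → x < z
  <-≤-trans = Nonstrict.<-≤-trans <-trans <-respʳ-≈

  ≤-<-trans : ∀ {x y z} → x ≤ y → y < z → x < z
  ≤-<-trans = Nonstrict.≤-<-trans sym <-trans <-respˡ-≈

  ≤-antisym : ∀ {x y} → x ≤ y → y ≤ x → x ≈ y
  ≤-antisym = Nonstrict.antisym isEquivalence <-trans irrefl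

  ≤-respʳ-≈ : ∀ {x y z} → y ≈ z → x ≤ y → x ≤ z
  ≤-respʳ-≈ = Nonstrict.≤-respʳ-≈ trans <-respʳ-≈

  ≤-respˡ-≈ : ∀ {x y z} → y ≈ z → y ≤ x → z ≤ x
  ≤-respˡ-≈ = Nonstrict.≤-respˡ-≈ sym trans <-respˡ-≈

  ≤-refl : ∀ {x} → x ≤ x
  ≤-refl = inj₂ refl

  <⇒≱ : ∀ {x y} → x < y → ¬ (y ≤ x)
  <⇒≱ x<y y≤x = irrefl refl (<-≤-trans x<y y≤x)

  ≮⇒≥ : ∀ {x y} → ¬ (x < y) → y ≤ x
  ≮⇒≥ {x} {y} x≮y with compare x y
  ... | tri< x<y _ _ = ⊥-elim (x≮y x<y)
  ... | tri≈ _ x≈y _ = inj₂ (sym x≈y)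
  ... | tri> _ _ y<x = inj₁ y<x

  ≰⇒> : ∀ {x y} → ¬ (x ≤ y) → y < x
  ≰⇒> {x} {y} x≰y with compare y x
  ... | tri< y<x _ _ = y<x
  ... | tri≈ _ y≈x _ = ⊥-elim (x≰y (inj₂ (sym y≈x)))
  ... | tri> _ _ x<y = ⊥-elim (x≰y (inj₁ x<y))

  pos-resp : ∀ {x y} → x ≈ y → 0# < x → 0# < y
  pos-resp = <-respʳ-≈

  nonneg-resp : ∀ {x y} → x ≈ y → 0# ≤ x → 0# ≤ y
  nonneg-resp = ≤-respʳ-≈

  sub-pos : ∀ {x y} → x < y → 0# < y - x
  sub-pos {x} x<y = <-respˡ-≈ (-‿inverseʳ x) (+-monoˡ-< (- x) x<y)

  pos-sub : ∀ {x y} → 0# < y - x → x < y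
  pos-sub {x} {y} 0<y-x = <-respʳ-≈ (solve 2 (λ x y → y ⊖ x ⊕ x := y) refl x y)
                            (<-respˡ-≈ (+-identityˡ x) (+-monoˡ-< x 0<y-x))

  sub-nonneg : ∀ {x y} → x ≤ y → 0# ≤ y - x
  sub-nonneg (inj₁ x<y) = inj₁ (sub-pos x<y)
  sub-nonneg {x} (inj₂ x≈y) = inj₂ (trans (sym (-‿inverseʳ x)) (+-congʳ x≈y))

  nonneg-sub : ∀ {x y} → 0# ≤ y - x → x ≤ y
  nonneg-sub (inj₁ p) = inj₁ (pos-sub p)
  nonneg-sub {x} {y} (inj₂ e) = inj₂ (trans (sym (+-identityˡ x))
    (trans (+-congʳ e) (solve 2 (λ x y → y ⊖ x ⊕ x := y) refl x y)))

  sub-zero : ∀ {x y} → y - x ≈ 0# → x ≈ y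
  sub-zero {x} {y} e = trans (sym (+-identityˡ x))
    (trans (+-congʳ (sym e)) (solve 2 (λ x y → y ⊖ x ⊕ x := y) refl x y))

  +-mono-< : ∀ {x y u v} → x < y → u < v → x + u < y + v
  +-mono-< {x} {y} {u} {v} x<y u<v = <-trans (+-monoˡ-< u x<y)
    (<-respˡ-≈ (+-comm u y) (<-respʳ-≈ (+-comm v y) (+-monoˡ-< y u<v)))

  +-mono-<-≤ : ∀ {x y u v} → x < y → u ≤ v → x + u < y + v
  +-mono-<-≤ x<y (inj₁ u<v) = +-mono-< x<y u<v
  +-mono-<-≤ x<y (inj₂ u≈v) = <-respʳ-≈ (+-congˡ u≈v) (+-monoˡ-< _ x<y)

  +-mono-≤ : ∀ {x y u v} → x ≤ y → u ≤ v → x + u ≤ y + v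
  +-mono-≤ (inj₁ x<y) u≤v = inj₁ (+-mono-<-≤ x<y u≤v)
  +-mono-≤ {x} {y} {u} {v} (inj₂ x≈y) (inj₁ u<v) =
    inj₁ (<-respˡ-≈ (+-comm u x) (<-respʳ-≈ (+-comm v y) (+-mono-<-≤ u<v (inj₂ x≈y))))
  +-mono-≤ (inj₂ x≈y) (inj₂ u≈v) = inj₂ (+-cong x≈y u≈v)

  +-pos : ∀ {x y} → 0# < x → 0# < y → 0# < x + y
  +-pos p q = <-respˡ-≈ (+-identityˡ 0#) (+-mono-< p q)

  +-pos-nonneg : ∀ {x y} → 0# < x → 0# ≤ y → 0# < x + y
  +-pos-nonneg p q = <-respˡ-≈ (+-identityˡ 0#) (+-mono-<-≤ p q)

  +-nonneg : ∀ {x y} → 0# ≤ x → 0# ≤ y → 0# ≤ x + y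
  +-nonneg p q = ≤-respˡ-≈ (+-identityˡ 0#) (+-mono-≤ p q)

  *-nonneg : ∀ {x y} → 0# ≤ x → 0# ≤ y → 0# ≤ x * y
  *-nonneg (inj₁ p) (inj₁ q) = inj₁ (*-pos p q)
  *-nonneg {x} {y} (inj₂ e) _ = inj₂ (trans (sym (zeroˡ y)) (*-congʳ e))
  *-nonneg {x} {y} (inj₁ _) (inj₂ e) = inj₂ (trans (sym (zeroʳ x)) (*-congˡ e))

  *-monoˡ-≤ : ∀ {x y} z → 0# ≤ z → x ≤ y → x * z ≤ y * z
  *-monoˡ-≤ {x} {y} z p x≤y = nonneg-sub (nonneg-resp
    (solve 3 (λ x y z → (y ⊖ x) ⊗ z := y ⊗ z ⊖ x ⊗ z) refl x y z) (*-nonneg (sub-nonneg x≤y) p))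

  data Sign (x : Carrier) : Set where
    positive : 0# < x   → Sign x
    null     : x ≈ 0#   → Sign x
    negative : 0# < - x → Sign x

  neg-pos : ∀ {x} → x < 0# → 0# < - x
  neg-pos {x} x<0 = pos-resp (+-identityˡ (- x)) (sub-pos x<0)

  pos-neg : ∀ {x} → 0# < - x → x < 0#
  pos-neg {x} p = pos-sub (pos-resp (sym (+-identityˡ (- x))) p)

  sign : ∀ x → Sign x
  sign x with compare 0# x
  ... | tri< p _ _ = positive p
  ... | tri≈ _ p _ = null (sym p)
  ... | tri> _ _ p = negative (neg-pos p)

  ¬pos-neg : ∀ {x} → 0# < x → ¬ (0# < - x)
  ¬pos-neg {x} p q = irrefl refl (pos-resp (-‿inverseʳ x) (+-pos p q))

  pos⇒≉0 : ∀ {x} → 0# < x → ¬ (x ≈ 0#)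
  pos⇒≉0 p e = irrefl (sym e) p

  neg⇒≉0 : ∀ {x} → 0# < - x → ¬ (x ≈ 0#)
  neg⇒≉0 p e = irrefl e (pos-neg p)

  neg-neg-pos : ∀ {x} → 0# < x → 0# < - (- x)
  neg-neg-pos {x} = pos-resp (solve 1 (λ x → x := ⊝ (⊝ x)) refl x)

  pos-*-neg : ∀ {x y} → 0# < x → 0# < - y → 0# < - (x * y)
  pos-*-neg {x} {y} p q = pos-resp (solve 2 (λ x y → x ⊗ ⊝ y := ⊝ (x ⊗ y)) refl x y) (*-pos p q)

  neg-*-pos : ∀ {x y} → 0# < - x → 0# < y → 0# < - (x * y)
  neg-*-pos {x} {y} p q = pos-resp (solve 2 (λ x y → ⊝ x ⊗ y := ⊝ (x ⊗ y)) refl x y) (*-pos p q)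

  neg-*-neg : ∀ {x y} → 0# < - x → 0# < - y → 0# < x * y
  neg-*-neg {x} {y} p q = pos-resp (solve 2 (λ x y → ⊝ x ⊗ ⊝ y := x ⊗ y) refl x y) (*-pos p q)

  data SameSign (x y : Carrier) : Set where
    both-positive : 0# < x → 0# < y → SameSign x y
    both-negative : 0# < - x → 0# < - y → SameSign x y

  *-pos⇒sameSign : ∀ {x y} → 0# < x * y → SameSign x y
  *-pos⇒sameSign {x} {y} p with sign x | sign y
  ... | positive q | positive r = both-positive q r
  ... | negative q | negative r = both-negative q r
  ... | null e     | _          = ⊥-elim (irrefl (sym (trans (*-congʳ e) (zeroˡ y))) p)
  ... | _          | null e     = ⊥-elim (irrefl (sym (trans (*-congˡ e) (zeroʳ x))) p)
  ... | positive q | negative r = ⊥-elim (¬pos-neg p (pos-*-neg q r))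
  ... | negative q | positive r = ⊥-elim (¬pos-neg p (neg-*-pos q r))

  *-cancel-pos : ∀ {x y} → 0# < x * y → 0# < x → 0# < y
  *-cancel-pos p q with *-pos⇒sameSign p
  ... | both-positive _ r = r
  ... | both-negative r _ = ⊥-elim (¬pos-neg q r)

  zero-product : ∀ {x y} → x * y ≈ 0# → ¬ (x ≈ 0#) → y ≈ 0#
  zero-product {x} {y} e x≉0 with sign x | sign y
  ... | _ | null p = p
  ... | null p     | _          = ⊥-elim (x≉0 p)
  ... | positive p | positive q = ⊥-elim (pos⇒≉0 (*-pos p q) e)
  ... | positive p | negative q = ⊥-elim (neg⇒≉0 (pos-*-neg p q) e)
  ... | negative p | positive q = ⊥-elim (neg⇒≉0 (neg-*-pos p q) e)
  ... | negative p | negative q = ⊥-elim (pos⇒≉0 (neg-*-neg p q) e)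

  ⁻¹-pos : ∀ {x} → 0# < x → 0# < x ⁻¹
  ⁻¹-pos p = *-cancel-pos (pos-resp (sym (*-inverseʳ (pos⇒≉0 p))) 0<1) p

  /-cancel : ∀ {x} y → ¬ (x ≈ 0#) → x * (y * x ⁻¹) ≈ y
  /-cancel {x} y x≉0 = trans (solve 3 (λ x y z → x ⊗ (y ⊗ z) := y ⊗ (x ⊗ z)) refl x y (x ⁻¹))
    (trans (*-congˡ (*-inverseʳ x≉0)) (*-identityʳ y))

  double-nonneg : ∀ {x} → 0# ≤ x + x → 0# ≤ x
  double-nonneg {x} p = ≮⇒≥ λ x<0 → <⇒≱ (<-respʳ-≈ (+-identityˡ 0#) (+-mono-< x<0 x<0)) p

  double-pos : ∀ {x} → 0# < x + x → 0# < x
  double-pos {x} p = *-cancel-pos (pos-resp (solve 1 (λ x → x ⊕ x := (:1 ⊕ :1) ⊗ x) refl x) p) (+-pos 0<1 0<1)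

  -- Unlike `fromℤ`, this unfolds at a successor to `1# + fromℕ n` and ends in `0#`; later calls of
  -- `solve` therefore write `fromℕ (suc i)` as `:1 ⊕ i`, and `fromℕ 4` as four `:1` and a `:0`.
  fromℕ : ℕ → Carrier
  fromℕ n = n ×.× 1#

  fromℕ-+ : ∀ m n → fromℕ (m ℕ.+ n) ≈ fromℕ m + fromℕ n
  fromℕ-+ = ×.×-homo-+ 1#

  fromℕ-* : ∀ m n → fromℕ (m ℕ.* n) ≈ fromℕ m * fromℕ n
  fromℕ-* = ×.×1-homo-*

  fromℕ-cong : ∀ {m n} → m ≡ n → fromℕ m ≈ fromℕ n
  fromℕ-cong e = reflexive (≡.cong fromℕ e)

  fromℕ-nonneg : ∀ n → 0# ≤ fromℕ n
  fromℕ-nonneg zero    = ≤-refl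
  fromℕ-nonneg (suc n) = inj₁ (+-pos-nonneg 0<1 (fromℕ-nonneg n))

  fromℕ-pos : ∀ {n} → 1 ℕ.≤ n → 0# < fromℕ n
  fromℕ-pos {suc n} _ = +-pos-nonneg 0<1 (fromℕ-nonneg n)

  fromℕ-mono-≤ : ∀ {m n} → m ℕ.≤ n → fromℕ m ≤ fromℕ n
  fromℕ-mono-≤ {n = n} z≤n = fromℕ-nonneg n
  fromℕ-mono-≤ (s≤s m≤n) = +-mono-≤ ≤-refl (fromℕ-mono-≤ m≤n)

  fromℕ-mono-< : ∀ {m n} → m ℕ.< n → fromℕ m < fromℕ n
  fromℕ-mono-< {m} m<n = <-≤-trans
    (<-respˡ-≈ (+-identityˡ _) (+-monoˡ-< (fromℕ m) 0<1)) (fromℕ-mono-≤ m<n)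

  fromℕ-cancel-< : ∀ {m n} → fromℕ m < fromℕ n → m ℕ.< n
  fromℕ-cancel-< {m} {n} p with m ℕₚ.<? n
  ... | yes m<n = m<n
  ... | no m≮n  = ⊥-elim (<⇒≱ p (fromℕ-mono-≤ (ℕₚ.≮⇒≥ m≮n)))

  fromℕ-injective : ∀ {m n} → fromℕ m ≈ fromℕ n → m ≡ n
  fromℕ-injective {m} {n} e = ℕₚ.≤-antisym
    (ℕₚ.≮⇒≥ λ n<m → irrefl (sym e) (fromℕ-mono-< n<m))
    (ℕₚ.≮⇒≥ λ m<n → irrefl e (fromℕ-mono-< m<n))

  -- A supremum s of ℕ would give n > s − 1, hence n + 1 > s.
  archimedean : ExcludedMiddle 0ℓ → ∀ x → ∃[ n ] x < fromℕ n
  archimedean em x with em {∃[ n ] x < fromℕ n}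
  ... | yes p = p
  ... | no ¬p with supremum (λ y → ∃[ n ] y ≈ fromℕ n) (0# , 0 , refl)
                     (x , λ { y (n , e) → ≤-respˡ-≈ (sym e) (≮⇒≥ λ q → ¬p (n , q)) })
  ... | s , upper , least with em {∃[ n ] s - 1# < fromℕ n}
  ... | yes (n , q) = ⊥-elim (<⇒≱
          (<-respˡ-≈ (solve 1 (λ s → s ⊖ :1 ⊕ :1 := s) refl s)
            (<-respʳ-≈ (+-comm (fromℕ n) 1#) (+-monoˡ-< 1# q)))
          (upper _ (suc n , refl)))
  ... | no ¬q = ⊥-elim (<⇒≱
          (pos-sub (pos-resp (solve 1 (λ s → :1 := s ⊖ (s ⊖ :1)) refl s) 0<1))
          (least (s - 1#) λ { y (n , e) → ≤-respˡ-≈ (sym e) (≮⇒≥ λ q → ¬q (n , q)) }))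

-- Orientations and proper crossings

module Orientation (ℝ : CompleteOrderedField) where
  open CompleteOrderedField ℝ
  open IntegerRingSolver ℝ
  open FieldProperties ℝ
  open Plane ℝ using (Point; _≈ₚ_)

  orient : Point → Point → Point → Carrier
  orient (px , py) (qx , qy) (rx , ry) = (qx - px) * (ry - py) - (qy - py) * (rx - px)

  :orient : ∀ {n} → Expr ℤ n × Expr ℤ n → Expr ℤ n × Expr ℤ n → Expr ℤ n × Expr ℤ n → Expr ℤ n
  :orient (px , py) (qx , qy) (rx , ry) = (qx ⊖ px) ⊗ (ry ⊖ py) ⊖ (qy ⊖ py) ⊗ (rx ⊖ px)

  orient-swap : ∀ P Q R → orient Q P R ≈ - orient P Q R
  orient-swap (px , py) (qx , qy) (rx , ry) = solve 6 (λ px py qx qy rx ry →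
    :orient (qx , qy) (px , py) (rx , ry) := ⊝ :orient (px , py) (qx , qy) (rx , ry)) refl px py qx qy rx ry

  orient-rotate : ∀ P Q R → orient Q R P ≈ orient P Q R
  orient-rotate (px , py) (qx , qy) (rx , ry) = solve 6 (λ px py qx qy rx ry →
    :orient (qx , qy) (rx , ry) (px , py) := :orient (px , py) (qx , qy) (rx , ry)) refl px py qx qy rx ry

  orient-flip : ∀ P Q R → orient P R Q ≈ - orient P Q R
  orient-flip P Q R = trans (orient-rotate Q P R) (orient-swap P Q R)

  -- PQR + PRS and PQS + QRS are both the doubled signed area of the quadrilateral PQRS, cut along
  -- one diagonal or the other.
  orient-four : ∀ P Q R S →
    (orient P Q R - orient P Q S) + (orient P R S - orient Q R S) ≈ 0#
  orient-four (px , py) (qx , qy) (rx , ry) (sx , sy) = solve 8 (λ px py qx qy rx ry sx sy →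
    (:orient (px , py) (qx , qy) (rx , ry) ⊖ :orient (px , py) (qx , qy) (sx , sy)) ⊕
    (:orient (px , py) (rx , ry) (sx , sy) ⊖ :orient (qx , qy) (rx , ry) (sx , sy)) := :0)
    refl px py qx qy rx ry sx sy

  orient-cong : ∀ {P P′ Q Q′ R R′} → P ≈ₚ P′ → Q ≈ₚ Q′ → R ≈ₚ R′ → orient P Q R ≈ orient P′ Q′ R′
  orient-cong (px , py) (qx , qy) (rx , ry) =
    +-cong (*-cong (+-cong qx (-‿cong px)) (+-cong ry (-‿cong py)))
           (-‿cong (*-cong (+-cong qy (-‿cong py)) (+-cong rx (-‿cong px))))

  -- In general position the segments PQ and RS cross exactly when R and S lie
  -- on different sides of PQ, and P and Q on different sides of RS.
  ProperCrossing : Point → Point → Point → Point → Set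
  ProperCrossing P Q R S =
    (0# < - (orient P Q R * orient P Q S)) × (0# < - (orient P R S * orient Q R S))

  rise : Point → Point → Carrier
  rise (px , py) (qx , qy) = (qx - px) * (qy - py)

  -- An axis-parallel edge counts as blue, but its rise is 0 and it is excluded here. The product
  -- thus expresses equality of colours only when no rise vanishes; in exchange it is a strict
  -- polynomial inequality.
  Monochromatic : Point → Point → Point → Point → Set
  Monochromatic P Q R S = 0# < rise P Q * rise R S

  MonoCross : Point → Point → Point → Point → Set
  MonoCross P Q R S = ProperCrossing P Q R S × Monochromatic P Q R S

  SomeMonoCross : Point → Point → Point → Point → Set
  SomeMonoCross P Q R S = MonoCross P Q R S ⊎ (MonoCross P R Q S ⊎ MonoCross P S Q R)

  private
    neg*neg : ∀ {x y x′ y′} → x′ ≈ - x → y′ ≈ - y → x * y ≈ x′ * y′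
    neg*neg {x} {y} e f = trans (solve 2 (λ x y → x ⊗ y := ⊝ x ⊗ ⊝ y) refl x y)
                            (sym (*-cong e f))

    neg-resp : ∀ {x y} → x ≈ y → 0# < - x → 0# < - y
    neg-resp e = pos-resp (-‿cong e)

  rise-sym : ∀ P Q → rise P Q ≈ rise Q P
  rise-sym (px , py) (qx , qy) = solve 4 (λ px py qx qy →
    (qx ⊖ px) ⊗ (qy ⊖ py) := (px ⊖ qx) ⊗ (py ⊖ qy)) refl px py qx qy

  rise-cong : ∀ {P P′ Q Q′} → P ≈ₚ P′ → Q ≈ₚ Q′ → rise P Q ≈ rise P′ Q′
  rise-cong (px , py) (qx , qy) = *-cong (+-cong qx (-‿cong px)) (+-cong qy (-‿cong py))

  monoCross-cong : ∀ {P P′ Q Q′ R R′ S S′} → P ≈ₚ P′ → Q ≈ₚ Q′ → R ≈ₚ R′ → S ≈ₚ S′ →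
    MonoCross P Q R S → MonoCross P′ Q′ R′ S′
  monoCross-cong p q r s ((c₁ , c₂) , m) =
    (neg-resp (*-cong (orient-cong p q r) (orient-cong p q s)) c₁ ,
     neg-resp (*-cong (orient-cong p r s) (orient-cong q r s)) c₂) ,
    pos-resp (*-cong (rise-cong p q) (rise-cong r s)) m

  monoCross-swapˡ : ∀ P Q R S → MonoCross P Q R S → MonoCross Q P R S
  monoCross-swapˡ P Q R S ((c₁ , c₂) , m) =
    (neg-resp (neg*neg (orient-swap P Q R) (orient-swap P Q S)) c₁ , neg-resp (*-comm _ _) c₂) ,
    pos-resp (*-congʳ (rise-sym P Q)) m

  monoCross-exchange : ∀ P Q R S → MonoCross P Q R S → MonoCross R S P Q
  monoCross-exchange P Q R S ((c₁ , c₂) , m) =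
    (neg-resp (*-cong (sym (orient-rotate P R S)) (sym (orient-rotate Q R S))) c₂ ,
     neg-resp (*-cong (orient-rotate² P Q R) (orient-rotate² P Q S)) c₁) ,
    pos-resp (*-comm _ _) m
    where
    orient-rotate² : ∀ P Q R → orient P Q R ≈ orient R P Q
    orient-rotate² P Q R = orient-rotate R P Q

  monoCross-swapʳ : ∀ P Q R S → MonoCross P Q R S → MonoCross P Q S R
  monoCross-swapʳ P Q R S = monoCross-exchange S R P Q ∘ monoCross-swapˡ R S P Q ∘ monoCross-exchange P Q R S

  reflect : Carrier → Point → Point
  reflect h (x , y) = x , h - y

  orient-reflect : ∀ h P Q R → orient (reflect h P) (reflect h Q) (reflect h R) ≈ - orient P Q R
  orient-reflect h (px , py) (qx , qy) (rx , ry) = solve 7 (λ h px py qx qy rx ry →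
    (qx ⊖ px) ⊗ ((h ⊖ ry) ⊖ (h ⊖ py)) ⊖ ((h ⊖ qy) ⊖ (h ⊖ py)) ⊗ (rx ⊖ px) :=
    ⊝ ((qx ⊖ px) ⊗ (ry ⊖ py) ⊖ (qy ⊖ py) ⊗ (rx ⊖ px))) refl h px py qx qy rx ry

  rise-reflect : ∀ h P Q → rise (reflect h P) (reflect h Q) ≈ - rise P Q
  rise-reflect h (px , py) (qx , qy) = solve 5 (λ h px py qx qy →
    (qx ⊖ px) ⊗ ((h ⊖ qy) ⊖ (h ⊖ py)) := ⊝ ((qx ⊖ px) ⊗ (qy ⊖ py))) refl h px py qx qy

  -- Reflection in a horizontal line negates every orientation and every rise, while only products
  -- of two of them enter. It exchanges rising and falling edges, which reduces one colour to the
  -- other.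
  monoCross-reflect : ∀ h P Q R S → MonoCross P Q R S →
    MonoCross (reflect h P) (reflect h Q) (reflect h R) (reflect h S)
  monoCross-reflect h P Q R S ((c₁ , c₂) , m) =
    (neg-resp (neg*neg (orient-reflect h P Q R) (orient-reflect h P Q S)) c₁ ,
     neg-resp (neg*neg (orient-reflect h P R S) (orient-reflect h Q R S)) c₂) ,
    pos-resp (neg*neg (rise-reflect h P Q) (rise-reflect h R S)) m

  -- Two pairings that both crossed would give the four signed areas of
  -- orient-four alternating signs.
  private
    alternate : ∀ {α β γ δ} → (α - β) + (γ - δ) ≈ 0# →
      0# < - (α * β) → 0# < - (γ * δ) → ¬ (0# < α * γ)
    alternate {α} {β} {γ} {δ} e p q r with *-pos⇒sameSign {α} { - β} (pos-resp (solve 2 (λ x y → ⊝ (x ⊗ y) := x ⊗ ⊝ y) refl α β) p)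
                           | *-pos⇒sameSign {γ} { - δ} (pos-resp (solve 2 (λ x y → ⊝ (x ⊗ y) := x ⊗ ⊝ y) refl γ δ) q)
                           | *-pos⇒sameSign r
    ... | both-positive a b | both-positive c d | _ = irrefl (sym e) (+-pos (+-pos a b) (+-pos c d))
    ... | both-negative a b | both-negative c d | _ = irrefl refl (pos-resp
            (trans (solve 4 (λ α β γ δ → (⊝ α ⊕ ⊝ (⊝ β)) ⊕ (⊝ γ ⊕ ⊝ (⊝ δ)) := ⊝ ((α ⊖ β) ⊕ (γ ⊖ δ))) refl α β γ δ)
              (trans (-‿cong e) (solve 0 (⊝ :0 := :0) refl)))
            (+-pos (+-pos a b) (+-pos c d)))
    ... | both-positive a _ | both-negative c _ | both-positive _ x = ¬pos-neg x c
    ... | both-positive a _ | both-negative c _ | both-negative x _ = ¬pos-neg a x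
    ... | both-negative a _ | both-positive c _ | both-positive x _ = ¬pos-neg x a
    ... | both-negative a _ | both-positive c _ | both-negative _ x = ¬pos-neg c x

  monoCross-exclusive : ∀ P Q R S → ¬ (MonoCross P Q R S × MonoCross P R Q S)
  monoCross-exclusive P Q R S (((c₁ , c₂) , _) , ((d₁ , _) , _)) =
    -- The second crossing separates Q and S by the line PR, that is, PRQ and PRS have opposite
    -- signs; PQR and PRS then have equal ones.
    alternate (orient-four P Q R S) c₁ c₂ (pos-resp
      (trans (-‿cong (*-congʳ (orient-flip P Q R))) (solve 2 (λ x y → ⊝ (⊝ x ⊗ y) := x ⊗ y) refl _ _)) d₁)

  monoCross-exclusive₃ : ∀ P Q R S → ¬ (MonoCross P Q R S × MonoCross P S Q R)
  monoCross-exclusive₃ P Q R S (c , d) = monoCross-exclusive P Q S R (monoCross-swapʳ P Q R S c , d)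

  private
    -- By `alternate`, PQR and PRS cannot agree in sign, and the crossing makes PRS and QRS differ,
    -- so the three signs alternate.
    opposite : ∀ P Q R S → ProperCrossing P Q R S →
      (0# < - orient P Q R × 0# < orient P R S × 0# < - orient Q R S) ⊎
      (0# < orient P Q R × 0# < - orient P R S × 0# < orient Q R S)
    opposite P Q R S (c₁ , c₂) with sign (orient P Q R) | sign (orient P R S) | sign (orient Q R S)
    ... | null e | _ | _ = ⊥-elim (neg⇒≉0 c₁ (trans (*-congʳ e) (zeroˡ _)))
    ... | _ | null e | _ = ⊥-elim (neg⇒≉0 c₂ (trans (*-congʳ e) (zeroˡ _)))
    ... | _ | _ | null e = ⊥-elim (neg⇒≉0 c₂ (trans (*-congˡ e) (zeroʳ _)))
    ... | negative a | positive c | negative d = inj₁ (a , c , d)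
    ... | positive a | negative c | positive d = inj₂ (a , c , d)
    ... | positive a | positive c | negative _ = ⊥-elim (alternate (orient-four P Q R S) c₁ c₂ (*-pos a c))
    ... | negative a | negative c | positive _ = ⊥-elim (alternate (orient-four P Q R S) c₁ c₂ (neg-*-neg a c))
    ... | _ | positive c | positive d = ⊥-elim (¬pos-neg (*-pos c d) c₂)
    ... | _ | negative c | negative d = ⊥-elim (¬pos-neg (neg-*-neg c d) c₂)

    weighted-sum : ∀ {α γ δ x y z} → 0# < x → 0# < y → 0# < z →
      γ * x + - δ * y + - α * z ≈ 0# →
      ¬ ((0# < - α × 0# < γ × 0# < - δ) ⊎ (0# < α × 0# < - γ × 0# < δ))
    weighted-sum p q r e (inj₁ (a , c , d)) =
      irrefl (sym e) (+-pos (+-pos (*-pos c p) (*-pos d q)) (*-pos a r))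
    weighted-sum {α} {γ} {δ} {x} {y} {z} p q r e (inj₂ (a , c , d)) = irrefl refl (pos-resp
      (trans (solve 6 (λ α γ δ x y z → ⊝ γ ⊗ x ⊕ δ ⊗ y ⊕ α ⊗ z := ⊝ (γ ⊗ x ⊕ ⊝ δ ⊗ y ⊕ ⊝ α ⊗ z)) refl α γ δ x y z)
        (trans (-‿cong e) (solve 0 (⊝ :0 := :0) refl)))
      (+-pos (+-pos (*-pos c p) (*-pos d q)) (*-pos a r)))

  -- The crossing point would need an abscissa both below that of Q and above that of R.
  -- Algebraically, three orientations satisfy a linear relation whose weights r - q, r - p and s -
  -- r are positive, and by `opposite` a crossing would give all its terms one sign.
  separatedˣ : ∀ P Q R S → proj₁ P < proj₁ Q → proj₁ Q < proj₁ R → proj₁ R < proj₁ S →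
    ¬ ProperCrossing P Q R S
  separatedˣ P@(px , py) Q@(qx , qy) R@(rx , ry) S@(sx , sy) p q r c =
    weighted-sum (sub-pos q) (sub-pos (<-trans p q)) (sub-pos r)
      (solve 8 (λ px py qx qy rx ry sx sy →
        :orient (px , py) (rx , ry) (sx , sy) ⊗ (rx ⊖ qx) ⊕ ⊝ :orient (qx , qy) (rx , ry) (sx , sy) ⊗ (rx ⊖ px)
        ⊕ ⊝ :orient (px , py) (qx , qy) (rx , ry) ⊗ (sx ⊖ rx) := :0) refl px py qx qy rx ry sx sy)
      (opposite P Q R S c)

  separatedʸ : ∀ P Q R S → proj₂ P < proj₂ Q → proj₂ Q < proj₂ R → proj₂ R < proj₂ S →
    ¬ ProperCrossing P Q R S
  separatedʸ P@(px , py) Q@(qx , qy) R@(rx , ry) S@(sx , sy) p q r c =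
    weighted-sum (sub-pos q) (sub-pos (<-trans p q)) (sub-pos r)
      (solve 8 (λ px py qx qy rx ry sx sy →
        :orient (px , py) (rx , ry) (sx , sy) ⊗ (ry ⊖ qy) ⊕ ⊝ :orient (qx , qy) (rx , ry) (sx , sy) ⊗ (ry ⊖ py)
        ⊕ ⊝ :orient (px , py) (qx , qy) (rx , ry) ⊗ (sy ⊖ ry) := :0) refl px py qx qy rx ry sx sy)
      (opposite P Q R S c)

-- Crossing criteria in terms of gaps

-- The points have abscissae z < z + a < z + a + b < z + a + b + c and ordinates
-- Z < Z + A < Z + A + B < Z + A + B + C.  A lemma is named after the horizontal
-- and the vertical order of its points.
module Gaps (ℝ : CompleteOrderedField) where
  open CompleteOrderedField ℝ
  open IntegerRingSolver ℝ
  open FieldProperties ℝ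
  open Orientation ℝ

  infix 8 _∧_
  -- For positive a and b, a positive value means that the slope B/b exceeds A/a.
  _∧_ : Carrier × Carrier → Carrier × Carrier → Carrier
  (a , A) ∧ (b , B) = a * B - A * b

  -- a/(a+b+c) exceeds A/(A+B)
  Exceeds : (a b c A B C : Carrier) → Set
  Exceeds a b c A B C = (a + b + c) * A < (A + B) * a

  private
    :2 : ∀ {n} → Expr ℤ n → Expr ℤ n → Expr ℤ n
    :2 z a = z ⊕ a

    :3 : ∀ {n} → Expr ℤ n → Expr ℤ n → Expr ℤ n → Expr ℤ n
    :3 z a b = z ⊕ a ⊕ b

    :4 : ∀ {n} → Expr ℤ n → Expr ℤ n → Expr ℤ n → Expr ℤ n → Expr ℤ n
    :4 z a b c = z ⊕ a ⊕ b ⊕ c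

  module _ (z a b c Z A B C : Carrier)
           (0<a : 0# < a) (0<b : 0# < b) (0<c : 0# < c)
           (0<A : 0# < A) (0<B : 0# < B) (0<C : 0# < C) where

    private
      x₁ = z
      x₂ = z + a
      x₃ = z + a + b
      x₄ = z + a + b + c
      y₁ = Z
      y₂ = Z + A
      y₃ = Z + A + B
      y₄ = Z + A + B + C

      grow : ∀ {x d} → 0# < d → x < x + d
      grow {x} {d} p = pos-sub (pos-resp (solve 2 (λ x d → d := x ⊕ d ⊖ x) refl x d) p)

      x₁<x₂ = grow {x₁} 0<a
      x₂<x₃ = grow {x₂} 0<b
      x₃<x₄ = grow {x₃} 0<c
      x₁<x₃ = <-trans x₁<x₂ x₂<x₃
      x₁<x₄ = <-trans x₁<x₃ x₃<x₄
      x₂<x₄ = <-trans x₂<x₃ x₃<x₄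
      y₁<y₂ = grow {y₁} 0<A
      y₂<y₃ = grow {y₂} 0<B
      y₃<y₄ = grow {y₃} 0<C
      y₁<y₃ = <-trans y₁<y₂ y₂<y₃
      y₁<y₄ = <-trans y₁<y₃ y₃<y₄
      y₂<y₄ = <-trans y₂<y₃ y₃<y₄

      rising : ∀ {px py qx qy rx ry sx sy} → px < qx → py < qy → rx < sx → ry < sy →
        Monochromatic (px , py) (qx , qy) (rx , ry) (sx , sy)
      rising p q r s = *-pos (*-pos (sub-pos p) (sub-pos q)) (*-pos (sub-pos r) (sub-pos s))

      -- Transitivity of the slope order.
      middle-slope : (a , A) ∧ (c , C) * b ≈ a * (b , B) ∧ (c , C) + c * (a , A) ∧ (b , B)
      middle-slope = solve 6 (λ a b c A B C → (a ⊗ C ⊖ A ⊗ c) ⊗ b :=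
        a ⊗ (b ⊗ C ⊖ B ⊗ c) ⊕ c ⊗ (a ⊗ B ⊖ A ⊗ b)) refl a b c A B C

      e₁₂ = (a , A) ∧ (b , B)
      e₂₃ = (b , B) ∧ (c , C)
      e₁₃ = (a , A) ∧ (c , C)

      e₁₃-pos : 0# < e₁₂ → 0# < e₂₃ → 0# < e₁₃
      e₁₃-pos p q = *-cancel-pos (pos-resp (trans (sym middle-slope) (*-comm _ _))
        (+-pos (*-pos 0<a q) (*-pos 0<c p))) 0<b

      e₁₃-neg : 0# < - e₁₂ → 0# < - e₂₃ → 0# < - e₁₃
      e₁₃-neg p q = *-cancel-pos (pos-resp (trans
        (solve 4 (λ a c x y → a ⊗ ⊝ y ⊕ c ⊗ ⊝ x := ⊝ (a ⊗ y ⊕ c ⊗ x)) refl a c e₁₂ e₂₃)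
        (trans (-‿cong (sym middle-slope)) (solve 2 (λ x b → ⊝ (x ⊗ b) := b ⊗ ⊝ x) refl e₁₃ b)))
        (+-pos (*-pos 0<a q) (*-pos 0<c p))) 0<b

    module PRQS-PRQS where
      P Q R S : Carrier × Carrier
      P = x₁ , y₁
      R = x₂ , y₂
      Q = x₃ , y₃
      S = x₄ , y₄

      private
        α : orient P Q R ≈ - e₁₂
        α = solve 8 (λ z a b c Z A B C → :orient (z , Z) (:3 z a b , :3 Z A B) (:2 z a , :2 Z A)
          := ⊝ (a ⊗ B ⊖ A ⊗ b)) refl z a b c Z A B C

        β : orient P Q S ≈ e₁₃ + e₂₃
        β = solve 8 (λ z a b c Z A B C → :orient (z , Z) (:3 z a b , :3 Z A B) (:4 z a b c , :4 Z A B C)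
          := (a ⊗ C ⊖ A ⊗ c) ⊕ (b ⊗ C ⊖ B ⊗ c)) refl z a b c Z A B C

        γ : orient P R S ≈ e₁₂ + e₁₃
        γ = solve 8 (λ z a b c Z A B C → :orient (z , Z) (:2 z a , :2 Z A) (:4 z a b c , :4 Z A B C)
          := (a ⊗ B ⊖ A ⊗ b) ⊕ (a ⊗ C ⊖ A ⊗ c)) refl z a b c Z A B C

        δ : orient Q R S ≈ - e₂₃
        δ = solve 8 (λ z a b c Z A B C → :orient (:3 z a b , :3 Z A B) (:2 z a , :2 Z A) (:4 z a b c , :4 Z A B C)
          := ⊝ (b ⊗ C ⊖ B ⊗ c)) refl z a b c Z A B C

        αβ : - (orient P Q R * orient P Q S) ≈ e₁₂ * (e₁₃ + e₂₃)
        αβ = trans (-‿cong (*-cong α β)) (solve 2 (λ x y → ⊝ (⊝ x ⊗ y) := x ⊗ y) refl _ _)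

        γδ : - (orient P R S * orient Q R S) ≈ (e₁₂ + e₁₃) * e₂₃
        γδ = trans (-‿cong (*-cong γ δ)) (solve 2 (λ x y → ⊝ (x ⊗ ⊝ y) := x ⊗ y) refl _ _)

        neg-sum : ∀ {x y} → 0# < - x → 0# < - y → 0# < - (x + y)
        neg-sum {x} {y} p q = pos-resp (solve 2 (λ x y → ⊝ x ⊕ ⊝ y := ⊝ (x ⊕ y)) refl x y) (+-pos p q)

      -- The points form a rising chain P, R, Q, S with steps (a, A), (b, B), (c, C). If its two
      -- turns go the same way, P, R, Q, S are in this order the vertices of a convex quadrilateral,
      -- with diagonals PQ and RS.
      intro : 0# < e₁₂ * e₂₃ → MonoCross P Q R S
      intro p = (pos-resp (sym αβ) (proj₁ products) , pos-resp (sym γδ) (proj₂ products)) ,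
                rising x₁<x₃ y₁<y₃ x₂<x₄ y₂<y₄
        where
        products : (0# < e₁₂ * (e₁₃ + e₂₃)) × (0# < (e₁₂ + e₁₃) * e₂₃)
        products with *-pos⇒sameSign p
        ... | both-positive q r = let t = e₁₃-pos q r in *-pos q (+-pos t r) , *-pos (+-pos q t) r
        ... | both-negative q r = let t = e₁₃-neg q r in
                neg-*-neg q (neg-sum t r) , neg-*-neg (neg-sum q t) r

      elim : MonoCross P Q R S → 0# < e₁₂ * e₂₃
      elim ((p , q) , _) with *-pos⇒sameSign (pos-resp αβ p) | *-pos⇒sameSign (pos-resp γδ q)
      ... | both-positive s _ | both-positive _ t = *-pos s t
      ... | both-negative s _ | both-negative _ t = neg-*-neg s t
      -- Turns in opposite directions are contradictory: the four quantities claimed to be positive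
      -- add up to 0.
      ... | both-positive s t | both-negative u v = ⊥-elim (irrefl refl (pos-resp
              (solve 3 (λ x y w → ((y ⊕ w) ⊕ ⊝ (x ⊕ y)) ⊕ (x ⊕ ⊝ w) := :0) refl e₁₂ e₁₃ e₂₃)
              (+-pos (+-pos t u) (+-pos s v))))
      ... | both-negative s t | both-positive u v = ⊥-elim (irrefl refl (pos-resp
              (solve 3 (λ x y w → (⊝ (y ⊕ w) ⊕ (x ⊕ y)) ⊕ (⊝ x ⊕ w) := :0) refl e₁₂ e₁₃ e₂₃)
              (+-pos (+-pos t u) (+-pos s v))))

    module PRQS-PRSQ where
      P Q R S : Carrier × Carrier
      P = x₁ , y₁
      R = x₂ , y₂
      Q = x₃ , y₄
      S = x₄ , y₃

      private
        α : orient P Q R ≈ (a + b) * A - (A + B + C) * a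
        α = solve 8 (λ z a b c Z A B C → :orient (z , Z) (:3 z a b , :4 Z A B C) (:2 z a , :2 Z A)
          := (a ⊕ b) ⊗ A ⊖ (A ⊕ B ⊕ C) ⊗ a) refl z a b c Z A B C

        β : - ((a + b) * C + (A + B + C) * c) ≈ orient P Q S
        β = solve 8 (λ z a b c Z A B C → ⊝ ((a ⊕ b) ⊗ C ⊕ (A ⊕ B ⊕ C) ⊗ c) :=
          :orient (z , Z) (:3 z a b , :4 Z A B C) (:4 z a b c , :3 Z A B)) refl z a b c Z A B C

        γ : (((a + b) * A - (A + B + C) * a) + (a * C + A * c)) ≈ - orient P R S
        γ = solve 8 (λ z a b c Z A B C → (((a ⊕ b) ⊗ A ⊖ (A ⊕ B ⊕ C) ⊗ a) ⊕ (a ⊗ C ⊕ A ⊗ c))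
          := ⊝ :orient (z , Z) (:2 z a , :2 Z A) (:4 z a b c , :3 Z A B)) refl z a b c Z A B C

        δ : b * C + (B + C) * c ≈ orient Q R S
        δ = solve 8 (λ z a b c Z A B C → b ⊗ C ⊕ (B ⊕ C) ⊗ c :=
          :orient (:3 z a b , :4 Z A B C) (:2 z a , :2 Z A) (:4 z a b c , :3 Z A B)) refl z a b c Z A B C

        0<-β : 0# < - orient P Q S
        0<-β = pos-resp (-‿cong β) (neg-neg-pos
          (+-pos (*-pos (+-pos 0<a 0<b) 0<C) (*-pos (+-pos (+-pos 0<A 0<B) 0<C) 0<c)))

      -- S lies to the right of Q and below it, hence always under the line PQ. So R has to lie
      -- above that line, and once it does, the remaining sign conditions hold as well.
      intro : Exceeds A B C a b c → MonoCross P Q R S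
      intro p = (pos-*-neg 0<α 0<-β ,
                 neg-*-pos (pos-resp γ (+-pos (sub-pos p) (+-pos (*-pos 0<a 0<C) (*-pos 0<A 0<c))))
                   (pos-resp δ (+-pos (*-pos 0<b 0<C) (*-pos (+-pos 0<B 0<C) 0<c)))) ,
                rising x₁<x₃ y₁<y₄ x₂<x₄ y₂<y₃
        where
        0<α : 0# < orient P Q R
        0<α = pos-resp (sym α) (sub-pos p)

      elim : MonoCross P Q R S → Exceeds A B C a b c
      elim ((p , _) , _) = pos-sub (pos-resp α (*-cancel-pos (pos-resp
        (solve 2 (λ x y → ⊝ (x ⊗ y) := ⊝ y ⊗ x) refl _ _) p) 0<-β))

    module PRQS-RPQS where
      P Q R S : Carrier × Carrier
      P = x₁ , y₂
      R = x₂ , y₁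
      Q = x₃ , y₃
      S = x₄ , y₄

      private
        α : (a + b) * A + B * a ≈ - orient P Q R
        α = solve 8 (λ z a b c Z A B C → (a ⊕ b) ⊗ A ⊕ B ⊗ a :=
          ⊝ :orient (z , :2 Z A) (:3 z a b , :3 Z A B) (:2 z a , Z)) refl z a b c Z A B C

        β : ((b + c) * C - (C + B + A) * c) + (a * C + A * c) ≈ orient P Q S
        β = solve 8 (λ z a b c Z A B C → ((b ⊕ c) ⊗ C ⊖ (C ⊕ B ⊕ A) ⊗ c) ⊕ (a ⊗ C ⊕ A ⊗ c) :=
          :orient (z , :2 Z A) (:3 z a b , :3 Z A B) (:4 z a b c , :4 Z A B C)) refl z a b c Z A B C

        γ : a * (B + C) + A * (a + b + c) ≈ orient P R S
        γ = solve 8 (λ z a b c Z A B C → a ⊗ (B ⊕ C) ⊕ A ⊗ (a ⊕ b ⊕ c) :=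
          :orient (z , :2 Z A) (:2 z a , Z) (:4 z a b c , :4 Z A B C)) refl z a b c Z A B C

        δ : (c + b) * C - (C + B + A) * c ≈ - orient Q R S
        δ = solve 8 (λ z a b c Z A B C → (c ⊕ b) ⊗ C ⊖ (C ⊕ B ⊕ A) ⊗ c :=
          ⊝ :orient (:3 z a b , :3 Z A B) (:2 z a , Z) (:4 z a b c , :4 Z A B C)) refl z a b c Z A B C

        0<γ : 0# < orient P R S
        0<γ = pos-resp γ (+-pos (*-pos 0<a (+-pos 0<B 0<C)) (*-pos 0<A (+-pos (+-pos 0<a 0<b) 0<c)))

      -- A half-turn of the plane, with P and S and likewise Q and R interchanged, leads to the
      -- order of `PRQS-PRSQ`; the gaps are then read backwards.
      intro : Exceeds C B A c b a → MonoCross P Q R S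
      intro p = (neg-*-pos (pos-resp α (+-pos (*-pos (+-pos 0<a 0<b) 0<A) (*-pos 0<B 0<a)))
                   (pos-resp β (+-pos (pos-resp (+-congʳ (*-congʳ (+-comm c b))) (sub-pos p))
                     (+-pos (*-pos 0<a 0<C) (*-pos 0<A 0<c)))) ,
                 pos-*-neg 0<γ (pos-resp δ (sub-pos p))) ,
                rising x₁<x₃ y₂<y₃ x₂<x₄ y₁<y₄

      elim : MonoCross P Q R S → Exceeds C B A c b a
      elim ((_ , q) , _) = pos-sub (pos-resp (sym δ) (*-cancel-pos (pos-resp
        (solve 2 (λ x y → ⊝ (x ⊗ y) := x ⊗ ⊝ y) refl _ _) q) 0<γ))

    module PRQS-RPSQ where
      P Q R S : Carrier × Carrier
      P = x₁ , y₂
      R = x₂ , y₁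
      Q = x₃ , y₄
      S = x₄ , y₃

      private
        α : (a + b) * A + (B + C) * a ≈ - orient P Q R
        α = solve 8 (λ z a b c Z A B C → (a ⊕ b) ⊗ A ⊕ (B ⊕ C) ⊗ a :=
          ⊝ :orient (z , :2 Z A) (:3 z a b , :4 Z A B C) (:2 z a , Z)) refl z a b c Z A B C

        β : C * (a + b) + (B + C) * c ≈ - orient P Q S
        β = solve 8 (λ z a b c Z A B C → C ⊗ (a ⊕ b) ⊕ (B ⊕ C) ⊗ c :=
          ⊝ :orient (z , :2 Z A) (:3 z a b , :4 Z A B C) (:4 z a b c , :3 Z A B)) refl z a b c Z A B C

      -- R lies to the right of P and below it, and S to the right of Q and below it, so both are
      -- under the line PQ.
      never : ¬ MonoCross P Q R S
      never ((p , _) , _) = ¬pos-neg (neg-*-neg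
        (pos-resp α (+-pos (*-pos (+-pos 0<a 0<b) 0<A) (*-pos (+-pos 0<B 0<C) 0<a)))
        (pos-resp β (+-pos (*-pos 0<C (+-pos 0<a 0<b)) (*-pos (+-pos 0<B 0<C) 0<c)))) p

    module PRSQ-PRSQ where
      P Q R S : Carrier × Carrier
      P = x₁ , y₁
      R = x₂ , y₂
      S = x₃ , y₃
      Q = x₄ , y₄

      private
        u : Carrier × Carrier
        u = a + b + c , A + B + C
        d₁ = (a , A) ∧ u
        d₃ = (c , C) ∧ u

        α : orient P Q R ≈ - d₁
        α = solve 8 (λ z a b c Z A B C → :orient (z , Z) (:4 z a b c , :4 Z A B C) (:2 z a , :2 Z A) :=
          ⊝ (a ⊗ (A ⊕ B ⊕ C) ⊖ A ⊗ (a ⊕ b ⊕ c))) refl z a b c Z A B C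

        β : orient P Q S ≈ d₃
        β = solve 8 (λ z a b c Z A B C → :orient (z , Z) (:4 z a b c , :4 Z A B C) (:3 z a b , :3 Z A B) :=
          (c ⊗ (A ⊕ B ⊕ C) ⊖ C ⊗ (a ⊕ b ⊕ c))) refl z a b c Z A B C

        αβ : - (orient P Q R * orient P Q S) ≈ d₁ * d₃
        αβ = trans (-‿cong (*-cong α β)) (solve 2 (λ x y → ⊝ (⊝ x ⊗ y) := x ⊗ y) refl _ _)

        -- After multiplication by the positive width, the orientations relative to RS are
        -- combinations of d₁ and d₃ with positive weights; the second half of the crossing
        -- condition thus follows from the first.
        γ : (a + b + c) * orient P R S ≈ a * (d₁ + d₃) + b * d₁
        γ = solve 8 (λ z a b c Z A B C → (a ⊕ b ⊕ c) ⊗ :orient (z , Z) (:2 z a , :2 Z A) (:3 z a b , :3 Z A B) :=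
          a ⊗ ((a ⊗ (A ⊕ B ⊕ C) ⊖ A ⊗ (a ⊕ b ⊕ c)) ⊕ (c ⊗ (A ⊕ B ⊕ C) ⊖ C ⊗ (a ⊕ b ⊕ c))) ⊕
          b ⊗ (a ⊗ (A ⊕ B ⊕ C) ⊖ A ⊗ (a ⊕ b ⊕ c))) refl z a b c Z A B C

        δ : (a + b + c) * - orient Q R S ≈ c * (d₁ + d₃) + b * d₃
        δ = solve 8 (λ z a b c Z A B C → (a ⊕ b ⊕ c) ⊗ ⊝ :orient (:4 z a b c , :4 Z A B C) (:2 z a , :2 Z A) (:3 z a b , :3 Z A B) :=
          c ⊗ ((a ⊗ (A ⊕ B ⊕ C) ⊖ A ⊗ (a ⊕ b ⊕ c)) ⊕ (c ⊗ (A ⊕ B ⊕ C) ⊖ C ⊗ (a ⊕ b ⊕ c))) ⊕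
          b ⊗ (c ⊗ (A ⊕ B ⊕ C) ⊖ C ⊗ (a ⊕ b ⊕ c))) refl z a b c Z A B C

        0<s : 0# < a + b + c
        0<s = +-pos (+-pos 0<a 0<b) 0<c

        combine-neg : ∀ k l x y → 0# < k → 0# < l → 0# < - x → 0# < - y → 0# < - (k * (x + y) + l * x)
        combine-neg k l x y p q r s = pos-resp
          (solve 4 (λ k l x y → k ⊗ (⊝ x ⊕ ⊝ y) ⊕ l ⊗ ⊝ x := ⊝ (k ⊗ (x ⊕ y) ⊕ l ⊗ x)) refl k l x y)
          (+-pos (*-pos p (+-pos r s)) (*-pos q r))

        *-neg : ∀ x y → - (x * y) ≈ x * - y
        *-neg x y = solve 2 (λ x y → ⊝ (x ⊗ y) := x ⊗ ⊝ y) refl x y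

        0<-γδ : 0# < d₁ * d₃ → 0# < - (orient P R S * orient Q R S)
        0<-γδ p with *-pos⇒sameSign p
        ... | both-positive q r = pos-*-neg
                (*-cancel-pos (pos-resp (sym γ) (+-pos (*-pos 0<a (+-pos q r)) (*-pos 0<b q))) 0<s)
                (*-cancel-pos (pos-resp (sym δ) (+-pos (*-pos 0<c (+-pos q r)) (*-pos 0<b r))) 0<s)
        ... | both-negative q r = neg-*-pos
                (*-cancel-pos (pos-resp (trans (-‿cong (sym γ)) (*-neg _ _)) (combine-neg a b d₁ d₃ 0<a 0<b q r)) 0<s)
                (*-cancel-pos (pos-resp (trans (-‿cong (trans (+-congʳ (*-congˡ (+-comm d₃ d₁))) (sym δ)))
                  (solve 2 (λ s x → ⊝ (s ⊗ ⊝ x) := s ⊗ x) refl _ _)) (combine-neg c b d₃ d₁ 0<c 0<b r q)) 0<s)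

      -- R and S lie in the rectangle with diagonal PQ, and so does the segment RS. If they are on
      -- different sides of the line PQ, that segment meets the line inside the rectangle, hence on
      -- PQ.
      intro : 0# < d₁ * d₃ → MonoCross P Q R S
      intro p = (pos-resp (sym αβ) p , 0<-γδ p) , rising x₁<x₄ y₁<y₄ x₂<x₃ y₂<y₃

      elim : MonoCross P Q R S → 0# < d₁ * d₃
      elim ((p , _) , _) = pos-resp αβ p

    module PRSQ-RPQS where
      P Q R S : Carrier × Carrier
      P = x₁ , y₂
      R = x₂ , y₁
      S = x₃ , y₄
      Q = x₄ , y₃

      private
        s = a + b + c

        α : s * A + B * a ≈ - orient P Q R
        α = solve 8 (λ z a b c Z A B C → (a ⊕ b ⊕ c) ⊗ A ⊕ B ⊗ a :=
          ⊝ :orient (z , :2 Z A) (:4 z a b c , :3 Z A B) (:2 z a , Z)) refl z a b c Z A B C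

        β : B * c + s * C ≈ orient P Q S
        β = solve 8 (λ z a b c Z A B C → B ⊗ c ⊕ (a ⊕ b ⊕ c) ⊗ C :=
          :orient (z , :2 Z A) (:4 z a b c , :3 Z A B) (:3 z a b , :4 Z A B C)) refl z a b c Z A B C

        γ : a * (B + C) + A * (a + b) ≈ orient P R S
        γ = solve 8 (λ z a b c Z A B C → a ⊗ (B ⊕ C) ⊕ A ⊗ (a ⊕ b) :=
          :orient (z , :2 Z A) (:2 z a , Z) (:3 z a b , :4 Z A B C)) refl z a b c Z A B C

        δ : (b + c) * C + (A + B) * c ≈ - orient Q R S
        δ = solve 8 (λ z a b c Z A B C → (b ⊕ c) ⊗ C ⊕ (A ⊕ B) ⊗ c :=
          ⊝ :orient (:4 z a b c , :3 Z A B) (:2 z a , Z) (:3 z a b , :4 Z A B C)) refl z a b c Z A B C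

        0<s : 0# < s
        0<s = +-pos (+-pos 0<a 0<b) 0<c

      -- PQ joins the left side of the bounding box to the right one, and RS joins the bottom to the
      -- top.
      always : MonoCross P Q R S
      always = (neg-*-pos (pos-resp α (+-pos (*-pos 0<s 0<A) (*-pos 0<B 0<a)))
                          (pos-resp β (+-pos (*-pos 0<B 0<c) (*-pos 0<s 0<C))) ,
                pos-*-neg (pos-resp γ (+-pos (*-pos 0<a (+-pos 0<B 0<C)) (*-pos 0<A (+-pos 0<a 0<b))))
                          (pos-resp δ (+-pos (*-pos (+-pos 0<b 0<c) 0<C) (*-pos (+-pos 0<A 0<B) 0<c)))) ,
               rising x₁<x₄ y₂<y₃ x₂<x₃ y₁<y₄

    module PRSQ-PRQS where
      P Q R S : Carrier × Carrier
      P = x₁ , y₁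
      R = x₂ , y₂
      S = x₃ , y₄
      Q = x₄ , y₃

      private
        α : (A + B) * a - (a + b + c) * A ≈ - orient P Q R
        α = solve 8 (λ z a b c Z A B C → (A ⊕ B) ⊗ a ⊖ (a ⊕ b ⊕ c) ⊗ A :=
          ⊝ :orient (z , Z) (:4 z a b c , :3 Z A B) (:2 z a , :2 Z A)) refl z a b c Z A B C

        β : (a + b + c) * C + (A + B) * c ≈ orient P Q S
        β = solve 8 (λ z a b c Z A B C → (a ⊕ b ⊕ c) ⊗ C ⊕ (A ⊕ B) ⊗ c :=
          :orient (z , Z) (:4 z a b c , :3 Z A B) (:3 z a b , :4 Z A B C)) refl z a b c Z A B C

        γ : ((A + B) * a - (a + b + c) * A) + (A * c + a * C) ≈ orient P R S
        γ = solve 8 (λ z a b c Z A B C → ((A ⊕ B) ⊗ a ⊖ (a ⊕ b ⊕ c) ⊗ A) ⊕ (A ⊗ c ⊕ a ⊗ C) :=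
          :orient (z , Z) (:2 z a , :2 Z A) (:3 z a b , :4 Z A B C)) refl z a b c Z A B C

        δ : (b + c) * C + B * c ≈ - orient Q R S
        δ = solve 8 (λ z a b c Z A B C → (b ⊕ c) ⊗ C ⊕ B ⊗ c :=
          ⊝ :orient (:4 z a b c , :3 Z A B) (:2 z a , :2 Z A) (:3 z a b , :4 Z A B C)) refl z a b c Z A B C

        0<β : 0# < orient P Q S
        0<β = pos-resp β (+-pos (*-pos (+-pos (+-pos 0<a 0<b) 0<c) 0<C) (*-pos (+-pos 0<A 0<B) 0<c))

      -- Exchanging the two coordinates turns this order into that of `PRQS-PRSQ`, with the two
      -- triples of gaps exchanged.
      intro : Exceeds a b c A B C → MonoCross P Q R S
      intro p = (neg-*-pos (pos-resp α (sub-pos p)) 0<β ,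
                 pos-*-neg (pos-resp γ (+-pos (sub-pos p) (+-pos (*-pos 0<A 0<c) (*-pos 0<a 0<C))))
                           (pos-resp δ (+-pos (*-pos (+-pos 0<b 0<c) 0<C) (*-pos 0<B 0<c)))) ,
                rising x₁<x₄ y₁<y₃ x₂<x₃ y₂<y₄

      elim : MonoCross P Q R S → Exceeds a b c A B C
      elim ((p , _) , _) = pos-sub (pos-resp (sym α) (*-cancel-pos (pos-resp
        (solve 2 (λ x y → ⊝ (x ⊗ y) := y ⊗ ⊝ x) refl _ _) p) 0<β))

    module PRSQ-RPSQ where
      P Q R S : Carrier × Carrier
      P = x₁ , y₂
      R = x₂ , y₁
      S = x₃ , y₃
      Q = x₄ , y₄

      private
        α : (a + b + c) * A + (B + C) * a ≈ - orient P Q R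
        α = solve 8 (λ z a b c Z A B C → (a ⊕ b ⊕ c) ⊗ A ⊕ (B ⊕ C) ⊗ a :=
          ⊝ :orient (z , :2 Z A) (:4 z a b c , :4 Z A B C) (:2 z a , Z)) refl z a b c Z A B C

        β : (C + B) * c - (c + b + a) * C ≈ orient P Q S
        β = solve 8 (λ z a b c Z A B C → (C ⊕ B) ⊗ c ⊖ (c ⊕ b ⊕ a) ⊗ C :=
          :orient (z , :2 Z A) (:4 z a b c , :4 Z A B C) (:3 z a b , :3 Z A B)) refl z a b c Z A B C

        γ : a * B + A * (a + b) ≈ orient P R S
        γ = solve 8 (λ z a b c Z A B C → a ⊗ B ⊕ A ⊗ (a ⊕ b) :=
          :orient (z , :2 Z A) (:2 z a , Z) (:3 z a b , :3 Z A B)) refl z a b c Z A B C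

        δ : ((C + B) * c - (c + b + a) * C) + (A * c + a * C) ≈ - orient Q R S
        δ = solve 8 (λ z a b c Z A B C → ((C ⊕ B) ⊗ c ⊖ (c ⊕ b ⊕ a) ⊗ C) ⊕ (A ⊗ c ⊕ a ⊗ C) :=
          ⊝ :orient (:4 z a b c , :4 Z A B C) (:2 z a , Z) (:3 z a b , :3 Z A B)) refl z a b c Z A B C

        0<-α : 0# < - orient P Q R
        0<-α = pos-resp α (+-pos (*-pos (+-pos (+-pos 0<a 0<b) 0<c) 0<A) (*-pos (+-pos 0<B 0<C) 0<a))

      -- A half-turn, with P and Q and likewise R and S interchanged, leads to the order of
      -- `PRSQ-PRQS`.
      intro : Exceeds c b a C B A → MonoCross P Q R S
      intro p = (neg-*-pos 0<-α (pos-resp β (sub-pos p)) ,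
                 pos-*-neg (pos-resp γ (+-pos (*-pos 0<a 0<B) (*-pos 0<A (+-pos 0<a 0<b))))
                           (pos-resp δ (+-pos (sub-pos p) (+-pos (*-pos 0<A 0<c) (*-pos 0<a 0<C))))) ,
                rising x₁<x₄ y₂<y₄ x₂<x₃ y₁<y₃

      elim : MonoCross P Q R S → Exceeds c b a C B A
      elim ((p , _) , _) = pos-sub (pos-resp (sym β) (*-cancel-pos (pos-resp
        (solve 2 (λ x y → ⊝ (x ⊗ y) := ⊝ x ⊗ y) refl _ _) p) 0<-α))

-- Finite sums and equality up to an error

module Sums where
  open Nat
  open ℕₚ

  ∑ : ℕ → (ℕ → ℕ) → ℕ
  ∑ zero    f = 0
  ∑ (suc n) f = ∑ n f + f n

  syntax ∑ n (λ i → e) = ∑[ i < n ] e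

  ∑-cong-< : ∀ n {f g} → (∀ i → i < n → f i ≡ g i) → ∑ n f ≡ ∑ n g
  ∑-cong-< zero    eq = ≡.refl
  ∑-cong-< (suc n) eq = ≡.cong₂ _+_ (∑-cong-< n λ i i<n → eq i (m<n⇒m<1+n i<n)) (eq n ≤-refl)

  ∑-cong : ∀ n {f g} → (∀ i → f i ≡ g i) → ∑ n f ≡ ∑ n g
  ∑-cong n eq = ∑-cong-< n λ i _ → eq i

  ∑-mono : ∀ n {f g} → (∀ i → f i ≤ g i) → ∑ n f ≤ ∑ n g
  ∑-mono zero    le = ≤-refl
  ∑-mono (suc n) le = +-mono-≤ (∑-mono n le) (le n)

  ∑-zero : ∀ n {f} → (∀ i → i < n → f i ≡ 0) → ∑ n f ≡ 0
  ∑-zero zero    eq = ≡.refl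
  ∑-zero (suc n) eq = ≡.cong₂ _+_ (∑-zero n λ i i<n → eq i (m<n⇒m<1+n i<n)) (eq n ≤-refl)

  ∑-+ : ∀ n f g → ∑[ i < n ] (f i + g i) ≡ ∑ n f + ∑ n g
  ∑-+ zero    f g = ≡.refl
  ∑-+ (suc n) f g = ≡.trans (≡.cong (_+ (f n + g n)) (∑-+ n f g)) (interchange (∑ n f) (∑ n g) (f n) (g n))
    where
    interchange : ∀ a b c d → a + b + (c + d) ≡ a + c + (b + d)
    interchange = solve-∀

  ∑-*ˡ : ∀ n k f → ∑[ i < n ] (k * f i) ≡ k * ∑ n f
  ∑-*ˡ zero    k f = ≡.sym (*-zeroʳ k)
  ∑-*ˡ (suc n) k f = ≡.trans (≡.cong (_+ k * f n) (∑-*ˡ n k f)) (≡.sym (*-distribˡ-+ k (∑ n f) (f n)))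

  ∑-const : ∀ n k → ∑[ i < n ] k ≡ n * k
  ∑-const zero    k = ≡.refl
  ∑-const (suc n) k = ≡.trans (≡.cong (_+ k) (∑-const n k)) (+-comm (n * k) k)

  ∑-bound : ∀ n {f} k → (∀ i → f i ≤ k) → ∑ n f ≤ n * k
  ∑-bound n k le = ≤-trans (∑-mono n le) (≤-reflexive (∑-const n k))

  ∑-comm : ∀ m n (f : ℕ → ℕ → ℕ) → ∑[ i < m ] ∑[ j < n ] f i j ≡ ∑[ j < n ] ∑[ i < m ] f i j
  ∑-comm zero    n f = ≡.sym (∑-zero n λ _ _ → ≡.refl)
  ∑-comm (suc m) n f = ≡.trans (≡.cong (_+ ∑ n (f m)) (∑-comm m n f))
                         (≡.sym (∑-+ n (λ j → ∑[ i < m ] f i j) (f m)))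

  ∑-split : ∀ m n f → ∑ (m + n) f ≡ ∑ m f + ∑[ j < n ] f (m + j)
  ∑-split m zero    f = ≡.trans (≡.cong (λ k → ∑ k f) (+-identityʳ m)) (≡.sym (+-identityʳ _))
  ∑-split m (suc n) f = ≡.trans (≡.cong (λ k → ∑ k f) (+-suc m n))
    (≡.trans (≡.cong (_+ f (m + n)) (∑-split m n f)) (+-assoc (∑ m f) _ _))

  ∑-reverse : ∀ n f → ∑ n f ≡ ∑[ i < n ] f (n ∸ suc i)
  ∑-reverse zero    f = ≡.refl
  ∑-reverse (suc n) f = ≡.trans (+-comm (∑ n f) (f n))
    (≡.trans (≡.cong (f n +_) (∑-reverse n f)) (≡.sym (∑-split 1 n (λ i → f (n ∸ i)))))

  ∑⁴ : ℕ → (ℕ → ℕ → ℕ → ℕ → ℕ) → ℕ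
  ∑⁴ n f = ∑[ p < n ] ∑[ q < n ] ∑[ r < n ] ∑[ s < n ] f p q r s

  ∑⁴-cong-< : ∀ n {f g} →
    (∀ p q r s → p < n → q < n → r < n → s < n → f p q r s ≡ g p q r s) → ∑⁴ n f ≡ ∑⁴ n g
  ∑⁴-cong-< n eq = ∑-cong-< n λ p p<n → ∑-cong-< n λ q q<n → ∑-cong-< n λ r r<n → ∑-cong-< n λ s s<n →
    eq p q r s p<n q<n r<n s<n

  ∑⁴-cong : ∀ n {f g} → (∀ p q r s → f p q r s ≡ g p q r s) → ∑⁴ n f ≡ ∑⁴ n g
  ∑⁴-cong n eq = ∑⁴-cong-< n λ p q r s _ _ _ _ → eq p q r s

  ∑⁴-mono : ∀ n {f g} → (∀ p q r s → f p q r s ≤ g p q r s) → ∑⁴ n f ≤ ∑⁴ n g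
  ∑⁴-mono n le = ∑-mono n λ p → ∑-mono n λ q → ∑-mono n λ r → ∑-mono n λ s → le p q r s

  ∑⁴-zero : ∀ n {f} → (∀ p q r s → f p q r s ≡ 0) → ∑⁴ n f ≡ 0
  ∑⁴-zero n eq = ∑-zero n λ p _ → ∑-zero n λ q _ → ∑-zero n λ r _ → ∑-zero n λ s _ → eq p q r s

  ∑⁴-+ : ∀ n f g → ∑⁴ n (λ p q r s → f p q r s + g p q r s) ≡ ∑⁴ n f + ∑⁴ n g
  ∑⁴-+ n f g = ≡.trans (∑-cong n λ p → ≡.trans (∑-cong n λ q → ≡.trans (∑-cong n λ r →
    ∑-+ n (f p q r) (g p q r)) (∑-+ n _ _)) (∑-+ n _ _)) (∑-+ n _ _)

  ∑⁴-*ˡ : ∀ n k f → ∑⁴ n (λ p q r s → k * f p q r s) ≡ k * ∑⁴ n f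
  ∑⁴-*ˡ n k f = ≡.trans (∑-cong n λ p → ≡.trans (∑-cong n λ q → ≡.trans (∑-cong n λ r →
    ∑-*ˡ n k (f p q r)) (∑-*ˡ n k _)) (∑-*ˡ n k _)) (∑-*ˡ n k _)

  ∑⁴-bound : ∀ n {f} k → (∀ p q r s → f p q r s ≤ k) → ∑⁴ n f ≤ n ^ 4 * k
  ∑⁴-bound n k le = ≤-trans
    (∑-bound n _ λ p → ∑-bound n _ λ q → ∑-bound n _ λ r → ∑-bound n k λ s → le p q r s)
    (≤-reflexive (assoc n k))
    where
    assoc : ∀ n k → n * (n * (n * (n * k))) ≡ n * (n * (n * (n * 1))) * k
    assoc = solve-∀

  ∑⁴-const : ∀ n k → ∑⁴ n (λ _ _ _ _ → k) ≡ n ^ 4 * k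
  ∑⁴-const n k = ≡.trans
    (≡.trans (∑-cong n λ p → ≡.trans (∑-cong n λ q → ≡.trans (∑-cong n λ r → ∑-const n k)
      (∑-const n _)) (∑-const n _)) (∑-const n _)) (assoc n k)
    where
    assoc : ∀ n k → n * (n * (n * (n * k))) ≡ n * (n * (n * (n * 1))) * k
    assoc = solve-∀

  ∑⁴-bound₄ : ∀ n {f} k → (∀ p q r → ∑ n (f p q r) ≤ k) → ∑⁴ n f ≤ n ^ 3 * k
  ∑⁴-bound₄ n k le = ≤-trans (∑-bound n _ λ p → ∑-bound n _ λ q → ∑-bound n _ λ r → le p q r)
    (≤-reflexive (assoc n k))
    where
    assoc : ∀ n k → n * (n * (n * k)) ≡ n * (n * (n * 1)) * k
    assoc = solve-∀

  ∑⁴-swap₁₂ : ∀ n f → ∑⁴ n f ≡ ∑⁴ n (λ p q r s → f q p r s)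
  ∑⁴-swap₁₂ n f = ∑-comm n n _

  ∑⁴-swap₂₃ : ∀ n f → ∑⁴ n f ≡ ∑⁴ n (λ p q r s → f p r q s)
  ∑⁴-swap₂₃ n f = ∑-cong n λ p → ∑-comm n n _

  ∑⁴-swap₃₄ : ∀ n f → ∑⁴ n f ≡ ∑⁴ n (λ p q r s → f p q s r)
  ∑⁴-swap₃₄ n f = ∑-cong n λ p → ∑-cong n λ q → ∑-comm n n _

  ∑⁴-exchange : ∀ n f → ∑⁴ n f ≡ ∑⁴ n (λ p q r s → f r s p q)
  ∑⁴-exchange n f = ≡.trans (∑⁴-swap₂₃ n f) (≡.trans (∑⁴-swap₁₂ n _)
    (≡.trans (∑⁴-swap₃₄ n _) (∑⁴-swap₂₃ n _)))

  ∑⁴-reverse : ∀ n f → ∑⁴ n f ≡ ∑⁴ n (λ p q r s → f (n ∸ suc p) (n ∸ suc q) (n ∸ suc r) (n ∸ suc s))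
  ∑⁴-reverse n f = ≡.trans (∑-reverse n _) (∑-cong n λ p → ≡.trans (∑-reverse n _) (∑-cong n λ q →
    ≡.trans (∑-reverse n _) (∑-cong n λ r → ∑-reverse n _)))

  ∑∑⁴-comm : ∀ n (f : ℕ → ℕ → ℕ → ℕ → ℕ → ℕ) →
    ∑[ i < n ] ∑⁴ n (f i) ≡ ∑⁴ n (λ p q r s → ∑[ i < n ] f i p q r s)
  ∑∑⁴-comm n f = ≡.trans (∑-comm n n _) (∑-cong n λ p → ≡.trans (∑-comm n n _) (∑-cong n λ q →
    ≡.trans (∑-comm n n _) (∑-cong n λ r → ∑-comm n n _)))

  ∑⁴-comm : ∀ n (f : ℕ → ℕ → ℕ → ℕ → ℕ → ℕ → ℕ → ℕ → ℕ) →
    ∑⁴ n (λ p q r s → ∑⁴ n (f p q r s)) ≡ ∑⁴ n (λ P Q R S → ∑⁴ n λ p q r s → f p q r s P Q R S)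
  ∑⁴-comm n f = ≡.trans (∑-cong n λ p → ≡.trans (∑-cong n λ q → ≡.trans (∑-cong n λ r →
    ∑∑⁴-comm n _) (∑∑⁴-comm n _)) (∑∑⁴-comm n _)) (∑∑⁴-comm n _)

  infix 4 _≈[_]_
  -- Distance at most `e`, as two inequalities because subtraction on ℕ truncates.
  record _≈[_]_ (a e b : ℕ) : Set where
    constructor _,_
    field
      upper : a ≤ b + e
      lower : b ≤ a + e

  open _≈[_]_ public

  ≈-of-≡ : ∀ {a b e} → a ≡ b → a ≈[ e ] b
  ≈-of-≡ {a} ≡.refl = m≤m+n a _ , m≤m+n a _

  ≈-trans : ∀ {a b c e e′} → a ≈[ e ] b → b ≈[ e′ ] c → a ≈[ e + e′ ] c
  ≈-trans {a} {b} {c} {e} {e′} (u , l) (u′ , l′) =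
    ≤-trans u (≤-trans (+-monoˡ-≤ e u′) (≤-reflexive (≡.trans (+-assoc c e′ e) (≡.cong (c +_) (+-comm e′ e))))) ,
    ≤-trans l′ (≤-trans (+-monoˡ-≤ e′ l) (≤-reflexive (+-assoc a e e′)))

  ≈-weaken : ∀ {a b e e′} → e ≤ e′ → a ≈[ e ] b → a ≈[ e′ ] b
  ≈-weaken {a} {b} e≤e′ (u , l) = ≤-trans u (+-monoʳ-≤ b e≤e′) , ≤-trans l (+-monoʳ-≤ a e≤e′)

  ≈-+ : ∀ {a b c d e e′} → a ≈[ e ] b → c ≈[ e′ ] d → a + c ≈[ e + e′ ] b + d
  ≈-+ {a} {b} {c} {d} {e} {e′} (u , l) (u′ , l′) =
    ≤-trans (+-mono-≤ u u′) (≤-reflexive (shuffle b e d e′)) ,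
    ≤-trans (+-mono-≤ l l′) (≤-reflexive (shuffle a e c e′))
    where
    shuffle : ∀ b e d e′ → b + e + (d + e′) ≡ b + d + (e + e′)
    shuffle = solve-∀

  ≈-*ˡ : ∀ k {a b e} → a ≈[ e ] b → k * a ≈[ k * e ] k * b
  ≈-*ˡ k {a} {b} {e} (u , l) =
    ≤-trans (*-monoʳ-≤ k u) (≤-reflexive (*-distribˡ-+ k b e)) ,
    ≤-trans (*-monoʳ-≤ k l) (≤-reflexive (*-distribˡ-+ k a e))

  ≈-∑ : ∀ n {f g e} → (∀ i → f i ≈[ e i ] g i) → ∑ n f ≈[ ∑ n e ] ∑ n g
  ≈-∑ n {f} {g} {e} eq =
    ≤-trans (∑-mono n λ i → upper (eq i)) (≤-reflexive (∑-+ n g e)) ,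
    ≤-trans (∑-mono n λ i → lower (eq i)) (≤-reflexive (∑-+ n f e))

  ≈-∑⁴ : ∀ n {f g e} → (∀ p q r s → f p q r s ≈[ e p q r s ] g p q r s) → ∑⁴ n f ≈[ ∑⁴ n e ] ∑⁴ n g
  ≈-∑⁴ n eq = ≈-∑ n λ p → ≈-∑ n λ q → ≈-∑ n λ r → ≈-∑ n λ s → eq p q r s

  ≈-resp : ∀ {a a′ b b′ e} → a ≡ a′ → b ≡ b′ → a ≈[ e ] b → a′ ≈[ e ] b′
  ≈-resp ≡.refl ≡.refl p = p

-- Indicators of propositions

module Indicators (em : ExcludedMiddle 0ℓ) where
  open Nat
  open ℕₚ
  open Sums

  private
    fromDec : ∀ {P : Set} → Dec P → ℕ
    fromDec (yes _) = 1
    fromDec (no _)  = 0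

  ⟦_⟧ : Set → ℕ
  ⟦ P ⟧ = fromDec (em {P})

  ⟦⟧-yes : ∀ {P} → P → ⟦ P ⟧ ≡ 1
  ⟦⟧-yes {P} p with em {P}
  ... | yes _ = ≡.refl
  ... | no ¬p = ⊥-elim (¬p p)

  ⟦⟧-no : ∀ {P} → ¬ P → ⟦ P ⟧ ≡ 0
  ⟦⟧-no {P} ¬p with em {P}
  ... | yes p = ⊥-elim (¬p p)
  ... | no _  = ≡.refl

  ⟦⟧≤1 : ∀ P → ⟦ P ⟧ ≤ 1
  ⟦⟧≤1 P with em {P}
  ... | yes _ = ≤-refl
  ... | no _  = z≤n

  ⟦⟧-≤ : ∀ {P k} → (P → 1 ≤ k) → ⟦ P ⟧ ≤ k
  ⟦⟧-≤ {P} f with em {P}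
  ... | yes p = f p
  ... | no _  = z≤n

  ⟦⟧-mono : ∀ {P Q} → (P → Q) → ⟦ P ⟧ ≤ ⟦ Q ⟧
  ⟦⟧-mono f = ⟦⟧-≤ λ p → ≤-reflexive (≡.sym (⟦⟧-yes (f p)))

  ⟦⟧-cong : ∀ {P Q} → (P → Q) → (Q → P) → ⟦ P ⟧ ≡ ⟦ Q ⟧
  ⟦⟧-cong f g = ≤-antisym (⟦⟧-mono f) (⟦⟧-mono g)

  ⟦⟧-⊎ : ∀ {P Q} → ⟦ P ⊎ Q ⟧ ≤ ⟦ P ⟧ + ⟦ Q ⟧
  ⟦⟧-⊎ {P} {Q} = ⟦⟧-≤ λ
    { (inj₁ p) → ≤-trans (≤-reflexive (≡.sym (⟦⟧-yes p))) (m≤m+n ⟦ P ⟧ ⟦ Q ⟧)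
    ; (inj₂ q) → ≤-trans (≤-reflexive (≡.sym (⟦⟧-yes q))) (m≤n+m ⟦ Q ⟧ ⟦ P ⟧) }

  ⟦⟧-disjoint : ∀ {P Q} → ¬ (P × Q) → ⟦ P ⊎ Q ⟧ ≡ ⟦ P ⟧ + ⟦ Q ⟧
  ⟦⟧-disjoint {P} {Q} disjoint with em {P} | em {Q}
  ... | yes p | yes q = ⊥-elim (disjoint (p , q))
  ... | yes p | no _  = ⟦⟧-yes (inj₁ p)
  ... | no _  | yes q = ⟦⟧-yes (inj₂ q)
  ... | no ¬p | no ¬q = ⟦⟧-no [ ¬p , ¬q ]′

  ⟦⟧-× : ∀ P Q → ⟦ P × Q ⟧ ≡ ⟦ P ⟧ * ⟦ Q ⟧
  ⟦⟧-× P Q with em {P} | em {Q}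
  ... | yes p | yes q = ⟦⟧-yes (p , q)
  ... | yes p | no ¬q = ⟦⟧-no (¬q ∘ proj₂)
  ... | no ¬p | _     = ⟦⟧-no (¬p ∘ proj₁)

  ⟦⟧-yes-* : ∀ {P} k → P → ⟦ P ⟧ * k ≡ k
  ⟦⟧-yes-* k p = ≡.trans (≡.cong (_* k) (⟦⟧-yes p)) (+-identityʳ k)

  ⟦⟧-no-* : ∀ {P} k → ¬ P → ⟦ P ⟧ * k ≡ 0
  ⟦⟧-no-* k ¬p = ≡.cong (_* k) (⟦⟧-no ¬p)

  ⟦⟧*≤ : ∀ P k → ⟦ P ⟧ * k ≤ k
  ⟦⟧*≤ P k = ≤-trans (*-monoˡ-≤ k (⟦⟧≤1 P)) (≤-reflexive (+-identityʳ k))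

  ∑-below : ∀ {m n} f → m ≤ n → ∑[ i < n ] (⟦ i < m ⟧ * f i) ≡ ∑ m f
  ∑-below {m} {n} f m≤n = let l = n ∸ m in
    ≡.trans (≡.cong (λ k → ∑ k (λ i → ⟦ i < m ⟧ * f i)) (≡.sym (m+[n∸m]≡n m≤n)))
    (≡.trans (∑-split m l _)
    (≡.trans (≡.cong₂ _+_ (∑-cong-< m λ i i<m → ⟦⟧-yes-* (f i) i<m)
                          (∑-zero l λ i _ → ⟦⟧-no-* (f (m + i)) (≤⇒≯ (m≤m+n m i))))
      (+-identityʳ _)))

  -- The substitution j = i + 1 + a keeps the full range n for a and moves the constraint into an
  -- indicator, so that nested sums have no dependent ranges and can be interchanged.
  ∑-above : ∀ i n f → ∑[ j < n ] (⟦ i < j ⟧ * f j) ≡ ∑[ a < n ] (⟦ i + suc a < n ⟧ * f (i + suc a))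
  ∑-above i n f with ℕₚ.<-≤-connex i n
  ... | inj₂ n≤i = ≡.trans (∑-zero n λ j j<n → ⟦⟧-no-* (f j) (≤⇒≯ (≤-trans (<⇒≤ j<n) n≤i)))
          (≡.sym (∑-zero n λ a _ → ⟦⟧-no-* (f (i + suc a)) (≤⇒≯ (≤-trans n≤i (m≤m+n i (suc a))))))
  ... | inj₁ i<n = begin
      ∑[ j < n ] (⟦ i < j ⟧ * f j)
        ≡⟨ ≡.cong (λ k → ∑[ j < k ] (⟦ i < j ⟧ * f j)) (m+[n∸m]≡n i<n) ⟨
      ∑[ j < suc i + l ] (⟦ i < j ⟧ * f j)
        ≡⟨ ∑-split (suc i) l _ ⟩
      ∑[ j < suc i ] (⟦ i < j ⟧ * f j) + ∑[ a < l ] (⟦ i < suc i + a ⟧ * f (suc i + a))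
        ≡⟨ ≡.cong₂ _+_ (∑-zero (suc i) λ j j≤i → ⟦⟧-no-* (f j) (≤⇒≯ (≤-pred j≤i)))
             (∑-cong l λ a → ≡.trans (⟦⟧-yes-* _ (s≤s (m≤m+n i a))) (≡.cong f (≡.sym (+-suc i a)))) ⟩
      ∑[ a < l ] f (i + suc a)
        ≡⟨ ∑-below (λ a → f (i + suc a)) (m∸n≤m n (suc i)) ⟨
      ∑[ a < n ] (⟦ a < l ⟧ * f (i + suc a))
        ≡⟨ ∑-cong n (λ a → ≡.cong (_* f (i + suc a)) (⟦⟧-cong (to a) (from a))) ⟩
      ∑[ a < n ] (⟦ i + suc a < n ⟧ * f (i + suc a)) ∎
    where
    open ≡.≡-Reasoning
    l = n ∸ suc i
    to : ∀ a → a < l → i + suc a < n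
    to a a<l = ≡.subst₂ _<_ (≡.sym (+-suc i a)) (m+[n∸m]≡n i<n) (+-monoʳ-< (suc i) a<l)
    from : ∀ a → i + suc a < n → a < l
    from a p = +-cancelˡ-< (suc i) a l (≡.subst₂ _<_ (+-suc i a) (≡.sym (m+[n∸m]≡n i<n)) p)

  -- If P n holds then so do only numbers within L of n, whence the bound L.
  window : ∀ n L {P : ℕ → Set} → (∀ i j → i ≤ j → P i → P j → j < i + L) → ∑[ i < n ] ⟦ P i ⟧ ≤ L
  window zero    L near = z≤n
  window (suc n) L {P} near with em {P n}
  ... | no _  = ≤-trans (≤-reflexive (+-identityʳ _)) (window n L near)
  ... | yes p with ℕₚ.≤-total (suc n) L
  ...   | inj₁ n<L = ≤-trans (+-monoˡ-≤ 1 (∑-bound n 1 λ i → ⟦⟧≤1 (P i)))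
                       (≤-trans (≤-reflexive (≡.trans (≡.cong (_+ 1) (*-identityʳ n)) (+-comm n 1))) n<L)
  ...   | inj₂ L≤1+n = ≤-trans (≤-reflexive (≡.cong (∑[ i < n ] ⟦ P i ⟧ +_) (≡.sym (⟦⟧-yes p))))
      (≤-trans (≤-reflexive (≡.cong (λ k → ∑[ i < k ] ⟦ P i ⟧) (≡.sym (m∸n+n≡m L≤1+n))))
      (≤-trans (≤-reflexive (∑-split (suc n ∸ L) L _))
      (+-mono-≤ (≤-reflexive (∑-zero (suc n ∸ L) far))
        (≤-trans (∑-bound L 1 λ i → ⟦⟧≤1 _) (≤-reflexive (*-identityʳ L))))))
    where
    far : ∀ i → i < suc n ∸ L → ⟦ P i ⟧ ≡ 0
    far i i<n-L = ⟦⟧-no λ q → <⇒≱ (near i n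
      (≤-pred (≤-trans i<n-L (m∸n≤m (suc n) L))) q p)
      (≤-pred (≤-trans (+-monoˡ-≤ L i<n-L) (≤-reflexive (m∸n+n≡m L≤1+n))))

-- Sums over sorted quadruples and over their gaps

module SortedSums (em : ExcludedMiddle 0ℓ) where
  open Nat
  open ℕₚ
  open Sums
  open Indicators em

  Sorted : ℕ → ℕ → ℕ → ℕ → Set
  Sorted a b c d = a < b × b < c × c < d

  𝕊 : ℕ → (ℕ → ℕ → ℕ → ℕ → ℕ) → ℕ
  𝕊 n f = ∑⁴ n λ a b c d → ⟦ Sorted a b c d ⟧ * f a b c d

  -- A sorted quadruple is given by its least entry z and its three gaps, which
  -- are positive; g depends on the gaps only.
  𝔾 : ℕ → (ℕ → ℕ → ℕ → ℕ) → ℕ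
  𝔾 n g = ∑⁴ n λ z a b c → ⟦ z + suc a + suc b + suc c < n ⟧ * g (suc a) (suc b) (suc c)

  private
    ∑³-factor : ∀ n (u : ℕ → ℕ) (v : ℕ → ℕ → ℕ) (w f : ℕ → ℕ → ℕ → ℕ) →
      ∑[ b < n ] ∑[ c < n ] ∑[ d < n ] (u b * (v b c * (w b c d * f b c d))) ≡
      ∑[ b < n ] (u b * ∑[ c < n ] (v b c * ∑[ d < n ] (w b c d * f b c d)))
    ∑³-factor n u v w f = ∑-cong n λ b → ≡.trans (∑-cong n λ c →
      ≡.trans (∑-*ˡ n (u b) _) (≡.cong (u b *_) (∑-*ˡ n (v b c) _))) (∑-*ˡ n (u b) _)

  𝕊⇒𝔾 : ∀ n {f g} → (∀ z a b c → 0 < a → 0 < b → 0 < c →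
    f z (z + a) (z + a + b) (z + a + b + c) ≡ g a b c) → 𝕊 n f ≡ 𝔾 n g
  𝕊⇒𝔾 n {f} {g} eq = ∑-cong n λ z → begin
    ∑[ b < n ] ∑[ c < n ] ∑[ d < n ] (⟦ Sorted z b c d ⟧ * f z b c d)
      ≡⟨ (∑-cong n λ b → ∑-cong n λ c → ∑-cong n λ d → split-sorted z b c d (f z b c d)) ⟩
    ∑[ b < n ] ∑[ c < n ] ∑[ d < n ] (⟦ z < b ⟧ * (⟦ b < c ⟧ * (⟦ c < d ⟧ * f z b c d)))
      ≡⟨ ∑³-factor n (λ b → ⟦ z < b ⟧) (λ b c → ⟦ b < c ⟧) (λ b c d → ⟦ c < d ⟧) (f z) ⟩
    ∑[ b < n ] (⟦ z < b ⟧ * ∑[ c < n ] (⟦ b < c ⟧ * ∑[ d < n ] (⟦ c < d ⟧ * f z b c d)))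
      ≡⟨ ∑-above z n _ ⟩
    ∑[ a < n ] (⟦ z + suc a < n ⟧ * ∑[ c < n ] (⟦ z + suc a < c ⟧ * ∑[ d < n ] (⟦ c < d ⟧ * f z (z + suc a) c d)))
      ≡⟨ (∑-cong n λ a → ≡.cong (⟦ z + suc a < n ⟧ *_) (≡.trans (∑-above (z + suc a) n _)
           (∑-cong n λ b → ≡.cong (⟦ z + suc a + suc b < n ⟧ *_) (∑-above (z + suc a + suc b) n _)))) ⟩
    ∑[ a < n ] (⟦ z + suc a < n ⟧ * ∑[ b < n ] (⟦ z + suc a + suc b < n ⟧ * ∑[ c < n ]
      (⟦ z + suc a + suc b + suc c < n ⟧ * f z (z + suc a) (z + suc a + suc b) (z + suc a + suc b + suc c))))
      ≡⟨ ∑³-factor n (λ a → ⟦ z + suc a < n ⟧) (λ a b → ⟦ z + suc a + suc b < n ⟧)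
           (λ a b c → ⟦ z + suc a + suc b + suc c < n ⟧) _ ⟨
    ∑[ a < n ] ∑[ b < n ] ∑[ c < n ] (⟦ z + suc a < n ⟧ * (⟦ z + suc a + suc b < n ⟧ *
      (⟦ z + suc a + suc b + suc c < n ⟧ * f z (z + suc a) (z + suc a + suc b) (z + suc a + suc b + suc c))))
      -- The bound on the greatest entry implies those on the two middle ones, whose indicators
      -- `absorb` removes.
      ≡⟨ (∑-cong n λ a → ∑-cong n λ b → ∑-cong n λ c → ≡.trans
           (≡.cong (λ k → ⟦ z + suc a < n ⟧ * (⟦ z + suc a + suc b < n ⟧ * (⟦ z + suc a + suc b + suc c < n ⟧ * k)))
             (eq z (suc a) (suc b) (suc c) z<s z<s z<s))
           (absorb (≤-trans (s≤s (m≤m+n _ (suc b)))) (≤-trans (s≤s (m≤m+n _ (suc c)))) _)) ⟩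
    ∑[ a < n ] ∑[ b < n ] ∑[ c < n ] (⟦ z + suc a + suc b + suc c < n ⟧ * g (suc a) (suc b) (suc c)) ∎
    where
    open ≡.≡-Reasoning
    split-sorted : ∀ a b c d k → ⟦ Sorted a b c d ⟧ * k ≡ ⟦ a < b ⟧ * (⟦ b < c ⟧ * (⟦ c < d ⟧ * k))
    split-sorted a b c d k = ≡.trans (≡.cong (_* k) (≡.trans (⟦⟧-× _ _) (≡.cong (⟦ a < b ⟧ *_) (⟦⟧-× _ _))))
      (assoc ⟦ a < b ⟧ ⟦ b < c ⟧ ⟦ c < d ⟧ k)
      where
      assoc : ∀ u v w k → u * (v * w) * k ≡ u * (v * (w * k))
      assoc = solve-∀
    absorb : ∀ {P Q R : Set} → (Q → P) → (R → Q) → ∀ k → ⟦ P ⟧ * (⟦ Q ⟧ * (⟦ R ⟧ * k)) ≡ ⟦ R ⟧ * k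
    absorb {P} {Q} {R} f h k with em {R}
    ... | yes r = ≡.trans (⟦⟧-yes-* _ (f (h r))) (⟦⟧-yes-* _ (h r))
    ... | no _  = ≡.trans (≡.cong (⟦ P ⟧ *_) (*-zeroʳ ⟦ Q ⟧)) (*-zeroʳ ⟦ P ⟧)

  𝕊-≈ : ∀ n k {f g} → (∀ a b c d → Sorted a b c d → f a b c d ≈[ k ] g a b c d) →
    𝕊 n f ≈[ n ^ 4 * k ] 𝕊 n g
  𝕊-≈ n k {f} {g} eq = ≈-weaken (≤-reflexive (∑⁴-const n k)) (≈-∑⁴ n λ a b c d → pointwise a b c d)
    where
    pointwise : ∀ a b c d → ⟦ Sorted a b c d ⟧ * f a b c d ≈[ k ] ⟦ Sorted a b c d ⟧ * g a b c d
    pointwise a b c d with em {Sorted a b c d}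
    ... | yes p = ≈-resp (≡.sym (+-identityʳ _)) (≡.sym (+-identityʳ _)) (eq a b c d p)
    ... | no _  = z≤n , z≤n

  𝔾-≈ : ∀ n {f g e} → (∀ a b c → 0 < a → 0 < b → 0 < c → f a b c ≈[ e a b c ] g a b c) →
    𝔾 n f ≈[ 𝔾 n e ] 𝔾 n g
  𝔾-≈ n eq = ≈-∑⁴ n λ z a b c → ≈-*ˡ ⟦ z + suc a + suc b + suc c < n ⟧ (eq (suc a) (suc b) (suc c) z<s z<s z<s)

  𝔾-cong : ∀ n {f g} → (∀ a b c → 0 < a → 0 < b → 0 < c → f a b c ≡ g a b c) → 𝔾 n f ≡ 𝔾 n g
  𝔾-cong n eq = ∑⁴-cong n λ z a b c →
    ≡.cong (⟦ z + suc a + suc b + suc c < n ⟧ *_) (eq (suc a) (suc b) (suc c) z<s z<s z<s)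

  𝔾-+ : ∀ n f g → 𝔾 n (λ a b c → f a b c + g a b c) ≡ 𝔾 n f + 𝔾 n g
  𝔾-+ n f g = ≡.trans (∑⁴-cong n λ z a b c → *-distribˡ-+ ⟦ z + suc a + suc b + suc c < n ⟧ _ _) (∑⁴-+ n _ _)

  𝔾-*ˡ : ∀ n k f → 𝔾 n (λ a b c → k * f a b c) ≡ k * 𝔾 n f
  𝔾-*ˡ n k f = ≡.trans (∑⁴-cong n λ z a b c → swap ⟦ z + suc a + suc b + suc c < n ⟧ k _) (∑⁴-*ˡ n k _)
    where
    swap : ∀ u k v → u * (k * v) ≡ k * (u * v)
    swap = solve-∀

  𝔾-bound₃ : ∀ n {f} k → (∀ a b → ∑[ c < n ] f a b (suc c) ≤ k) → 𝔾 n f ≤ n ^ 3 * k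
  𝔾-bound₃ n k le = ∑⁴-bound₄ n k λ z a b →
    ≤-trans (∑-mono n λ c → ⟦⟧*≤ _ _) (le (suc a) (suc b))

  𝔾-bound : ∀ n {f} k → (∀ a b c → 0 < a → 0 < b → 0 < c → f a b c ≤ k) → 𝔾 n f ≤ n ^ 4 * k
  𝔾-bound n k le = ∑⁴-bound n k λ z a b c →
    ≤-trans (⟦⟧*≤ _ _) (le (suc a) (suc b) (suc c) z<s z<s z<s)

  -- The constraint involves the gaps only through their sum, so the gaps are exchangeable; the
  -- averaging arguments rest on this.
  𝔾-swap₁₂ : ∀ n f → 𝔾 n f ≡ 𝔾 n (λ a b c → f b a c)
  𝔾-swap₁₂ n f = ≡.trans (∑⁴-swap₂₃ n _) (∑⁴-cong n λ z a b c →
    ≡.cong (λ k → ⟦ k < n ⟧ * f (suc b) (suc a) (suc c)) (shuffle z a b c))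
    where
    shuffle : ∀ z a b c → z + suc b + suc a + suc c ≡ z + suc a + suc b + suc c
    shuffle = solve-∀

  𝔾-swap₂₃ : ∀ n f → 𝔾 n f ≡ 𝔾 n (λ a b c → f a c b)
  𝔾-swap₂₃ n f = ≡.trans (∑⁴-swap₃₄ n _) (∑⁴-cong n λ z a b c →
    ≡.cong (λ k → ⟦ k < n ⟧ * f (suc a) (suc c) (suc b)) (shuffle z a b c))
    where
    shuffle : ∀ z a b c → z + suc a + suc c + suc b ≡ z + suc a + suc b + suc c
    shuffle = solve-∀

  𝔾-rotate : ∀ n f → 𝔾 n f ≡ 𝔾 n (λ a b c → f b c a)
  𝔾-rotate n f = ≡.trans (𝔾-swap₂₃ n f) (𝔾-swap₁₂ n λ a b c → f a c b)

  𝔾-reverse : ∀ n f → 𝔾 n f ≡ 𝔾 n (λ a b c → f c b a)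
  𝔾-reverse n f = ≡.trans (𝔾-rotate n f) (𝔾-swap₂₃ n λ a b c → f b c a)

  𝔾-comm : ∀ n (f : ℕ → ℕ → ℕ → ℕ → ℕ → ℕ → ℕ) →
    𝔾 n (λ a b c → 𝔾 n (f a b c)) ≡ 𝔾 n (λ A B C → 𝔾 n λ a b c → f a b c A B C)
  𝔾-comm n f = begin
    ∑⁴ n (λ z a b c → w z a b c * ∑⁴ n λ Z A B C → w Z A B C * f⁺ a b c A B C)
      ≡⟨ (∑⁴-cong n λ z a b c → ∑⁴-*ˡ n (w z a b c) λ Z A B C → w Z A B C * f⁺ a b c A B C) ⟨
    ∑⁴ n (λ z a b c → ∑⁴ n λ Z A B C → w z a b c * (w Z A B C * f⁺ a b c A B C))
      ≡⟨ ∑⁴-comm n (λ z a b c Z A B C → w z a b c * (w Z A B C * f⁺ a b c A B C)) ⟩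
    ∑⁴ n (λ Z A B C → ∑⁴ n λ z a b c → w z a b c * (w Z A B C * f⁺ a b c A B C))
      ≡⟨ (∑⁴-cong n λ Z A B C → ∑⁴-cong n λ z a b c → swap (w z a b c) (w Z A B C) (f⁺ a b c A B C)) ⟩
    ∑⁴ n (λ Z A B C → ∑⁴ n λ z a b c → w Z A B C * (w z a b c * f⁺ a b c A B C))
      ≡⟨ (∑⁴-cong n λ Z A B C → ∑⁴-*ˡ n (w Z A B C) λ z a b c → w z a b c * f⁺ a b c A B C) ⟩
    ∑⁴ n (λ Z A B C → w Z A B C * ∑⁴ n λ z a b c → w z a b c * f⁺ a b c A B C) ∎
    where
    open ≡.≡-Reasoning
    w : ℕ → ℕ → ℕ → ℕ → ℕ
    w z a b c = ⟦ z + suc a + suc b + suc c < n ⟧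
    f⁺ : ℕ → ℕ → ℕ → ℕ → ℕ → ℕ → ℕ
    f⁺ a b c A B C = f (suc a) (suc b) (suc c) (suc A) (suc B) (suc C)
    swap : ∀ u k v → u * (k * v) ≡ k * (u * v)
    swap = solve-∀

  tie₁₃ : ∀ n → ∑⁴ n (λ p q r s → ⟦ p ≡ r ⟧) ≤ n ^ 3
  tie₂₃ : ∀ n → ∑⁴ n (λ p q r s → ⟦ q ≡ r ⟧) ≤ n ^ 3
  tie₂₄ : ∀ n → ∑⁴ n (λ p q r s → ⟦ q ≡ s ⟧) ≤ n ^ 3
  tie₁₄ : ∀ n → ∑⁴ n (λ p q r s → ⟦ p ≡ s ⟧) ≤ n ^ 3

  private
    only : ∀ n i → ∑[ j < n ] ⟦ i ≡ j ⟧ ≤ 1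
    only n i = window n 1 λ { j k _ ≡.refl ≡.refl → ≤-reflexive (+-comm 1 j) }

    one : ∀ n {k} → k ≤ n ^ 3 * 1 → k ≤ n ^ 3
    one n le = ≤-trans le (≤-reflexive (*-identityʳ (n ^ 3)))

  tie₁₄ n = one n (∑⁴-bound₄ n 1 λ p q r → only n p)
  tie₂₄ n = one n (∑⁴-bound₄ n 1 λ p q r → only n q)
  tie₁₃ n = ≤-trans (≤-reflexive (∑⁴-swap₃₄ n _)) (tie₁₄ n)
  tie₂₃ n = ≤-trans (≤-reflexive (∑⁴-swap₃₄ n _)) (tie₂₄ n)

  private
    tri : ∀ {P Q : Set} k → (P ⊎ Q ⊎ k ≡ 0) → ¬ (P × Q) → k ≡ ⟦ P ⟧ * k + ⟦ Q ⟧ * k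
    tri {P} {Q} k (inj₁ p) d = ≡.sym (≡.trans (≡.cong₂ _+_ (⟦⟧-yes-* k p) (⟦⟧-no-* k λ q → d (p , q))) (+-identityʳ k))
    tri {P} {Q} k (inj₂ (inj₁ q)) d = ≡.sym (≡.cong₂ _+_ (⟦⟧-no-* k λ p → d (p , q)) (⟦⟧-yes-* k q))
    tri {P} {Q} .0 (inj₂ (inj₂ ≡.refl)) d = ≡.sym (≡.cong₂ _+_ (*-zeroʳ ⟦ P ⟧) (*-zeroʳ ⟦ Q ⟧))

    twice : ∀ k → k + k ≡ 2 * k
    twice k = ≡.cong (k +_) (≡.sym (+-identityʳ k))

  wlog₁₂ : ∀ n K → (∀ p q r s → K p q r s ≡ K q p r s) → (∀ p r s → K p p r s ≡ 0) →
    ∑⁴ n K ≡ 2 * ∑⁴ n (λ p q r s → ⟦ p < q ⟧ * K p q r s)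
  wlog₁₂ n K symm diag = begin
    ∑⁴ n K
      ≡⟨ (∑⁴-cong n λ p q r s → tri (K p q r s) (cases p q r s) (λ (x , y) → <-asym x y)) ⟩
    ∑⁴ n (λ p q r s → ⟦ p < q ⟧ * K p q r s + ⟦ q < p ⟧ * K p q r s)
      ≡⟨ ∑⁴-+ n _ _ ⟩
    L + ∑⁴ n (λ p q r s → ⟦ q < p ⟧ * K p q r s)
      ≡⟨ ≡.cong (L +_) (≡.trans (∑⁴-swap₁₂ n _)
           (∑⁴-cong n λ p q r s → ≡.cong (⟦ p < q ⟧ *_) (symm q p r s))) ⟩
    L + L
      ≡⟨ twice L ⟩
    2 * L ∎
    where
    open ≡.≡-Reasoning
    L = ∑⁴ n (λ p q r s → ⟦ p < q ⟧ * K p q r s)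
    cases : ∀ p q r s → p < q ⊎ q < p ⊎ K p q r s ≡ 0
    cases p q r s with <-cmp p q
    ... | tri< x _ _ = inj₁ x
    ... | tri≈ _ ≡.refl _ = inj₂ (inj₂ (diag p r s))
    ... | tri> _ _ x = inj₂ (inj₁ x)

  wlog₃₄ : ∀ n K → (∀ p q r s → K p q r s ≡ K p q s r) → (∀ p q r → K p q r r ≡ 0) →
    ∑⁴ n K ≡ 2 * ∑⁴ n (λ p q r s → ⟦ r < s ⟧ * K p q r s)
  wlog₃₄ n K symm diag = ≡.trans (∑⁴-exchange n K) (≡.trans
    (wlog₁₂ n (λ p q r s → K r s p q) (λ p q r s → symm r s p q) (λ p r s → diag r s p))
    (≡.cong (2 *_) (∑⁴-exchange n _)))

  -- Points of different edges may share a coordinate without making `K` vanish. So, unlike in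
  -- `wlog₁₂`, the diagonal costs an error: at most n³ quadruples of weight at most `B`.
  wlog₁₃ : ∀ n B K → (∀ p q r s → K p q r s ≡ K r s p q) → (∀ p q r s → K p q r s ≤ B) →
    ∑⁴ n K ≈[ n ^ 3 * B ] 2 * ∑⁴ n (λ p q r s → ⟦ p < r ⟧ * K p q r s)
  wlog₁₃ n B K symm bound = ≈-trans′ (≈-weaken error (≈-∑⁴ n pointwise)) total
    where
    open ≡.≡-Reasoning
    L = ∑⁴ n (λ p q r s → ⟦ p < r ⟧ * K p q r s)
    ≈-trans′ : ∀ {a b c e} → a ≈[ e ] b → b ≡ c → a ≈[ e ] c
    ≈-trans′ p ≡.refl = p
    pointwise : ∀ p q r s → K p q r s ≈[ ⟦ p ≡ r ⟧ * B ] ⟦ p < r ⟧ * K p q r s + ⟦ r < p ⟧ * K p q r s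
    pointwise p q r s with <-cmp p r
    ... | tri< x _ _ = ≈-of-≡ (tri _ (inj₁ x) (λ (x , y) → <-asym x y))
    ... | tri> _ _ x = ≈-of-≡ (tri _ (inj₂ (inj₁ x)) (λ (x , y) → <-asym x y))
    ... | tri≈ _ x _ = ≡.subst₂ (λ k l → K p q r s ≈[ k ] l) (≡.sym (⟦⟧-yes-* B x))
            (≡.sym (≡.cong₂ _+_ (⟦⟧-no-* (K p q r s) (λ y → <-irrefl x y)) (⟦⟧-no-* (K p q r s) λ y → <-irrefl (≡.sym x) y)))
            (bound p q r s , z≤n)
    error : ∑⁴ n (λ p q r s → ⟦ p ≡ r ⟧ * B) ≤ n ^ 3 * B
    error = ≤-trans (≤-reflexive (≡.trans (∑⁴-cong n λ p q r s → *-comm ⟦ p ≡ r ⟧ B) (∑⁴-*ˡ n B _)))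
      (≤-trans (*-monoʳ-≤ B (tie₁₃ n)) (≤-reflexive (*-comm B (n ^ 3))))
    total : ∑⁴ n (λ p q r s → ⟦ p < r ⟧ * K p q r s + ⟦ r < p ⟧ * K p q r s) ≡ 2 * L
    total = ≡.trans (∑⁴-+ n _ _) (≡.trans (≡.cong (L +_) (≡.trans (∑⁴-exchange n _)
      (∑⁴-cong n λ p q r s → ≡.cong (⟦ p < r ⟧ *_) (symm r s p q)))) (twice L))

-- Reduction to a few relative orders by symmetry

module Decompositions (em : ExcludedMiddle 0ℓ) where
  open Nat
  open ℕₚ
  open Sums
  open Indicators em
  open SortedSums em

  private
    pair-≈ : ∀ {A S₁ S₂ T : Set} → (S₁ → A) → (S₂ → A) → ¬ (S₁ × S₂) → (A → (S₁ ⊎ S₂) ⊎ T) →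
      ⟦ A ⟧ ≈[ ⟦ T ⟧ ] ⟦ S₁ ⟧ + ⟦ S₂ ⟧
    pair-≈ f g d h =
      ≤-trans (⟦⟧-mono h) (≤-trans ⟦⟧-⊎ (+-monoˡ-≤ _ ⟦⟧-⊎)) ,
      ≤-trans (≤-reflexive (≡.sym (⟦⟧-disjoint d))) (≤-trans (⟦⟧-mono [ f , g ]′) (m≤m+n _ _))

    ≈-*ʳ : ∀ {a b e} k B → k ≤ B → a ≈[ e ] b → a * k ≈[ e * B ] b * k
    ≈-*ʳ {a} {b} {e} k B k≤B p = ≈-resp (*-comm k a) (*-comm k b)
      (≈-weaken (≤-trans (*-monoˡ-≤ e k≤B) (≤-reflexive (*-comm B e))) (≈-*ˡ k p))

  -- The symmetries p ↔ q, r ↔ s and pq ↔ rs account for the factor 2³ and leave the orders pqrs,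
  -- prqs and prsq, of which the first contributes nothing. With e = n³B, the tie p = r costs e, and
  -- the ties q = r and q = s cost 2e; the factors collected on the way give 4(e + 2 · 2e) = 20e.
  decompose₁ : ∀ n B H →
    (∀ p q r s → H p q r s ≡ H q p r s) →
    (∀ p q r s → H p q r s ≡ H r s p q) →
    (∀ p r s → H p p r s ≡ 0) →
    (∀ p q r s → H p q r s ≤ B) →
    (∀ p q r s → p < q → q < r → r < s → H p q r s ≡ 0) →
    ∑⁴ n H ≈[ 20 * (n ^ 3 * B) ] 8 * (𝕊 n (λ a b c d → H a c b d) + 𝕊 n (λ a b c d → H a d b c))
  decompose₁ n B H swap exchange diag bound disjoint =
    ≈-resp (≡.sym total) (collect 𝕊₁ 𝕊₂) (≈-weaken (≤-reflexive (errors (n ^ 3 * B)))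
      (≈-*ˡ 4 (≈-trans (wlog₁₃ n B K exchange-K bound-K) (≈-*ˡ 2 half))))
    where
    open ≡.≡-Reasoning
    𝕊₁ = 𝕊 n (λ a b c d → H a c b d)
    𝕊₂ = 𝕊 n (λ a b c d → H a d b c)
    K L : ℕ → ℕ → ℕ → ℕ → ℕ
    K p q r s = ⟦ r < s ⟧ * (⟦ p < q ⟧ * H p q r s)
    L p q r s = ⟦ p < r ⟧ * K p q r s

    collect : ∀ x y → 4 * (2 * (x + y)) ≡ 8 * (x + y)
    collect = solve-∀

    errors : ∀ e → 4 * (e + 2 * (2 * e)) ≡ 20 * e
    errors = solve-∀

    total : ∑⁴ n H ≡ 4 * ∑⁴ n K
    total = ≡.trans (wlog₁₂ n H swap diag) (≡.trans (≡.cong (2 *_) (wlog₃₄ n (λ p q r s → ⟦ p < q ⟧ * H p q r s)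
      (λ p q r s → ≡.cong (⟦ p < q ⟧ *_)
        (≡.trans (exchange p q r s) (≡.trans (swap r s p q) (exchange s r p q))))
      (λ p q r → ≡.trans (≡.cong (⟦ p < q ⟧ *_) (≡.trans (exchange p q r r) (diag r p q))) (*-zeroʳ ⟦ p < q ⟧))))
      (≡.sym (*-assoc 2 2 (∑⁴ n K))))

    exchange-K : ∀ p q r s → K p q r s ≡ K r s p q
    exchange-K p q r s = ≡.trans (≡.cong (λ k → ⟦ r < s ⟧ * (⟦ p < q ⟧ * k)) (exchange p q r s))
      (comm ⟦ r < s ⟧ ⟦ p < q ⟧ (H r s p q))
      where
      comm : ∀ u v k → u * (v * k) ≡ v * (u * k)
      comm = solve-∀

    bound-K : ∀ p q r s → K p q r s ≤ B
    bound-K p q r s = ≤-trans (⟦⟧*≤ _ _) (≤-trans (⟦⟧*≤ _ _) (bound p q r s))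

    pointwise : ∀ p q r s → L p q r s ≈[ ⟦ q ≡ r ⊎ q ≡ s ⟧ * B ]
      ⟦ Sorted p r q s ⟧ * H p q r s + ⟦ Sorted p r s q ⟧ * H p q r s
    pointwise p q r s = ≈-resp (≡.sym merged) (*-distribʳ-+ (H p q r s) ⟦ Sorted p r q s ⟧ ⟦ Sorted p r s q ⟧) cases
      where
      A = p < r × r < s × p < q
      merged : L p q r s ≡ ⟦ A ⟧ * H p q r s
      merged = ≡.sym (≡.trans (≡.cong (_* H p q r s) (≡.trans (⟦⟧-× _ _) (≡.cong (⟦ p < r ⟧ *_) (⟦⟧-× _ _))))
        (assoc ⟦ p < r ⟧ ⟦ r < s ⟧ ⟦ p < q ⟧ (H p q r s)))
        where
        assoc : ∀ u v w k → u * (v * w) * k ≡ u * (v * (w * k))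
        assoc = solve-∀
      order : ¬ (p < q × q < r × r < s) → A → (Sorted p r q s ⊎ Sorted p r s q) ⊎ (q ≡ r ⊎ q ≡ s)
      order d (p<r , r<s , p<q) with <-cmp q r | <-cmp q s
      ... | tri< q<r _ _ | _            = ⊥-elim (d (p<q , q<r , r<s))
      ... | tri≈ _ q≡r _ | _            = inj₂ (inj₁ q≡r)
      ... | tri> _ _ r<q | tri< q<s _ _ = inj₁ (inj₁ (p<r , r<q , q<s))
      ... | tri> _ _ r<q | tri≈ _ q≡s _ = inj₂ (inj₂ q≡s)
      ... | tri> _ _ r<q | tri> _ _ s<q = inj₁ (inj₂ (p<r , r<s , s<q))
      cases : ⟦ A ⟧ * H p q r s ≈[ ⟦ q ≡ r ⊎ q ≡ s ⟧ * B ] (⟦ Sorted p r q s ⟧ + ⟦ Sorted p r s q ⟧) * H p q r s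
      cases with em {p < q × q < r × r < s}
      ... | yes (p<q , q<r , r<s) = ≈-of-≡ (≡.trans (vanish ⟦ A ⟧) (≡.sym (vanish (⟦ Sorted p r q s ⟧ + ⟦ Sorted p r s q ⟧))))
        where
        vanish : ∀ k → k * H p q r s ≡ 0
        vanish k = ≡.trans (≡.cong (k *_) (disjoint p q r s p<q q<r r<s)) (*-zeroʳ k)
      ... | no d = ≈-*ʳ (H p q r s) B (bound p q r s) (pair-≈
              (λ (p<r , r<q , q<s) → p<r , <-trans r<q q<s , <-trans p<r r<q)
              (λ (p<r , r<s , s<q) → p<r , r<s , <-trans p<r (<-trans r<s s<q))
              (λ ((_ , _ , q<s) , (_ , _ , s<q)) → <-asym q<s s<q) (order d))

    error : ∑⁴ n (λ p q r s → ⟦ q ≡ r ⊎ q ≡ s ⟧ * B) ≤ 2 * (n ^ 3 * B)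
    error = ≤-trans (≤-reflexive (≡.trans (∑⁴-cong n λ p q r s → *-comm ⟦ q ≡ r ⊎ q ≡ s ⟧ B) (∑⁴-*ˡ n B _)))
      (≤-trans (*-monoʳ-≤ B (≤-trans (∑⁴-mono n λ p q r s → ⟦⟧-⊎)
        (≤-trans (≤-reflexive (∑⁴-+ n _ _)) (+-mono-≤ (tie₂₃ n) (tie₂₄ n)))))
        (≤-reflexive (regroup B (n ^ 3))))
      where
      regroup : ∀ B k → B * (k + k) ≡ 2 * (k * B)
      regroup = solve-∀

    half : ∑⁴ n L ≈[ 2 * (n ^ 3 * B) ] 𝕊₁ + 𝕊₂
    half = ≈-weaken error (≈-resp ≡.refl
      (≡.trans (∑⁴-+ n _ _) (≡.cong₂ _+_ (∑⁴-swap₂₃ n _) (≡.trans (∑⁴-swap₂₃ n _) (∑⁴-swap₃₄ n _))))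
      (≈-∑⁴ n pointwise))

  -- Both pairs are increasing or both are decreasing, and reversal of the range is an exact
  -- bijection between the two cases, whence the outer factor 2. Of the six orders with p < q and r
  -- < s, the last two hypotheses exclude those with disjoint intervals. The four possible ties cost
  -- n³ each, doubled to 8n³.
  decompose₂ : ∀ n (Y : ℕ → ℕ → ℕ → ℕ → Set) →
    (∀ p q r s → p < n → q < n → r < n → s < n →
      Y p q r s → Y (n ∸ suc p) (n ∸ suc q) (n ∸ suc r) (n ∸ suc s)) →
    (∀ p q r s → Y p q r s → (p < q × r < s) ⊎ (q < p × s < r)) →
    (∀ p q r s → Y p q r s → p < q → r < s → ¬ (q < r)) →
    (∀ p q r s → Y p q r s → p < q → r < s → ¬ (s < p)) →
    ∑⁴ n (λ p q r s → ⟦ Y p q r s ⟧) ≈[ 8 * n ^ 3 ]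
      2 * ((𝕊 n (λ a b c d → ⟦ Y a c b d ⟧) + 𝕊 n (λ a b c d → ⟦ Y a d b c ⟧)) +
           (𝕊 n (λ a b c d → ⟦ Y b c a d ⟧) + 𝕊 n (λ a b c d → ⟦ Y b d a c ⟧)))
  decompose₂ n Y reverse colour sep₁ sep₂ =
    ≈-resp (≡.sym total) ≡.refl (≈-weaken (≤-reflexive (errors (n ^ 3))) (≈-*ˡ 2 half))
    where
    errors : ∀ e → 2 * ((e + e) + (e + e)) ≡ 8 * e
    errors = solve-∀

    Up Down : ℕ → ℕ → ℕ → ℕ → Set
    Up   p q r s = (p < q × r < s) × Y p q r s
    Down p q r s = (q < p × s < r) × Y p q r s

    rev-< : ∀ {p q} → q < n → p < q → n ∸ suc q < n ∸ suc p
    rev-< q<n p<q = ∸-monoʳ-< (s≤s p<q) q<n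

    rev-rev : ∀ {p} → p < n → n ∸ suc (n ∸ suc p) ≡ p
    rev-rev {p} p<n = ≡.trans (≡.cong (n ∸_) (≡.sym (+-∸-assoc 1 p<n))) (m∸[m∸n]≡n (<⇒≤ p<n))

    rev-bound : ∀ {p} → p < n → n ∸ suc p < n
    rev-bound {p} p<n = ∸-monoʳ-< {n = suc p} {o = 0} z<s p<n

    reversed : ∀ p q r s → p < n → q < n → r < n → s < n →
      ⟦ Down (n ∸ suc p) (n ∸ suc q) (n ∸ suc r) (n ∸ suc s) ⟧ ≡ ⟦ Up p q r s ⟧
    reversed p q r s p<n q<n r<n s<n = ⟦⟧-cong
      (λ ((x , y) , t) →
        (≡.subst₂ _<_ (rev-rev p<n) (rev-rev q<n) (rev-< (rev-bound p<n) x) ,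
         ≡.subst₂ _<_ (rev-rev r<n) (rev-rev s<n) (rev-< (rev-bound r<n) y)) ,
        back (reverse _ _ _ _ (rev-bound p<n) (rev-bound q<n) (rev-bound r<n) (rev-bound s<n) t))
      (λ ((x , y) , t) → (rev-< q<n x , rev-< s<n y) , reverse p q r s p<n q<n r<n s<n t)
      where
      back : Y (n ∸ suc (n ∸ suc p)) (n ∸ suc (n ∸ suc q)) (n ∸ suc (n ∸ suc r)) (n ∸ suc (n ∸ suc s)) → Y p q r s
      back t rewrite rev-rev p<n | rev-rev q<n | rev-rev r<n | rev-rev s<n = t

    total : ∑⁴ n (λ p q r s → ⟦ Y p q r s ⟧) ≡ 2 * ∑⁴ n (λ p q r s → ⟦ Up p q r s ⟧)
    total = ≡.trans (∑⁴-cong n λ p q r s → ≡.trans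
        (⟦⟧-cong (λ y → [ (λ c → inj₁ (c , y)) , (λ c → inj₂ (c , y)) ]′ (colour p q r s y)) [ proj₂ , proj₂ ]′)
        (⟦⟧-disjoint λ { (((x , _) , _) , ((y , _) , _)) → <-asym x y }))
      (≡.trans (∑⁴-+ n _ _) (≡.cong (∑⁴ n (λ p q r s → ⟦ Up p q r s ⟧) +_)
        (≡.trans (≡.trans (∑⁴-reverse n _) (∑⁴-cong-< n reversed)) (≡.sym (+-identityʳ _)))))

    S₁ S₂ S₃ S₄ Tie : ℕ → ℕ → ℕ → ℕ → Set
    S₁ p q r s = Sorted p r q s × Y p q r s
    S₂ p q r s = Sorted p r s q × Y p q r s
    S₃ p q r s = Sorted r p q s × Y p q r s
    S₄ p q r s = Sorted r p s q × Y p q r s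
    Tie p q r s = (p ≡ r ⊎ q ≡ s) ⊎ (q ≡ r ⊎ p ≡ s)

    order : ∀ p q r s → Up p q r s → ((S₁ p q r s ⊎ S₂ p q r s) ⊎ (S₃ p q r s ⊎ S₄ p q r s)) ⊎ Tie p q r s
    order p q r s ((p<q , r<s) , y) with <-cmp p r | <-cmp q s
    ... | tri≈ _ e _ | _          = inj₂ (inj₁ (inj₁ e))
    ... | _          | tri≈ _ e _ = inj₂ (inj₁ (inj₂ e))
    ... | tri< p<r _ _ | tri< q<s _ _ with <-cmp q r
    ...   | tri< q<r _ _ = ⊥-elim (sep₁ p q r s y p<q r<s q<r)
    ...   | tri≈ _ e _   = inj₂ (inj₂ (inj₁ e))
    ...   | tri> _ _ r<q = inj₁ (inj₁ (inj₁ ((p<r , r<q , q<s) , y)))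
    order p q r s ((p<q , r<s) , y) | tri< p<r _ _ | tri> _ _ s<q = inj₁ (inj₁ (inj₂ ((p<r , r<s , s<q) , y)))
    order p q r s ((p<q , r<s) , y) | tri> _ _ r<p | tri< q<s _ _ = inj₁ (inj₂ (inj₁ ((r<p , p<q , q<s) , y)))
    order p q r s ((p<q , r<s) , y) | tri> _ _ r<p | tri> _ _ s<q with <-cmp p s
    ... | tri< p<s _ _ = inj₁ (inj₂ (inj₂ ((r<p , p<s , s<q) , y)))
    ... | tri≈ _ e _   = inj₂ (inj₂ (inj₂ e))
    ... | tri> _ _ s<p = ⊥-elim (sep₂ p q r s y p<q r<s s<p)

    up₁ : ∀ {p q r s} → S₁ p q r s → Up p q r s
    up₁ ((p<r , r<q , q<s) , y) = (<-trans p<r r<q , <-trans r<q q<s) , y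
    up₂ : ∀ {p q r s} → S₂ p q r s → Up p q r s
    up₂ ((p<r , r<s , s<q) , y) = (<-trans p<r (<-trans r<s s<q) , r<s) , y
    up₃ : ∀ {p q r s} → S₃ p q r s → Up p q r s
    up₃ ((r<p , p<q , q<s) , y) = (p<q , <-trans r<p (<-trans p<q q<s)) , y
    up₄ : ∀ {p q r s} → S₄ p q r s → Up p q r s
    up₄ ((r<p , p<s , s<q) , y) = (<-trans p<s s<q , <-trans r<p p<s) , y

    pointwise : ∀ p q r s → ⟦ Up p q r s ⟧ ≈[ ⟦ Tie p q r s ⟧ ]
      (⟦ Sorted p r q s ⟧ * ⟦ Y p q r s ⟧ + ⟦ Sorted p r s q ⟧ * ⟦ Y p q r s ⟧) +
      (⟦ Sorted r p q s ⟧ * ⟦ Y p q r s ⟧ + ⟦ Sorted r p s q ⟧ * ⟦ Y p q r s ⟧)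
    pointwise p q r s = ≈-resp ≡.refl
      (≡.cong₂ _+_ (≡.trans (⟦⟧-disjoint λ { (((_ , _ , x) , _) , ((_ , _ , y) , _)) → <-asym x y })
                            (≡.cong₂ _+_ (⟦⟧-× _ _) (⟦⟧-× _ _)))
                   (≡.trans (⟦⟧-disjoint λ { (((_ , _ , x) , _) , ((_ , _ , y) , _)) → <-asym x y })
                            (≡.cong₂ _+_ (⟦⟧-× _ _) (⟦⟧-× _ _))))
      (pair-≈ [ up₁ , up₂ ]′ [ up₃ , up₄ ]′
        (λ { (inj₁ ((x , _) , _) , inj₁ ((y , _) , _)) → <-asym x y
           ; (inj₁ ((x , _) , _) , inj₂ ((y , _) , _)) → <-asym x y
           ; (inj₂ ((x , _) , _) , inj₁ ((y , _) , _)) → <-asym x y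
           ; (inj₂ ((x , _) , _) , inj₂ ((y , _) , _)) → <-asym x y })
        (order p q r s))

    error : ∑⁴ n (λ p q r s → ⟦ Tie p q r s ⟧) ≤ (n ^ 3 + n ^ 3) + (n ^ 3 + n ^ 3)
    error = ≤-trans (∑⁴-mono n λ p q r s → ≤-trans ⟦⟧-⊎ (+-mono-≤ ⟦⟧-⊎ ⟦⟧-⊎))
      (≤-trans (≤-reflexive (≡.trans (∑⁴-+ n _ _) (≡.cong₂ _+_ (∑⁴-+ n _ _) (∑⁴-+ n _ _))))
        (+-mono-≤ (+-mono-≤ (tie₁₃ n) (tie₂₄ n)) (+-mono-≤ (tie₂₃ n) (tie₁₄ n))))

    half : ∑⁴ n (λ p q r s → ⟦ Up p q r s ⟧) ≈[ (n ^ 3 + n ^ 3) + (n ^ 3 + n ^ 3) ]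
      ((𝕊 n (λ a b c d → ⟦ Y a c b d ⟧) + 𝕊 n (λ a b c d → ⟦ Y a d b c ⟧)) +
       (𝕊 n (λ a b c d → ⟦ Y b c a d ⟧) + 𝕊 n (λ a b c d → ⟦ Y b d a c ⟧)))
    half = ≈-weaken error (≈-resp ≡.refl
      (≡.trans (∑⁴-+ n _ _) (≡.cong₂ _+_
        (≡.trans (∑⁴-+ n _ _) (≡.cong₂ _+_ (∑⁴-swap₂₃ n _) (≡.trans (∑⁴-swap₂₃ n _) (∑⁴-swap₃₄ n _))))
        (≡.trans (∑⁴-+ n _ _) (≡.cong₂ _+_
          (≡.trans (∑⁴-swap₂₃ n _) (∑⁴-swap₁₂ n _))
          (≡.trans (∑⁴-swap₂₃ n _) (≡.trans (∑⁴-swap₁₂ n _) (∑⁴-swap₃₄ n _)))))))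
      (≈-∑⁴ n pointwise))

-- Averages over permuted gaps

module GapAverages (em : ExcludedMiddle 0ℓ) where
  open Nat
  open ℕₚ
  open Sums
  open Indicators em
  open SortedSums em

  𝔾𝔾 : ℕ → (ℕ → ℕ → ℕ → ℕ → ℕ → ℕ → ℕ) → ℕ
  𝔾𝔾 n f = 𝔾 n λ a b c → 𝔾 n (f a b c)

  𝔾𝔾-one : ∀ n → 𝔾𝔾 n (λ _ _ _ _ _ _ → 1) ≡ 𝔾 n (λ _ _ _ → 1) * 𝔾 n (λ _ _ _ → 1)
  𝔾𝔾-one n = ≡.trans (𝔾-cong n λ a b c _ _ _ → ≡.sym (*-identityʳ W)) (𝔾-*ˡ n W λ _ _ _ → 1)
    where
    W = 𝔾 n (λ _ _ _ → 1)

  𝔾𝔾-≈ : ∀ n {f g e} →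
    (∀ a b c A B C → 0 < a → 0 < b → 0 < c → 0 < A → 0 < B → 0 < C →
      f a b c A B C ≈[ e a b c A B C ] g a b c A B C) →
    𝔾𝔾 n f ≈[ 𝔾𝔾 n e ] 𝔾𝔾 n g
  𝔾𝔾-≈ n eq = 𝔾-≈ n λ a b c 0<a 0<b 0<c → 𝔾-≈ n λ A B C 0<A 0<B 0<C → eq a b c A B C 0<a 0<b 0<c 0<A 0<B 0<C

  𝔾𝔾-cong : ∀ n f g →
    (∀ a b c A B C → 0 < a → 0 < b → 0 < c → 0 < A → 0 < B → 0 < C → f a b c A B C ≡ g a b c A B C) →
    𝔾𝔾 n f ≡ 𝔾𝔾 n g
  𝔾𝔾-cong n f g eq = 𝔾-cong n {λ a b c → 𝔾 n (f a b c)} {λ a b c → 𝔾 n (g a b c)} λ a b c 0<a 0<b 0<c →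
    𝔾-cong n λ A B C 0<A 0<B 0<C → eq a b c A B C 0<a 0<b 0<c 0<A 0<B 0<C

  𝔾𝔾-+ : ∀ n f g → 𝔾𝔾 n (λ a b c A B C → f a b c A B C + g a b c A B C) ≡ 𝔾𝔾 n f + 𝔾𝔾 n g
  𝔾𝔾-+ n f g = ≡.trans (𝔾-cong n λ a b c _ _ _ → 𝔾-+ n (f a b c) (g a b c))
    (𝔾-+ n (λ a b c → 𝔾 n (f a b c)) (λ a b c → 𝔾 n (g a b c)))

  𝔾𝔾-rotate : ∀ n f → 𝔾𝔾 n f ≡ 𝔾𝔾 n (λ a b c A B C → f b c a B C A)
  𝔾𝔾-rotate n f = ≡.trans (𝔾-rotate n λ a b c → 𝔾 n (f a b c)) (𝔾-cong n λ a b c _ _ _ → 𝔾-rotate n (f b c a))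

  𝔾𝔾-reverse : ∀ n f → 𝔾𝔾 n f ≡ 𝔾𝔾 n (λ a b c A B C → f c b a C B A)
  𝔾𝔾-reverse n f = ≡.trans (𝔾-reverse n λ a b c → 𝔾 n (f a b c)) (𝔾-cong n λ a b c _ _ _ → 𝔾-reverse n (f c b a))

  private
    thrice : ∀ k → k + (k + k) ≡ 3 * k
    thrice k = ≡.cong (λ l → k + (k + l)) (≡.sym (+-identityʳ k))

  -- Rotating both triples of gaps at once leaves `𝔾𝔾` unchanged, so three times the sum of `f` is
  -- the sum over its three rotations, which is estimated pointwise.
  third : ∀ n f e →
    (∀ a b c A B C → 0 < a → 0 < b → 0 < c → 0 < A → 0 < B → 0 < C →
      f a b c A B C + (f b c a B C A + f c a b C A B) ≈[ e a b c A B C ] 1) →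
    3 * 𝔾𝔾 n f ≈[ 𝔾𝔾 n e ] 𝔾𝔾 n (λ _ _ _ _ _ _ → 1)
  third n f e average = ≈-resp (≡.trans (𝔾𝔾-+ n f λ a b c A B C → f′ a b c A B C + f″ a b c A B C)
      (≡.trans (≡.cong (𝔾𝔾 n f +_) (≡.trans (𝔾𝔾-+ n f′ f″)
        (≡.cong₂ _+_ (≡.sym (𝔾𝔾-rotate n f)) (≡.sym (≡.trans (𝔾𝔾-rotate n f) (𝔾𝔾-rotate n f′))))))
      (thrice (𝔾𝔾 n f))))
    ≡.refl (𝔾𝔾-≈ n average)
    where
    f′ f″ : ℕ → ℕ → ℕ → ℕ → ℕ → ℕ → ℕ
    f′ a b c A B C = f b c a B C A
    f″ a b c A B C = f c a b C A B

  -- The condition on A is downward closed, so κ is the length of an initial run: the last counted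
  -- multiple κs is below m, and the next one is not, unless the range L ended first.
  multiples-below : ∀ s m L → 0 < m → let κ = ∑[ A < L ] ⟦ s * suc A < m ⟧ in
    κ ≤ L × κ * s < m × (κ ≡ L ⊎ m ≤ suc κ * s)
  multiples-below s m zero 0<m = z≤n , 0<m , inj₁ ≡.refl
  multiples-below s m (suc L) 0<m with multiples-below s m L 0<m | em {s * suc L < m}
  ... | κ≤L , κs<m , lower | yes p rewrite +-comm (∑[ A < L ] ⟦ s * suc A < m ⟧) 1 =
        s≤s κ≤L ,
        ≤-<-trans (≤-trans (*-monoˡ-≤ s (s≤s κ≤L)) (≤-reflexive (*-comm (suc L) s))) p ,
        [ (λ e → inj₁ (≡.cong suc e)) , (λ le → inj₂ (≤-trans le (m≤n+m _ s))) ]′ lower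
  ... | κ≤L , κs<m , lower | no ¬p rewrite +-identityʳ (∑[ A < L ] ⟦ s * suc A < m ⟧) =
        m≤n⇒m≤1+n κ≤L , κs<m , inj₂ ([ (λ e → ≤-trans (≮⇒≥ ¬p)
          (≤-reflexive (≡.trans (*-comm s (suc L)) (≡.cong (λ k → suc k * s) (≡.sym e))))) , id ]′ lower)

  private
    -- Change of variables D = A + B. For fixed Z, C and D the only constraint left on A is 0 < A <
    -- D; this is the equidistribution of A for given A + B.
    antidiagonal : ∀ n (φ : ℕ → ℕ → ℕ) → 𝔾 n (λ A B C → φ A (A + B)) ≡
      ∑[ Z < n ] ∑[ C < n ] ∑[ D < n ] (⟦ Z + D + suc C < n ⟧ * ∑[ A < n ] (⟦ suc A < D ⟧ * φ (suc A) D))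
    antidiagonal n φ = ∑-cong n λ Z → begin
      ∑[ A < n ] ∑[ B < n ] ∑[ C < n ] (⟦ Z + suc A + suc B + suc C < n ⟧ * φ (suc A) (suc A + suc B))
        ≡⟨ (∑-cong n λ A → ∑-comm n n _) ⟩
      ∑[ A < n ] ∑[ C < n ] ∑[ B < n ] (⟦ Z + suc A + suc B + suc C < n ⟧ * φ (suc A) (suc A + suc B))
        ≡⟨ ∑-comm n n _ ⟩
      ∑[ C < n ] ∑[ A < n ] ∑[ B < n ] (⟦ Z + suc A + suc B + suc C < n ⟧ * φ (suc A) (suc A + suc B))
        ≡⟨ (∑-cong n λ C → ∑-cong n λ A → ≡.trans (∑-cong n λ B → absorb Z A B C)
             (≡.sym (∑-above (suc A) n λ D → ⟦ Z + D + suc C < n ⟧ * φ (suc A) D))) ⟩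
      ∑[ C < n ] ∑[ A < n ] ∑[ D < n ] (⟦ suc A < D ⟧ * (⟦ Z + D + suc C < n ⟧ * φ (suc A) D))
        ≡⟨ (∑-cong n λ C → ≡.trans (∑-comm n n _) (∑-cong n λ D →
             ≡.trans (∑-cong n λ A → swap ⟦ suc A < D ⟧ ⟦ Z + D + suc C < n ⟧ (φ (suc A) D))
               (∑-*ˡ n ⟦ Z + D + suc C < n ⟧ λ A → ⟦ suc A < D ⟧ * φ (suc A) D))) ⟩
      ∑[ C < n ] ∑[ D < n ] (⟦ Z + D + suc C < n ⟧ * ∑[ A < n ] (⟦ suc A < D ⟧ * φ (suc A) D)) ∎
      where
      open ≡.≡-Reasoning
      swap : ∀ u k v → u * (k * v) ≡ k * (u * v)
      swap = solve-∀
      absorb : ∀ Z A B C → ⟦ Z + suc A + suc B + suc C < n ⟧ * φ (suc A) (suc A + suc B) ≡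
        ⟦ suc A + suc B < n ⟧ * (⟦ Z + (suc A + suc B) + suc C < n ⟧ * φ (suc A) (suc A + suc B))
      absorb Z A B C rewrite +-assoc Z (suc A) (suc B) with em {Z + (suc A + suc B) + suc C < n}
      ... | yes p = ≡.sym (⟦⟧-yes-* _ (≤-<-trans (≤-trans (m≤n+m _ Z) (m≤m+n _ (suc C))) p))
      ... | no _  = ≡.sym (*-zeroʳ ⟦ suc A + suc B < n ⟧)

  share : ℕ → ℕ → ℕ → ℕ → ℕ → ℕ → ℕ
  share a b c A B C = ⟦ (a + b + c) * A < (A + B) * a ⟧

  private
    shares-average : ∀ n a b c → 0 < a → 0 < b → 0 < c → let s = a + b + c in
      𝔾 n (λ A B C → ⟦ s * A < (A + B) * a ⟧ + (⟦ s * A < (A + B) * b ⟧ + ⟦ s * A < (A + B) * c ⟧))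
      ≈[ n ^ 3 * 2 ] 𝔾 n (λ _ _ _ → 1)
    shares-average n a b c 0<a 0<b 0<c = ≈-resp (≡.sym (antidiagonal n φ)) (≡.sym (antidiagonal n λ _ _ → 1))
      (≈-weaken error (≈-∑ n λ Z → ≈-∑ n λ C → ≈-∑ n λ D → weighted Z C D))
      where
      s = a + b + c
      φ : ℕ → ℕ → ℕ
      φ A D = ⟦ s * A < D * a ⟧ + (⟦ s * A < D * b ⟧ + ⟦ s * A < D * c ⟧)

      -- Adding κ(m) s < D m ≤ (κ(m) + 1) s over m = a, b, c, which sum to s, and dividing by s
      -- gives k < D ≤ k + 3. As D = L + 1, the count k misses L by at most 2.
      counts : ∀ L → ∑[ A < L ] φ (suc A) (suc L) ≈[ 2 ] ∑[ A < L ] 1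
      counts L = ≡.subst₂ (λ k l → k ≈[ 2 ] l) (≡.sym split) (≡.sym (≡.trans (∑-const L 1) (*-identityʳ L)))
        (≤-trans (≤-pred k<1+L) (m≤m+n L 2) , ≤-pred (≤-trans 1+L≤k+3 (≤-reflexive (+-suc k 2))))
        where
        D = suc L
        κ : ℕ → ℕ
        κ m = ∑[ A < L ] ⟦ s * suc A < D * m ⟧
        k = κ a + (κ b + κ c)
        split : ∑[ A < L ] φ (suc A) D ≡ k
        split = ≡.trans (∑-+ L _ _) (≡.cong (κ a +_) (∑-+ L _ _))
        a≤s : a ≤ s
        a≤s = ≤-trans (m≤m+n a b) (m≤m+n (a + b) c)
        b≤s : b ≤ s
        b≤s = ≤-trans (m≤n+m b a) (m≤m+n (a + b) c)
        c≤s : c ≤ s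
        c≤s = m≤n+m c (a + b)
        above : ∀ {m} → 0 < m → κ m * s < D * m
        above {m} 0<m = proj₁ (proj₂ (multiples-below s (D * m) L (*-mono-≤ {1} {D} (s≤s z≤n) 0<m)))
        below : ∀ {m} → 0 < m → m ≤ s → D * m ≤ suc (κ m) * s
        below {m} 0<m m≤s with proj₂ (proj₂ (multiples-below s (D * m) L (*-mono-≤ {1} {D} (s≤s z≤n) 0<m)))
        -- If the count was ended by the range, then κ = L, and m ≤ s gives D m ≤ (L + 1) s.
        ... | inj₁ e = ≤-trans (*-monoʳ-≤ D m≤s) (≤-reflexive (≡.cong (λ k → suc k * s) (≡.sym e)))
        ... | inj₂ p = p
        k<1+L : k < D
        k<1+L = *-cancelʳ-< s k D (≡.subst₂ _<_ (lhs (κ a) (κ b) (κ c) s) (rhs D a b c)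
          (+-mono-< (above 0<a) (+-mono-< (above 0<b) (above 0<c))))
          where
          lhs : ∀ x y z s → x * s + (y * s + z * s) ≡ (x + (y + z)) * s
          lhs = solve-∀
          rhs : ∀ D a b c → D * a + (D * b + D * c) ≡ D * (a + b + c)
          rhs = solve-∀
        1+L≤k+3 : D ≤ k + 3
        1+L≤k+3 = *-cancelʳ-≤ D (k + 3) s ⦃ >-nonZero (≤-trans 0<a a≤s) ⦄
          (≡.subst₂ _≤_ (rhs D a b c) (lhs (κ a) (κ b) (κ c) s)
          (+-mono-≤ (below 0<a a≤s) (+-mono-≤ (below 0<b b≤s) (below 0<c c≤s))))
          where
          lhs : ∀ x y z s → suc x * s + (suc y * s + suc z * s) ≡ (x + (y + z) + 3) * s
          lhs = solve-∀
          rhs : ∀ D a b c → D * a + (D * b + D * c) ≡ D * (a + b + c)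
          rhs = solve-∀

      inner : ∀ D → D < n →
        ∑[ A < n ] (⟦ suc A < D ⟧ * φ (suc A) D) ≈[ 2 ] ∑[ A < n ] (⟦ suc A < D ⟧ * 1)
      inner zero _ = ≈-of-≡ (≡.trans (∑-zero n λ A _ → ⟦⟧-no-* _ λ ())
        (≡.sym (∑-zero n λ A _ → ⟦⟧-no-* {suc A < 0} 1 λ ())))
      inner (suc L) L<n = ≈-resp (≡.sym (below (λ A → φ (suc A) (suc L)))) (≡.sym (below (λ _ → 1))) (counts L)
        where
        below : ∀ f → ∑[ A < n ] (⟦ suc A < suc L ⟧ * f A) ≡ ∑ L f
        below f = ≡.trans (∑-cong n λ A → ≡.cong (_* f A) (⟦⟧-cong ≤-pred s≤s)) (∑-below f (<⇒≤ (<-trans (n<1+n L) L<n)))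

      weighted : ∀ Z C D → ⟦ Z + D + suc C < n ⟧ * ∑[ A < n ] (⟦ suc A < D ⟧ * φ (suc A) D)
        ≈[ 2 ] ⟦ Z + D + suc C < n ⟧ * ∑[ A < n ] (⟦ suc A < D ⟧ * 1)
      weighted Z C D with em {Z + D + suc C < n}
      ... | yes p = ≈-resp (≡.sym (+-identityʳ _)) (≡.sym (+-identityʳ _))
                      (inner D (≤-<-trans (≤-trans (m≤n+m D Z) (m≤m+n (Z + D) (suc C))) p))
      ... | no _  = z≤n , z≤n

      error : ∑[ Z < n ] ∑[ C < n ] ∑[ D < n ] 2 ≤ n ^ 3 * 2
      error = ≤-trans (∑-bound n _ λ Z → ∑-bound n _ λ C → ∑-bound n 2 λ D → ≤-refl) (≤-reflexive (assoc n 2))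
        where
        assoc : ∀ n k → n * (n * (n * k)) ≡ n * (n * (n * 1)) * k
        assoc = solve-∀

  private
    thrice-𝔾 : ∀ n f g h → 𝔾 n (λ a b c → f a b c + (g a b c + h a b c)) ≡ 𝔾 n f + (𝔾 n g + 𝔾 n h)
    thrice-𝔾 n f g h = ≡.trans (𝔾-+ n f λ a b c → g a b c + h a b c) (≡.cong (𝔾 n f +_) (𝔾-+ n g h))

  -- In contrast to `third`, only a, b, c are rotated while A, B, C stay fixed: the average is
  -- already taken within the inner sum.
  third-share : ∀ n → 3 * 𝔾𝔾 n share ≈[ n ^ 4 * (n ^ 3 * 2) ] 𝔾𝔾 n (λ _ _ _ _ _ _ → 1)
  third-share n = ≈-resp lhs ≡.refl
    (≈-weaken (𝔾-bound n _ λ _ _ _ _ _ _ → ≤-refl) (𝔾-≈ n λ a b c 0<a 0<b 0<c → shares-average n a b c 0<a 0<b 0<c))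
    where
    open ≡.≡-Reasoning
    F : ℕ → ℕ → ℕ → ℕ
    F a b c = 𝔾 n (share a b c)
    t : ℕ → ℕ → ℕ → ℕ → ℕ → ℕ
    t s m A B C = ⟦ s * A < (A + B) * m ⟧
    rename : ∀ {s s′} → s ≡ s′ → ∀ m → 𝔾 n (t s m) ≡ 𝔾 n (t s′ m)
    rename ≡.refl m = ≡.refl
    cyc₁ : ∀ a b c → a + b + c ≡ b + c + a
    cyc₁ = solve-∀
    cyc₂ : ∀ a b c → a + b + c ≡ c + a + b
    cyc₂ = solve-∀
    lhs : 𝔾 n (λ a b c → 𝔾 n (λ A B C → t (a + b + c) a A B C + (t (a + b + c) b A B C + t (a + b + c) c A B C))) ≡ 3 * 𝔾𝔾 n share
    lhs = begin
      𝔾 n (λ a b c → 𝔾 n (λ A B C → t (a + b + c) a A B C + (t (a + b + c) b A B C + t (a + b + c) c A B C)))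
        ≡⟨ (𝔾-cong n {f = λ a b c → 𝔾 n (λ A B C → t (a + b + c) a A B C + (t (a + b + c) b A B C + t (a + b + c) c A B C))}
             λ a b c _ _ _ → ≡.trans (thrice-𝔾 n (t (a + b + c) a) (t (a + b + c) b) (t (a + b + c) c))
             (≡.cong (F a b c +_) (≡.cong₂ _+_ (rename (cyc₁ a b c) b) (rename (cyc₂ a b c) c)))) ⟩
      𝔾 n (λ a b c → F a b c + (F b c a + F c a b))
        ≡⟨ thrice-𝔾 n F (λ a b c → F b c a) (λ a b c → F c a b) ⟩
      𝔾 n F + (𝔾 n (λ a b c → F b c a) + 𝔾 n (λ a b c → F c a b))
        ≡⟨ ≡.cong (𝔾 n F +_) (≡.cong₂ _+_ (𝔾-rotate n F) (≡.trans (𝔾-rotate n F) (𝔾-rotate n λ a b c → F b c a))) ⟨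
      𝔾 n F + (𝔾 n F + 𝔾 n F)
        ≡⟨ thrice (𝔾 n F) ⟩
      3 * 𝔾 n F ∎

-- Densities of the two slope criteria

module LatticeAverages (em : ExcludedMiddle 0ℓ) (ℝ : CompleteOrderedField) where
  open CompleteOrderedField ℝ hiding (zero)
  open IntegerRingSolver ℝ
  open FieldProperties ℝ
  open Gaps ℝ
  open Sums
  open Indicators em
  open SortedSums em
  open GapAverages em

  private
    ι : ℕ → Carrier
    ι = fromℕ

    infix 9 _∙_
    _∙_ : ℕ → ℕ → Carrier × Carrier
    a ∙ A = ι a , ι A

  -- Comparisons of slopes are cross-multiplied into signs of `∧`. The reference vector in `medians`
  -- is the sum of the three steps, whose slope is the mediant of theirs.
  slopes medians : ℕ → ℕ → ℕ → ℕ → ℕ → ℕ → ℕ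
  slopes a b c A B C = ⟦ 0# < (a ∙ A ∧ b ∙ B) * (b ∙ B ∧ c ∙ C) ⟧
  medians a b c A B C = ⟦ 0# < (a ∙ A ∧ (ι a + ι b + ι c , ι A + ι B + ι C)) * (c ∙ C ∧ (ι a + ι b + ι c , ι A + ι B + ι C)) ⟧

  -- Of three nonzero numbers that are not all of one sign, exactly one pair
  -- has equal signs.
  equal-sign-pairs : ∀ {k l m} x y z → 0# < k → 0# < l → 0# < m → k * x + l * y + m * z ≈ 0# →
    ⟦ 0# < x * y ⟧ ℕ.+ (⟦ 0# < y * z ⟧ ℕ.+ ⟦ 0# < z * x ⟧)
      ≈[ ⟦ x ≈ 0# ⟧ ℕ.+ (⟦ y ≈ 0# ⟧ ℕ.+ ⟦ z ≈ 0# ⟧) ] 1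
  equal-sign-pairs {k} {l} {m} x y z 0<k 0<l 0<m e = go (sign x) (sign y) (sign z)
    where
    open ℕₚ using () renaming (≤-trans to ≤ℕ-trans; ≤-reflexive to ≤ℕ-reflexive)

    degenerate : ∀ a b c {e} → a ℕ.≤ 1 → b ≡ 0 → c ≡ 0 → 1 ℕ.≤ e → a ℕ.+ (b ℕ.+ c) ≈[ e ] 1
    degenerate a _ _ a≤1 ≡.refl ≡.refl 1≤e = ≤ℕ-trans (≤ℕ-reflexive (ℕₚ.+-identityʳ a)) (≤ℕ-trans a≤1 (ℕₚ.m≤m+n 1 _)) ,
      ≤ℕ-trans 1≤e (ℕₚ.m≤n+m _ _)

    rot : ∀ a b c → a ℕ.+ (b ℕ.+ c) ≡ b ℕ.+ (c ℕ.+ a)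
    rot = solve-∀

    rot′ : ∀ a b c → a ℕ.+ (b ℕ.+ c) ≡ c ℕ.+ (a ℕ.+ b)
    rot′ = solve-∀

    no-zeroˡ : ∀ {u v} → u ≈ 0# → ⟦ 0# < u * v ⟧ ≡ 0
    no-zeroˡ p = ⟦⟧-no λ q → irrefl (sym (trans (*-congʳ p) (zeroˡ _))) q

    no-zeroʳ : ∀ {u v} → v ≈ 0# → ⟦ 0# < u * v ⟧ ≡ 0
    no-zeroʳ p = ⟦⟧-no λ q → irrefl (sym (trans (*-congˡ p) (zeroʳ _))) q

    one-zero : ∀ {P : Set} {j} → P → 1 ℕ.≤ ⟦ P ⟧ ℕ.+ j
    one-zero p = ≤ℕ-trans (≤ℕ-reflexive (≡.sym (⟦⟧-yes p))) (ℕₚ.m≤m+n _ _)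

    single : ∀ a b c {e} → a ≡ 1 → b ≡ 0 → c ≡ 0 → a ℕ.+ (b ℕ.+ c) ≈[ e ] 1
    single _ _ _ ≡.refl ≡.refl ≡.refl = ≈-of-≡ ≡.refl

    pn : ∀ {u v} → 0# < u → 0# < - v → ⟦ 0# < u * v ⟧ ≡ 0
    pn p q = ⟦⟧-no λ r → ¬pos-neg r (pos-*-neg p q)
    np : ∀ {u v} → 0# < - u → 0# < v → ⟦ 0# < u * v ⟧ ≡ 0
    np p q = ⟦⟧-no λ r → ¬pos-neg r (neg-*-pos p q)
    pp : ∀ {u v} → 0# < u → 0# < v → ⟦ 0# < u * v ⟧ ≡ 1
    pp p q = ⟦⟧-yes (*-pos p q)
    nn : ∀ {u v} → 0# < - u → 0# < - v → ⟦ 0# < u * v ⟧ ≡ 1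
    nn p q = ⟦⟧-yes (neg-*-neg p q)

    X Y Z : ℕ
    X = ⟦ 0# < x * y ⟧
    Y = ⟦ 0# < y * z ⟧
    Z = ⟦ 0# < z * x ⟧

    go : Sign x → Sign y → Sign z → X ℕ.+ (Y ℕ.+ Z) ≈[ ⟦ x ≈ 0# ⟧ ℕ.+ (⟦ y ≈ 0# ⟧ ℕ.+ ⟦ z ≈ 0# ⟧) ] 1
    go (null p) _ _ = ≈-resp (rot′ Y Z X) ≡.refl
      (degenerate Y Z X (⟦⟧≤1 _) (no-zeroʳ p) (no-zeroˡ p) (one-zero p))
    go _ (null p) _ = ≈-resp (rot Z X Y) ≡.refl
      (degenerate Z X Y (⟦⟧≤1 _) (no-zeroʳ p) (no-zeroˡ p) (≤ℕ-trans (one-zero p) (ℕₚ.m≤n+m _ ⟦ x ≈ 0# ⟧)))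
    go _ _ (null p) = degenerate X Y Z (⟦⟧≤1 _) (no-zeroʳ p) (no-zeroˡ p)
      (≤ℕ-trans (≤ℕ-trans (≤ℕ-reflexive (≡.sym (⟦⟧-yes p))) (ℕₚ.m≤n+m _ ⟦ y ≈ 0# ⟧)) (ℕₚ.m≤n+m _ ⟦ x ≈ 0# ⟧))
    go (positive p) (positive q) (positive r) = ⊥-elim (irrefl (sym e)
      (+-pos (+-pos (*-pos 0<k p) (*-pos 0<l q)) (*-pos 0<m r)))
    go (negative p) (negative q) (negative r) = ⊥-elim (irrefl refl (pos-resp
      (trans (solve 6 (λ k l m x y z → k ⊗ ⊝ x ⊕ l ⊗ ⊝ y ⊕ m ⊗ ⊝ z := ⊝ (k ⊗ x ⊕ l ⊗ y ⊕ m ⊗ z)) refl k l m x y z)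
        (trans (-‿cong e) (solve 0 (⊝ :0 := :0) refl)))
      (+-pos (+-pos (*-pos 0<k p) (*-pos 0<l q)) (*-pos 0<m r))))
    go (positive p) (positive q) (negative r) = single X Y Z (pp p q) (pn q r) (np r p)
    go (negative p) (negative q) (positive r) = single X Y Z (nn p q) (np q r) (pn r p)
    go (negative p) (positive q) (positive r) = ≈-resp (rot′ Y Z X) ≡.refl (single Y Z X (pp q r) (pn r p) (np p q))
    go (positive p) (negative q) (negative r) = ≈-resp (rot′ Y Z X) ≡.refl (single Y Z X (nn q r) (np r p) (pn p q))
    go (positive p) (negative q) (positive r) = ≈-resp (rot Z X Y) ≡.refl (single Z X Y (pp r p) (pn p q) (np q r))
    go (negative p) (positive q) (negative r) = ≈-resp (rot Z X Y) ≡.refl (single Z X Y (nn r p) (np p q) (pn q r))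

  -- A nonconstant affine function has at most one zero. The determinants below are affine in a
  -- single gap, so their zeros are rarer by a factor n than all configurations.
  affine-zeros : ∀ n {P : ℕ → Set} k m → ¬ (k ≈ 0#) → (∀ i → P i → k * ι (suc i) + m ≈ 0#) →
    ∑[ i < n ] ⟦ P i ⟧ ℕ.≤ 1
  affine-zeros n k m k≉0 zeros = window n 1 λ i j _ p q → ℕₚ.≤-reflexive (≡.trans
    (ℕₚ.suc-injective (≡.cong suc (fromℕ-injective (same (zeros j q) (zeros i p))))) (ℕₚ.+-comm 1 i))
    where
    same : ∀ {x y} → k * x + m ≈ 0# → k * y + m ≈ 0# → x ≈ y
    same {x} {y} p q = sub-zero (zero-product
      (trans (solve 4 (λ k m x y → k ⊗ (y ⊖ x) := (k ⊗ y ⊕ m) ⊖ (k ⊗ x ⊕ m)) refl k m x y)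
        (trans (+-cong q (-‿cong p)) (-‿inverseʳ 0#))) k≉0)

  private
    module _ (n : ℕ) where
      Zeros : (ℕ → ℕ → ℕ → ℕ → ℕ → ℕ → Carrier) → ℕ
      Zeros f = 𝔾𝔾 n λ a b c A B C → ⟦ f a b c A B C ≈ 0# ⟧

      E : ℕ
      E = n ^ 4 ℕ.* (n ^ 3 ℕ.* 1)

      zeros-bound : ∀ f (k : ℕ → ℕ → ℕ → Carrier) (m : ℕ → ℕ → ℕ → ℕ → ℕ → Carrier) →
        (∀ a b c → 0 ℕ.< a → 0 ℕ.< b → 0 ℕ.< c → 0# < k a b c) →
        (∀ a b c A B C → k a b c * ι C + m a b c A B ≈ f a b c A B C) → Zeros f ℕ.≤ E
      zeros-bound f k m 0<k eq = 𝔾-bound n {λ a b c → 𝔾 n λ A B C → ⟦ f a b c A B C ≈ 0# ⟧} _ λ a b c 0<a 0<b 0<c →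
        𝔾-bound₃ n {λ A B C → ⟦ f a b c A B C ≈ 0# ⟧} 1 λ A B →
        affine-zeros n (k a b c) (m a b c A B) (pos⇒≉0 (0<k a b c 0<a 0<b 0<c))
          λ C p → trans (eq a b c A B (suc C)) p

      sum-of-three : ∀ f g h → Zeros f ℕ.≤ E → Zeros g ℕ.≤ E → Zeros h ℕ.≤ E →
        𝔾𝔾 n (λ a b c A B C → ⟦ f a b c A B C ≈ 0# ⟧ ℕ.+ (⟦ g a b c A B C ≈ 0# ⟧ ℕ.+ ⟦ h a b c A B C ≈ 0# ⟧)) ℕ.≤
        E ℕ.+ (E ℕ.+ E)
      sum-of-three f g h p q r = ℕₚ.≤-trans (ℕₚ.≤-reflexive (≡.trans
        (𝔾𝔾-+ n (λ a b c A B C → ⟦ f a b c A B C ≈ 0# ⟧) (λ a b c A B C → ⟦ g a b c A B C ≈ 0# ⟧ ℕ.+ ⟦ h a b c A B C ≈ 0# ⟧))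
        (≡.cong (Zeros f ℕ.+_) (𝔾𝔾-+ n (λ a b c A B C → ⟦ g a b c A B C ≈ 0# ⟧) (λ a b c A B C → ⟦ h a b c A B C ≈ 0# ⟧)))))
        (ℕₚ.+-mono-≤ p (ℕₚ.+-mono-≤ q r))

      e₁₂ e₂₃ e₃₁ : ℕ → ℕ → ℕ → ℕ → ℕ → ℕ → Carrier
      e₁₂ a b c A B C = a ∙ A ∧ b ∙ B
      e₂₃ a b c A B C = b ∙ B ∧ c ∙ C
      e₃₁ a b c A B C = c ∙ C ∧ a ∙ A

      zeros-e₂₃ : Zeros e₂₃ ℕ.≤ E
      zeros-e₂₃ = zeros-bound e₂₃ (λ a b c → ι b) (λ a b c A B → - (ι B * ι c))
        (λ a b c _ 0<b _ → fromℕ-pos 0<b) (λ a b c A B C → refl)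

      zeros-e₁₂ : Zeros e₁₂ ℕ.≤ E
      zeros-e₁₂ = ℕₚ.≤-trans (ℕₚ.≤-reflexive (𝔾𝔾-rotate n (λ a b c A B C → ⟦ e₁₂ a b c A B C ≈ 0# ⟧))) zeros-e₂₃

      zeros-e₃₁ : Zeros e₃₁ ℕ.≤ E
      zeros-e₃₁ = ℕₚ.≤-trans (ℕₚ.≤-reflexive (≡.sym (𝔾𝔾-rotate n (λ a b c A B C → ⟦ e₂₃ a b c A B C ≈ 0# ⟧)))) zeros-e₂₃

      u : ℕ → ℕ → ℕ → ℕ → ℕ → ℕ → Carrier × Carrier
      u a b c A B C = ι a + ι b + ι c , ι A + ι B + ι C

      d₁ d₂ d₃ : ℕ → ℕ → ℕ → ℕ → ℕ → ℕ → Carrier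
      d₁ a b c A B C = a ∙ A ∧ u a b c A B C
      d₂ a b c A B C = b ∙ B ∧ u a b c A B C
      d₃ a b c A B C = c ∙ C ∧ u a b c A B C

      zeros-d₁ : Zeros d₁ ℕ.≤ E
      zeros-d₁ = zeros-bound d₁ (λ a b c → ι a) (λ a b c A B → ι a * (ι A + ι B) - ι A * (ι a + ι b + ι c))
        (λ a b c 0<a _ _ → fromℕ-pos 0<a) (λ a b c A B C → solve 6 (λ a b c A B C →
          a ⊗ C ⊕ (a ⊗ (A ⊕ B) ⊖ A ⊗ (a ⊕ b ⊕ c)) := a ⊗ (A ⊕ B ⊕ C) ⊖ A ⊗ (a ⊕ b ⊕ c)) refl
          (ι a) (ι b) (ι c) (ι A) (ι B) (ι C))

      zeros-d₂ : Zeros d₂ ℕ.≤ E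
      zeros-d₂ = zeros-bound d₂ (λ a b c → ι b) (λ a b c A B → ι b * (ι A + ι B) - ι B * (ι a + ι b + ι c))
        (λ a b c _ 0<b _ → fromℕ-pos 0<b) (λ a b c A B C → solve 6 (λ a b c A B C →
          b ⊗ C ⊕ (b ⊗ (A ⊕ B) ⊖ B ⊗ (a ⊕ b ⊕ c)) := b ⊗ (A ⊕ B ⊕ C) ⊖ B ⊗ (a ⊕ b ⊕ c)) refl
          (ι a) (ι b) (ι c) (ι A) (ι B) (ι C))

      -- The coefficient of C in `d₃` is -(a + b), whereas `zeros-bound` wants a positive one;
      -- reading the gaps backwards turns `d₃` into `d₁`.
      zeros-d₃ : Zeros d₃ ℕ.≤ E
      zeros-d₃ = ℕₚ.≤-trans (ℕₚ.≤-reflexive (≡.trans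
        (𝔾𝔾-reverse n (λ a b c A B C → ⟦ d₃ a b c A B C ≈ 0# ⟧))
        (𝔾𝔾-cong n (λ a b c A B C → ⟦ d₃ c b a C B A ≈ 0# ⟧) (λ a b c A B C → ⟦ d₁ a b c A B C ≈ 0# ⟧) λ a b c A B C _ _ _ _ _ _ →
          ⟦⟧-cong (trans (sym (eq a b c A B C))) (trans (eq a b c A B C))))) zeros-d₁
        where
        eq : ∀ a b c A B C → d₃ c b a C B A ≈ d₁ a b c A B C
        eq a b c A B C = solve 6 (λ a b c A B C →
          a ⊗ (C ⊕ B ⊕ A) ⊖ A ⊗ (c ⊕ b ⊕ a) := a ⊗ (A ⊕ B ⊕ C) ⊖ A ⊗ (a ⊕ b ⊕ c)) refl
          (ι a) (ι b) (ι c) (ι A) (ι B) (ι C)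

  third-slopes : ∀ n → 3 ℕ.* 𝔾𝔾 n slopes ≈[ 3 ℕ.* (n ^ 4 ℕ.* n ^ 3) ] 𝔾𝔾 n (λ _ _ _ _ _ _ → 1)
  third-medians : ∀ n → 3 ℕ.* 𝔾𝔾 n medians ≈[ 3 ℕ.* (n ^ 4 ℕ.* n ^ 3) ] 𝔾𝔾 n (λ _ _ _ _ _ _ → 1)

  private
    three-errors : ∀ u v → u ℕ.* (v ℕ.* 1) ℕ.+ (u ℕ.* (v ℕ.* 1) ℕ.+ u ℕ.* (v ℕ.* 1)) ≡ 3 ℕ.* (u ℕ.* v)
    three-errors = solve-∀

  third-slopes n = ≈-weaken (ℕₚ.≤-trans
    (sum-of-three n (e₁₂ n) (e₂₃ n) (e₃₁ n) (zeros-e₁₂ n) (zeros-e₂₃ n) (zeros-e₃₁ n))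
    (ℕₚ.≤-reflexive (three-errors (n ^ 4) (n ^ 3))))
    (third n slopes _ λ a b c A B C 0<a 0<b 0<c _ _ _ →
      equal-sign-pairs (e₁₂ n a b c A B C) (e₂₃ n a b c A B C) (e₃₁ n a b c A B C)
        (fromℕ-pos 0<c) (fromℕ-pos 0<a) (fromℕ-pos 0<b)
        -- The determinant with rows (a, b, c), (a, b, c), (A, B, C), expanded along its first row.
        -- Its positive coefficients keep the three minors from having one sign.
        (solve 6 (λ a b c A B C → c ⊗ (a ⊗ B ⊖ A ⊗ b) ⊕ a ⊗ (b ⊗ C ⊖ B ⊗ c) ⊕ b ⊗ (c ⊗ A ⊖ C ⊗ a) := :0)
          refl (ι a) (ι b) (ι c) (ι A) (ι B) (ι C)))

  third-medians n = ≈-weaken (ℕₚ.≤-trans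
    (sum-of-three n (d₁ n) (d₃ n) (d₂ n) (zeros-d₁ n) (zeros-d₃ n) (zeros-d₂ n))
    (ℕₚ.≤-reflexive (three-errors (n ^ 4) (n ^ 3))))
    (third n medians _ λ a b c A B C 0<a 0<b 0<c _ _ _ → ≈-resp
      (≡.cong (medians a b c A B C ℕ.+_) (≡.trans (ℕₚ.+-comm ⟦ 0# < d₃ n a b c A B C * d₂ n a b c A B C ⟧ _)
        (≡.cong₂ ℕ._+_
          (⟦⟧-cong (pos-resp (*-cong (rot₁ a b c A B C) (rot₂ a b c A B C)))
                   (pos-resp (sym (*-cong (rot₁ a b c A B C) (rot₂ a b c A B C)))))
          (⟦⟧-cong (pos-resp (*-cong (rot₃ a b c A B C) (rot₁′ a b c A B C)))
                   (pos-resp (sym (*-cong (rot₃ a b c A B C) (rot₁′ a b c A B C))))))))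
      ≡.refl
      (equal-sign-pairs (d₁ n a b c A B C) (d₃ n a b c A B C) (d₂ n a b c A B C) 0<1 0<1 0<1
        -- The steps add up to u, so their products with u add up to u ∧ u = 0.
        (solve 6 (λ a b c A B C → :1 ⊗ (a ⊗ (A ⊕ B ⊕ C) ⊖ A ⊗ (a ⊕ b ⊕ c)) ⊕ :1 ⊗ (c ⊗ (A ⊕ B ⊕ C) ⊖ C ⊗ (a ⊕ b ⊕ c)) ⊕
          :1 ⊗ (b ⊗ (A ⊕ B ⊕ C) ⊖ B ⊗ (a ⊕ b ⊕ c)) := :0)
          refl (ι a) (ι b) (ι c) (ι A) (ι B) (ι C))))
    where
    cycle : ∀ x y a b c A B C → (x , y) ∧ (a + b + c , A + B + C) ≈ (x , y) ∧ (b + c + a , B + C + A)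
    cycle x y a b c A B C = solve 8 (λ x y a b c A B C →
      x ⊗ (A ⊕ B ⊕ C) ⊖ y ⊗ (a ⊕ b ⊕ c) := x ⊗ (B ⊕ C ⊕ A) ⊖ y ⊗ (b ⊕ c ⊕ a)) refl x y a b c A B C
    rot₁ : ∀ a b c A B C → d₂ n a b c A B C ≈ b ∙ B ∧ (ι b + ι c + ι a , ι B + ι C + ι A)
    rot₁ a b c A B C = cycle _ _ _ _ _ _ _ _
    rot₂ : ∀ a b c A B C → d₁ n a b c A B C ≈ a ∙ A ∧ (ι b + ι c + ι a , ι B + ι C + ι A)
    rot₂ a b c A B C = cycle _ _ _ _ _ _ _ _
    rot₃ : ∀ a b c A B C → d₃ n a b c A B C ≈ c ∙ C ∧ (ι c + ι a + ι b , ι C + ι A + ι B)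
    rot₃ a b c A B C = sym (cycle _ _ _ _ _ _ _ _)
    rot₁′ : ∀ a b c A B C → d₂ n a b c A B C ≈ b ∙ B ∧ (ι c + ι a + ι b , ι C + ι A + ι B)
    rot₁′ a b c A B C = sym (cycle _ _ _ _ _ _ _ _)

-- Number of sorted quadruples

module GapTotal (em : ExcludedMiddle 0ℓ) where
  open Nat
  open ℕₚ
  open Sums
  open Indicators em
  open SortedSums em

  private
    -- The binomial coefficients of n over 2, 3 and 4. The equations that follow are the falling
    -- factorials n(n - 1), n(n - 1)(n - 2) and n(n - 1)(n - 2)(n - 3) with negative terms moved to
    -- the other side.
    C₂ C₃ C₄ : ℕ → ℕ
    C₂ n = ∑[ i < n ] i
    C₃ n = ∑[ i < n ] C₂ i
    C₄ n = ∑[ i < n ] C₃ i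

    C₂-eq : ∀ n → 2 * C₂ n + n ≡ n * n
    C₂-eq zero    = ≡.refl
    C₂-eq (suc n) = ≡.trans (step (C₂ n) n) (≡.trans (≡.cong (_+ (2 * n + 1)) (C₂-eq n)) (square n))
      where
      step : ∀ x n → 2 * (x + n) + suc n ≡ 2 * x + n + (2 * n + 1)
      step = solve-∀
      square : ∀ n → n * n + (2 * n + 1) ≡ suc n * suc n
      square = solve-∀

    C₃-eq : ∀ n → 6 * C₃ n + 3 * (n * n) ≡ n * n * n + 2 * n
    C₃-eq zero    = ≡.refl
    C₃-eq (suc n) = +-cancelʳ-≡ (3 * n) _ _ (≡.trans (step (C₃ n) (C₂ n) n)
      (≡.trans (≡.cong₂ (λ x y → x + 3 * y + (6 * n + 3)) (C₃-eq n) (C₂-eq n)) (cube n)))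
      where
      step : ∀ x y n → 6 * (x + y) + 3 * (suc n * suc n) + 3 * n ≡ 6 * x + 3 * (n * n) + 3 * (2 * y + n) + (6 * n + 3)
      step = solve-∀
      cube : ∀ n → n * n * n + 2 * n + 3 * (n * n) + (6 * n + 3) ≡ suc n * suc n * suc n + 2 * suc n + 3 * n
      cube = solve-∀

    C₄-eq : ∀ n → 24 * C₄ n + (6 * (n * n * n) + 6 * n) ≡ n * n * n * n + 11 * (n * n)
    C₄-eq zero    = ≡.refl
    C₄-eq (suc n) = +-cancelʳ-≡ (12 * (n * n)) _ _ (≡.trans (step (C₄ n) (C₃ n) n)
      (≡.trans (≡.cong₂ (λ x y → x + 4 * y + (18 * (n * n) + 18 * n + 12)) (C₄-eq n) (C₃-eq n)) (quartic n)))
      where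
      step : ∀ x y n → 24 * (x + y) + (6 * (suc n * suc n * suc n) + 6 * suc n) + 12 * (n * n) ≡
        24 * x + (6 * (n * n * n) + 6 * n) + 4 * (6 * y + 3 * (n * n)) + (18 * (n * n) + 18 * n + 12)
      step = solve-∀
      quartic : ∀ n → n * n * n * n + 11 * (n * n) + 4 * (n * n * n + 2 * n) + (18 * (n * n) + 18 * n + 12) ≡
        suc n * suc n * suc n * suc n + 11 * (suc n * suc n) + 12 * (n * n)
      quartic = solve-∀

  total : ℕ → ℕ
  total n = 𝔾 n (λ _ _ _ → 1)

  private
    total-eq : ∀ n → total n ≡ C₄ n
    total-eq n = begin
      𝔾 n (λ _ _ _ → 1)
        ≡⟨ 𝕊⇒𝔾 n {λ _ _ _ _ → 1} (λ _ _ _ _ _ _ _ → ≡.refl) ⟨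
      ∑⁴ n (λ a b c d → ⟦ Sorted a b c d ⟧ * 1)
        ≡⟨ (∑⁴-cong n λ a b c d → split a b c d) ⟩
      ∑⁴ n (λ a b c d → ⟦ c < d ⟧ * (⟦ b < c ⟧ * (⟦ a < b ⟧ * 1)))
        ≡⟨ reorder (λ d c b a → ⟦ c < d ⟧ * (⟦ b < c ⟧ * (⟦ a < b ⟧ * 1))) ⟨
      ∑[ d < n ] ∑[ c < n ] ∑[ b < n ] ∑[ a < n ] (⟦ c < d ⟧ * (⟦ b < c ⟧ * (⟦ a < b ⟧ * 1)))
        ≡⟨ (∑-cong-< n λ d d<n → ≡.trans (∑-cong-< n λ c c<n → ≡.trans (∑-cong-< n λ b b<n →
             ≡.trans (∑-*ˡ n ⟦ c < d ⟧ _) (≡.cong (⟦ c < d ⟧ *_) (≡.trans (∑-*ˡ n ⟦ b < c ⟧ _)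
               (≡.cong (⟦ b < c ⟧ *_) (≡.trans (∑-below (λ _ → 1) (<⇒≤ b<n)) (≡.trans (∑-const b 1) (*-identityʳ b)))))))
             (≡.trans (∑-*ˡ n ⟦ c < d ⟧ _) (≡.cong (⟦ c < d ⟧ *_) (∑-below id (<⇒≤ c<n)))))
             (∑-below C₂ (<⇒≤ d<n))) ⟩
      C₄ n ∎
      where
      open ≡.≡-Reasoning
      split : ∀ a b c d → ⟦ Sorted a b c d ⟧ * 1 ≡ ⟦ c < d ⟧ * (⟦ b < c ⟧ * (⟦ a < b ⟧ * 1))
      split a b c d = ≡.trans (≡.cong (_* 1) (≡.trans (⟦⟧-× _ _) (≡.cong (⟦ a < b ⟧ *_) (⟦⟧-× _ _))))
        (assoc ⟦ a < b ⟧ ⟦ b < c ⟧ ⟦ c < d ⟧)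
        where
        assoc : ∀ u v w → u * (v * w) * 1 ≡ w * (v * (u * 1))
        assoc = solve-∀
      reorder : ∀ f → ∑⁴ n f ≡ ∑⁴ n (λ a b c d → f d c b a)
      reorder f = ≡.trans (∑⁴-exchange n f) (≡.trans (∑⁴-swap₁₂ n _) (∑⁴-swap₃₄ n _))

    cubes : ∀ n → n * n ≤ n ^ 3 × n ≤ n ^ 3
    cubes zero    = z≤n , z≤n
    cubes (suc n) = *-monoʳ-≤ (suc n) (m≤m*n (suc n) (suc n * 1)) , m≤m*n (suc n) (suc n * (suc n * 1))

  -- Below n⁴ the falling factorial has the terms 11n² on one side and 6n³ + 6n on the other; 12n³
  -- covers either.
  total-≈ : ∀ n → 24 * total n ≈[ 12 * n ^ 3 ] n ^ 4
  total-≈ n rewrite total-eq n =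
    ≤-trans (m≤m+n _ _) (≤-trans (≤-reflexive (C₄-eq n)) (+-mono-≤ (≤-reflexive (power n))
      (≤-trans (*-monoʳ-≤ 11 (proj₁ (cubes n))) (*-monoˡ-≤ (n ^ 3) {11} {12} (n≤1+n 11))))) ,
    ≤-trans (≤-trans (≤-reflexive (≡.sym (power n))) (m≤m+n _ _)) (≤-trans (≤-reflexive (≡.sym (C₄-eq n)))
      (+-monoʳ-≤ (24 * C₄ n) (≤-trans (+-mono-≤ (≤-reflexive (cube n)) (*-monoʳ-≤ 6 (proj₂ (cubes n))))
        (≤-reflexive (twelve (n ^ 3))))))
    where
    power : ∀ n → n * n * n * n ≡ n * (n * (n * (n * 1)))
    power = solve-∀
    cube : ∀ n → 6 * (n * n * n) ≡ 6 * (n * (n * (n * 1)))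
    cube = solve-∀
    twelve : ∀ k → 6 * k + 6 * k ≡ 12 * k
    twelve = solve-∀

-- Asymptotic equality

module Asymptotics where
  open Nat
  open ℕₚ
  open Sums

  infix 4 _≋_
  -- Agreement up to O(n⁷), one order below the n⁸ quadruples of cells. The exponent is split as 4 +
  -- 3 because the estimates sum freely over four indices of one coordinate and three of the other.
  _≋_ : (ℕ → ℕ) → (ℕ → ℕ) → Set
  f ≋ g = ∃[ k ] ∀ n → f n ≈[ k * (n ^ 4 * n ^ 3) ] g n

  ≋-of-≡ : ∀ {f g} → (∀ n → f n ≡ g n) → f ≋ g
  ≋-of-≡ eq = 0 , λ n → ≈-of-≡ (eq n)

  ≋-trans : ∀ {f g h} → f ≋ g → g ≋ h → f ≋ h
  ≋-trans (k , p) (l , q) = k + l , λ n →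
    ≈-weaken (≤-reflexive (≡.sym (*-distribʳ-+ (n ^ 4 * n ^ 3) k l))) (≈-trans (p n) (q n))

  ≋-+ : ∀ {f g f′ g′} → f ≋ g → f′ ≋ g′ → (λ n → f n + f′ n) ≋ (λ n → g n + g′ n)
  ≋-+ (k , p) (l , q) = k + l , λ n →
    ≈-weaken (≤-reflexive (≡.sym (*-distribʳ-+ (n ^ 4 * n ^ 3) k l))) (≈-+ (p n) (q n))

  ≋-*ˡ : ∀ m {f g} → f ≋ g → (λ n → m * f n) ≋ (λ n → m * g n)
  ≋-*ˡ m (k , p) = m * k , λ n →
    ≈-weaken (≤-reflexive (≡.sym (*-assoc m k (n ^ 4 * n ^ 3)))) (≈-*ˡ m (p n))

  -- By w² - n⁸ = w(w - n⁴) + n⁴(w - n⁴) and w ≤ 13n⁴, the constant is 13 · 12 + 12 = 168.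
  square-≋ : ∀ {w : ℕ → ℕ} → (∀ n → w n ≈[ 12 * n ^ 3 ] n ^ 4) → (λ n → w n * w n) ≋ (λ n → n ^ 4 * n ^ 4)
  square-≋ {w} p = 168 , λ n → ≈-weaken (error n)
    (≈-trans (≈-*ˡ (w n) (p n)) (≈-resp (*-comm (n ^ 4) (w n)) ≡.refl (≈-*ˡ (n ^ 4) (p n))))
    where
    cube≤ : ∀ n → n ^ 3 ≤ n ^ 4
    cube≤ zero    = ≤-refl
    cube≤ (suc n) = m≤m+n (suc n ^ 3) (n * suc n ^ 3)
    error : ∀ n → w n * (12 * n ^ 3) + n ^ 4 * (12 * n ^ 3) ≤ 168 * (n ^ 4 * n ^ 3)
    error n = ≤-trans (+-monoˡ-≤ _ (*-monoˡ-≤ (12 * n ^ 3)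
      (≤-trans (upper (p n)) (+-monoʳ-≤ (n ^ 4) (*-monoʳ-≤ 12 (cube≤ n))))))
      (≤-reflexive (collect (n ^ 4) (n ^ 3)))
      where
      collect : ∀ x y → (x + 12 * x) * (12 * y) + x * (12 * y) ≡ 168 * (x * y)
      collect = solve-∀

-- Crossing quadruples of the grid

module CrossingCount (em : ExcludedMiddle 0ℓ) (ℝ : CompleteOrderedField) where
  open CompleteOrderedField ℝ hiding (zero)
  open IntegerRingSolver ℝ
  open FieldProperties ℝ
  open Plane ℝ using (Point; _≈ₚ_)
  open Orientation ℝ
  open Gaps ℝ
  open Sums
  open Asymptotics
  open Indicators em
  open SortedSums em
  open Decompositions em
  open GapAverages em
  open GapTotal em
  open LatticeAverages em ℝ

  gridPoint : ℕ → ℕ → Point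
  gridPoint i j = fromℕ i , fromℕ j

  GridCross SomeGridCross : (p q r s P Q R S : ℕ) → Set
  GridCross p q r s P Q R S = MonoCross (gridPoint p P) (gridPoint q Q) (gridPoint r R) (gridPoint s S)
  SomeGridCross p q r s P Q R S = SomeMonoCross (gridPoint p P) (gridPoint q Q) (gridPoint r R) (gridPoint s S)

  private
    module _ (n : ℕ) where
      -- The abscissae are parameters and only the ordinates are summed, so that `decompose₁` can
      -- sort the former before `decompose₂` sorts the latter.
      H : ℕ → ℕ → ℕ → ℕ → ℕ
      H p q r s = ∑⁴ n λ P Q R S → ⟦ GridCross p q r s P Q R S ⟧

      H-swap : ∀ p q r s → H p q r s ≡ H q p r s
      H-swap p q r s = ≡.trans (∑⁴-swap₁₂ n _) (∑⁴-cong n λ P Q R S →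
        ⟦⟧-cong (monoCross-swapˡ _ _ _ _) (monoCross-swapˡ _ _ _ _))

      H-exchange : ∀ p q r s → H p q r s ≡ H r s p q
      H-exchange p q r s = ≡.trans (∑⁴-exchange n _) (∑⁴-cong n λ P Q R S →
        ⟦⟧-cong (monoCross-exchange _ _ _ _) (monoCross-exchange _ _ _ _))

      H-diagonal : ∀ p r s → H p p r s ≡ 0
      H-diagonal p r s = ∑⁴-zero n λ P Q R S → ⟦⟧-no λ (_ , m) → irrefl (sym
        (trans (*-congʳ (trans (*-congʳ (-‿inverseʳ _)) (zeroˡ _))) (zeroˡ _))) m

      H-bound : ∀ p q r s → H p q r s ℕ.≤ n ^ 4
      H-bound p q r s = ℕₚ.≤-trans (∑⁴-bound n 1 λ P Q R S → ⟦⟧≤1 _) (ℕₚ.≤-reflexive (ℕₚ.*-identityʳ _))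

      H-disjoint : ∀ p q r s → p ℕ.< q → q ℕ.< r → r ℕ.< s → H p q r s ≡ 0
      H-disjoint p q r s p<q q<r r<s = ∑⁴-zero n λ P Q R S → ⟦⟧-no λ (c , _) →
        separatedˣ (gridPoint p P) (gridPoint q Q) (gridPoint r R) (gridPoint s S)
          (fromℕ-mono-< p<q) (fromℕ-mono-< q<r) (fromℕ-mono-< r<s) c

      fromℕ-reverse : ∀ {i} → i ℕ.< n → fromℕ n - 1# - fromℕ i ≈ fromℕ (n ℕ.∸ suc i)
      fromℕ-reverse {i} i<n = trans (+-congʳ (+-congʳ (trans (fromℕ-cong (≡.sym (ℕₚ.m∸n+n≡m i<n))) (fromℕ-+ (n ℕ.∸ suc i) (suc i)))))
        (solve 2 (λ k i → k ⊕ (:1 ⊕ i) ⊖ :1 ⊖ i := k) refl (fromℕ (n ℕ.∸ suc i)) (fromℕ i))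

      vertical : ∀ p q r s → p ℕ.< q → r ℕ.< s → ∑⁴ n (λ P Q R S → ⟦ GridCross p q r s P Q R S ⟧)
        ≈[ 8 ℕ.* n ^ 3 ]
        2 ℕ.* ((𝕊 n (λ A B C D → ⟦ GridCross p q r s A C B D ⟧) ℕ.+ 𝕊 n (λ A B C D → ⟦ GridCross p q r s A D B C ⟧)) ℕ.+
               (𝕊 n (λ A B C D → ⟦ GridCross p q r s B C A D ⟧) ℕ.+ 𝕊 n (λ A B C D → ⟦ GridCross p q r s B D A C ⟧)))
      vertical p q r s p<q r<s = decompose₂ n (GridCross p q r s)
        (λ P Q R S P<n Q<n R<n S<n y → monoCross-cong
          (refl , fromℕ-reverse P<n) (refl , fromℕ-reverse Q<n) (refl , fromℕ-reverse R<n) (refl , fromℕ-reverse S<n)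
          -- On row indices, the reversal P ↦ n - 1 - P is a reflection in a horizontal line.
          (monoCross-reflect (fromℕ n - 1#) _ _ _ _ y))
        (λ P Q R S (_ , m) → colour P Q R S (*-pos⇒sameSign m))
        (λ P Q R S (c , _) P<Q R<S Q<R → separatedʸ (gridPoint p P) (gridPoint q Q) (gridPoint r R) (gridPoint s S)
          (fromℕ-mono-< P<Q) (fromℕ-mono-< Q<R) (fromℕ-mono-< R<S) c)
        (λ P Q R S y P<Q R<S S<P → separatedʸ (gridPoint r R) (gridPoint s S) (gridPoint p P) (gridPoint q Q)
          (fromℕ-mono-< R<S) (fromℕ-mono-< S<P) (fromℕ-mono-< P<Q)
          (proj₁ (monoCross-exchange (gridPoint p P) (gridPoint q Q) (gridPoint r R) (gridPoint s S) y)))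
        where
        rising : ∀ {p q P Q} → p ℕ.< q → 0# < rise (gridPoint p P) (gridPoint q Q) → P ℕ.< Q
        rising p<q x = fromℕ-cancel-< (pos-sub (*-cancel-pos x (sub-pos (fromℕ-mono-< p<q))))
        falling : ∀ {p q P Q} → p ℕ.< q → 0# < - rise (gridPoint p P) (gridPoint q Q) → Q ℕ.< P
        falling {p} {q} {P} {Q} p<q x = fromℕ-cancel-< (pos-sub (*-cancel-pos (pos-resp
          (solve 4 (λ p q P Q → ⊝ ((q ⊖ p) ⊗ (Q ⊖ P)) := (q ⊖ p) ⊗ (P ⊖ Q)) refl (fromℕ p) (fromℕ q) (fromℕ P) (fromℕ Q)) x)
          (sub-pos (fromℕ-mono-< p<q))))
        colour : ∀ P Q R S → SameSign (rise (gridPoint p P) (gridPoint q Q)) (rise (gridPoint r R) (gridPoint s S)) →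
          (P ℕ.< Q × R ℕ.< S) ⊎ (Q ℕ.< P × S ℕ.< R)
        colour P Q R S (both-positive x y) = inj₁ (rising p<q x , rising r<s y)
        colour P Q R S (both-negative x y) = inj₂ (falling {P = P} {Q} p<q x , falling {P = R} {S} r<s y)

      private
        ≈₂ : ∀ z a → fromℕ (z ℕ.+ a) ≈ fromℕ z + fromℕ a
        ≈₂ = fromℕ-+
        ≈₃ : ∀ z a b → fromℕ (z ℕ.+ a ℕ.+ b) ≈ fromℕ z + fromℕ a + fromℕ b
        ≈₃ z a b = trans (fromℕ-+ (z ℕ.+ a) b) (+-congʳ (fromℕ-+ z a))
        ≈₄ : ∀ z a b c → fromℕ (z ℕ.+ a ℕ.+ b ℕ.+ c) ≈ fromℕ z + fromℕ a + fromℕ b + fromℕ c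
        ≈₄ z a b c = trans (fromℕ-+ (z ℕ.+ a ℕ.+ b) c) (+-congʳ (≈₃ z a b))

        ≈ₚ-sym : ∀ {P Q} → P ≈ₚ Q → Q ≈ₚ P
        ≈ₚ-sym (x , y) = sym x , sym y

        crossing-cong : ∀ {P P′ Q Q′ R R′ S S′} → P ≈ₚ P′ → Q ≈ₚ Q′ → R ≈ₚ R′ → S ≈ₚ S′ →
          ⟦ MonoCross P Q R S ⟧ ≡ ⟦ MonoCross P′ Q′ R′ S′ ⟧
        crossing-cong p q r s = ⟦⟧-cong (monoCross-cong p q r s)
          (monoCross-cong (≈ₚ-sym p) (≈ₚ-sym q) (≈ₚ-sym r) (≈ₚ-sym s))

        exceeds-ℕ : ∀ a b c A B C →
          ⟦ Exceeds (fromℕ a) (fromℕ b) (fromℕ c) (fromℕ A) (fromℕ B) (fromℕ C) ⟧ ≡ share a b c A B C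
        exceeds-ℕ a b c A B C = ⟦⟧-cong
          (λ p → fromℕ-cancel-< (<-respˡ-≈ (sym lhs) (<-respʳ-≈ (sym rhs) p)))
          (λ p → <-respˡ-≈ lhs (<-respʳ-≈ rhs (fromℕ-mono-< p)))
          where
          lhs : fromℕ ((a ℕ.+ b ℕ.+ c) ℕ.* A) ≈ (fromℕ a + fromℕ b + fromℕ c) * fromℕ A
          lhs = trans (fromℕ-* (a ℕ.+ b ℕ.+ c) A) (*-congʳ (≈₃ a b c))
          rhs : fromℕ ((A ℕ.+ B) ℕ.* a) ≈ (fromℕ A + fromℕ B) * fromℕ a
          rhs = trans (fromℕ-* (A ℕ.+ B) a) (*-congʳ (fromℕ-+ A B))

        Eight : Set₁
        Eight = ℕ → ℕ → ℕ → ℕ → ℕ → ℕ → ℕ → ℕ → Set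

        to-gaps : ∀ (X : Eight) f →
          (∀ z a b c Z A B C → 0 ℕ.< a → 0 ℕ.< b → 0 ℕ.< c → 0 ℕ.< A → 0 ℕ.< B → 0 ℕ.< C →
            ⟦ X z (z ℕ.+ a) (z ℕ.+ a ℕ.+ b) (z ℕ.+ a ℕ.+ b ℕ.+ c) Z (Z ℕ.+ A) (Z ℕ.+ A ℕ.+ B) (Z ℕ.+ A ℕ.+ B ℕ.+ C) ⟧ ≡
            f a b c A B C) →
          𝕊 n (λ a b c d → 𝕊 n λ A B C D → ⟦ X a b c d A B C D ⟧) ≡ 𝔾𝔾 n f
        to-gaps X f eq = 𝕊⇒𝔾 n λ z a b c 0<a 0<b 0<c → 𝕊⇒𝔾 n λ Z A B C 0<A 0<B 0<C →
          eq z a b c Z A B C 0<a 0<b 0<c 0<A 0<B 0<C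

        pos⁺ : ∀ {k} → 0 ℕ.< k → 0# < fromℕ k
        pos⁺ = fromℕ-pos

      one-third : ℕ
      one-third = 𝔾𝔾 n share

      PRQS-PRQS-count : 𝕊 n (λ a b c d → 𝕊 n λ A B C D → ⟦ GridCross a c b d A C B D ⟧) ≡ 𝔾𝔾 n slopes
      PRQS-PRQS-count = to-gaps (λ a b c d A B C D → GridCross a c b d A C B D) slopes λ z a b c Z A B C 0<a 0<b 0<c 0<A 0<B 0<C →
        let open PRQS-PRQS (fromℕ z) (fromℕ a) (fromℕ b) (fromℕ c) (fromℕ Z) (fromℕ A) (fromℕ B) (fromℕ C)
                   (pos⁺ 0<a) (pos⁺ 0<b) (pos⁺ 0<c) (pos⁺ 0<A) (pos⁺ 0<B) (pos⁺ 0<C)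
        in ≡.trans (crossing-cong (refl , refl) (≈₃ z a b , ≈₃ Z A B) (≈₂ z a , ≈₂ Z A) (≈₄ z a b c , ≈₄ Z A B C))
                   (⟦⟧-cong elim intro)

      PRQS-PRSQ-count : 𝕊 n (λ a b c d → 𝕊 n λ A B C D → ⟦ GridCross a c b d A D B C ⟧) ≡ one-third
      PRQS-PRSQ-count = ≡.trans (to-gaps (λ a b c d A B C D → GridCross a c b d A D B C) (λ a b c A B C → share A B C a b c)
        λ z a b c Z A B C 0<a 0<b 0<c 0<A 0<B 0<C →
        let open PRQS-PRSQ (fromℕ z) (fromℕ a) (fromℕ b) (fromℕ c) (fromℕ Z) (fromℕ A) (fromℕ B) (fromℕ C)
                   (pos⁺ 0<a) (pos⁺ 0<b) (pos⁺ 0<c) (pos⁺ 0<A) (pos⁺ 0<B) (pos⁺ 0<C)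
        in ≡.trans (crossing-cong (refl , refl) (≈₃ z a b , ≈₄ Z A B C) (≈₂ z a , ≈₂ Z A) (≈₄ z a b c , ≈₃ Z A B))
                   (≡.trans (⟦⟧-cong elim intro) (exceeds-ℕ A B C a b c)))
        -- The criterion is that of `share` with abscissae and ordinates exchanged, hence the
        -- interchange of the two sums.
        (𝔾-comm n (λ a b c A B C → share A B C a b c))

      PRQS-RPQS-count : 𝕊 n (λ a b c d → 𝕊 n λ A B C D → ⟦ GridCross a c b d B C A D ⟧) ≡ one-third
      PRQS-RPQS-count = ≡.trans (to-gaps (λ a b c d A B C D → GridCross a c b d B C A D) (λ a b c A B C → share C B A c b a)
        λ z a b c Z A B C 0<a 0<b 0<c 0<A 0<B 0<C →
        let open PRQS-RPQS (fromℕ z) (fromℕ a) (fromℕ b) (fromℕ c) (fromℕ Z) (fromℕ A) (fromℕ B) (fromℕ C)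
                   (pos⁺ 0<a) (pos⁺ 0<b) (pos⁺ 0<c) (pos⁺ 0<A) (pos⁺ 0<B) (pos⁺ 0<C)
        in ≡.trans (crossing-cong (refl , ≈₂ Z A) (≈₃ z a b , ≈₃ Z A B) (≈₂ z a , refl) (≈₄ z a b c , ≈₄ Z A B C))
                   (≡.trans (⟦⟧-cong elim intro) (exceeds-ℕ C B A c b a)))
        (≡.trans (𝔾-comm n (λ a b c A B C → share C B A c b a)) (≡.sym (𝔾𝔾-reverse n share)))

      PRQS-RPSQ-count : 𝕊 n (λ a b c d → 𝕊 n λ A B C D → ⟦ GridCross a c b d B D A C ⟧) ≡ 0
      PRQS-RPSQ-count = ≡.trans (to-gaps (λ a b c d A B C D → GridCross a c b d B D A C) (λ _ _ _ _ _ _ → 0)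
        λ z a b c Z A B C 0<a 0<b 0<c 0<A 0<B 0<C →
        let open PRQS-RPSQ (fromℕ z) (fromℕ a) (fromℕ b) (fromℕ c) (fromℕ Z) (fromℕ A) (fromℕ B) (fromℕ C)
                   (pos⁺ 0<a) (pos⁺ 0<b) (pos⁺ 0<c) (pos⁺ 0<A) (pos⁺ 0<B) (pos⁺ 0<C)
        in ≡.trans (crossing-cong (refl , ≈₂ Z A) (≈₃ z a b , ≈₄ Z A B C) (≈₂ z a , refl) (≈₄ z a b c , ≈₃ Z A B))
                   (⟦⟧-no never))
        (ℕₚ.n≤0⇒n≡0 (ℕₚ.≤-trans (𝔾-bound n 0 λ a b c _ _ _ →
          ℕₚ.≤-trans (𝔾-bound n 0 λ _ _ _ _ _ _ → z≤n) (ℕₚ.≤-reflexive (ℕₚ.*-zeroʳ (n ^ 4))))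
          (ℕₚ.≤-reflexive (ℕₚ.*-zeroʳ (n ^ 4)))))

      PRSQ-PRSQ-count : 𝕊 n (λ a b c d → 𝕊 n λ A B C D → ⟦ GridCross a d b c A D B C ⟧) ≡ 𝔾𝔾 n medians
      PRSQ-PRSQ-count = to-gaps (λ a b c d A B C D → GridCross a d b c A D B C) medians λ z a b c Z A B C 0<a 0<b 0<c 0<A 0<B 0<C →
        let open PRSQ-PRSQ (fromℕ z) (fromℕ a) (fromℕ b) (fromℕ c) (fromℕ Z) (fromℕ A) (fromℕ B) (fromℕ C)
                   (pos⁺ 0<a) (pos⁺ 0<b) (pos⁺ 0<c) (pos⁺ 0<A) (pos⁺ 0<B) (pos⁺ 0<C)
        in ≡.trans (crossing-cong (refl , refl) (≈₄ z a b c , ≈₄ Z A B C) (≈₂ z a , ≈₂ Z A) (≈₃ z a b , ≈₃ Z A B))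
                   (⟦⟧-cong elim intro)

      PRSQ-PRQS-count : 𝕊 n (λ a b c d → 𝕊 n λ A B C D → ⟦ GridCross a d b c A C B D ⟧) ≡ one-third
      PRSQ-PRQS-count = to-gaps (λ a b c d A B C D → GridCross a d b c A C B D) share λ z a b c Z A B C 0<a 0<b 0<c 0<A 0<B 0<C →
        let open PRSQ-PRQS (fromℕ z) (fromℕ a) (fromℕ b) (fromℕ c) (fromℕ Z) (fromℕ A) (fromℕ B) (fromℕ C)
                   (pos⁺ 0<a) (pos⁺ 0<b) (pos⁺ 0<c) (pos⁺ 0<A) (pos⁺ 0<B) (pos⁺ 0<C)
        in ≡.trans (crossing-cong (refl , refl) (≈₄ z a b c , ≈₃ Z A B) (≈₂ z a , ≈₂ Z A) (≈₃ z a b , ≈₄ Z A B C))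
                   (≡.trans (⟦⟧-cong elim intro) (exceeds-ℕ a b c A B C))

      PRSQ-RPQS-count : 𝕊 n (λ a b c d → 𝕊 n λ A B C D → ⟦ GridCross a d b c B C A D ⟧) ≡ 𝔾𝔾 n (λ _ _ _ _ _ _ → 1)
      PRSQ-RPQS-count = to-gaps (λ a b c d A B C D → GridCross a d b c B C A D) _ λ z a b c Z A B C 0<a 0<b 0<c 0<A 0<B 0<C →
        let open PRSQ-RPQS (fromℕ z) (fromℕ a) (fromℕ b) (fromℕ c) (fromℕ Z) (fromℕ A) (fromℕ B) (fromℕ C)
                   (pos⁺ 0<a) (pos⁺ 0<b) (pos⁺ 0<c) (pos⁺ 0<A) (pos⁺ 0<B) (pos⁺ 0<C)
        in ≡.trans (crossing-cong (refl , ≈₂ Z A) (≈₄ z a b c , ≈₃ Z A B) (≈₂ z a , refl) (≈₃ z a b , ≈₄ Z A B C))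
                   (⟦⟧-yes always)

      PRSQ-RPSQ-count : 𝕊 n (λ a b c d → 𝕊 n λ A B C D → ⟦ GridCross a d b c B D A C ⟧) ≡ one-third
      PRSQ-RPSQ-count = ≡.trans (to-gaps (λ a b c d A B C D → GridCross a d b c B D A C) (λ a b c A B C → share c b a C B A)
        λ z a b c Z A B C 0<a 0<b 0<c 0<A 0<B 0<C →
        let open PRSQ-RPSQ (fromℕ z) (fromℕ a) (fromℕ b) (fromℕ c) (fromℕ Z) (fromℕ A) (fromℕ B) (fromℕ C)
                   (pos⁺ 0<a) (pos⁺ 0<b) (pos⁺ 0<c) (pos⁺ 0<A) (pos⁺ 0<B) (pos⁺ 0<C)
        in ≡.trans (crossing-cong (refl , ≈₂ Z A) (≈₄ z a b c , ≈₄ Z A B C) (≈₂ z a , refl) (≈₃ z a b , ≈₃ Z A B))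
                   (≡.trans (⟦⟧-cong elim intro) (exceeds-ℕ c b a C B A)))
        (≡.sym (𝔾𝔾-reverse n share))

  crossings : ℕ → ℕ
  crossings n = ∑⁴ n λ p q r s → H n p q r s

  private
    Horizontal Nested : ℕ → ℕ
    Horizontal n = 𝕊 n (λ a b c d → H n a c b d)
    Nested n = 𝕊 n (λ a b c d → H n a d b c)

    W² : ℕ → ℕ
    W² n = 𝔾𝔾 n (λ _ _ _ _ _ _ → 1)

    slopes-≋ : (λ n → 3 ℕ.* 𝔾𝔾 n slopes) ≋ W²
    slopes-≋ = 3 , third-slopes

    medians-≋ : (λ n → 3 ℕ.* 𝔾𝔾 n medians) ≋ W²
    medians-≋ = 3 , third-medians

    share-≋ : (λ n → 3 ℕ.* one-third n) ≋ W²
    share-≋ = 2 , λ n → ≈-weaken (ℕₚ.≤-reflexive (regroup (n ^ 4) (n ^ 3))) (third-share n)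
      where
      regroup : ∀ x y → x ℕ.* (y ℕ.* 2) ≡ 2 ℕ.* (x ℕ.* y)
      regroup = solve-∀

    first-step : crossings ≋ (λ n → 8 ℕ.* (Horizontal n ℕ.+ Nested n))
    first-step = 20 , λ n → ≈-weaken (ℕₚ.≤-reflexive (≡.cong (20 ℕ.*_) (ℕₚ.*-comm (n ^ 3) (n ^ 4))))
      (decompose₁ n (n ^ 4) (H n) (H-swap n) (H-exchange n) (H-diagonal n) (H-bound n) (H-disjoint n))

    𝕊-sum : ∀ n f g h k →
      𝕊 n (λ a b c d → 2 ℕ.* ((f a b c d ℕ.+ g a b c d) ℕ.+ (h a b c d ℕ.+ k a b c d))) ≡
      2 ℕ.* ((𝕊 n f ℕ.+ 𝕊 n g) ℕ.+ (𝕊 n h ℕ.+ 𝕊 n k))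
    𝕊-sum n f g h k = ≡.trans (∑⁴-cong n λ a b c d → distribute ⟦ Sorted a b c d ⟧ (f a b c d) (g a b c d) (h a b c d) (k a b c d))
      (≡.trans (∑⁴-*ˡ n 2 _) (≡.cong (2 ℕ.*_) (≡.trans (∑⁴-+ n _ _) (≡.cong₂ ℕ._+_ (∑⁴-+ n _ _) (∑⁴-+ n _ _)))))
      where
      distribute : ∀ s f g h k → s ℕ.* (2 ℕ.* ((f ℕ.+ g) ℕ.+ (h ℕ.+ k))) ≡ 2 ℕ.* ((s ℕ.* f ℕ.+ s ℕ.* g) ℕ.+ (s ℕ.* h ℕ.+ s ℕ.* k))
      distribute = solve-∀

    eightfold : ∀ x y → x ℕ.* (8 ℕ.* y) ≡ 8 ℕ.* (x ℕ.* y)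
    eightfold = solve-∀

    horizontal-step : Horizontal ≋ λ n → 2 ℕ.* ((𝔾𝔾 n slopes ℕ.+ one-third n) ℕ.+ (one-third n ℕ.+ 0))
    horizontal-step = 8 , λ n → ≈-resp ≡.refl (≡.trans (𝕊-sum n _ _ _ _) (≡.cong (2 ℕ.*_)
        (≡.cong₂ ℕ._+_ (≡.cong₂ ℕ._+_ (PRQS-PRQS-count n) (PRQS-PRSQ-count n))
                       (≡.cong₂ ℕ._+_ (PRQS-RPQS-count n) (PRQS-RPSQ-count n)))))
      (≈-weaken (ℕₚ.≤-reflexive (eightfold (n ^ 4) (n ^ 3)))
        (𝕊-≈ n (8 ℕ.* n ^ 3) λ a b c d (a<b , b<c , c<d) →
          vertical n a c b d (ℕₚ.<-trans a<b b<c) (ℕₚ.<-trans b<c c<d)))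

    nested-step : Nested ≋ λ n → 2 ℕ.* ((one-third n ℕ.+ 𝔾𝔾 n medians) ℕ.+ (W² n ℕ.+ one-third n))
    nested-step = 8 , λ n → ≈-resp ≡.refl (≡.trans (𝕊-sum n _ _ _ _) (≡.cong (2 ℕ.*_)
        (≡.cong₂ ℕ._+_ (≡.cong₂ ℕ._+_ (PRSQ-PRQS-count n) (PRSQ-PRSQ-count n))
                       (≡.cong₂ ℕ._+_ (PRSQ-RPQS-count n) (PRSQ-RPSQ-count n)))))
      (≈-weaken (ℕₚ.≤-reflexive (eightfold (n ^ 4) (n ^ 3)))
        (𝕊-≈ n (8 ℕ.* n ^ 3) λ a b c d (a<b , b<c , c<d) →
          vertical n a d b c (ℕₚ.<-trans a<b (ℕₚ.<-trans b<c c<d)) b<c))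

    W²-≋ : (λ n → 576 ℕ.* W² n) ≋ (λ n → n ^ 4 ℕ.* n ^ 4)
    W²-≋ = ≋-trans (≋-of-≡ λ n → ≡.trans (≡.cong (576 ℕ.*_) (𝔾𝔾-one n)) (regroup (total n))) (square-≋ total-≈)
      where
      regroup : ∀ w → 576 ℕ.* (w ℕ.* w) ≡ 24 ℕ.* w ℕ.* (24 ℕ.* w)
      regroup = solve-∀

  -- The two steps give 16(s + 4t + m + w), where 3s, 3t and 3m are each asymptotic to w; this is
  -- 48w. The factor 12 makes it 576w = 24²w, the square of what `total-≈` evaluates.
  crossings-≋ : (λ n → 12 ℕ.* crossings n) ≋ (λ n → n ^ 4 ℕ.* n ^ 4)
  crossings-≋ = ≋-trans (≋-*ˡ 12 (≋-trans first-step (≋-*ˡ 8 (≋-+ horizontal-step nested-step))))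
    (≋-trans (≋-of-≡ λ n → expand (𝔾𝔾 n slopes) (one-third n) (𝔾𝔾 n medians) (W² n))
    (≋-trans (≋-*ˡ 64 (≋-+ (≋-+ slopes-≋ medians-≋) (≋-+ (≋-*ˡ 4 share-≋) (≋-of-≡ λ n → ≡.refl))))
    (≋-trans (≋-of-≡ λ n → total-weight (W² n)) W²-≋)))
    where
    expand : ∀ s t m w → 12 ℕ.* (8 ℕ.* (2 ℕ.* ((s ℕ.+ t) ℕ.+ (t ℕ.+ 0)) ℕ.+ 2 ℕ.* ((t ℕ.+ m) ℕ.+ (w ℕ.+ t)))) ≡
      64 ℕ.* ((3 ℕ.* s ℕ.+ 3 ℕ.* m) ℕ.+ (4 ℕ.* (3 ℕ.* t) ℕ.+ 3 ℕ.* w))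
    expand = solve-∀
    total-weight : ∀ w → 64 ℕ.* ((w ℕ.+ w) ℕ.+ (4 ℕ.* w ℕ.+ 3 ℕ.* w)) ≡ 576 ℕ.* w
    total-weight = solve-∀

  someCrossings : ℕ → ℕ
  someCrossings n = ∑⁴ n λ p q r s → ∑⁴ n λ P Q R S → ⟦ SomeGridCross p q r s P Q R S ⟧

  -- Exclusiveness turns the disjunction into a sum, and relabelling the points in both coordinates
  -- shows the three pairings equally frequent; so 12 drops to 4.
  someCrossings-≋ : (λ n → 4 ℕ.* someCrossings n) ≋ (λ n → n ^ 4 ℕ.* n ^ 4)
  someCrossings-≋ = ≋-trans (≋-of-≡ λ n → ≡.trans (≡.cong (4 ℕ.*_) (thrice n)) (regroup (crossings n))) crossings-≋
    where
    regroup : ∀ c → 4 ℕ.* (c ℕ.+ (c ℕ.+ c)) ≡ 12 ℕ.* c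
    regroup = solve-∀

    pointwise : ∀ P Q R S → ⟦ SomeMonoCross P Q R S ⟧ ≡
      ⟦ MonoCross P Q R S ⟧ ℕ.+ (⟦ MonoCross P R Q S ⟧ ℕ.+ ⟦ MonoCross P S Q R ⟧)
    pointwise P Q R S = ≡.trans
      (⟦⟧-disjoint λ { (x , inj₁ y) → monoCross-exclusive P Q R S (x , y)
                     ; (x , inj₂ y) → monoCross-exclusive₃ P Q R S (x , y) })
      (≡.cong (⟦ MonoCross P Q R S ⟧ ℕ.+_) (⟦⟧-disjoint λ (x , y) →
        monoCross-exclusive₃ P R Q S (x , monoCross-swapʳ P S Q R y)))

    thrice : ∀ n → someCrossings n ≡ crossings n ℕ.+ (crossings n ℕ.+ crossings n)
    thrice n = ≡.trans (∑⁴-cong n λ p q r s → ≡.trans (∑⁴-cong n λ P Q R S → pointwise _ _ _ _)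
        (≡.trans (∑⁴-+ n _ _) (≡.cong (H n p q r s ℕ.+_) (∑⁴-+ n _ _))))
      (≡.trans (∑⁴-+ n _ _) (≡.cong (crossings n ℕ.+_) (≡.trans (∑⁴-+ n _ _) (≡.cong₂ ℕ._+_
        (≡.trans (∑⁴-swap₂₃ n _) (∑⁴-cong n λ p q r s → ∑⁴-swap₂₃ n _))
        (≡.trans (∑⁴-swap₃₄ n _) (≡.trans (∑⁴-swap₂₃ n _)
          (∑⁴-cong n λ p q r s → ≡.trans (∑⁴-swap₃₄ n _) (∑⁴-swap₂₃ n _))))))))

-- Crossing segments and sign conditions

module Segments (ℝ : CompleteOrderedField) where
  open CompleteOrderedField ℝ hiding (zero)
  open IntegerRingSolver ℝ
  open FieldProperties ℝ
  open Plane ℝ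
  open Orientation ℝ

  interior-sym : ∀ P Q {z} → Interior P Q z → Interior Q P z
  interior-sym (px , py) (qx , qy) (t , 0<t , t<1 , x , y) =
    1# - t , sub-pos t<1 , pos-sub (pos-resp (solve 1 (λ t → t := :1 ⊖ (:1 ⊖ t)) refl t) 0<t) ,
    trans x (flip px qx) , trans y (flip py qy)
    where
    flip : ∀ p q → p + t * (q - p) ≈ q + (1# - t) * (p - q)
    flip p q = solve 3 (λ t p q → p ⊕ t ⊗ (q ⊖ p) := q ⊕ (:1 ⊖ t) ⊗ (p ⊖ q)) refl t p q

  -- The determinant of the two directions, zero for parallel edges. `orient P R S` is its special
  -- case `det P R P S`, the form it takes in the solver calls below.
  det : Point → Point → Point → Point → Carrier
  det (px , py) (qx , qy) (rx , ry) (sx , sy) = (qx - px) * (sy - ry) - (qy - py) * (sx - rx)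

  private
    :det : ∀ {n} → Expr ℤ n × Expr ℤ n → Expr ℤ n × Expr ℤ n → Expr ℤ n × Expr ℤ n → Expr ℤ n × Expr ℤ n → Expr ℤ n
    :det (px , py) (qx , qy) (rx , ry) (sx , sy) = (qx ⊖ px) ⊗ (sy ⊖ ry) ⊖ (qy ⊖ py) ⊗ (sx ⊖ rx)

    det-PRS : ∀ P Q R S → det P Q R S ≈ orient P R S - orient Q R S
    det-PRS (px , py) (qx , qy) (rx , ry) (sx , sy) = solve 8 (λ px py qx qy rx ry sx sy →
      :det (px , py) (qx , qy) (rx , ry) (sx , sy) :=
      :det (px , py) (rx , ry) (px , py) (sx , sy) ⊖ :det (qx , qy) (rx , ry) (qx , qy) (sx , sy))
      refl px py qx qy rx ry sx sy

    det-PQS : ∀ P Q R S → det P Q R S ≈ orient P Q S - orient P Q R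
    det-PQS (px , py) (qx , qy) (rx , ry) (sx , sy) = solve 8 (λ px py qx qy rx ry sx sy →
      :det (px , py) (qx , qy) (rx , ry) (sx , sy) :=
      :det (px , py) (qx , qy) (px , py) (sx , sy) ⊖ :det (px , py) (qx , qy) (px , py) (rx , ry))
      refl px py qx qy rx ry sx sy

    *-zero-cong : ∀ {x y z w} → x ≈ 0# → y ≈ 0# → x * z - y * w ≈ 0#
    *-zero-cong {z = z} {w} e f = trans (+-cong (trans (*-congʳ e) (zeroˡ z)) (-‿cong (trans (*-congʳ f) (zeroˡ w)))) (-‿inverseʳ 0#)

  -- Cramer's rule for t (Q − P) − s (S − R) = R − P.
  module _ (P Q R S : Point) {t s : Carrier}
           (ex : (proj₁ P + t * (proj₁ Q - proj₁ P)) ≈ proj₁ R + s * (proj₁ S - proj₁ R))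
           (ey : (proj₂ P + t * (proj₂ Q - proj₂ P)) ≈ proj₂ R + s * (proj₂ S - proj₂ R)) where
    private
      px = proj₁ P
      py = proj₂ P
      qx = proj₁ Q
      qy = proj₂ Q
      rx = proj₁ R
      ry = proj₂ R
      sx = proj₁ S
      sy = proj₂ S

      gap : ∀ {a b} → a ≈ b → b - a ≈ 0#
      gap {a} {b} e = trans (+-congˡ (-‿cong e)) (-‿inverseʳ b)

    cramer₁ : orient P R S ≈ t * det P Q R S
    cramer₁ = sym (sub-zero (trans (solve 10 (λ px py qx qy rx ry sx sy t s →
      :det (px , py) (rx , ry) (px , py) (sx , sy) ⊖ t ⊗ :det (px , py) (qx , qy) (rx , ry) (sx , sy) :=
      ((rx ⊕ s ⊗ (sx ⊖ rx)) ⊖ (px ⊕ t ⊗ (qx ⊖ px))) ⊗ (sy ⊖ ry) ⊖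
      ((ry ⊕ s ⊗ (sy ⊖ ry)) ⊖ (py ⊕ t ⊗ (qy ⊖ py))) ⊗ (sx ⊖ rx)) refl px py qx qy rx ry sx sy t s)
      (*-zero-cong (gap ex) (gap ey))))

    cramer₂ : - orient P Q R ≈ s * det P Q R S
    cramer₂ = sym (sub-zero (trans (solve 10 (λ px py qx qy rx ry sx sy t s →
      ⊝ :det (px , py) (qx , qy) (px , py) (rx , ry) ⊖ s ⊗ :det (px , py) (qx , qy) (rx , ry) (sx , sy) :=
      ((rx ⊕ s ⊗ (sx ⊖ rx)) ⊖ (px ⊕ t ⊗ (qx ⊖ px))) ⊗ (qy ⊖ py) ⊖
      ((ry ⊕ s ⊗ (sy ⊖ ry)) ⊖ (py ⊕ t ⊗ (qy ⊖ py))) ⊗ (qx ⊖ px)) refl px py qx qy rx ry sx sy t s)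
      (*-zero-cong (gap ex) (gap ey))))

  square-pos : ∀ {x} → ¬ (x ≈ 0#) → 0# < x * x
  square-pos {x} x≉0 with sign x
  ... | positive p = *-pos p p
  ... | negative p = neg-*-neg p p
  ... | null e     = ⊥-elim (x≉0 e)

  square-nonneg : ∀ x → 0# ≤ x * x
  square-nonneg x with sign x
  ... | positive p = inj₁ (*-pos p p)
  ... | negative p = inj₁ (neg-*-neg p p)
  ... | null e     = inj₂ (sym (trans (*-congʳ e) (zeroˡ x)))

  -- Cramer's rule gives -α = sD, β = (1 - s)D, γ = tD and -δ = (1 - t)D, hence -αβ = s(1 - s)D² and
  -- -γδ = t(1 - t)D².
  cross⇒proper : ∀ P Q R S → ¬ (det P Q R S ≈ 0#) → Interior P Q ≬ Interior R S → ProperCrossing P Q R S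
  cross⇒proper P Q R S D≉0 (z , (t , 0<t , t<1 , tx , ty) , (s , 0<s , s<1 , sx , sy)) =
    pos-resp eq₁ (*-pos (*-pos 0<s (sub-pos s<1)) (square-pos D≉0)) ,
    pos-resp eq₂ (*-pos (*-pos 0<t (sub-pos t<1)) (square-pos D≉0))
    where
    D = det P Q R S
    ex = trans (sym tx) sx
    ey = trans (sym ty) sy
    α = orient P Q R
    β = orient P Q S
    γ = orient P R S
    δ = orient Q R S
    β≈ : β ≈ (1# - s) * D
    β≈ = trans (solve 2 (λ α β → β := (β ⊖ α) ⊖ (⊝ α)) refl α β)
      (trans (+-cong (sym (det-PQS P Q R S)) (-‿cong (cramer₂ P Q R S ex ey)))
        (solve 2 (λ s D → D ⊖ s ⊗ D := (:1 ⊖ s) ⊗ D) refl s D))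
    -δ≈ : - δ ≈ (1# - t) * D
    -δ≈ = trans (solve 2 (λ γ δ → ⊝ δ := (γ ⊖ δ) ⊖ γ) refl γ δ)
      (trans (+-cong (sym (det-PRS P Q R S)) (-‿cong (cramer₁ P Q R S ex ey)))
        (solve 2 (λ s D → D ⊖ s ⊗ D := (:1 ⊖ s) ⊗ D) refl t D))
    eq₁ : s * (1# - s) * (D * D) ≈ - (α * β)
    eq₁ = trans (solve 3 (λ s s′ D → s ⊗ s′ ⊗ (D ⊗ D) := (s ⊗ D) ⊗ (s′ ⊗ D)) refl s (1# - s) D)
      (trans (*-cong (sym (cramer₂ P Q R S ex ey)) (sym β≈)) (solve 2 (λ α β → ⊝ α ⊗ β := ⊝ (α ⊗ β)) refl α β))
    eq₂ : t * (1# - t) * (D * D) ≈ - (γ * δ)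
    eq₂ = trans (solve 3 (λ s s′ D → s ⊗ s′ ⊗ (D ⊗ D) := (s ⊗ D) ⊗ (s′ ⊗ D)) refl t (1# - t) D)
      (trans (*-cong (sym (cramer₁ P Q R S ex ey)) (sym -δ≈)) (solve 2 (λ α β → α ⊗ ⊝ β := ⊝ (α ⊗ β)) refl γ δ))

  parallel⇒collinear : ∀ P Q R S → det P Q R S ≈ 0# → Interior P Q ≬ Interior R S → orient P Q R ≈ 0#
  parallel⇒collinear P Q R S D≈0 (z , (t , 0<t , t<1 , tx , ty) , (s , 0<s , s<1 , sx , sy)) =
    trans (solve 1 (λ x → x := ⊝ (⊝ x)) refl (orient P Q R))
      (trans (-‿cong (trans (cramer₂ P Q R S (trans (sym tx) sx) (trans (sym ty) sy)) (trans (*-congˡ D≈0) (zeroʳ s))))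
        (solve 0 (⊝ :0 := :0) refl))

  crossing-lines : ∀ P Q R S → ¬ (orient P Q R ≈ 0#) → Interior P Q ≬ Interior R S → ProperCrossing P Q R S
  crossing-lines P Q R S n c = cross⇒proper P Q R S (λ e → n (parallel⇒collinear P Q R S e c)) c

  -- `det P Q P R` is `orient P Q R`, so a common interior point would come from a proper crossing;
  -- but the end point P lies on the line PQ.
  fan : ∀ P Q R → ¬ (orient P Q R ≈ 0#) → ¬ (Interior P Q ≬ Interior P R)
  fan P Q R n c = neg⇒≉0 (proj₁ (cross⇒proper P Q P R n c))
    (trans (*-congʳ (solve 4 (λ px py qx qy → :det (px , py) (qx , qy) (px , py) (px , py) := :0) refl
      (proj₁ P) (proj₂ P) (proj₁ Q) (proj₂ Q))) (zeroˡ _))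

  proper⇒cross : ∀ P Q R S → ProperCrossing P Q R S → Interior P Q ≬ Interior R S
  proper⇒cross P@(px , py) Q@(qx , qy) R@(rx , ry) S@(sx , sy) (c₁ , c₂) =
    (px + t * (qx - px) , py + t * (qy - py)) ,
    (t , 0<t , pos-sub 0<1-t , refl , refl) ,
    (s , 0<s , pos-sub 0<1-s , meet ex , meet ey)
    where
    D = det P Q R S
    α = orient P Q R
    β = orient P Q S
    γ = orient P R S
    δ = orient Q R S
    -- Cramer's rule read backwards. From D = γ - δ = β - α follow γD = γ² - γδ > 0 and its three
    -- analogues, which place both parameters between 0 and 1.
    t = γ * D ⁻¹
    s = (- α) * D ⁻¹
    0<γD : 0# < γ * D
    0<γD = pos-resp (trans (solve 2 (λ γ δ → ⊝ (γ ⊗ δ) ⊕ γ ⊗ γ := γ ⊗ (γ ⊖ δ)) refl γ δ) (*-congˡ (sym (det-PRS P Q R S))))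
      (+-pos-nonneg c₂ (square-nonneg γ))
    0<-δD : 0# < - δ * D
    0<-δD = pos-resp (trans (solve 2 (λ γ δ → ⊝ (γ ⊗ δ) ⊕ δ ⊗ δ := ⊝ δ ⊗ (γ ⊖ δ)) refl γ δ) (*-congˡ (sym (det-PRS P Q R S))))
      (+-pos-nonneg c₂ (square-nonneg δ))
    0<-αD : 0# < - α * D
    0<-αD = pos-resp (trans (solve 2 (λ α β → ⊝ (α ⊗ β) ⊕ α ⊗ α := ⊝ α ⊗ (β ⊖ α)) refl α β) (*-congˡ (sym (det-PQS P Q R S))))
      (+-pos-nonneg c₁ (square-nonneg α))
    0<βD : 0# < β * D
    0<βD = pos-resp (trans (solve 2 (λ α β → ⊝ (α ⊗ β) ⊕ β ⊗ β := β ⊗ (β ⊖ α)) refl α β) (*-congˡ (sym (det-PQS P Q R S))))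
      (+-pos-nonneg c₁ (square-nonneg β))
    D≉0 : ¬ (D ≈ 0#)
    D≉0 e = pos⇒≉0 0<γD (trans (*-congˡ e) (zeroʳ γ))
    Dt≈ : D * t ≈ γ
    Dt≈ = /-cancel γ D≉0
    Ds≈ : D * s ≈ - α
    Ds≈ = /-cancel (- α) D≉0
    D²-cancel : ∀ {x y} → D * x ≈ y → 0# < y * D → 0# < x
    D²-cancel {x} e p = *-cancel-pos (pos-resp (trans (*-congʳ (sym e))
      (solve 2 (λ D x → D ⊗ x ⊗ D := D ⊗ D ⊗ x) refl D x)) p) (square-pos D≉0)
    0<t : 0# < t
    0<t = D²-cancel Dt≈ 0<γD
    0<s : 0# < s
    0<s = D²-cancel Ds≈ 0<-αD
    0<1-t : 0# < 1# - t
    0<1-t = D²-cancel (trans (solve 2 (λ D t → D ⊗ (:1 ⊖ t) := D ⊖ D ⊗ t) refl D t)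
      (trans (+-cong (det-PRS P Q R S) (-‿cong Dt≈)) (solve 2 (λ γ δ → γ ⊖ δ ⊖ γ := ⊝ δ) refl γ δ))) 0<-δD
    0<1-s : 0# < 1# - s
    0<1-s = D²-cancel (trans (solve 2 (λ D t → D ⊗ (:1 ⊖ t) := D ⊖ D ⊗ t) refl D s)
      (trans (+-cong (det-PQS P Q R S) (-‿cong Ds≈)) (solve 2 (λ α β → β ⊖ α ⊖ ⊝ α := β) refl α β))) 0<βD
    meet : ∀ {p q r w} → D * p + γ * (q - p) ≈ D * r + - α * (w - r) → p + t * (q - p) ≈ r + s * (w - r)
    meet {p} {q} {r} {w} e = sym (sub-zero (zero-product (trans
      (solve 7 (λ D t s p q r w → D ⊗ (p ⊕ t ⊗ (q ⊖ p) ⊖ (r ⊕ s ⊗ (w ⊖ r))) :=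
        D ⊗ p ⊕ D ⊗ t ⊗ (q ⊖ p) ⊖ (D ⊗ r ⊕ D ⊗ s ⊗ (w ⊖ r))) refl D t s p q r w)
      (trans (+-cong (+-congˡ (*-congʳ Dt≈)) (-‿cong (+-congˡ (*-congʳ Ds≈))))
        (trans (+-congʳ e) (-‿inverseʳ _)))) D≉0))
    ex : D * px + γ * (qx - px) ≈ D * rx + - α * (sx - rx)
    ex = solve 8 (λ px py qx qy rx ry sx sy →
      :det (px , py) (qx , qy) (rx , ry) (sx , sy) ⊗ px ⊕ :det (px , py) (rx , ry) (px , py) (sx , sy) ⊗ (qx ⊖ px) :=
      :det (px , py) (qx , qy) (rx , ry) (sx , sy) ⊗ rx ⊕ ⊝ :det (px , py) (qx , qy) (px , py) (rx , ry) ⊗ (sx ⊖ rx))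
      refl px py qx qy rx ry sx sy
    ey : D * py + γ * (qy - py) ≈ D * ry + - α * (sy - ry)
    ey = solve 8 (λ px py qx qy rx ry sx sy →
      :det (px , py) (qx , qy) (rx , ry) (sx , sy) ⊗ py ⊕ :det (px , py) (rx , ry) (px , py) (sx , sy) ⊗ (qy ⊖ py) :=
      :det (px , py) (qx , qy) (rx , ry) (sx , sy) ⊗ ry ⊕ ⊝ :det (px , py) (qx , qy) (px , py) (rx , ry) ⊗ (sy ⊖ ry))
      refl px py qx qy rx ry sx sy

  private
    slope-rise : ∀ P Q → ¬ (proj₁ P ≈ proj₁ Q) → let dx = proj₁ Q - proj₁ P in
      (dx * dx) * ((proj₂ Q - proj₂ P) * dx ⁻¹) ≈ rise P Q
    slope-rise P Q n = trans (*-assoc _ _ _) (*-congˡ (/-cancel _ (n ∘ sub-zero)))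

  positiveSlope⇒rising : ∀ P Q → PositiveSlope P Q → 0# < rise P Q
  positiveSlope⇒rising P Q (n , p) = pos-resp (slope-rise P Q n) (*-pos (square-pos (n ∘ sub-zero)) p)

  rising⇒positiveSlope : ∀ P Q → 0# < rise P Q → PositiveSlope P Q
  rising⇒positiveSlope P Q p = n ,
    *-cancel-pos (pos-resp (sym (slope-rise P Q n)) p) (square-pos (n ∘ sub-zero))
    where
    n : ¬ (proj₁ P ≈ proj₁ Q)
    n e = pos⇒≉0 p (trans (*-congʳ (trans (+-congˡ (-‿cong e)) (-‿inverseʳ _))) (zeroˡ _))

  mono⇒colours : ∀ P Q R S → Monochromatic P Q R S → ∃[ c ] HasColour c P Q × HasColour c R S
  mono⇒colours P Q R S m with *-pos⇒sameSign m
  ... | both-positive p q = red , rising⇒positiveSlope P Q p , rising⇒positiveSlope R S q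
  ... | both-negative p q = blue , (λ r → ¬pos-neg (positiveSlope⇒rising P Q r) p) , (λ r → ¬pos-neg (positiveSlope⇒rising R S r) q)

  colours⇒mono : ∀ P Q R S → ¬ (rise P Q ≈ 0#) → ¬ (rise R S ≈ 0#) →
    ∃[ c ] HasColour c P Q × HasColour c R S → Monochromatic P Q R S
  colours⇒mono P Q R S _ _ (red , p , q) = *-pos (positiveSlope⇒rising P Q p) (positiveSlope⇒rising R S q)
  colours⇒mono P Q R S m n (blue , p , q) = neg-*-neg (falling P Q m p) (falling R S n q)
    where
    falling : ∀ P Q → ¬ (rise P Q ≈ 0#) → ¬ PositiveSlope P Q → 0# < - rise P Q
    falling P Q m p with sign (rise P Q)
    ... | positive q = ⊥-elim (p (rising⇒positiveSlope P Q q))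
    ... | null e     = ⊥-elim (m e)
    ... | negative q = q

  -- Besides collinear triples, axis-parallel edges are ruled out: such an edge is blue although its
  -- rise is not negative.
  record GeneralPosition (P Q R S : Point) : Set where
    field
      PQR : ¬ (orient P Q R ≈ 0#)
      PQS : ¬ (orient P Q S ≈ 0#)
      PRS : ¬ (orient P R S ≈ 0#)
      QRS : ¬ (orient Q R S ≈ 0#)
      PQ  : ¬ (rise P Q ≈ 0#)
      PR  : ¬ (rise P R ≈ 0#)
      PS  : ¬ (rise P S ≈ 0#)
      QR  : ¬ (rise Q R ≈ 0#)
      QS  : ¬ (rise Q S ≈ 0#)
      RS  : ¬ (rise R S ≈ 0#)

  private
    ≬-sym : ∀ {P Q R S} → Interior P Q ≬ Interior R S → Interior R S ≬ Interior P Q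
    ≬-sym (z , p , q) = z , q , p

    module Triangle (P Q R : Point) (n : ¬ (orient P Q R ≈ 0#)) where
      PQ-PR : ¬ (Interior P Q ≬ Interior P R)
      PQ-PR = fan P Q R n

      PQ-QR : ¬ (Interior P Q ≬ Interior Q R)
      PQ-QR (z , p , q) = fan Q R P (λ e → n (trans (sym (orient-rotate P Q R)) e)) (z , q , interior-sym P Q p)

      PR-QR : ¬ (Interior P R ≬ Interior Q R)
      PR-QR (z , p , q) = fan R P Q (λ e → n (trans (orient-rotate R P Q) e))
        (z , interior-sym P R p , interior-sym Q R q)

    data View : Edge 4 → Set where
      e01 : View (0F , 1F , s≤s z≤n)
      e02 : View (0F , 2F , s≤s z≤n)
      e03 : View (0F , 3F , s≤s z≤n)
      e12 : View (1F , 2F , s≤s (s≤s z≤n))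
      e13 : View (1F , 3F , s≤s (s≤s z≤n))
      e23 : View (2F , 3F , s≤s (s≤s (s≤s z≤n)))

    view : ∀ e → View e
    view (0F , 1F , s≤s z≤n)             = e01
    view (0F , 2F , s≤s z≤n)             = e02
    view (0F , 3F , s≤s z≤n)             = e03
    view (1F , 2F , s≤s (s≤s z≤n))       = e12
    view (1F , 3F , s≤s (s≤s z≤n))       = e13
    view (2F , 3F , s≤s (s≤s (s≤s z≤n))) = e23
    view (1F , 1F , s≤s ())
    view (2F , 1F , s≤s ())
    view (2F , 2F , s≤s (s≤s ()))
    view (3F , 1F , s≤s ())
    view (3F , 2F , s≤s (s≤s ()))
    view (3F , 3F , s≤s (s≤s (s≤s ())))

  module _ (p : Vector Point 4) where
    private
      P = p 0F
      Q = p 1F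
      R = p 2F
      S = p 3F

    someMonoCross⇒ : SomeMonoCross P Q R S → HasMonochromaticCrossing p
    someMonoCross⇒ (inj₁ (c , m)) =
      (0F , 1F , s≤s z≤n) , (2F , 3F , s≤s (s≤s (s≤s z≤n))) , (λ ()) , proper⇒cross P Q R S c , mono⇒colours P Q R S m
    someMonoCross⇒ (inj₂ (inj₁ (c , m))) =
      (0F , 2F , s≤s z≤n) , (1F , 3F , s≤s (s≤s z≤n)) , (λ ()) , proper⇒cross P R Q S c , mono⇒colours P R Q S m
    someMonoCross⇒ (inj₂ (inj₂ (c , m))) =
      (0F , 3F , s≤s z≤n) , (1F , 2F , s≤s (s≤s z≤n)) , (λ ()) , proper⇒cross P S Q R c , mono⇒colours P S Q R m

    ⇒someMonoCross : GeneralPosition P Q R S → HasMonochromaticCrossing p → SomeMonoCross P Q R S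
    ⇒someMonoCross gp (e , f , e≢f , c , m) = go (view e) (view f) e≢f c m
      where
      open GeneralPosition gp
      module PQR△ = Triangle P Q R PQR
      module PQS△ = Triangle P Q S PQS
      module PRS△ = Triangle P R S PRS
      module QRS△ = Triangle Q R S QRS

      first : Interior P Q ≬ Interior R S → ∃[ k ] HasColour k P Q × HasColour k R S → SomeMonoCross P Q R S
      first c m = inj₁ (crossing-lines P Q R S PQR c , colours⇒mono P Q R S PQ RS m)

      flipped : ∀ P Q R → ¬ (orient P Q R ≈ 0#) → ¬ (orient P R Q ≈ 0#)
      flipped P Q R n e = n (trans (orient-flip P R Q) (trans (-‿cong e) (solve 0 (⊝ :0 := :0) refl)))

      second : Interior P R ≬ Interior Q S → ∃[ k ] HasColour k P R × HasColour k Q S → SomeMonoCross P Q R S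
      second c m = inj₂ (inj₁ (crossing-lines P R Q S (flipped P Q R PQR) c , colours⇒mono P R Q S PR QS m))

      third : Interior P S ≬ Interior Q R → ∃[ k ] HasColour k P S × HasColour k Q R → SomeMonoCross P Q R S
      third c m = inj₂ (inj₂ (crossing-lines P S Q R (flipped P Q S PQS) c , colours⇒mono P S Q R PS QR m))

      colour-sym : ∀ {A B C D} → ∃[ k ] HasColour k A B × HasColour k C D → ∃[ k ] HasColour k C D × HasColour k A B
      colour-sym (k , x , y) = k , y , x

      -- Of the 36 ordered pairs of edges, 6 are disjoint, 6 are equal, and 24 share one vertex and
      -- so belong to a nondegenerate triangle.
      go : ∀ {e f} → View e → View f → e ≢ f → Cross p e f → SameColour p e f → SomeMonoCross P Q R S
      go e01 e23 _ c m = first c m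
      go e23 e01 _ c m = first (≬-sym {R} {S} {P} {Q} c) (colour-sym {R} {S} {P} {Q} m)
      go e02 e13 _ c m = second c m
      go e13 e02 _ c m = second (≬-sym {Q} {S} {P} {R} c) (colour-sym {Q} {S} {P} {R} m)
      go e03 e12 _ c m = third c m
      go e12 e03 _ c m = third (≬-sym {Q} {R} {P} {S} c) (colour-sym {Q} {R} {P} {S} m)
      go e01 e01 n _ _ = ⊥-elim (n ≡.refl)
      go e02 e02 n _ _ = ⊥-elim (n ≡.refl)
      go e03 e03 n _ _ = ⊥-elim (n ≡.refl)
      go e12 e12 n _ _ = ⊥-elim (n ≡.refl)
      go e13 e13 n _ _ = ⊥-elim (n ≡.refl)
      go e23 e23 n _ _ = ⊥-elim (n ≡.refl)
      go e01 e02 _ c _ = ⊥-elim (PQR△.PQ-PR c)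
      go e02 e01 _ c _ = ⊥-elim (PQR△.PQ-PR (≬-sym {P} {R} {P} {Q} c))
      go e01 e12 _ c _ = ⊥-elim (PQR△.PQ-QR c)
      go e12 e01 _ c _ = ⊥-elim (PQR△.PQ-QR (≬-sym {Q} {R} {P} {Q} c))
      go e02 e12 _ c _ = ⊥-elim (PQR△.PR-QR c)
      go e12 e02 _ c _ = ⊥-elim (PQR△.PR-QR (≬-sym {Q} {R} {P} {R} c))
      go e01 e03 _ c _ = ⊥-elim (PQS△.PQ-PR c)
      go e03 e01 _ c _ = ⊥-elim (PQS△.PQ-PR (≬-sym {P} {S} {P} {Q} c))
      go e01 e13 _ c _ = ⊥-elim (PQS△.PQ-QR c)
      go e13 e01 _ c _ = ⊥-elim (PQS△.PQ-QR (≬-sym {Q} {S} {P} {Q} c))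
      go e03 e13 _ c _ = ⊥-elim (PQS△.PR-QR c)
      go e13 e03 _ c _ = ⊥-elim (PQS△.PR-QR (≬-sym {Q} {S} {P} {S} c))
      go e02 e03 _ c _ = ⊥-elim (PRS△.PQ-PR c)
      go e03 e02 _ c _ = ⊥-elim (PRS△.PQ-PR (≬-sym {P} {S} {P} {R} c))
      go e02 e23 _ c _ = ⊥-elim (PRS△.PQ-QR c)
      go e23 e02 _ c _ = ⊥-elim (PRS△.PQ-QR (≬-sym {R} {S} {P} {R} c))
      go e03 e23 _ c _ = ⊥-elim (PRS△.PR-QR c)
      go e23 e03 _ c _ = ⊥-elim (PRS△.PR-QR (≬-sym {R} {S} {P} {S} c))
      go e12 e13 _ c _ = ⊥-elim (QRS△.PQ-PR c)
      go e13 e12 _ c _ = ⊥-elim (QRS△.PQ-PR (≬-sym {Q} {S} {Q} {R} c))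
      go e12 e23 _ c _ = ⊥-elim (QRS△.PQ-QR c)
      go e23 e12 _ c _ = ⊥-elim (QRS△.PQ-QR (≬-sym {R} {S} {Q} {R} c))
      go e13 e23 _ c _ = ⊥-elim (QRS△.PR-QR c)
      go e23 e13 _ c _ = ⊥-elim (QRS△.PR-QR (≬-sym {R} {S} {Q} {S} c))

-- Quadruples with the same signs

module Agreement (ℝ : CompleteOrderedField) where
  open CompleteOrderedField ℝ hiding (zero)
  open IntegerRingSolver ℝ
  open FieldProperties ℝ
  open Plane ℝ using (Point; _≈ₚ_)
  open Orientation ℝ
  open Segments ℝ using (GeneralPosition)

  sameSign-* : ∀ {x y x′ y′} → SameSign x y → SameSign x′ y′ → SameSign (x * x′) (y * y′)
  sameSign-* (both-positive p q) (both-positive r s) = both-positive (*-pos p r) (*-pos q s)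
  sameSign-* (both-positive p q) (both-negative r s) = both-negative (pos-*-neg p r) (pos-*-neg q s)
  sameSign-* (both-negative p q) (both-positive r s) = both-negative (neg-*-pos p r) (neg-*-pos q s)
  sameSign-* (both-negative p q) (both-negative r s) = both-positive (neg-*-neg p r) (neg-*-neg q s)

  sameSign-sym : ∀ {x y} → SameSign x y → SameSign y x
  sameSign-sym (both-positive p q) = both-positive q p
  sameSign-sym (both-negative p q) = both-negative q p

  sameSign-neg : ∀ {x y} → SameSign x y → SameSign (- x) (- y)
  sameSign-neg (both-positive p q) = both-negative (neg-neg-pos p) (neg-neg-pos q)
  sameSign-neg (both-negative p q) = both-positive p q

  sameSign-cong : ∀ {x y x′ y′} → x ≈ x′ → y ≈ y′ → SameSign x y → SameSign x′ y′
  sameSign-cong e f (both-positive p q) = both-positive (pos-resp e p) (pos-resp f q)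
  sameSign-cong e f (both-negative p q) = both-negative (pos-resp (-‿cong e) p) (pos-resp (-‿cong f) q)

  sameSign-pos : ∀ {x y} → SameSign x y → 0# < x → 0# < y
  sameSign-pos (both-positive _ q) _ = q
  sameSign-pos (both-negative p _) r = ⊥-elim (¬pos-neg r p)

  sameSign-≉0 : ∀ {x y} → SameSign x y → ¬ (x ≈ 0#)
  sameSign-≉0 (both-positive p _) = pos⇒≉0 p
  sameSign-≉0 (both-negative p _) = neg⇒≉0 p

  -- Equality of order types and of the signs of all rises, hence of everything on which
  -- `SomeMonoCross` depends. As `SameSign` excludes 0, agreement also puts both quadruples in
  -- general position.
  record Agree (P Q R S P′ Q′ R′ S′ : Point) : Set where
    field
      PQR : SameSign (orient P Q R) (orient P′ Q′ R′)
      PQS : SameSign (orient P Q S) (orient P′ Q′ S′)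
      PRS : SameSign (orient P R S) (orient P′ R′ S′)
      QRS : SameSign (orient Q R S) (orient Q′ R′ S′)
      PQ  : SameSign (rise P Q) (rise P′ Q′)
      PR  : SameSign (rise P R) (rise P′ R′)
      PS  : SameSign (rise P S) (rise P′ S′)
      QR  : SameSign (rise Q R) (rise Q′ R′)
      QS  : SameSign (rise Q S) (rise Q′ S′)
      RS  : SameSign (rise R S) (rise R′ S′)

  agree-sym : ∀ {P Q R S P′ Q′ R′ S′} → Agree P Q R S P′ Q′ R′ S′ → Agree P′ Q′ R′ S′ P Q R S
  agree-sym a = record
    { PQR = sameSign-sym PQR ; PQS = sameSign-sym PQS ; PRS = sameSign-sym PRS ; QRS = sameSign-sym QRS
    ; PQ = sameSign-sym PQ ; PR = sameSign-sym PR ; PS = sameSign-sym PS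
    ; QR = sameSign-sym QR ; QS = sameSign-sym QS ; RS = sameSign-sym RS }
    where open Agree a

  agree⇒generalPosition : ∀ {P Q R S P′ Q′ R′ S′} → Agree P Q R S P′ Q′ R′ S′ → GeneralPosition P Q R S
  agree⇒generalPosition a = record
    { PQR = sameSign-≉0 PQR ; PQS = sameSign-≉0 PQS ; PRS = sameSign-≉0 PRS ; QRS = sameSign-≉0 QRS
    ; PQ = sameSign-≉0 PQ ; PR = sameSign-≉0 PR ; PS = sameSign-≉0 PS
    ; QR = sameSign-≉0 QR ; QS = sameSign-≉0 QS ; RS = sameSign-≉0 RS }
    where open Agree a

  private
    flip : ∀ {P Q R P′ Q′ R′} → SameSign (orient P Q R) (orient P′ Q′ R′) → SameSign (orient P R Q) (orient P′ R′ Q′)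
    flip s = sameSign-cong (sym (orient-flip _ _ _)) (sym (orient-flip _ _ _)) (sameSign-neg s)

    swap : ∀ {P Q R P′ Q′ R′} → SameSign (orient P Q R) (orient P′ Q′ R′) → SameSign (orient Q P R) (orient Q′ P′ R′)
    swap s = sameSign-cong (sym (orient-swap _ _ _)) (sym (orient-swap _ _ _)) (sameSign-neg s)

    rise-swap : ∀ {P Q P′ Q′} → SameSign (rise P Q) (rise P′ Q′) → SameSign (rise Q P) (rise Q′ P′)
    rise-swap s = sameSign-cong (rise-sym _ _) (rise-sym _ _) s

  agree-swap₂₃ : ∀ {P Q R S P′ Q′ R′ S′} → Agree P Q R S P′ Q′ R′ S′ → Agree P R Q S P′ R′ Q′ S′
  agree-swap₂₃ a = record
    { PQR = flip PQR ; PQS = PRS ; PRS = PQS ; QRS = swap QRS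
    ; PQ = PR ; PR = PQ ; PS = PS ; QR = rise-swap QR ; QS = RS ; RS = QS }
    where open Agree a

  agree-swap₃₄ : ∀ {P Q R S P′ Q′ R′ S′} → Agree P Q R S P′ Q′ R′ S′ → Agree P Q S R P′ Q′ S′ R′
  agree-swap₃₄ a = record
    { PQR = PQS ; PQS = PQR ; PRS = flip PRS ; QRS = flip QRS
    ; PQ = PQ ; PR = PS ; PS = PR ; QR = QS ; QS = QR ; RS = rise-swap RS }
    where open Agree a

  monoCross-agree : ∀ {P Q R S P′ Q′ R′ S′} → Agree P Q R S P′ Q′ R′ S′ →
    MonoCross P Q R S → MonoCross P′ Q′ R′ S′
  monoCross-agree a ((c₁ , c₂) , m) =
    (sameSign-pos (sameSign-neg (sameSign-* PQR PQS)) c₁ , sameSign-pos (sameSign-neg (sameSign-* PRS QRS)) c₂) ,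
    sameSign-pos (sameSign-* PQ RS) m
    where open Agree a

  someMonoCross-agree : ∀ {P Q R S P′ Q′ R′ S′} → Agree P Q R S P′ Q′ R′ S′ →
    SomeMonoCross P Q R S → SomeMonoCross P′ Q′ R′ S′
  someMonoCross-agree a (inj₁ c)        = inj₁ (monoCross-agree a c)
  someMonoCross-agree a (inj₂ (inj₁ c)) = inj₂ (inj₁ (monoCross-agree (agree-swap₂₃ a) c))
  someMonoCross-agree a (inj₂ (inj₂ c)) = inj₂ (inj₂ (monoCross-agree (agree-swap₂₃ (agree-swap₃₄ a)) c))

  Within : Carrier → Carrier → Set
  Within x b = (x ≤ b) × (- x ≤ b)

  within-neg : ∀ {x b} → Within x b → Within (- x) b
  within-neg {x} (u , l) = l , ≤-respˡ-≈ (solve 1 (λ x → x := ⊝ (⊝ x)) refl x) u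

  within-+ : ∀ {x y b c} → Within x b → Within y c → Within (x + y) (b + c)
  within-+ {x} {y} (u , l) (u′ , l′) = +-mono-≤ u u′ ,
    ≤-respˡ-≈ (solve 2 (λ x y → ⊝ x ⊕ ⊝ y := ⊝ (x ⊕ y)) refl x y) (+-mono-≤ l l′)

  private
    -- Because (b - x)(c + y) + (b + x)(c - y) = 2(bc - xy), without any case distinction on signs.
    product-bound : ∀ {x y b c} → Within x b → Within y c → x * y ≤ b * c
    product-bound {x} {y} {b} {c} (u , l) (u′ , l′) = nonneg-sub (double-nonneg (nonneg-resp
      (solve 4 (λ x y b c → (b ⊖ x) ⊗ (c ⊖ ⊝ y) ⊕ (b ⊖ ⊝ x) ⊗ (c ⊖ y) := (b ⊗ c ⊖ x ⊗ y) ⊕ (b ⊗ c ⊖ x ⊗ y)) refl x y b c)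
      (+-nonneg (*-nonneg (sub-nonneg u) (sub-nonneg l′)) (*-nonneg (sub-nonneg l) (sub-nonneg u′)))))

  within-* : ∀ {x y b c} → Within x b → Within y c → Within (x * y) (b * c)
  within-* {x} {y} w v = product-bound w v ,
    ≤-respˡ-≈ (solve 2 (λ x y → ⊝ x ⊗ y := ⊝ (x ⊗ y)) refl x y) (product-bound (within-neg w) v)

  within-cong : ∀ {x y b} → x ≈ y → Within x b → Within y b
  within-cong e (u , l) = ≤-respˡ-≈ e u , ≤-respˡ-≈ (-‿cong e) l

  sameSign-near : ∀ {x y b k} → Within (x - y) b → b < k → 0# ≤ b → (k ≤ y) ⊎ (k ≤ - y) → SameSign x y
  sameSign-near {x} {y} {b} {k} (u , l) b<k 0≤b (inj₁ k≤y) =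
    both-positive (pos-resp (solve 3 (λ x y b → (y ⊖ b) ⊕ (b ⊖ ⊝ (x ⊖ y)) := x) refl x y b)
      (+-pos-nonneg (sub-pos (<-≤-trans b<k k≤y)) (sub-nonneg l)))
      (≤-<-trans 0≤b (<-≤-trans b<k k≤y))
  sameSign-near {x} {y} {b} {k} (u , l) b<k 0≤b (inj₂ k≤-y) =
    both-negative (pos-resp (solve 3 (λ x y b → (⊝ y ⊖ b) ⊕ (b ⊖ (x ⊖ y)) := ⊝ x) refl x y b)
      (+-pos-nonneg (sub-pos (<-≤-trans b<k k≤-y)) (sub-nonneg u)))
      (≤-<-trans 0≤b (<-≤-trans b<k k≤-y))

-- Cells on which the signs are constant

module Cells (em : ExcludedMiddle 0ℓ) (ℝ : CompleteOrderedField) where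
  open CompleteOrderedField ℝ hiding (zero)
  open IntegerRingSolver ℝ
  open FieldProperties ℝ
  open Plane ℝ using (Point; _≈ₚ_)
  open Orientation ℝ
  open Agreement ℝ
  open Sums
  open Indicators em
  open CrossingCount em ℝ using (gridPoint)

  Close : ℕ → ℕ → Set
  Close i j = i ℕ.≤ suc j × j ℕ.≤ suc i

  SomeClose : ℕ → ℕ → ℕ → ℕ → Set
  SomeClose p q r s = (Close p q ⊎ Close p r ⊎ Close p s) ⊎ (Close q r ⊎ Close q s ⊎ Close r s)

  -- With indices up to m = n - 1, each of the two products in an orientation varies by at most 2m +
  -- 1 within the cells. The orientation then varies by at most 4m + 2, which is below the threshold
  -- 4n = 4m + 4.
  Flat : ℕ → (p q r P Q R : ℕ) → Set
  Flat n p q r P Q R = orient (gridPoint p P) (gridPoint q Q) (gridPoint r R) < fromℕ (4 ℕ.* n)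
                     × - orient (gridPoint p P) (gridPoint q Q) (gridPoint r R) < fromℕ (4 ℕ.* n)

  SomeFlat : ℕ → (p q r s P Q R S : ℕ) → Set
  SomeFlat n p q r s P Q R S =
    (Flat n p q r P Q R ⊎ Flat n p q s P Q S) ⊎ (Flat n p r s P R S ⊎ Flat n q r s Q R S)

  -- Outside the bad cells, every sign that MonoCross depends on is constant on
  -- the cell.
  Bad : ℕ → (p q r s P Q R S : ℕ) → Set
  Bad n p q r s P Q R S = (SomeClose p q r s ⊎ SomeClose P Q R S) ⊎ SomeFlat n p q r s P Q R S

  Near : Carrier → ℕ → Set
  Near x i = (fromℕ i ≤ x) × (x ≤ fromℕ (suc i))

  NearPoint : Point → ℕ → ℕ → Set
  NearPoint (x , y) i j = Near x i × Near y j

  private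
    near-difference : ∀ i j {x y} → Near x i → Near y j → Within ((y - x) - (fromℕ j - fromℕ i)) 1#
    near-difference i j {x} {y} (l , u) (l′ , u′) =
      nonneg-sub (nonneg-resp (solve 4 (λ x y i j → ((:1 ⊕ j) ⊖ y) ⊕ (x ⊖ i) := :1 ⊖ ((y ⊖ x) ⊖ (j ⊖ i))) refl x y (fromℕ i) (fromℕ j))
        (+-nonneg (sub-nonneg u′) (sub-nonneg l))) ,
      nonneg-sub (nonneg-resp (solve 4 (λ x y i j → ((:1 ⊕ i) ⊖ x) ⊕ (y ⊖ j) := :1 ⊖ ⊝ ((y ⊖ x) ⊖ (j ⊖ i))) refl x y (fromℕ i) (fromℕ j))
        (+-nonneg (sub-nonneg u) (sub-nonneg l′)))

    index-difference : ∀ {m i j} → i ℕ.≤ m → j ℕ.≤ m → Within (fromℕ j - fromℕ i) (fromℕ m)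
    index-difference {m} {i} {j} i≤m j≤m =
      nonneg-sub (nonneg-resp (solve 3 (λ m i j → (m ⊖ j) ⊕ i := m ⊖ (j ⊖ i)) refl (fromℕ m) (fromℕ i) (fromℕ j))
        (+-nonneg (sub-nonneg (fromℕ-mono-≤ j≤m)) (fromℕ-nonneg i))) ,
      nonneg-sub (nonneg-resp (solve 3 (λ m i j → (m ⊖ i) ⊕ j := m ⊖ ⊝ (j ⊖ i)) refl (fromℕ m) (fromℕ i) (fromℕ j))
        (+-nonneg (sub-nonneg (fromℕ-mono-≤ i≤m)) (fromℕ-nonneg j)))

    product-error : ∀ {u v d e m} → Within (u - d) 1# → Within (v - e) 1# → Within d m → Within e m →
      Within (u * v - d * e) (m * 1# + 1# * m + 1# * 1#)
    product-error {u} {v} {d} {e} p q r s = within-cong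
      (solve 4 (λ u v d e → d ⊗ (v ⊖ e) ⊕ (u ⊖ d) ⊗ e ⊕ (u ⊖ d) ⊗ (v ⊖ e) := u ⊗ v ⊖ d ⊗ e) refl u v d e)
      (within-+ (within-+ (within-* r q) (within-* p s)) (within-* p q))

  orient-near : ∀ m {P Q R p q r P′ Q′ R′} → p ℕ.≤ m → q ℕ.≤ m → r ℕ.≤ m → P′ ℕ.≤ m → Q′ ℕ.≤ m → R′ ℕ.≤ m →
    NearPoint P p P′ → NearPoint Q q Q′ → NearPoint R r R′ → ¬ Flat (suc m) p q r P′ Q′ R′ →
    SameSign (orient P Q R) (orient (gridPoint p P′) (gridPoint q Q′) (gridPoint r R′))
  orient-near m {px , py} {qx , qy} {rx , ry} {p} {q} {r} {P′} {Q′} {R′} p≤m q≤m r≤m P≤m Q≤m R≤m (pX , pY) (qX , qY) (rX , rY) steep =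
    sameSign-near {b = E + E}
      (within-cong (solve 8 (λ u v d e u′ v′ d′ e′ → (u ⊗ v ⊖ d ⊗ e) ⊕ ⊝ (u′ ⊗ v′ ⊖ d′ ⊗ e′) := (u ⊗ v ⊖ u′ ⊗ v′) ⊖ (d ⊗ e ⊖ d′ ⊗ e′))
          refl (qx - px) (ry - py) (fromℕ q - fromℕ p) (fromℕ R′ - fromℕ P′) (qy - py) (rx - px) (fromℕ Q′ - fromℕ P′) (fromℕ r - fromℕ p))
        (within-+
          (product-error (near-difference p q pX qX) (near-difference P′ R′ pY rY) (index-difference p≤m q≤m) (index-difference P≤m R≤m))
          (within-neg (product-error (near-difference P′ Q′ pY qY) (near-difference p r pX rX) (index-difference P≤m Q≤m) (index-difference p≤m r≤m)))))
      (pos-sub (pos-resp small (+-pos 0<1 0<1)))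
      (+-nonneg 0≤E 0≤E)
      far
    where
    E = fromℕ m * 1# + 1# * fromℕ m + 1# * 1#
    0≤1 : 0# ≤ 1#
    0≤1 = inj₁ 0<1
    0≤E : 0# ≤ E
    0≤E = +-nonneg (+-nonneg (*-nonneg (fromℕ-nonneg m) 0≤1) (*-nonneg 0≤1 (fromℕ-nonneg m))) (*-nonneg 0≤1 0≤1)
    small : 1# + 1# ≈ fromℕ (4 ℕ.* suc m) - (E + E)
    small = trans (solve 1 (λ m → :1 ⊕ :1 :=
        (:1 ⊕ (:1 ⊕ (:1 ⊕ (:1 ⊕ :0)))) ⊗ (:1 ⊕ m) ⊖ ((m ⊗ :1 ⊕ :1 ⊗ m ⊕ :1 ⊗ :1) ⊕ (m ⊗ :1 ⊕ :1 ⊗ m ⊕ :1 ⊗ :1))) refl (fromℕ m))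
      (+-congʳ (sym (fromℕ-* 4 (suc m))))
    far : (fromℕ (4 ℕ.* suc m) ≤ orient (gridPoint p P′) (gridPoint q Q′) (gridPoint r R′)) ⊎
          (fromℕ (4 ℕ.* suc m) ≤ - orient (gridPoint p P′) (gridPoint q Q′) (gridPoint r R′))
    far with em {fromℕ (4 ℕ.* suc m) ≤ orient (gridPoint p P′) (gridPoint q Q′) (gridPoint r R′)}
    ... | yes x = inj₁ x
    ... | no ¬x = inj₂ (≮⇒≥ λ y → steep (≰⇒> ¬x , y))

  private
    -- The difference deviates by at most 1 from that of the indices, and indices that are not close
    -- differ by at least 2.
    difference-near : ∀ i j {x y} → Near x i → Near y j → ¬ Close i j → SameSign (y - x) (fromℕ j - fromℕ i)
    difference-near i j {x} {y} p q apart = sameSign-near (near-difference i j p q)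
      (pos-sub (pos-resp (solve 0 (:1 := :1 ⊕ :1 ⊖ :1) refl) 0<1)) (inj₁ 0<1) far
      where
      step : ∀ {i j} → suc (suc i) ℕ.≤ j → 1# + 1# ≤ fromℕ j - fromℕ i
      step {i} {j} le = nonneg-sub (nonneg-resp (solve 2 (λ i j → j ⊖ (:1 ⊕ (:1 ⊕ i)) := (j ⊖ i) ⊖ (:1 ⊕ :1)) refl (fromℕ i) (fromℕ j))
        (sub-nonneg (fromℕ-mono-≤ le)))
      far : (1# + 1# ≤ fromℕ j - fromℕ i) ⊎ (1# + 1# ≤ - (fromℕ j - fromℕ i))
      far with i ℕₚ.≤? suc j | j ℕₚ.≤? suc i
      ... | yes a | yes b = ⊥-elim (apart (a , b))
      ... | _ | no b = inj₁ (step (ℕₚ.≰⇒> b))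
      ... | no a | _ = inj₂ (≤-respʳ-≈ (solve 2 (λ i j → i ⊖ j := ⊝ (j ⊖ i)) refl (fromℕ i) (fromℕ j)) (step (ℕₚ.≰⇒> a)))

    rise-near : ∀ {P Q p q P′ Q′} → NearPoint P p P′ → NearPoint Q q Q′ → ¬ Close p q → ¬ Close P′ Q′ →
      SameSign (rise P Q) (rise (gridPoint p P′) (gridPoint q Q′))
    rise-near {p = p} {q} {P′} {Q′} (pX , pY) (qX , qY) m n = sameSign-* (difference-near p q pX qX m) (difference-near P′ Q′ pY qY n)

  agree-near : ∀ n {P Q R S p q r s P′ Q′ R′ S′} →
    p ℕ.< n → q ℕ.< n → r ℕ.< n → s ℕ.< n → P′ ℕ.< n → Q′ ℕ.< n → R′ ℕ.< n → S′ ℕ.< n →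
    NearPoint P p P′ → NearPoint Q q Q′ → NearPoint R r R′ → NearPoint S s S′ →
    ¬ Bad n p q r s P′ Q′ R′ S′ →
    Agree P Q R S (gridPoint p P′) (gridPoint q Q′) (gridPoint r R′) (gridPoint s S′)
  agree-near (suc m) (s≤s p) (s≤s q) (s≤s r) (s≤s s) (s≤s P) (s≤s Q) (s≤s R) (s≤s S) nP nQ nR nS good = record
    { PQR = orient-near m p q r P Q R nP nQ nR (good ∘ inj₂ ∘ inj₁ ∘ inj₁)
    ; PQS = orient-near m p q s P Q S nP nQ nS (good ∘ inj₂ ∘ inj₁ ∘ inj₂)
    ; PRS = orient-near m p r s P R S nP nR nS (good ∘ inj₂ ∘ inj₂ ∘ inj₁)
    ; QRS = orient-near m q r s Q R S nQ nR nS (good ∘ inj₂ ∘ inj₂ ∘ inj₂)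
    ; PQ = rise-near nP nQ (good ∘ inj₁ ∘ inj₁ ∘ inj₁ ∘ inj₁) (good ∘ inj₁ ∘ inj₂ ∘ inj₁ ∘ inj₁)
    ; PR = rise-near nP nR (good ∘ inj₁ ∘ inj₁ ∘ inj₁ ∘ inj₂ ∘ inj₁) (good ∘ inj₁ ∘ inj₂ ∘ inj₁ ∘ inj₂ ∘ inj₁)
    ; PS = rise-near nP nS (good ∘ inj₁ ∘ inj₁ ∘ inj₁ ∘ inj₂ ∘ inj₂) (good ∘ inj₁ ∘ inj₂ ∘ inj₁ ∘ inj₂ ∘ inj₂)
    ; QR = rise-near nQ nR (good ∘ inj₁ ∘ inj₁ ∘ inj₂ ∘ inj₁) (good ∘ inj₁ ∘ inj₂ ∘ inj₂ ∘ inj₁)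
    ; QS = rise-near nQ nS (good ∘ inj₁ ∘ inj₁ ∘ inj₂ ∘ inj₂ ∘ inj₁) (good ∘ inj₁ ∘ inj₂ ∘ inj₂ ∘ inj₂ ∘ inj₁)
    ; RS = rise-near nR nS (good ∘ inj₁ ∘ inj₁ ∘ inj₂ ∘ inj₂ ∘ inj₂) (good ∘ inj₁ ∘ inj₂ ∘ inj₂ ∘ inj₂ ∘ inj₂)
    }

  count : ℕ → ((p q r s P Q R S : ℕ) → Set) → ℕ
  count n X = ∑⁴ n λ p q r s → ∑⁴ n λ P Q R S → ⟦ X p q r s P Q R S ⟧

  count-⊎ : ∀ n X Y {k l} → count n X ℕ.≤ k → count n Y ℕ.≤ l →
    count n (λ p q r s P Q R S → X p q r s P Q R S ⊎ Y p q r s P Q R S) ℕ.≤ k ℕ.+ l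
  count-⊎ n X Y x y = ℕₚ.≤-trans (∑⁴-mono n λ p q r s → ℕₚ.≤-trans (∑⁴-mono n λ P Q R S → ⟦⟧-⊎) (ℕₚ.≤-reflexive (∑⁴-+ n _ _)))
    (ℕₚ.≤-trans (ℕₚ.≤-reflexive (∑⁴-+ n _ _)) (ℕₚ.+-mono-≤ x y))

  private
    count-swap₁₂ : ∀ n X → count n X ≡ count n (λ p q r s P Q R S → X q p r s Q P R S)
    count-swap₁₂ n X = ≡.trans (∑⁴-swap₁₂ n _) (∑⁴-cong n λ p q r s → ∑⁴-swap₁₂ n _)

    count-swap₂₃ : ∀ n X → count n X ≡ count n (λ p q r s P Q R S → X p r q s P R Q S)
    count-swap₂₃ n X = ≡.trans (∑⁴-swap₂₃ n _) (∑⁴-cong n λ p q r s → ∑⁴-swap₂₃ n _)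

    count-swap₃₄ : ∀ n X → count n X ≡ count n (λ p q r s P Q R S → X p q s r P Q S R)
    count-swap₃₄ n X = ≡.trans (∑⁴-swap₃₄ n _) (∑⁴-cong n λ p q r s → ∑⁴-swap₃₄ n _)

    close-window : ∀ n i → ∑[ j < n ] ⟦ Close i j ⟧ ℕ.≤ 3
    close-window n i = window n 3 λ j k _ (i≤1+j , _) (_ , k≤1+i) →
      ℕₚ.≤-trans (s≤s (ℕₚ.≤-trans k≤1+i (s≤s i≤1+j))) (ℕₚ.≤-reflexive (ℕₚ.+-comm 3 j))

    module _ (n : ℕ) where
      c₁₄ : ∑⁴ n (λ p q r s → ⟦ Close p s ⟧) ℕ.≤ n ^ 3 ℕ.* 3
      c₁₄ = ∑⁴-bound₄ n 3 λ p q r → close-window n p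
      c₂₄ : ∑⁴ n (λ p q r s → ⟦ Close q s ⟧) ℕ.≤ n ^ 3 ℕ.* 3
      c₂₄ = ∑⁴-bound₄ n 3 λ p q r → close-window n q
      c₃₄ : ∑⁴ n (λ p q r s → ⟦ Close r s ⟧) ℕ.≤ n ^ 3 ℕ.* 3
      c₃₄ = ∑⁴-bound₄ n 3 λ p q r → close-window n r
      c₁₃ : ∑⁴ n (λ p q r s → ⟦ Close p r ⟧) ℕ.≤ n ^ 3 ℕ.* 3
      c₁₃ = ℕₚ.≤-trans (ℕₚ.≤-reflexive (∑⁴-swap₃₄ n _)) c₁₄
      c₂₃ : ∑⁴ n (λ p q r s → ⟦ Close q r ⟧) ℕ.≤ n ^ 3 ℕ.* 3
      c₂₃ = ℕₚ.≤-trans (ℕₚ.≤-reflexive (∑⁴-swap₃₄ n _)) c₂₄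
      c₁₂ : ∑⁴ n (λ p q r s → ⟦ Close p q ⟧) ℕ.≤ n ^ 3 ℕ.* 3
      c₁₂ = ℕₚ.≤-trans (ℕₚ.≤-reflexive (∑⁴-swap₂₃ n _)) c₁₃

      someClose-bound : ∑⁴ n (λ p q r s → ⟦ SomeClose p q r s ⟧) ℕ.≤ 18 ℕ.* n ^ 3
      someClose-bound = ℕₚ.≤-trans (either
        (either c₁₂ (either c₁₃ c₁₄))
        (either c₂₃ (either c₂₄ c₃₄)))
        (ℕₚ.≤-reflexive (sum (n ^ 3)))
        where
        either : ∀ {X Y : ℕ → ℕ → ℕ → ℕ → Set} {k l} → ∑⁴ n (λ p q r s → ⟦ X p q r s ⟧) ℕ.≤ k → ∑⁴ n (λ p q r s → ⟦ Y p q r s ⟧) ℕ.≤ l →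
          ∑⁴ n (λ p q r s → ⟦ X p q r s ⊎ Y p q r s ⟧) ℕ.≤ k ℕ.+ l
        either x y = ℕₚ.≤-trans (∑⁴-mono n λ p q r s → ⟦⟧-⊎)
          (ℕₚ.≤-trans (ℕₚ.≤-reflexive (∑⁴-+ n _ _)) (ℕₚ.+-mono-≤ x y))
        sum : ∀ k → (k ℕ.* 3 ℕ.+ (k ℕ.* 3 ℕ.+ k ℕ.* 3)) ℕ.+ (k ℕ.* 3 ℕ.+ (k ℕ.* 3 ℕ.+ k ℕ.* 3)) ≡ 18 ℕ.* k
        sum = solve-∀

      closeX-bound : count n (λ p q r s P Q R S → SomeClose p q r s) ℕ.≤ 18 ℕ.* (n ^ 4 ℕ.* n ^ 3)
      closeX-bound = ℕₚ.≤-trans (ℕₚ.≤-reflexive (≡.trans (∑⁴-cong n λ p q r s → ∑⁴-const n ⟦ SomeClose p q r s ⟧) (∑⁴-*ˡ n (n ^ 4) _)))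
        (ℕₚ.≤-trans (ℕₚ.*-monoʳ-≤ (n ^ 4) someClose-bound) (ℕₚ.≤-reflexive (regroup (n ^ 4) (n ^ 3))))
        where
        regroup : ∀ x y → x ℕ.* (18 ℕ.* y) ≡ 18 ℕ.* (x ℕ.* y)
        regroup = solve-∀

      closeY-bound : count n (λ p q r s P Q R S → SomeClose P Q R S) ℕ.≤ 18 ℕ.* (n ^ 4 ℕ.* n ^ 3)
      closeY-bound = ℕₚ.≤-trans (∑⁴-bound n _ λ p q r s → someClose-bound) (ℕₚ.≤-reflexive (regroup (n ^ 4) (n ^ 3)))
        where
        regroup : ∀ x y → x ℕ.* (18 ℕ.* y) ≡ 18 ℕ.* (x ℕ.* y)
        regroup = solve-∀

    module _ (M : ℕ) where
      n = M ℕ.* M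
      E = M ℕ.* (n ^ 4 ℕ.* n ^ 3)

      -- Columns less than M apart, for which the rate in `flat-window` is too small to be of use.
      Comparable : ℕ → ℕ → Set
      Comparable p q = p ℕ.< q ℕ.+ M × q ℕ.< p ℕ.+ M

      comparable-window : ∀ p → ∑[ q < n ] ⟦ Comparable p q ⟧ ℕ.≤ 2 ℕ.* M
      comparable-window p = window n (2 ℕ.* M) λ i j _ (p<i+M , _) (_ , j<p+M) →
        ℕₚ.<-≤-trans j<p+M (ℕₚ.≤-trans (ℕₚ.+-monoˡ-≤ M (ℕₚ.<⇒≤ p<i+M)) (ℕₚ.≤-reflexive (regroup i M)))
        where
        regroup : ∀ i M → i ℕ.+ M ℕ.+ M ≡ i ℕ.+ 2 ℕ.* M
        regroup = solve-∀

      -- As R moves, the orientation of a triple changes at rate |q − p| ≥ M.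
      flat-window : ∀ p q s P Q → ∑[ S < n ] ⟦ (¬ Comparable p q) × Flat n p q s P Q S ⟧ ℕ.≤ 8 ℕ.* M
      -- Flatness confines the orientation to an interval of length 8n = 8M², which a rate of at
      -- least M leaves within 8M rows.
      flat-window p q s P Q = window n (8 ℕ.* M) λ S S′ S≤S′ (apart , u , l) (_ , u′ , l′) → ℕₚ.≰⇒> λ le →
        contradiction S S′ le apart u l u′ l′
        where
        o : ℕ → Carrier
        o S = orient (gridPoint p P) (gridPoint q Q) (gridPoint s S)
        K = fromℕ (4 ℕ.* n)
        dx = fromℕ q - fromℕ p
        rate : ∀ S S′ → o S′ - o S ≈ dx * (fromℕ S′ - fromℕ S)
        rate S S′ = solve 7 (λ p q s P Q S S′ →
          ((q ⊖ p) ⊗ (S′ ⊖ P) ⊖ (Q ⊖ P) ⊗ (s ⊖ p)) ⊖ ((q ⊖ p) ⊗ (S ⊖ P) ⊖ (Q ⊖ P) ⊗ (s ⊖ p)) := (q ⊖ p) ⊗ (S′ ⊖ S))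
          refl (fromℕ p) (fromℕ q) (fromℕ s) (fromℕ P) (fromℕ Q) (fromℕ S) (fromℕ S′)
        large : ∀ {x} S S′ → S ℕ.+ 8 ℕ.* M ℕ.≤ S′ → fromℕ M ≤ x → K + K ≤ x * (fromℕ S′ - fromℕ S)
        large {x} S S′ le M≤x = ≤-trans (≤-respˡ-≈ eq (*-monoʳ M gap)) (*-monoˡ-≤ _ (≤-trans (fromℕ-nonneg (8 ℕ.* M)) gap) M≤x)
          where
          *-monoʳ : ∀ M {u v} → u ≤ v → fromℕ M * u ≤ fromℕ M * v
          *-monoʳ M {u} {v} le = ≤-respˡ-≈ (*-comm u (fromℕ M)) (≤-respʳ-≈ (*-comm v (fromℕ M)) (*-monoˡ-≤ (fromℕ M) (fromℕ-nonneg M) le))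
          gap : fromℕ (8 ℕ.* M) ≤ fromℕ S′ - fromℕ S
          gap = nonneg-sub (nonneg-resp (solve 3 (λ s k s′ → s′ ⊖ (s ⊕ k) := (s′ ⊖ s) ⊖ k) refl (fromℕ S) (fromℕ (8 ℕ.* M)) (fromℕ S′))
            (sub-nonneg (≤-respˡ-≈ (fromℕ-+ S (8 ℕ.* M)) (fromℕ-mono-≤ le))))
          eq : fromℕ M * fromℕ (8 ℕ.* M) ≈ K + K
          eq = trans (sym (fromℕ-* M (8 ℕ.* M))) (trans (fromℕ-cong (double M)) (fromℕ-+ (4 ℕ.* n) (4 ℕ.* n)))
            where
            double : ∀ M → M ℕ.* (8 ℕ.* M) ≡ 4 ℕ.* (M ℕ.* M) ℕ.+ 4 ℕ.* (M ℕ.* M)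
            double = solve-∀
        steep : ¬ Comparable p q → (fromℕ M ≤ dx) ⊎ (fromℕ M ≤ - dx)
        steep apart with p ℕₚ.<? q ℕ.+ M | q ℕₚ.<? p ℕ.+ M
        ... | yes a | yes b = ⊥-elim (apart (a , b))
        ... | no a | _ = inj₂ (nonneg-sub (nonneg-resp (solve 3 (λ p q M → p ⊖ (q ⊕ M) := ⊝ (q ⊖ p) ⊖ M) refl (fromℕ p) (fromℕ q) (fromℕ M))
                (sub-nonneg (≤-respˡ-≈ (fromℕ-+ q M) (fromℕ-mono-≤ (ℕₚ.≮⇒≥ a))))))
        ... | _ | no b = inj₁ (nonneg-sub (nonneg-resp (solve 3 (λ p q M → q ⊖ (p ⊕ M) := (q ⊖ p) ⊖ M) refl (fromℕ p) (fromℕ q) (fromℕ M))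
                (sub-nonneg (≤-respˡ-≈ (fromℕ-+ p M) (fromℕ-mono-≤ (ℕₚ.≮⇒≥ b))))))
        contradiction : ∀ S S′ → S ℕ.+ 8 ℕ.* M ℕ.≤ S′ → ¬ Comparable p q →
          o S < K → - o S < K → o S′ < K → - o S′ < K → ⊥
        contradiction S S′ le apart u l u′ l′ with steep apart
        ... | inj₁ a = <⇒≱ (<-respˡ-≈ (rate S S′) (+-mono-< u′ l)) (large S S′ le a)
        ... | inj₂ a = <⇒≱ (<-respˡ-≈ (trans (solve 2 (λ x y → x ⊕ ⊝ y := ⊝ (y ⊖ x)) refl (o S) (o S′))
                (trans (-‿cong (rate S S′)) (solve 2 (λ d k → ⊝ (d ⊗ k) := ⊝ d ⊗ k) refl dx (fromℕ S′ - fromℕ S)))) (+-mono-< u l′))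
              (large S S′ le a)

      -- Triples with comparable columns are counted whether flat or not, with at most 2M choices of
      -- q for each p; for the others at most 8M rows S remain. Together 2 + 8 = 10.
      flat₁₂₄ : count n (λ p q r s P Q R S → Flat n p q s P Q S) ℕ.≤ 10 ℕ.* E
      flat₁₂₄ = ℕₚ.≤-trans (∑⁴-mono n λ p q r s → ∑⁴-mono n λ P Q R S → ℕₚ.≤-trans (⟦⟧-mono (split p q s P Q S)) ⟦⟧-⊎)
        (ℕₚ.≤-trans (≤-reflexive′ (≡.trans (∑⁴-cong n λ p q r s → ∑⁴-+ n _ _) (∑⁴-+ n _ _)))
        (ℕₚ.≤-trans (ℕₚ.+-mono-≤ near far) (≤-reflexive′ (regroup (n ^ 4) (n ^ 3) M))))
        where
        ≤-reflexive′ = ℕₚ.≤-reflexive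
        split : ∀ p q s P Q S → Flat n p q s P Q S → Comparable p q ⊎ ((¬ Comparable p q) × Flat n p q s P Q S)
        split p q s P Q S f with em {Comparable p q}
        ... | yes c = inj₁ c
        ... | no ¬c = inj₂ (¬c , f)
        near : ∑⁴ n (λ p q r s → ∑⁴ n λ P Q R S → ⟦ Comparable p q ⟧) ℕ.≤ n ^ 4 ℕ.* (n ^ 3 ℕ.* (2 ℕ.* M))
        near = ℕₚ.≤-trans (≤-reflexive′ (≡.trans (∑⁴-cong n λ p q r s → ∑⁴-const n ⟦ Comparable p q ⟧) (∑⁴-*ˡ n (n ^ 4) _)))
          (ℕₚ.*-monoʳ-≤ (n ^ 4) (ℕₚ.≤-trans (≤-reflexive′ (≡.trans (∑⁴-swap₂₃ n _) (∑⁴-swap₃₄ n _)))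
            (∑⁴-bound₄ n _ λ p q r → comparable-window p)))
        far : ∑⁴ n (λ p q r s → ∑⁴ n λ P Q R S → ⟦ (¬ Comparable p q) × Flat n p q s P Q S ⟧) ℕ.≤ n ^ 4 ℕ.* (n ^ 3 ℕ.* (8 ℕ.* M))
        far = ∑⁴-bound n _ λ p q r s → ∑⁴-bound₄ n _ λ P Q R → flat-window p q s P Q
        regroup : ∀ x y M → x ℕ.* (y ℕ.* (2 ℕ.* M)) ℕ.+ x ℕ.* (y ℕ.* (8 ℕ.* M)) ≡ 10 ℕ.* (M ℕ.* (x ℕ.* y))
        regroup = solve-∀

      flat₁₂₃ : count n (λ p q r s P Q R S → Flat n p q r P Q R) ℕ.≤ 10 ℕ.* E
      flat₁₂₃ = ℕₚ.≤-trans (ℕₚ.≤-reflexive (count-swap₃₄ n (λ p q r s P Q R S → Flat n p q r P Q R))) flat₁₂₄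

      flat₁₃₄ : count n (λ p q r s P Q R S → Flat n p r s P R S) ℕ.≤ 10 ℕ.* E
      flat₁₃₄ = ℕₚ.≤-trans (ℕₚ.≤-reflexive (count-swap₂₃ n (λ p q r s P Q R S → Flat n p r s P R S))) flat₁₂₄

      flat₂₃₄ : count n (λ p q r s P Q R S → Flat n q r s Q R S) ℕ.≤ 10 ℕ.* E
      flat₂₃₄ = ℕₚ.≤-trans (ℕₚ.≤-reflexive (count-swap₁₂ n (λ p q r s P Q R S → Flat n q r s Q R S))) flat₁₃₄

  -- The side n = M² balances the pairs with |q − p| < M against the flat triples
  -- with |q − p| ≥ M: both have density O(1/M).
  bad-bound : ∀ M → let n = M ℕ.* M in count n (Bad n) ℕ.≤ 76 ℕ.* (M ℕ.* (n ^ 4 ℕ.* n ^ 3))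
  bad-bound zero = z≤n
  bad-bound M@(suc _) = ℕₚ.≤-trans
    (count-⊎ (n M) _ _ (count-⊎ (n M) _ _ (closeX-bound (n M)) (closeY-bound (n M)))
      (count-⊎ (n M) _ _ (count-⊎ (n M) _ _ (flat₁₂₃ M) (flat₁₂₄ M)) (count-⊎ (n M) _ _ (flat₁₃₄ M) (flat₂₃₄ M))))
    (ℕₚ.≤-trans (ℕₚ.+-monoˡ-≤ _ (ℕₚ.+-mono-≤ (ℕₚ.*-monoʳ-≤ 18 widen) (ℕₚ.*-monoʳ-≤ 18 widen))) (ℕₚ.≤-reflexive (sum (E M))))
    where
    widen : n M ^ 4 ℕ.* n M ^ 3 ℕ.≤ E M
    widen = ℕₚ.m≤n*m (n M ^ 4 ℕ.* n M ^ 3) M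
    -- Two coordinates with six close pairs of weight 3 each, and four flat triples of weight 10: 2
    -- · 18 + 4 · 10 = 76.
    sum : ∀ e → (18 ℕ.* e ℕ.+ 18 ℕ.* e) ℕ.+ ((10 ℕ.* e ℕ.+ 10 ℕ.* e) ℕ.+ (10 ℕ.* e ℕ.+ 10 ℕ.* e)) ≡ 76 ℕ.* e
    sum = solve-∀

-- Elementary probability

module Events (em : ExcludedMiddle 0ℓ) {ℝ : CompleteOrderedField} (𝓟 : ProbabilitySpace ℝ) where
  open CompleteOrderedField ℝ hiding (zero)
  open IntegerRingSolver ℝ
  open FieldProperties ℝ
  open ProbabilitySpace 𝓟
  open Sums

  private
    Event : Set₁
    Event = Pred Ω 0ℓ

    double-negation : {A : Set} → ¬ ¬ A → A
    double-negation {A} ¬¬a with em {A}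
    ... | yes a = a
    ... | no ¬a = ⊥-elim (¬¬a ¬a)

    pair : Event → Event → ℕ → Event
    pair A B 0             = A
    pair A B 1             = B
    pair A B (suc (suc _)) = ∅

  measurable-∅ : Measurable ∅
  measurable-∅ = resp ((λ f → f _) , λ ()) (complement whole)

  private
    pair-measurable : ∀ {A B} → Measurable A → Measurable B → ∀ n → Measurable (pair A B n)
    pair-measurable a b 0             = a
    pair-measurable a b 1             = b
    pair-measurable a b (suc (suc _)) = measurable-∅

    pair-union : ∀ A B → ⋃ ℕ (pair A B) ≐ A ∪ B
    pair-union A B = (λ { (0 , x) → inj₁ x ; (1 , x) → inj₂ x }) , λ { (inj₁ x) → 0 , x ; (inj₂ x) → 1 , x }

  measurable-∪ : ∀ {A B} → Measurable A → Measurable B → Measurable (A ∪ B)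
  measurable-∪ {A} {B} a b = resp (pair-union A B) (union (pair-measurable a b))

  measurable-∩ : ∀ {A B} → Measurable A → Measurable B → Measurable (A ∩ B)
  measurable-∩ a b = resp
    ((λ f → double-negation (λ ¬x → f (inj₁ ¬x)) , double-negation (λ ¬y → f (inj₂ ¬y))) ,
     λ { (x , y) (inj₁ ¬x) → ¬x x ; (x , y) (inj₂ ¬y) → ¬y y })
    (complement (measurable-∪ (complement a) (complement b)))

  measurable-const : (P : Set) → Measurable (λ _ → P)
  measurable-const P with em {P}
  ... | yes p = resp ((λ _ → p) , λ _ → _) whole
  ... | no ¬p = resp (⊥-elim , ¬p) measurable-∅

  measurable-Fin : ∀ {n} {A : Fin n → Event} → (∀ i → Measurable (A i)) → Measurable (λ ω → ∃[ i ] A i ω)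
  measurable-Fin {zero}  a = resp (⊥-elim , λ { (() , _) }) measurable-∅
  measurable-Fin {suc n} a = resp
    ([ (λ x → Fin.zero , x) , (λ (i , x) → Fin.suc i , x) ]′ ,
     λ { (Fin.zero , x) → inj₁ x ; (Fin.suc i , x) → inj₂ (i , x) })
    (measurable-∪ (a Fin.zero) (measurable-Fin (a ∘ Fin.suc)))

  measurable-⋂Fin : ∀ {n} {A : Fin n → Event} → (∀ i → Measurable (A i)) → Measurable (⋂ (Fin n) A)
  measurable-⋂Fin a = resp
    ((λ f i → double-negation λ ¬x → f (i , ¬x)) , λ g (i , ¬x) → ¬x (g i))
    (complement (measurable-Fin λ i → complement (a i)))

  -- Meant for edges, which carry a proof of i < j: as there is at most one proof, the union over
  -- proofs is a single event or empty.
  measurable-irrelevant : ∀ {P : Set} {A : P → Event} → (∀ (p q : P) → p ≡ q) →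
    (∀ p → Measurable (A p)) → Measurable (λ ω → Σ[ p ∈ P ] A p ω)
  measurable-irrelevant {P} {A} irrelevant a with em {P}
  ... | yes p = resp ((λ x → p , x) , λ { {ω} (q , x) → ≡.subst (λ r → A r ω) (irrelevant q p) x }) (a p)
  ... | no ¬p = resp (⊥-elim , ¬p ∘ proj₁) measurable-∅

  private
    limit-of-constant : ∀ {s l} c k → (∀ n → s (k ℕ.+ n) ≈ c) → s ⟶ l → l ≈ c
    limit-of-constant {s} {l} c k constant limit with compare l c
    ... | tri≈ _ e _ = e
    ... | tri< l<c _ _ with limit (c - l) (sub-pos l<c)
    ...   | N , near = ⊥-elim (irrefl (constant N)
            (<-respʳ-≈ (solve 2 (λ l c → l ⊕ (c ⊖ l) := c) refl l c) (proj₂ (near (k ℕ.+ N) (ℕₚ.m≤n+m N k)))))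
    limit-of-constant {s} {l} c k constant limit | tri> _ _ c<l with limit (l - c) (sub-pos c<l)
    ... | N , near = ⊥-elim (irrefl (sym (constant N))
            (<-respˡ-≈ (solve 2 (λ l c → l ⊖ (l ⊖ c) := c) refl l c) (proj₁ (near (k ℕ.+ N) (ℕₚ.m≤n+m N k)))))

    ∑-nonneg : ∀ n (f : Fin n → Carrier) → (∀ i → 0# ≤ f i) → 0# ≤ CompleteOrderedField.∑ ℝ f
    ∑-nonneg zero    f p = ≤-refl
    ∑-nonneg (suc n) f p = +-nonneg (p Fin.zero) (∑-nonneg n (f ∘ Fin.suc) (p ∘ Fin.suc))

    ∑-null : ∀ n (f : Fin n → Carrier) → (∀ i → f i ≈ 0#) → CompleteOrderedField.∑ ℝ f ≈ 0#
    ∑-null zero    f p = refl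
    ∑-null (suc n) f p = trans (+-cong (p Fin.zero) (∑-null n (f ∘ Fin.suc) (p ∘ Fin.suc))) (+-identityˡ 0#)

  -- e + e + … tends to e, where e = ℙ ∅.
  ℙ-∅ : ℙ measurable-∅ ≈ 0#
  ℙ-∅ with ℙ-nonNeg measurable-∅
  ... | inj₂ e = sym e
  ... | inj₁ 0<e with ℙ-union {λ _ → ∅} (λ _ → measurable-∅) (λ _ ()) (ℙ measurable-∅) 0<e
  ...   | N , near = ⊥-elim (<⇒≱ (proj₂ (near (2 ℕ.+ N) (ℕₚ.m≤n+m N 2)))
          (≤-respˡ-≈ (+-congʳ (ℙ-cong measurable-∅ (union λ _ → measurable-∅) ((λ ()) , proj₂)))
            (+-mono-≤ ≤-refl (≤-respˡ-≈ (+-identityʳ _) (+-mono-≤ ≤-refl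
              (∑-nonneg N (λ _ → ℙ measurable-∅) (λ _ → ℙ-nonNeg measurable-∅)))))))

  ℙ-disjoint : ∀ {A B} (a : Measurable A) (b : Measurable B) → (∀ {ω} → A ω → ¬ B ω) →
    ℙ (measurable-∪ a b) ≈ ℙ a + ℙ b
  ℙ-disjoint {A} {B} a b disjoint = trans
    (sym (ℙ-cong (union (pair-measurable a b)) (measurable-∪ a b) (pair-union A B)))
    (limit-of-constant (ℙ a + ℙ b) 2
      (λ n → +-congˡ (trans (+-congˡ (∑-null n _ λ _ → ℙ-∅)) (+-identityʳ _)))
      (ℙ-union (pair-measurable a b) apart))
    where
    apart : ∀ {m n} → m ≢ n → ¬ (pair A B m ≬ pair A B n)
    apart {0}           {0}           m≢n _           = m≢n ≡.refl
    apart {0}           {1}           _ (ω , x , y)   = disjoint x y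
    apart {1}           {0}           _ (ω , x , y)   = disjoint y x
    apart {1}           {1}           m≢n _           = m≢n ≡.refl
    apart {suc (suc _)}               _ (ω , () , _)
    apart {0}           {suc (suc _)} _ (ω , _ , ())
    apart {1}           {suc (suc _)} _ (ω , _ , ())

  ℙ-mono : ∀ {A B} (a : Measurable A) (b : Measurable B) → A ⊆ B → ℙ a ≤ ℙ b
  ℙ-mono {A} {B} a b A⊆B = ≤-respʳ-≈ (trans (sym (ℙ-disjoint a rest (λ x (_ , ¬x) → ¬x x)))
      (ℙ-cong (measurable-∪ a rest) b ([ A⊆B , proj₁ ]′ , split)))
    (≤-respˡ-≈ (+-identityʳ _) (+-mono-≤ ≤-refl (ℙ-nonNeg rest)))
    where
    rest = measurable-∩ b (complement a)
    split : B ⊆ A ∪ (B ∩ ∁ A)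
    split {ω} y with em {A ω}
    ... | yes x = inj₁ x
    ... | no ¬x = inj₂ (y , ¬x)

  ℙ-complement : ∀ {A} (a : Measurable A) → ℙ a + ℙ (complement a) ≈ 1#
  ℙ-complement {A} a = trans (sym (ℙ-disjoint a (complement a) (λ x ¬x → ¬x x)))
    (trans (ℙ-cong _ whole (_ , total)) ℙ-whole)
    where
    total : U ⊆ A ∪ ∁ A
    total {ω} _ with em {A ω}
    ... | yes x = inj₁ x
    ... | no ¬x = inj₂ ¬x

  ℙ-subadditive : ∀ {A B C} (a : Measurable A) (b : Measurable B) (c : Measurable C) → C ⊆ A ∪ B → ℙ c ≤ ℙ a + ℙ b
  ℙ-subadditive {A} {B} a b c cover = ≤-trans (ℙ-mono c (measurable-∪ a rest) λ z → split (cover z))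
    (≤-trans (inj₂ (ℙ-disjoint a rest (λ x (_ , ¬x) → ¬x x))) (+-mono-≤ ≤-refl (ℙ-mono rest b proj₁)))
    where
    rest = measurable-∩ b (complement a)
    split : ∀ {ω} → (A ∪ B) ω → (A ∪ (B ∩ ∁ A)) ω
    split (inj₁ x) = inj₁ x
    split {ω} (inj₂ y) with em {A ω}
    ... | yes x = inj₁ x
    ... | no ¬x = inj₂ (y , ¬x)

  private
    Below : (ℕ → Event) → ℕ → Event
    Below A zero    = ∅
    Below A (suc n) = Below A n ∪ A n

    below-measurable : ∀ {A} → (∀ i → Measurable (A i)) → ∀ n → Measurable (Below A n)
    below-measurable a zero    = measurable-∅
    below-measurable a (suc n) = measurable-∪ (below-measurable a n) (a n)

    below-member : ∀ {A} n {ω} → ∃[ i ] (i ℕ.< n × A i ω) → Below A n ω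
    below-member (suc n) (i , i<1+n , x) with ℕₚ.m≤n⇒m<n∨m≡n i<1+n
    ... | inj₁ (s≤s i<n) = inj₁ (below-member n (i , i<n , x))
    ... | inj₂ ≡.refl    = inj₂ x

  -- The union bound inside an event G, with a null event O for the points outside the square. As
  -- the bounds are natural multiples of one κ, the lemma can be nested, each use adding one
  -- summation sign.
  ℙ-cover : ∀ n {G O : Event} {A : ℕ → Event} (g : Measurable G) (o : Measurable O) (a : ∀ i → Measurable (A i)) {κ} (c : ℕ → ℕ) →
    ℙ o ≈ 0# → (∀ {ω} → G ω → O ω ⊎ ∃[ i ] (i ℕ.< n × A i ω)) →
    (∀ i → i ℕ.< n → ℙ (measurable-∩ g (a i)) ≤ fromℕ (c i) * κ) →
    ℙ g ≤ fromℕ (Sums.∑ n c) * κ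
  ℙ-cover n {G} {O} {A} g o a {κ} c ℙo≈0 cover bound =
    ≤-trans (ℙ-subadditive (measurable-∩ g (below-measurable a n)) o g
      (λ x → [ inj₂ , (λ m → inj₁ (x , below-member n m)) ]′ (cover x)))
    (≤-respʳ-≈ (+-identityʳ _) (+-mono-≤ (go n ℕₚ.≤-refl) (inj₂ ℙo≈0)))
    where
    go : ∀ m → m ℕ.≤ n → ℙ (measurable-∩ g (below-measurable a m)) ≤ fromℕ (Sums.∑ m c) * κ
    go zero    _ = inj₂ (trans (ℙ-cong _ measurable-∅ (proj₂ , λ ())) (trans ℙ-∅ (sym (zeroˡ κ))))
    go (suc m) m<n = ≤-trans
      (ℙ-subadditive (measurable-∩ g (below-measurable a m)) (measurable-∩ g (a m)) _
        λ { (x , inj₁ y) → inj₁ (x , y) ; (x , inj₂ y) → inj₂ (x , y) })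
      (≤-respʳ-≈ (trans (sym (distribʳ κ _ _)) (*-congʳ (sym (fromℕ-+ (Sums.∑ m c) (c m)))))
        (+-mono-≤ (go m (ℕₚ.<⇒≤ m<n)) (bound m m<n)))

-- Rational approximation

module Rationals (em : ExcludedMiddle 0ℓ) (ℝ : CompleteOrderedField) where
  open CompleteOrderedField ℝ hiding (zero)
  open IntegerRingSolver ℝ
  open FieldProperties ℝ
  open Segments ℝ using (square-nonneg)

  ν : ℕ → Carrier
  ν n = fromℕ (suc n) ⁻¹

  ν-pos : ∀ n → 0# < ν n
  ν-pos n = ⁻¹-pos (fromℕ-pos {suc n} (s≤s z≤n))

  ν-inverse : ∀ n → fromℕ (suc n) * ν n ≈ 1#
  ν-inverse n = *-inverseʳ (pos⇒≉0 (fromℕ-pos {suc n} (s≤s z≤n)))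

  ν-small : ∀ {δ} → 0# < δ → ∃[ n ] ν n < δ
  ν-small {δ} 0<δ with archimedean em (δ ⁻¹)
  ... | n , δ⁻¹<n = n , pos-sub (*-cancel-pos (pos-resp eq (*-pos (sub-pos δ⁻¹<1+n) (*-pos 0<δ (ν-pos n)))) 0<1)
    where
    δ⁻¹<1+n : δ ⁻¹ < fromℕ (suc n)
    δ⁻¹<1+n = <-trans δ⁻¹<n (fromℕ-mono-< (ℕₚ.n<1+n n))
    eq : (fromℕ (suc n) - δ ⁻¹) * (δ * ν n) ≈ 1# * (δ - ν n)
    eq = trans (solve 4 (λ m i d v → (m ⊖ i) ⊗ (d ⊗ v) := (m ⊗ v) ⊗ d ⊖ (d ⊗ i) ⊗ v) refl (fromℕ (suc n)) (δ ⁻¹) δ (ν n))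
      (trans (+-cong (*-congʳ (ν-inverse n)) (-‿cong (*-congʳ (*-inverseʳ (pos⇒≉0 0<δ)))))
        (solve 2 (λ d v → :1 ⊗ d ⊖ :1 ⊗ v := :1 ⊗ (d ⊖ v)) refl δ (ν n)))

  floor : ∀ {x} → 0# ≤ x → ∃[ k ] (fromℕ k ≤ x × x < fromℕ (suc k))
  floor {x} 0≤x with archimedean em x
  ... | m , x<m = search m x<m
    where
    search : ∀ m → x < fromℕ m → ∃[ k ] (fromℕ k ≤ x × x < fromℕ (suc k))
    search zero    x<0 = ⊥-elim (<⇒≱ x<0 0≤x)
    search (suc m) x<1+m with compare x (fromℕ m)
    ... | tri< x<m _ _ = search m x<m
    ... | tri≈ _ e _   = m , inj₂ (sym e) , x<1+m
    ... | tri> _ _ m<x = m , inj₁ m<x , x<1+m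

  scaled : ∀ n k {x} → fromℕ k ≤ x * fromℕ (suc n) → fromℕ k * ν n ≤ x
  scaled n k {x} le = ≤-respʳ-≈ (trans (*-assoc x _ _) (trans (*-congˡ (ν-inverse n)) (*-identityʳ x)))
    (*-monoˡ-≤ (ν n) (inj₁ (ν-pos n)) le)

  scaled-< : ∀ n k {x} → x * fromℕ (suc n) < fromℕ k → x < fromℕ k * ν n
  scaled-< n k {x} lt = pos-sub (pos-resp
    (trans (solve 4 (λ k x m v → (k ⊖ x ⊗ m) ⊗ v := k ⊗ v ⊖ x ⊗ (m ⊗ v)) refl (fromℕ k) x (fromℕ (suc n)) (ν n))
      (+-congˡ (-‿cong (trans (*-congˡ (ν-inverse n)) (*-identityʳ x)))))
    (*-pos (sub-pos lt) (ν-pos n)))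

  dense⁺ : ∀ {x y} → 0# ≤ x → x < y → ∃[ n ] ∃[ k ] (x < fromℕ k * ν n × fromℕ k * ν n < y)
  dense⁺ {x} {y} 0≤x x<y = choose (ν-small (sub-pos x<y))
    where
    round : ∀ n → ν n < y - x → ∃[ k ] (fromℕ k ≤ x * fromℕ (suc n) × x * fromℕ (suc n) < fromℕ (suc k)) →
      ∃[ n ] ∃[ k ] (x < fromℕ k * ν n × fromℕ k * ν n < y)
    round n small (k , k≤ , <1+k) = n , suc k , scaled-< n (suc k) <1+k , pos-sub (pos-resp
      (solve 4 (λ x y k v → ((y ⊖ x) ⊖ v) ⊕ (x ⊖ k ⊗ v) := y ⊖ (:1 ⊕ k) ⊗ v) refl x y (fromℕ k) (ν n))
      (+-pos-nonneg (sub-pos small) (sub-nonneg (scaled n k k≤))))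
    choose : ∃[ n ] ν n < y - x → ∃[ n ] ∃[ k ] (x < fromℕ k * ν n × fromℕ k * ν n < y)
    choose (n , small) = round n small (floor (*-nonneg 0≤x (fromℕ-nonneg (suc n))))

  -- Every rational has the form k/(n + 1) - l; three natural indices suit countable unions over ℕ.
  rational : ℕ → ℕ → ℕ → Carrier
  rational n k l = fromℕ k * ν n - fromℕ l

  dense : ∀ {x y} → x < y → ∃[ n ] ∃[ k ] ∃[ l ] (x < rational n k l × rational n k l < y)
  dense {x} {y} x<y = shift (archimedean em (- x))
    where
    unshift : ∀ l → ∃[ n ] ∃[ k ] (x + fromℕ l < fromℕ k * ν n × fromℕ k * ν n < y + fromℕ l) →
      ∃[ n ] ∃[ k ] ∃[ l ] (x < rational n k l × rational n k l < y)
    unshift l (n , k , lo , hi) = n , k , l ,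
      pos-sub (pos-resp (solve 3 (λ x q l → q ⊖ (x ⊕ l) := (q ⊖ l) ⊖ x) refl x (fromℕ k * ν n) (fromℕ l)) (sub-pos lo)) ,
      pos-sub (pos-resp (solve 3 (λ y q l → (y ⊕ l) ⊖ q := y ⊖ (q ⊖ l)) refl y (fromℕ k * ν n) (fromℕ l)) (sub-pos hi))
    shift : ∃[ l ] - x < fromℕ l → ∃[ n ] ∃[ k ] ∃[ l ] (x < rational n k l × rational n k l < y)
    shift (l , -x<l) = unshift l (dense⁺
      (inj₁ (pos-resp (solve 2 (λ x l → l ⊖ ⊝ x := x ⊕ l) refl x (fromℕ l)) (sub-pos -x<l)))
      (+-monoˡ-< (fromℕ l) x<y))

  -- The choice δ = ε/(b + ε) gives 1 - δ = b/(b + ε) and ε - δb = ε²/(b + ε), both positive.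
  shrink : ∀ {ε b} → 0# < ε → 0# < b → ∃[ δ ] (0# < δ × δ < 1# × δ * b < ε)
  shrink {ε} {b} 0<ε 0<b = δ , *-pos 0<ε (⁻¹-pos 0<b+ε) ,
    pos-sub (pos-resp eq₁ (*-pos 0<b (⁻¹-pos 0<b+ε))) ,
    pos-sub (pos-resp eq₂ (*-pos 0<ε (*-pos 0<ε (⁻¹-pos 0<b+ε))))
    where
    0<b+ε = +-pos 0<b 0<ε
    i = (b + ε) ⁻¹
    δ = ε * i
    inv : (b + ε) * i ≈ 1#
    inv = *-inverseʳ (pos⇒≉0 0<b+ε)
    eq₁ : b * i ≈ 1# - δ
    eq₁ = trans (solve 3 (λ b e i → b ⊗ i := (b ⊕ e) ⊗ i ⊖ e ⊗ i) refl b ε i) (+-congʳ inv)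
    eq₂ : ε * (ε * i) ≈ ε - δ * b
    eq₂ = trans (solve 3 (λ b e i → e ⊗ (e ⊗ i) := e ⊗ ((b ⊕ e) ⊗ i) ⊖ e ⊗ i ⊗ b) refl b ε i)
      (+-congʳ (trans (*-congˡ inv) (*-identityʳ ε)))

  -- The polynomial y² + 1 replaces |y| in estimates: 2(y² + 1 + y) = 1 + (y + 1)² + y².
  abs-bound⁺ : ∀ y → 0# < y * y + 1# + y
  abs-bound⁺ y = double-pos (pos-resp
    (solve 1 (λ y → (:1 ⊕ (y ⊕ :1) ⊗ (y ⊕ :1)) ⊕ y ⊗ y := (y ⊗ y ⊕ :1 ⊕ y) ⊕ (y ⊗ y ⊕ :1 ⊕ y)) refl y)
    (+-pos-nonneg (+-pos-nonneg 0<1 (square-nonneg (y + 1#))) (square-nonneg y)))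

  abs-bound⁻ : ∀ y → 0# < y * y + 1# - y
  abs-bound⁻ y = pos-resp (solve 1 (λ y → (⊝ y) ⊗ (⊝ y) ⊕ :1 ⊕ ⊝ y := y ⊗ y ⊕ :1 ⊖ y) refl y) (abs-bound⁺ (- y))

-- Measurable functions

module MeasurableFunctions (em : ExcludedMiddle 0ℓ) {ℝ : CompleteOrderedField} (𝓟 : ProbabilitySpace ℝ) where
  open CompleteOrderedField ℝ hiding (zero)
  open IntegerRingSolver ℝ
  open FieldProperties ℝ
  open Rationals em ℝ
  open ProbabilitySpace 𝓟
  open Events em 𝓟
  open Segments ℝ using (square-nonneg)

  record MeasurableFunction (f : Ω → Carrier) : Set₁ where
    field
      above : ∀ c → Measurable (λ ω → c < f ω)
      below : ∀ c → Measurable (λ ω → f ω < c)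

  open MeasurableFunction public

  constant : ∀ c → MeasurableFunction (λ _ → c)
  constant c = record { above = λ d → measurable-const (d < c) ; below = λ d → measurable-const (c < d) }

  private
    neg-< : ∀ {x y} → x < y → - y < - x
    neg-< {x} {y} p = pos-sub (pos-resp (solve 2 (λ x y → y ⊖ x := ⊝ x ⊖ ⊝ y) refl x y) (sub-pos p))

    neg-neg : ∀ x → - (- x) ≈ x
    neg-neg x = solve 1 (λ x → ⊝ (⊝ x) := x) refl x

  negate : ∀ {f} → MeasurableFunction f → MeasurableFunction (λ ω → - f ω)
  negate f = record
    { above = λ c → resp ((λ p → <-respˡ-≈ (neg-neg c) (neg-< p)) , (λ p → <-respˡ-≈ (neg-neg _) (neg-< p))) (below f (- c))
    ; below = λ c → resp ((λ p → <-respʳ-≈ (neg-neg c) (neg-< p)) , (λ p → <-respʳ-≈ (neg-neg _) (neg-< p))) (above f (- c)) }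

  private
    Open : (Carrier → Carrier → Set) → Set
    Open Φ = ∀ {x y} → Φ x y → ∃[ δ ] (0# < δ × (∀ {x′ y′} →
      x - δ < x′ → x′ < x + δ → y - δ < y′ → y′ < y + δ → Φ x′ y′))

    Box : (Carrier → Carrier → Set) → (a b c d : Carrier) → Set
    Box Φ a b c d = ∀ x y → a < x → x < b → c < y → y < d → Φ x y

    lower : ∀ {x δ} → 0# < δ → x - δ < x
    lower {x} {δ} p = pos-sub (pos-resp (solve 2 (λ x d → d := x ⊖ (x ⊖ d)) refl x δ) p)

    upper : ∀ {x δ} → 0# < δ → x < x + δ
    upper {x} {δ} p = pos-sub (pos-resp (solve 2 (λ x d → d := (x ⊕ d) ⊖ x) refl x δ) p)

    record SomeRational (A : Carrier → Set) : Set where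
      constructor some
      field
        {n k l} : ℕ
        holds   : A (rational n k l)

    some-measurable : ∀ (A : Carrier → Pred Ω 0ℓ) → (∀ q → Measurable (A q)) → Measurable (λ ω → SomeRational λ q → A q ω)
    some-measurable A a = resp {⋃ ℕ λ n → ⋃ ℕ λ k → ⋃ ℕ λ l → A (rational n k l)} (to , from)
      (union λ n → union λ k → union λ l → a (rational n k l))
      where
      to : ∀ {ω} → (⋃ ℕ λ n → ⋃ ℕ λ k → ⋃ ℕ λ l → A (rational n k l)) ω → SomeRational λ q → A q ω
      to (n , k , l , x) = some {n = n} {k = k} {l = l} x
      from : ∀ {ω} → (SomeRational λ q → A q ω) → (⋃ ℕ λ n → ⋃ ℕ λ k → ⋃ ℕ λ l → A (rational n k l)) ω
      from (some {n} {k} {l} x) = n , k , l , x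

    some-between : ∀ {x y} (A : Carrier → Set) → x < y → (∀ q → x < q → q < y → A q) → SomeRational A
    some-between {x} {y} A x<y f = from-dense (dense x<y)
      where
      from-dense : ∃[ n ] ∃[ k ] ∃[ l ] (x < rational n k l × rational n k l < y) → SomeRational A
      from-dense (n , k , l , a , b) = some {n = n} {k = k} {l = l} (f (rational n k l) a b)

  -- An open set is the union of the rational boxes that it contains.
  open-measurable : ∀ {Φ f g} → Open Φ → MeasurableFunction f → MeasurableFunction g → Measurable (λ ω → Φ (f ω) (g ω))
  open-measurable {Φ} {f} {g} open-Φ f-m g-m = resp
    {λ ω → SomeRational λ a → SomeRational λ b → SomeRational λ c → SomeRational λ d → Piece a b c d ω} (to , from)
    (some-measurable (λ a ω → SomeRational λ b → SomeRational λ c → SomeRational λ d → Piece a b c d ω) λ a →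
     some-measurable (λ b ω → SomeRational λ c → SomeRational λ d → Piece a b c d ω) λ b →
     some-measurable (λ c ω → SomeRational λ d → Piece a b c d ω) λ c →
     some-measurable (λ d ω → Piece a b c d ω) λ d →
      -- Whether a box lies in Φ does not depend on ω, so by excluded middle this factor is the
      -- whole space or empty.
      measurable-∩ (measurable-const (Box Φ a b c d))
        (measurable-∩ (measurable-∩ (above f-m a) (below f-m b)) (measurable-∩ (above g-m c) (below g-m d))))
    where
    Piece : Carrier → Carrier → Carrier → Carrier → Pred Ω 0ℓ
    Piece a b c d = (λ _ → Box Φ a b c d) ∩ (((λ ω → a < f ω) ∩ (λ ω → f ω < b)) ∩ ((λ ω → c < g ω) ∩ (λ ω → g ω < d)))
    to : ∀ {ω} → SomeRational (λ a → SomeRational λ b → SomeRational λ c → SomeRational λ d → Piece a b c d ω) → Φ (f ω) (g ω)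
    to {ω} (some (some (some (some (box , (a , b) , (c , d)))))) = box (f ω) (g ω) a b c d
    from : ∀ {ω} → Φ (f ω) (g ω) → SomeRational (λ a → SomeRational λ b → SomeRational λ c → SomeRational λ d → Piece a b c d ω)
    from {ω} φ = choose (open-Φ φ)
      where
      choose : ∃[ δ ] (0# < δ × (∀ {x′ y′} → f ω - δ < x′ → x′ < f ω + δ → g ω - δ < y′ → y′ < g ω + δ → Φ x′ y′)) →
        SomeRational (λ a → SomeRational λ b → SomeRational λ c → SomeRational λ d → Piece a b c d ω)
      choose (δ , 0<δ , near) =
        some-between (λ a → SomeRational λ b → SomeRational λ c → SomeRational λ d → Piece a b c d ω) (lower 0<δ) λ a a> a< →
        some-between (λ b → SomeRational λ c → SomeRational λ d → Piece a b c d ω) (upper 0<δ) λ b b> b< →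
        some-between (λ c → SomeRational λ d → Piece a b c d ω) (lower 0<δ) λ c c> c< →
        some-between (λ d → Piece a b c d ω) (upper 0<δ) λ d d> d< →
          (λ x y p q r s → near (<-trans a> p) (<-trans q b<) (<-trans c> r) (<-trans s d<)) , (a< , b>) , (c< , d>)

  private
    open-sum : ∀ c → Open (λ x y → c < x + y)
    open-sum c {x} {y} p with shrink (sub-pos p) (+-pos 0<1 0<1)
    ... | δ , 0<δ , _ , small = δ , 0<δ , λ {x′} {y′} x-δ<x′ _ y-δ<y′ _ → pos-sub (pos-resp
          (solve 6 (λ c x y x′ y′ d → ((x ⊕ y ⊖ c) ⊖ d ⊗ (:1 ⊕ :1)) ⊕ ((x′ ⊖ (x ⊖ d)) ⊕ (y′ ⊖ (y ⊖ d))) := x′ ⊕ y′ ⊖ c) refl c x y x′ y′ δ)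
          (+-pos (sub-pos small) (+-pos (sub-pos x-δ<x′) (sub-pos y-δ<y′))))

    -- With x′ = x + u and y′ = y + v the difference x′y′ − xy is u y + x v + u v,
    -- where |u|, |v| < δ < 1 and |x| < x² + 1, |y| < y² + 1.
    open-product : ∀ c → Open (λ x y → c < x * y)
    open-product c {x} {y} p with shrink {b = (x * x + 1#) + (y * y + 1#) + 1#} (sub-pos p)
      (+-pos (+-pos (square+1 x) (square+1 y)) 0<1)
      where
      square+1 : ∀ x → 0# < x * x + 1#
      square+1 x = pos-resp (+-comm 1# (x * x)) (+-pos-nonneg 0<1 (square-nonneg x))
    ... | δ , 0<δ , δ<1 , small = δ , 0<δ , λ {x′} {y′} x₋ x₊ y₋ y₊ → pos-sub (double-pos (pos-resp
      (solve 6 (λ c x y x′ y′ δ →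
        (((x ⊗ y ⊖ c) ⊖ δ ⊗ ((x ⊗ x ⊕ :1) ⊕ (y ⊗ y ⊕ :1) ⊕ :1)) ⊕ ((x ⊗ y ⊖ c) ⊖ δ ⊗ ((x ⊗ x ⊕ :1) ⊕ (y ⊗ y ⊕ :1) ⊕ :1)))
        ⊕ ((((x′ ⊖ (x ⊖ δ)) ⊗ (y ⊗ y ⊕ :1 ⊕ y) ⊕ ((x ⊕ δ) ⊖ x′) ⊗ (y ⊗ y ⊕ :1 ⊖ y))
          ⊕ ((y′ ⊖ (y ⊖ δ)) ⊗ (x ⊗ x ⊕ :1 ⊕ x) ⊕ ((y ⊕ δ) ⊖ y′) ⊗ (x ⊗ x ⊕ :1 ⊖ x)))
          ⊕ (((x′ ⊖ (x ⊖ δ)) ⊗ (y′ ⊖ (y ⊖ δ)) ⊕ ((x ⊕ δ) ⊖ x′) ⊗ ((y ⊕ δ) ⊖ y′)) ⊕ (δ ⊗ (:1 ⊖ δ) ⊕ δ ⊗ (:1 ⊖ δ))))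
        := (x′ ⊗ y′ ⊖ c) ⊕ (x′ ⊗ y′ ⊖ c)) refl c x y x′ y′ δ)
      (+-pos (+-pos (sub-pos small) (sub-pos small))
        (+-pos (+-pos (+-pos (*-pos (sub-pos x₋) (abs-bound⁺ y)) (*-pos (sub-pos x₊) (abs-bound⁻ y)))
                      (+-pos (*-pos (sub-pos y₋) (abs-bound⁺ x)) (*-pos (sub-pos y₊) (abs-bound⁻ x))))
               (+-pos (+-pos (*-pos (sub-pos x₋) (sub-pos y₋)) (*-pos (sub-pos x₊) (sub-pos y₊)))
                      (+-pos (*-pos 0<δ (sub-pos δ<1)) (*-pos 0<δ (sub-pos δ<1))))))))

    above⇒measurable : ∀ {f} → (∀ c → Measurable (λ ω → c < f ω)) → (∀ c → Measurable (λ ω → c < - f ω)) → MeasurableFunction f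
    above⇒measurable {f} a b = record { above = a ; below = λ c → resp
      ((λ p → <-respˡ-≈ (neg-neg _) (<-respʳ-≈ (neg-neg c) (neg-< p))) , neg-<) (b (- c)) }

  add : ∀ {f g} → MeasurableFunction f → MeasurableFunction g → MeasurableFunction (λ ω → f ω + g ω)
  add f g = above⇒measurable (λ c → open-measurable (open-sum c) f g)
    (λ c → resp (<-respʳ-≈ (eq _ _) , <-respʳ-≈ (sym (eq _ _))) (open-measurable (open-sum c) (negate f) (negate g)))
    where
    eq : ∀ x y → - x + - y ≈ - (x + y)
    eq x y = solve 2 (λ x y → ⊝ x ⊕ ⊝ y := ⊝ (x ⊕ y)) refl x y

  multiply : ∀ {f g} → MeasurableFunction f → MeasurableFunction g → MeasurableFunction (λ ω → f ω * g ω)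
  multiply f g = above⇒measurable (λ c → open-measurable (open-product c) f g)
    (λ c → resp (<-respʳ-≈ (eq _ _) , <-respʳ-≈ (sym (eq _ _))) (open-measurable (open-product c) (negate f) g))
    where
    eq : ∀ x y → - x * y ≈ - (x * y)
    eq x y = solve 2 (λ x y → ⊝ x ⊗ y := ⊝ (x ⊗ y)) refl x y

  subtract : ∀ {f g} → MeasurableFunction f → MeasurableFunction g → MeasurableFunction (λ ω → f ω - g ω)
  subtract f g = add f (negate g)

  measurable-pos : ∀ {f} → MeasurableFunction f → Measurable (λ ω → 0# < f ω)
  measurable-pos f = above f 0#

  measurable-< : ∀ {f g} → MeasurableFunction f → MeasurableFunction g → Measurable (λ ω → f ω < g ω)
  measurable-< f g = resp (pos-sub , sub-pos) (measurable-pos (subtract g f))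

  measurable-zero : ∀ {f} → MeasurableFunction f → Measurable (λ ω → f ω ≈ 0#)
  measurable-zero {f} f-m = resp (to , λ e → (λ p → irrefl (sym e) p) , (λ p → irrefl e p))
    (measurable-∩ (complement (above f-m 0#)) (complement (below f-m 0#)))
    where
    to : ∀ {ω} → ¬ (0# < f ω) × ¬ (f ω < 0#) → f ω ≈ 0#
    to {ω} (a , b) with compare (f ω) 0#
    ... | tri< p _ _ = ⊥-elim (b p)
    ... | tri≈ _ e _ = e
    ... | tri> _ _ p = ⊥-elim (a p)

-- Meeting segments with countable quantifiers only

module Intersections (em : ExcludedMiddle 0ℓ) (ℝ : CompleteOrderedField) where
  open CompleteOrderedField ℝ hiding (zero)
  open IntegerRingSolver ℝ
  open FieldProperties ℝ
  open Plane ℝ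
  open Orientation ℝ
  open Segments ℝ
  open Rationals em ℝ

  -- h = t v for some 0 < t < 1
  Between : Carrier → Carrier → Set
  Between h v = ((0# < h) × (h < v)) ⊎ (((v < h) × (h < 0#)) ⊎ ((h ≈ 0#) × (v ≈ 0#)))

  ratio : ∀ {h v} → ¬ (v ≈ 0#) → Between h v → ∃[ t ] (0# < t × t < 1# × h ≈ t * v)
  ratio {h} {v} v≉0 between = t , 0<t between , pos-sub (0<1-t between) , trans (sym vt≈h) (*-comm v t)
    where
    t = h * v ⁻¹
    vt≈h : v * t ≈ h
    vt≈h = /-cancel h v≉0
    0<t : Between h v → 0# < t
    0<t (inj₁ (0<h , h<v)) = *-cancel-pos (pos-resp (sym vt≈h) 0<h) (<-trans 0<h h<v)
    0<t (inj₂ (inj₁ (v<h , h<0))) = *-cancel-pos (pos-resp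
      (trans (-‿cong (sym vt≈h)) (solve 2 (λ v t → ⊝ (v ⊗ t) := ⊝ v ⊗ t) refl v t)) (neg-pos h<0)) (neg-pos (<-trans v<h h<0))
    0<t (inj₂ (inj₂ (_ , v≈0))) = ⊥-elim (v≉0 v≈0)
    v-h : v - h ≈ v * (1# - t)
    v-h = trans (+-congˡ (-‿cong (sym vt≈h))) (solve 2 (λ v t → v ⊖ v ⊗ t := v ⊗ (:1 ⊖ t)) refl v t)
    0<1-t : Between h v → 0# < 1# - t
    0<1-t (inj₁ (0<h , h<v)) = *-cancel-pos (pos-resp v-h (sub-pos h<v)) (<-trans 0<h h<v)
    0<1-t (inj₂ (inj₁ (v<h , h<0))) = *-cancel-pos (pos-resp
      (trans (solve 2 (λ h v → h ⊖ v := ⊝ (v ⊖ h)) refl h v) (trans (-‿cong v-h) (solve 2 (λ v t → ⊝ (v ⊗ t) := ⊝ v ⊗ t) refl v (1# - t))))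
      (sub-pos v<h)) (neg-pos (<-trans v<h h<0))
    0<1-t (inj₂ (inj₂ (_ , v≈0))) = ⊥-elim (v≉0 v≈0)

  between : ∀ {h v t} → 0# < t → t < 1# → h ≈ t * v → Between h v
  between {h} {v} {t} 0<t t<1 e with sign v
  ... | positive p = inj₁ (pos-resp (sym e) (*-pos 0<t p) , pos-sub (pos-resp
          (trans (solve 2 (λ v t → (:1 ⊖ t) ⊗ v := v ⊖ t ⊗ v) refl v t) (+-congˡ (-‿cong (sym e)))) (*-pos (sub-pos t<1) p)))
  ... | negative p = inj₂ (inj₁ (pos-sub (pos-resp
          (trans (solve 2 (λ v t → (:1 ⊖ t) ⊗ ⊝ v := t ⊗ v ⊖ v) refl v t) (+-congʳ (sym e))) (*-pos (sub-pos t<1) p)) ,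
          pos-neg (pos-resp (trans (solve 2 (λ v t → t ⊗ ⊝ v := ⊝ (t ⊗ v)) refl v t) (-‿cong (sym e))) (*-pos 0<t p))))
  ... | null p     = inj₂ (inj₂ (trans e (trans (*-congˡ p) (zeroʳ t)) , p))

  -- Membership in the open segment without a quantifier over the parameter, hence measurable in all
  -- three points. Collinearity makes the parameters of the two coordinates agree; the third case of
  -- `Between` covers axis-parallel and degenerate edges.
  OnSegment : Point → Point → Point → Set
  OnSegment P Q z = (orient P Q z ≈ 0#) × (Between (proj₁ z - proj₁ P) (proj₁ Q - proj₁ P) × Between (proj₂ z - proj₂ P) (proj₂ Q - proj₂ P))

  private
    offset : ∀ {x p t v} → x ≈ p + t * v → x - p ≈ t * v
    offset {x} {p} {t} {v} e = trans (+-congʳ e) (solve 3 (λ p t v → p ⊕ t ⊗ v ⊖ p := t ⊗ v) refl p t v)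

    unoffset : ∀ {x p t v} → x - p ≈ t * v → x ≈ p + t * v
    unoffset {x} {p} e = trans (solve 2 (λ x p → x := p ⊕ (x ⊖ p)) refl x p) (+-congˡ e)

    proportional : ∀ {h v h′ v′ t} → ¬ (v ≈ 0#) → v * h′ - v′ * h ≈ 0# → h ≈ t * v → h′ ≈ t * v′
    proportional {h} {v} {h′} {v′} {t} v≉0 e f = sym (sub-zero (zero-product
      (trans (solve 4 (λ v h′ v′ t → v ⊗ (h′ ⊖ t ⊗ v′) := v ⊗ h′ ⊖ v′ ⊗ (t ⊗ v)) refl v h′ v′ t)
        (trans (+-congˡ (-‿cong (*-congˡ (sym f)))) e)) v≉0))

  interior⇒onSegment : ∀ P Q z → Interior P Q z → OnSegment P Q z
  interior⇒onSegment P Q z (t , 0<t , t<1 , x , y) =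
    trans (+-cong (*-congˡ (offset y)) (-‿cong (*-congˡ (offset x))))
      (solve 3 (λ u v t → u ⊗ (t ⊗ v) ⊖ v ⊗ (t ⊗ u) := :0) refl (proj₁ Q - proj₁ P) (proj₂ Q - proj₂ P) t) ,
    between 0<t t<1 (offset x) , between 0<t t<1 (offset y)

  private
    half : ∃[ t ] (0# < t × t < 1#)
    half = from-dense (dense⁺ ≤-refl 0<1)
      where
      from-dense : ∃[ n ] ∃[ k ] (0# < fromℕ k * ν n × fromℕ k * ν n < 1#) → ∃[ t ] (0# < t × t < 1#)
      from-dense (n , k , p , q) = fromℕ k * ν n , p , q

    between-zero : ∀ {h v} t → v ≈ 0# → Between h v → h ≈ t * v
    between-zero t v≈0 (inj₁ (0<h , h<v)) = ⊥-elim (irrefl (sym v≈0) (<-trans 0<h h<v))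
    between-zero t v≈0 (inj₂ (inj₁ (v<h , h<0))) = ⊥-elim (irrefl v≈0 (<-trans v<h h<0))
    between-zero t v≈0 (inj₂ (inj₂ (h≈0 , _))) = trans h≈0 (sym (trans (*-congˡ v≈0) (zeroʳ t)))

  onSegment⇒interior : ∀ P Q z → OnSegment P Q z → Interior P Q z
  onSegment⇒interior P Q z (collinear , bx , by) = go (em {vx ≈ 0#}) (em {vy ≈ 0#})
    where
    vx = proj₁ Q - proj₁ P
    vy = proj₂ Q - proj₂ P
    go : Dec (vx ≈ 0#) → Dec (vy ≈ 0#) → Interior P Q z
    go (no n) _ = finish (ratio n bx)
      where
      finish : ∃[ t ] (0# < t × t < 1# × (proj₁ z - proj₁ P) ≈ t * vx) → Interior P Q z
      finish (t , 0<t , t<1 , e) = t , 0<t , t<1 , unoffset e , unoffset (proportional n collinear e)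
    go (yes e) (no n) = finish (ratio n by)
      where
      finish : ∃[ t ] (0# < t × t < 1# × (proj₂ z - proj₂ P) ≈ t * vy) → Interior P Q z
      finish (t , 0<t , t<1 , f) = t , 0<t , t<1 , unoffset (between-zero t e bx) , unoffset f
    go (yes e) (yes f) = finish half
      where
      finish : ∃[ t ] (0# < t × t < 1#) → Interior P Q z
      finish (t , 0<t , t<1) = t , 0<t , t<1 , unoffset (between-zero t e bx) , unoffset (between-zero t f by)

  along : Point → Point → Carrier → Point
  along P Q t = proj₁ P + t * (proj₁ Q - proj₁ P) , proj₂ P + t * (proj₂ Q - proj₂ P)

  interior-resp : ∀ P Q {z z′} → z ≈ₚ z′ → Interior P Q z → Interior P Q z′
  interior-resp P Q (ex , ey) (t , 0<t , t<1 , x , y) = t , 0<t , t<1 , trans (sym ex) x , trans (sym ey) y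

  MeetsAtRational : Point → Point → Point → Point → ℕ → ℕ → Set
  MeetsAtRational P Q R S n k = ((0# < fromℕ k * ν n) × (fromℕ k * ν n < 1#)) × OnSegment R S (along P Q (fromℕ k * ν n))

  -- A union over all real parameters need not be measurable, one over rational parameters is. For
  -- parallel edges nothing is lost, because they meet along an overlap or one of them is a single
  -- point.
  MeetsRationally : Point → Point → Point → Point → Set
  MeetsRationally P Q R S = ∃[ n ] ∃[ k ] MeetsAtRational P Q R S n k

  meetsRationally⇒meets : ∀ P Q R S → MeetsRationally P Q R S → Interior P Q ≬ Interior R S
  meetsRationally⇒meets P Q R S (n , k , (0<t , t<1) , on) =
    along P Q (fromℕ k * ν n) , (fromℕ k * ν n , 0<t , t<1 , refl , refl) , onSegment⇒interior R S _ on

  -- If Q − P = m (S − R), moving t by d moves s by d m; both stay in (0, 1)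
  -- for small d.
  private
    perturb : ∀ P Q R S m → proj₁ Q - proj₁ P ≈ m * (proj₁ S - proj₁ R) → proj₂ Q - proj₂ P ≈ m * (proj₂ S - proj₂ R) →
      Interior P Q ≬ Interior R S → MeetsRationally P Q R S
    perturb P Q R S m mx my (z , (t , 0<t , t<1 , tx , ty) , (s , 0<s , s<1 , sx , sy)) =
      choose (shrink {ε} {b} 0<ε (+-pos-nonneg 0<1 (square-nonneg m)))
      where
      -- ε is less than s, 1 - s and 1 - t, while b = 1 + m² is at least 1 and exceeds |m|. So d b <
      -- ε with d > 0 keeps t + d and s + d m inside (0, 1).
      ε = s * (1# - s) * (1# - t)
      b = 1# + m * m
      0<1-s = sub-pos s<1
      0<1-t = sub-pos t<1
      0<ε : 0# < ε
      0<ε = *-pos (*-pos 0<s 0<1-s) 0<1-t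

      shift : ∀ {x p q r w} d → x ≈ p + t * (q - p) → x ≈ r + s * (w - r) → q - p ≈ m * (w - r) →
        p + (t + d) * (q - p) ≈ r + (s + d * m) * (w - r)
      shift {x} {p} {q} {r} {w} d e f g =
        trans (solve 4 (λ p q t d → p ⊕ (t ⊕ d) ⊗ (q ⊖ p) := (p ⊕ t ⊗ (q ⊖ p)) ⊕ d ⊗ (q ⊖ p)) refl p q t d)
        (trans (+-cong (trans (sym e) f) (*-congˡ g))
          (solve 5 (λ r w s d m → (r ⊕ s ⊗ (w ⊖ r)) ⊕ d ⊗ (m ⊗ (w ⊖ r)) := r ⊕ (s ⊕ d ⊗ m) ⊗ (w ⊖ r)) refl r w s d m))

      at : ∀ n k → t < fromℕ k * ν n → (fromℕ k * ν n - t) * b < ε → MeetsRationally P Q R S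
      at n k t<q db<ε = n , k , (<-trans 0<t t<q , q<1) ,
        interior⇒onSegment R S (along P Q q) (s + d * m , 0<s′ , s′<1 , trans (at-q (proj₁ P) (proj₁ Q)) (shift d tx sx mx) ,
          trans (at-q (proj₂ P) (proj₂ Q)) (shift d ty sy my))
        where
        q = fromℕ k * ν n
        d = q - t
        0<d : 0# < d
        0<d = sub-pos t<q
        at-q : ∀ p p′ → p + q * (p′ - p) ≈ p + (t + d) * (p′ - p)
        at-q p p′ = +-congˡ (*-congʳ (solve 2 (λ q t → q := t ⊕ (q ⊖ t)) refl q t))
        q<1 : q < 1#
        q<1 = pos-sub (pos-resp (solve 4 (λ s t q m →
            ((:1 ⊖ t) ⊗ ((:1 ⊖ s) ⊕ s ⊗ s)) ⊕ (s ⊗ (:1 ⊖ s) ⊗ (:1 ⊖ t) ⊖ (q ⊖ t) ⊗ (:1 ⊕ m ⊗ m)) ⊕ (q ⊖ t) ⊗ (m ⊗ m) := :1 ⊖ q) refl s t q m)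
          (+-pos-nonneg (+-pos (*-pos 0<1-t (+-pos-nonneg 0<1-s (square-nonneg s))) (sub-pos db<ε))
            (*-nonneg (inj₁ 0<d) (square-nonneg m))))
        0<s′ : 0# < s + d * m
        0<s′ = pos-resp (solve 4 (λ s t d m →
            (s ⊗ (s ⊕ t ⊗ (:1 ⊖ s))) ⊕ (s ⊗ (:1 ⊖ s) ⊗ (:1 ⊖ t) ⊖ d ⊗ (:1 ⊕ m ⊗ m)) ⊕ d ⊗ (m ⊗ m ⊕ :1 ⊕ m) := s ⊕ d ⊗ m) refl s t d m)
          (+-pos (+-pos (*-pos 0<s (+-pos 0<s (*-pos 0<t 0<1-s))) (sub-pos db<ε)) (*-pos 0<d (abs-bound⁺ m)))
        s′<1 : s + d * m < 1#
        s′<1 = pos-sub (pos-resp (solve 4 (λ s t d m →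
            ((:1 ⊖ s) ⊗ ((:1 ⊖ s) ⊕ s ⊗ t)) ⊕ (s ⊗ (:1 ⊖ s) ⊗ (:1 ⊖ t) ⊖ d ⊗ (:1 ⊕ m ⊗ m)) ⊕ d ⊗ (m ⊗ m ⊕ :1 ⊖ m) := :1 ⊖ (s ⊕ d ⊗ m)) refl s t d m)
          (+-pos (+-pos (*-pos 0<1-s (+-pos 0<1-s (*-pos 0<s 0<t))) (sub-pos db<ε)) (*-pos 0<d (abs-bound⁻ m))))

      0<b : 0# < b
      0<b = +-pos-nonneg 0<1 (square-nonneg m)

      choose : ∃[ δ ] (0# < δ × δ < 1# × δ * b < ε) → MeetsRationally P Q R S
      choose (δ , 0<δ , _ , small) = from-dense (dense⁺ (inj₁ 0<t) (pos-sub (pos-resp (solve 2 (λ t d → d := (t ⊕ d) ⊖ t) refl t δ) 0<δ)))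
        where
        from-dense : ∃[ n ] ∃[ k ] (t < fromℕ k * ν n × fromℕ k * ν n < t + δ) → MeetsRationally P Q R S
        from-dense (n , k , t<q , q<t+δ) = at n k t<q (<-trans (pos-sub (pos-resp
          (solve 4 (λ q t d b → ((t ⊕ d) ⊖ q) ⊗ b := d ⊗ b ⊖ (q ⊖ t) ⊗ b) refl (fromℕ k * ν n) t δ b)
          (*-pos (sub-pos q<t+δ) 0<b))) small)

  -- If R and S differ, then Q - P is a multiple of S - R and the meeting parameter on PQ can be
  -- moved to a rational one. If they coincide, RS is a single point, and every rational parameter
  -- on RS represents it; hence the second alternative.
  parallel-meets : ∀ P Q R S → det P Q R S ≈ 0# → Interior P Q ≬ Interior R S →
    MeetsRationally P Q R S ⊎ MeetsRationally R S P Q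
  parallel-meets P Q R S D≈0 c@(z , p , (s , _ , _ , sx , sy)) = go (em {vx ≈ 0#}) (em {vy ≈ 0#})
    where
    ux = proj₁ Q - proj₁ P
    uy = proj₂ Q - proj₂ P
    vx = proj₁ S - proj₁ R
    vy = proj₂ S - proj₂ R
    quotient : ∀ {u v} → ¬ (v ≈ 0#) → u ≈ u * v ⁻¹ * v
    quotient {u} {v} n = trans (sym (/-cancel u n)) (*-comm v (u * v ⁻¹))
    go : Dec (vx ≈ 0#) → Dec (vy ≈ 0#) → MeetsRationally P Q R S ⊎ MeetsRationally R S P Q
    go (no n) _ = inj₁ (perturb P Q R S (ux * vx ⁻¹) (quotient n) (proportional n
      (trans (solve 4 (λ ux uy vx vy → vx ⊗ uy ⊖ vy ⊗ ux := ⊝ (ux ⊗ vy ⊖ uy ⊗ vx)) refl ux uy vx vy)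
        (trans (-‿cong D≈0) (solve 0 (⊝ :0 := :0) refl))) (quotient n)) c)
    go (yes _) (no n) = inj₁ (perturb P Q R S (uy * vy ⁻¹) (proportional n
      (trans (solve 4 (λ ux uy vx vy → vy ⊗ ux ⊖ vx ⊗ uy := ux ⊗ vy ⊖ uy ⊗ vx) refl ux uy vx vy) D≈0) (quotient n)) (quotient n) c)
    go (yes e) (yes f) = inj₂ (from-dense (dense⁺ ≤-refl 0<1))
      where
      still : ∀ {x r v} q → v ≈ 0# → x ≈ r + s * v → x ≈ r + q * v
      still q v≈0 e = trans e (+-congˡ (trans (trans (*-congˡ v≈0) (zeroʳ s)) (sym (trans (*-congˡ v≈0) (zeroʳ q)))))
      from-dense : ∃[ n ] ∃[ k ] (0# < fromℕ k * ν n × fromℕ k * ν n < 1#) → MeetsRationally R S P Q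
      from-dense (n , k , 0<q , q<1) = n , k , (0<q , q<1) , interior⇒onSegment P Q (along R S (fromℕ k * ν n))
        (interior-resp P Q (still (fromℕ k * ν n) e sx , still (fromℕ k * ν n) f sy) p)

-- Measurability of the crossing event

module MeasurableCrossing (em : ExcludedMiddle 0ℓ) {ℝ : CompleteOrderedField} (𝓟 : ProbabilitySpace ℝ) where
  open CompleteOrderedField ℝ hiding (zero)
  open IntegerRingSolver ℝ
  open FieldProperties ℝ
  open Plane ℝ hiding (resp; complement; union)
  open Orientation ℝ
  open Segments ℝ
  open Rationals em ℝ
  open Intersections em ℝ
  open ProbabilitySpace 𝓟
  open Events em 𝓟
  open MeasurableFunctions em 𝓟

  record MeasurablePoint (P : Ω → Point) : Set₁ where
    field
      x-measurable : MeasurableFunction (proj₁ ∘ P)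
      y-measurable : MeasurableFunction (proj₂ ∘ P)

  open MeasurablePoint public

  orient-measurable : ∀ {P Q R} → MeasurablePoint P → MeasurablePoint Q → MeasurablePoint R →
    MeasurableFunction (λ ω → orient (P ω) (Q ω) (R ω))
  orient-measurable p q r = subtract
    (multiply (subtract (x-measurable q) (x-measurable p)) (subtract (y-measurable r) (y-measurable p)))
    (multiply (subtract (y-measurable q) (y-measurable p)) (subtract (x-measurable r) (x-measurable p)))

  det-measurable : ∀ {P Q R S} → MeasurablePoint P → MeasurablePoint Q → MeasurablePoint R → MeasurablePoint S →
    MeasurableFunction (λ ω → det (P ω) (Q ω) (R ω) (S ω))
  det-measurable p q r s = subtract
    (multiply (subtract (x-measurable q) (x-measurable p)) (subtract (y-measurable s) (y-measurable r)))
    (multiply (subtract (y-measurable q) (y-measurable p)) (subtract (x-measurable s) (x-measurable r)))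

  rise-measurable : ∀ {P Q} → MeasurablePoint P → MeasurablePoint Q → MeasurableFunction (λ ω → rise (P ω) (Q ω))
  rise-measurable p q = multiply (subtract (x-measurable q) (x-measurable p)) (subtract (y-measurable q) (y-measurable p))

  between-measurable : ∀ {h v} → MeasurableFunction h → MeasurableFunction v → Measurable (λ ω → Between (h ω) (v ω))
  between-measurable h v = measurable-∪ (measurable-∩ (measurable-pos h) (measurable-< h v))
    (measurable-∪ (measurable-∩ (measurable-< v h) (below h 0#)) (measurable-∩ (measurable-zero h) (measurable-zero v)))

  onSegment-measurable : ∀ {P Q z} → MeasurablePoint P → MeasurablePoint Q → MeasurablePoint z →
    Measurable (λ ω → OnSegment (P ω) (Q ω) (z ω))
  onSegment-measurable p q z = measurable-∩ (measurable-zero (orient-measurable p q z))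
    (measurable-∩ (between-measurable (subtract (x-measurable z) (x-measurable p)) (subtract (x-measurable q) (x-measurable p)))
                  (between-measurable (subtract (y-measurable z) (y-measurable p)) (subtract (y-measurable q) (y-measurable p))))

  along-measurable : ∀ {P Q} t → MeasurablePoint P → MeasurablePoint Q → MeasurablePoint (λ ω → along (P ω) (Q ω) t)
  along-measurable t p q = record
    { x-measurable = add (x-measurable p) (multiply (constant t) (subtract (x-measurable q) (x-measurable p)))
    ; y-measurable = add (y-measurable p) (multiply (constant t) (subtract (y-measurable q) (y-measurable p))) }

  meetsRationally-measurable : ∀ {P Q R S} → MeasurablePoint P → MeasurablePoint Q → MeasurablePoint R → MeasurablePoint S →
    Measurable (λ ω → MeetsRationally (P ω) (Q ω) (R ω) (S ω))
  meetsRationally-measurable {P} {Q} {R} {S} p q r s =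
    union {λ n ω → ∃[ k ] MeetsAtRational (P ω) (Q ω) (R ω) (S ω) n k} λ n →
    union {λ k ω → MeetsAtRational (P ω) (Q ω) (R ω) (S ω) n k} λ k →
      measurable-∩ (measurable-const _) (onSegment-measurable r s (along-measurable (fromℕ k * ν n) p q))

  proper-measurable : ∀ {P Q R S} → MeasurablePoint P → MeasurablePoint Q → MeasurablePoint R → MeasurablePoint S →
    Measurable (λ ω → ProperCrossing (P ω) (Q ω) (R ω) (S ω))
  proper-measurable p q r s = measurable-∩
    (measurable-pos (negate (multiply (orient-measurable p q r) (orient-measurable p q s))))
    (measurable-pos (negate (multiply (orient-measurable p r s) (orient-measurable q r s))))

  -- Edges that are not parallel meet exactly in a proper crossing, an event given by strict
  -- inequalities; parallel ones meet exactly if they do so at a rational parameter of one of them.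
  meets-measurable : ∀ {P Q R S} → MeasurablePoint P → MeasurablePoint Q → MeasurablePoint R → MeasurablePoint S →
    Measurable (λ ω → Interior (P ω) (Q ω) ≬ Interior (R ω) (S ω))
  meets-measurable {P} {Q} {R} {S} p q r s = resp
    {λ ω → ProperCrossing (P ω) (Q ω) (R ω) (S ω) ⊎ ((det (P ω) (Q ω) (R ω) (S ω) ≈ 0#) ×
      (MeetsRationally (P ω) (Q ω) (R ω) (S ω) ⊎ MeetsRationally (R ω) (S ω) (P ω) (Q ω)))}
    ((λ {ω} → to ω) , (λ {ω} c → from ω c (em {det (P ω) (Q ω) (R ω) (S ω) ≈ 0#})))
    (measurable-∪ (proper-measurable p q r s) (measurable-∩ (measurable-zero (det-measurable p q r s))
      (measurable-∪ (meetsRationally-measurable p q r s) (meetsRationally-measurable r s p q))))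
    where
    to : ∀ ω → ProperCrossing (P ω) (Q ω) (R ω) (S ω) ⊎ ((det (P ω) (Q ω) (R ω) (S ω) ≈ 0#) ×
      (MeetsRationally (P ω) (Q ω) (R ω) (S ω) ⊎ MeetsRationally (R ω) (S ω) (P ω) (Q ω))) →
      Interior (P ω) (Q ω) ≬ Interior (R ω) (S ω)
    to ω (inj₁ c) = proper⇒cross (P ω) (Q ω) (R ω) (S ω) c
    to ω (inj₂ (_ , inj₁ m)) = meetsRationally⇒meets (P ω) (Q ω) (R ω) (S ω) m
    to ω (inj₂ (_ , inj₂ m)) = let (z , a , b) = meetsRationally⇒meets (R ω) (S ω) (P ω) (Q ω) m in z , b , a
    from : ∀ ω → Interior (P ω) (Q ω) ≬ Interior (R ω) (S ω) → Dec (det (P ω) (Q ω) (R ω) (S ω) ≈ 0#) →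
      ProperCrossing (P ω) (Q ω) (R ω) (S ω) ⊎ ((det (P ω) (Q ω) (R ω) (S ω) ≈ 0#) ×
      (MeetsRationally (P ω) (Q ω) (R ω) (S ω) ⊎ MeetsRationally (R ω) (S ω) (P ω) (Q ω)))
    from ω c (no D≉0)  = inj₁ (cross⇒proper (P ω) (Q ω) (R ω) (S ω) D≉0 c)
    from ω c (yes D≈0) = inj₂ (D≈0 , parallel-meets (P ω) (Q ω) (R ω) (S ω) D≈0 c)

  positiveSlope-measurable : ∀ {P Q} → MeasurablePoint P → MeasurablePoint Q → Measurable (λ ω → PositiveSlope (P ω) (Q ω))
  positiveSlope-measurable {P} {Q} p q = resp (rising⇒positiveSlope _ _ , positiveSlope⇒rising _ _) (measurable-pos (rise-measurable p q))

  hasColour-measurable : ∀ {P Q} c → MeasurablePoint P → MeasurablePoint Q → Measurable (λ ω → HasColour c (P ω) (Q ω))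
  hasColour-measurable red  p q = positiveSlope-measurable p q
  hasColour-measurable blue p q = complement (positiveSlope-measurable p q)

  monochromaticCrossing-measurable : ∀ {n} {Z : Fin n → Ω → Point} → (∀ i → MeasurablePoint (Z i)) →
    Measurable (λ ω → HasMonochromaticCrossing (λ i → Z i ω))
  monochromaticCrossing-measurable {n} {Z} z = edges (λ e ω → ∃[ f ] Pair e f ω) λ e → edges (Pair e) λ f → pair e f
    where
    Pair : Edge n → Edge n → Pred Ω 0ℓ
    Pair e f ω = (e ≢ f) × Cross (λ i → Z i ω) e f × SameColour (λ i → Z i ω) e f

    edges : (A : Edge n → Pred Ω 0ℓ) → (∀ e → Measurable (A e)) → Measurable (λ ω → ∃[ e ] A e ω)
    edges A a = resp
      {λ ω → ∃[ i ] ∃[ j ] Σ[ i<j ∈ i Fin.< j ] A (i , j , i<j) ω}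
      ((λ (i , j , i<j , x) → (i , j , i<j) , x) , λ ((i , j , i<j) , x) → i , j , i<j , x)
      (measurable-Fin λ i → measurable-Fin λ j → measurable-irrelevant {A = λ i<j → A (i , j , i<j)} ℕₚ.<-irrelevant λ i<j → a (i , j , i<j))

    pair : ∀ e f → Measurable (Pair e f)
    pair e@(i , j , _) f@(k , l , _) = measurable-∩ (measurable-const (e ≢ f)) (measurable-∩ (meets-measurable (z i) (z j) (z k) (z l))
      (resp {λ ω → (HasColour red (Z i ω) (Z j ω) × HasColour red (Z k ω) (Z l ω)) ⊎ (HasColour blue (Z i ω) (Z j ω) × HasColour blue (Z k ω) (Z l ω))}
        ([ (λ x → red , x) , (λ x → blue , x) ]′ , λ { (red , x) → inj₁ x ; (blue , x) → inj₂ x })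
        (measurable-∪ (measurable-∩ (hasColour-measurable red (z i) (z j)) (hasColour-measurable red (z k) (z l)))
                      (measurable-∩ (hasColour-measurable blue (z i) (z j)) (hasColour-measurable blue (z k) (z l))))))

-- Half-planes and the coordinates of random points

module HalfPlanes (em : ExcludedMiddle 0ℓ) {ℝ : CompleteOrderedField} (𝓟 : ProbabilitySpace ℝ) where
  open CompleteOrderedField ℝ hiding (zero)
  open IntegerRingSolver ℝ
  open FieldProperties ℝ
  open Plane ℝ hiding (resp; complement; union)
  private module B = Plane ℝ
  open Random 𝓟
  open MeasurableFunctions em 𝓟
  open MeasurableCrossing em 𝓟
  open ProbabilitySpace 𝓟

  private
    bound : ∀ x y → ∃[ n ] ((- fromℕ n ≤ x) × (x ≤ fromℕ n)) × ((- fromℕ n ≤ y) × (y ≤ fromℕ n))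
    bound x y = combine (archimedean em (x * x + 1#)) (archimedean em (y * y + 1#))
      where
      open Rationals em ℝ using (abs-bound⁺; abs-bound⁻)
      within : ∀ {x} m n → x * x + 1# < fromℕ m → m ℕ.≤ n → (- fromℕ n ≤ x) × (x ≤ fromℕ n)
      within {x} m n x²+1<m m≤n =
        inj₁ (pos-sub (pos-resp (solve 2 (λ x n → (n ⊖ (x ⊗ x ⊕ :1)) ⊕ (x ⊗ x ⊕ :1 ⊕ x) := x ⊖ ⊝ n) refl x (fromℕ n))
          (+-pos (sub-pos (<-≤-trans x²+1<m (fromℕ-mono-≤ m≤n))) (abs-bound⁺ x)))) ,
        inj₁ (pos-sub (pos-resp (solve 2 (λ x n → (n ⊖ (x ⊗ x ⊕ :1)) ⊕ (x ⊗ x ⊕ :1 ⊖ x) := n ⊖ x) refl x (fromℕ n))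
          (+-pos (sub-pos (<-≤-trans x²+1<m (fromℕ-mono-≤ m≤n))) (abs-bound⁻ x))))
      combine : ∃[ m ] x * x + 1# < fromℕ m → ∃[ n ] y * y + 1# < fromℕ n →
        ∃[ n ] ((- fromℕ n ≤ x) × (x ≤ fromℕ n)) × ((- fromℕ n ≤ y) × (y ≤ fromℕ n))
      combine (m , p) (n , q) = m ℕ.+ n , within m (m ℕ.+ n) p (ℕₚ.m≤m+n m n) , within n (m ℕ.+ n) q (ℕₚ.m≤n+m n m)

    left right lower upper : ∀ c → Pred Point 0ℓ
    left  c p = proj₁ p ≤ c
    right c p = c ≤ proj₁ p
    lower c p = proj₂ p ≤ c
    upper c p = c ≤ proj₂ p

    -- The generating rectangles are bounded, so a half-plane is exhausted by rectangles whose other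
    -- three sides recede to infinity.
    left-borel : ∀ c → Borel (left c)
    left-borel c = B.resp ((λ (n , (_ , x≤c) , _) → x≤c) , λ {p} x≤c → let (n , (a , _) , b) = bound (proj₁ p) (proj₂ p) in n , (a , x≤c) , b)
      (B.union λ n → rectangle (- fromℕ n) c (- fromℕ n) (fromℕ n))

    right-borel : ∀ c → Borel (right c)
    right-borel c = B.resp ((λ (n , (c≤x , _) , _) → c≤x) , λ {p} c≤x → let (n , (_ , a) , b) = bound (proj₁ p) (proj₂ p) in n , (c≤x , a) , b)
      (B.union λ n → rectangle c (fromℕ n) (- fromℕ n) (fromℕ n))

    lower-borel : ∀ c → Borel (lower c)
    lower-borel c = B.resp ((λ (n , _ , (_ , y≤c)) → y≤c) , λ {p} y≤c → let (n , a , (b , _)) = bound (proj₁ p) (proj₂ p) in n , a , (b , y≤c))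
      (B.union λ n → rectangle (- fromℕ n) (fromℕ n) (- fromℕ n) c)

    upper-borel : ∀ c → Borel (upper c)
    upper-borel c = B.resp ((λ (n , _ , (c≤y , _)) → c≤y) , λ {p} c≤y → let (n , a , (_ , b)) = bound (proj₁ p) (proj₂ p) in n , a , (c≤y , b))
      (B.union λ n → rectangle (- fromℕ n) (fromℕ n) c (fromℕ n))

  randomPoint-measurable : ∀ Z → MeasurablePoint (value Z)
  randomPoint-measurable Z = record
    { x-measurable = record
      { above = λ c → resp (≰⇒> , <⇒≱) (complement (measurable Z (left-borel c)))
      ; below = λ c → resp (≰⇒> , <⇒≱) (complement (measurable Z (right-borel c))) }
    ; y-measurable = record
      { above = λ c → resp (≰⇒> , <⇒≱) (complement (measurable Z (lower-borel c)))
      ; below = λ c → resp (≰⇒> , <⇒≱) (complement (measurable Z (upper-borel c))) } }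

-- Union bound over quadruples of cells

module GridBound (em : ExcludedMiddle 0ℓ) {ℝ : CompleteOrderedField} (𝓟 : ProbabilitySpace ℝ)
  (Z : Fin 4 → Random.RandomPoint 𝓟) (independent : Random.Independent 𝓟 Z)
  (uniform : ∀ i → Random.UniformOnUnitSquare 𝓟 (Z i)) where
  open CompleteOrderedField ℝ hiding (zero)
  open IntegerRingSolver ℝ
  open FieldProperties ℝ
  open Plane ℝ hiding (resp; complement; union)
  open Random 𝓟
  open ProbabilitySpace 𝓟
  open Events em 𝓟
  open Rationals em ℝ
  open Sums using (∑⁴)
  open Indicators em
  open Cells em ℝ using (count)

  private
    0≤1 : 0# ≤ 1#
    0≤1 = inj₁ 0<1

    unit-square : Pred Point 0ℓ
    unit-square = Rectangle 0# 1# 0# 1#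

    Outside : Fin 4 → Pred Ω 0ℓ
    Outside k = ∁ (value (Z k) ⊢ unit-square)

    outside-measurable : ∀ k → Measurable (Outside k)
    outside-measurable k = complement (measurable (Z k) (rectangle 0# 1# 0# 1#))

    outside-null : ∀ k → ℙ (outside-measurable k) ≈ 0#
    outside-null k = sym (sub-zero (trans (solve 2 (λ p q → q ⊖ :0 := (p ⊕ q) ⊖ p) refl (ℙ inside) (ℙ (outside-measurable k)))
      (trans (+-cong (ℙ-complement inside) (-‿cong (uniform k 0# 1# 0# 1# ≤-refl 0≤1 ≤-refl ≤-refl 0≤1 ≤-refl)))
        (solve 0 (:1 ⊖ (:1 ⊖ :0) ⊗ (:1 ⊖ :0) := :0) refl))))
      where
      inside = measurable (Z k) (rectangle 0# 1# 0# 1#)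

  -- The unit square is cut into (1 + m)² cells of side ν m = 1/(1 + m).
  module _ (m : ℕ) where
    private
      n = suc m

    -- Neighbouring slices share their borders: uniformity is stated for closed rectangles, and a
    -- union bound tolerates the overlap.
    Slice : ℕ → Carrier → Set
    Slice i x = (fromℕ i * ν m ≤ x) × (x ≤ fromℕ (suc i) * ν m)

    InCell : Fin 4 → ℕ → ℕ → Pred Ω 0ℓ
    InCell k i j ω = Slice i (proj₁ (value (Z k) ω)) × Slice j (proj₂ (value (Z k) ω))

    private
      slice-exists : ∀ {x} → 0# ≤ x → x ≤ 1# → ∃[ i ] (i ℕ.< n × Slice i x)
      slice-exists {x} 0≤x x≤1 = choose (floor (*-nonneg 0≤x (fromℕ-nonneg n)))
        where
        choose : ∃[ k ] (fromℕ k ≤ x * fromℕ n × x * fromℕ n < fromℕ (suc k)) → ∃[ i ] (i ℕ.< n × Slice i x)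
        choose (k , k≤ , <1+k) with k ℕₚ.<? n
        ... | yes k<n = k , k<n , scaled m k k≤ , inj₁ (scaled-< m (suc k) <1+k)
        -- Only x = 1 has a floor as large as n; it is put into the last slice.
        ... | no k≮n  = m , ℕₚ.≤-refl ,
              scaled m m (≤-trans (fromℕ-mono-≤ (ℕₚ.≤-trans (ℕₚ.n≤1+n m) (ℕₚ.≮⇒≥ k≮n))) k≤) ,
              ≤-respʳ-≈ (sym (ν-inverse m)) x≤1

      Column Row : Fin 4 → ℕ → Pred Ω 0ℓ
      Column k i = value (Z k) ⊢ Rectangle (fromℕ i * ν m) (fromℕ (suc i) * ν m) 0# 1#
      Row    k j = value (Z k) ⊢ Rectangle 0# 1# (fromℕ j * ν m) (fromℕ (suc j) * ν m)

      column-measurable : ∀ k i → Measurable (Column k i)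
      column-measurable k i = measurable (Z k) (rectangle _ _ _ _)

      row-measurable : ∀ k j → Measurable (Row k j)
      row-measurable k j = measurable (Z k) (rectangle _ _ _ _)

      column-cover : ∀ k ω → Outside k ω ⊎ ∃[ i ] (i ℕ.< n × Column k i ω)
      column-cover k ω with em {unit-square (value (Z k) ω)}
      ... | no out = inj₁ out
      ... | yes ((0≤x , x≤1) , y) = let (i , i<n , s) = slice-exists 0≤x x≤1 in inj₂ (i , i<n , s , y)

      row-cover : ∀ k ω → Outside k ω ⊎ ∃[ j ] (j ℕ.< n × Row k j ω)
      row-cover k ω with em {unit-square (value (Z k) ω)}
      ... | no out = inj₁ out
      ... | yes (x , (0≤y , y≤1)) = let (j , j<n , s) = slice-exists 0≤y y≤1 in inj₂ (j , j<n , x , s)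

    -- n⁻⁸ in the shape to which `∏` over four points unfolds, including the final `1#`.
    cell-volume : Carrier
    cell-volume = (ν m * ν m) * ((ν m * ν m) * ((ν m * ν m) * ((ν m * ν m) * 1#)))

    private
      cell-bounds : ∀ {i} → i ℕ.< n → (0# ≤ fromℕ i * ν m) × (fromℕ i * ν m ≤ fromℕ (suc i) * ν m) × (fromℕ (suc i) * ν m ≤ 1#)
      cell-bounds {i} i<n = *-nonneg (fromℕ-nonneg i) (inj₁ (ν-pos m)) ,
        *-monoˡ-≤ (ν m) (inj₁ (ν-pos m)) (fromℕ-mono-≤ (ℕₚ.n≤1+n i)) ,
        ≤-respʳ-≈ (ν-inverse m) (*-monoˡ-≤ (ν m) (inj₁ (ν-pos m)) (fromℕ-mono-≤ i<n))

      cell-borel : ∀ i j → Borel (Rectangle (fromℕ i * ν m) (fromℕ (suc i) * ν m) (fromℕ j * ν m) (fromℕ (suc j) * ν m))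
      cell-borel i j = rectangle _ _ _ _

      cell-probability : ∀ k {i j} → i ℕ.< n → j ℕ.< n → ℙ (measurable (Z k) (cell-borel i j)) ≈ ν m * ν m
      cell-probability k {i} {j} i<n j<n = trans
        (uniform k _ _ _ _ (proj₁ (cell-bounds i<n)) (proj₁ (proj₂ (cell-bounds i<n))) (proj₂ (proj₂ (cell-bounds i<n)))
          (proj₁ (cell-bounds j<n)) (proj₁ (proj₂ (cell-bounds j<n))) (proj₂ (proj₂ (cell-bounds j<n))))
        (solve 3 (λ i j v → ((:1 ⊕ i) ⊗ v ⊖ i ⊗ v) ⊗ ((:1 ⊕ j) ⊗ v ⊖ j ⊗ v) := v ⊗ v) refl (fromℕ i) (fromℕ j) (ν m))

      module _ (i j : Fin 4 → ℕ) (i<n : ∀ k → i k ℕ.< n) (j<n : ∀ k → j k ℕ.< n) where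
        all-measurable : Measurable (⋂ (Fin 4) λ k → InCell k (i k) (j k))
        all-measurable = measurable-⋂Fin λ k → measurable (Z k) (cell-borel (i k) (j k))

        all-probability : ℙ all-measurable ≈ cell-volume
        all-probability = trans
          (independent (λ k → Rectangle (fromℕ (i k) * ν m) (fromℕ (suc (i k)) * ν m) (fromℕ (j k) * ν m) (fromℕ (suc (j k)) * ν m))
            (λ k → cell-borel (i k) (j k)) all-measurable)
          (*-cong (cell-probability 0F (i<n 0F) (j<n 0F)) (*-cong (cell-probability 1F (i<n 1F) (j<n 1F))
            (*-cong (cell-probability 2F (i<n 2F) (j<n 2F)) (*-cong (cell-probability 3F (i<n 3F) (j<n 3F)) refl))))

    0<cell-volume : 0# < cell-volume
    0<cell-volume = *-pos 0<ν² (*-pos 0<ν² (*-pos 0<ν² (*-pos 0<ν² 0<1)))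
      where
      0<ν² = *-pos (ν-pos m) (ν-pos m)

    -- Each use of `ℙ-cover` splits by the column or row of one point and opens one sum, so the
    -- eight splittings follow the order of the sums in `count`. A piece that remains lies in a
    -- product of four cells, whose probability is known by independence.
    grid-bound : ∀ {G} (g : Measurable G) (X : (p q r s P Q R S : ℕ) → Set) →
      (∀ ω p q r s P Q R S → p ℕ.< n → q ℕ.< n → r ℕ.< n → s ℕ.< n → P ℕ.< n → Q ℕ.< n → R ℕ.< n → S ℕ.< n →
        G ω → InCell 0F p P ω → InCell 1F q Q ω → InCell 2F r R ω → InCell 3F s S ω → X p q r s P Q R S) →
      ℙ g ≤ fromℕ (count n X) * cell-volume
    grid-bound {G} g X inside =
      columns 0F g _ λ p p<n → columns 1F (measurable-∩ g (cm 0F p)) _ λ q q<n →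
      columns 2F (measurable-∩ (measurable-∩ g (cm 0F p)) (cm 1F q)) _ λ r r<n →
      columns 3F (measurable-∩ (measurable-∩ (measurable-∩ g (cm 0F p)) (cm 1F q)) (cm 2F r)) _ λ s s<n →
      let g₄ = measurable-∩ (measurable-∩ (measurable-∩ (measurable-∩ g (cm 0F p)) (cm 1F q)) (cm 2F r)) (cm 3F s) in
      rows 0F g₄ _ λ P P<n → rows 1F (measurable-∩ g₄ (rm 0F P)) _ λ Q Q<n →
      rows 2F (measurable-∩ (measurable-∩ g₄ (rm 0F P)) (rm 1F Q)) _ λ R R<n →
      rows 3F (measurable-∩ (measurable-∩ (measurable-∩ g₄ (rm 0F P)) (rm 1F Q)) (rm 2F R)) _ λ S S<n →
      last p q r s P Q R S p<n q<n r<n s<n P<n Q<n R<n S<n (em {X p q r s P Q R S})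
        (measurable-∩ (measurable-∩ (measurable-∩ (measurable-∩ g₄ (rm 0F P)) (rm 1F Q)) (rm 2F R)) (rm 3F S))
      where
      cm = column-measurable
      rm = row-measurable
      columns : ∀ k {A : Pred Ω 0ℓ} (a : Measurable A) c → (∀ i → i ℕ.< n → ℙ (measurable-∩ a (cm k i)) ≤ fromℕ (c i) * cell-volume) →
        ℙ a ≤ fromℕ (Sums.∑ n c) * cell-volume
      columns k a c = ℙ-cover n a (outside-measurable k) (cm k) c (outside-null k) λ {ω} _ → column-cover k ω
      rows : ∀ k {A : Pred Ω 0ℓ} (a : Measurable A) c → (∀ i → i ℕ.< n → ℙ (measurable-∩ a (rm k i)) ≤ fromℕ (c i) * cell-volume) →
        ℙ a ≤ fromℕ (Sums.∑ n c) * cell-volume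
      rows k a c = ℙ-cover n a (outside-measurable k) (rm k) c (outside-null k) λ {ω} _ → row-cover k ω

      Piece : (p q r s P Q R S : ℕ) → Pred Ω 0ℓ
      Piece p q r s P Q R S = (((((((G ∩ Column 0F p) ∩ Column 1F q) ∩ Column 2F r) ∩ Column 3F s) ∩ Row 0F P) ∩ Row 1F Q) ∩ Row 2F R) ∩ Row 3F S

      in-cells : ∀ p q r s P Q R S {ω} → Piece p q r s P Q R S ω →
        G ω × InCell 0F p P ω × InCell 1F q Q ω × InCell 2F r R ω × InCell 3F s S ω
      in-cells _ _ _ _ _ _ _ _ ((((((((x , (p , _)) , (q , _)) , (r , _)) , (s , _)) , (_ , P)) , (_ , Q)) , (_ , R)) , (_ , S)) =
        x , (p , P) , (q , Q) , (r , R) , (s , S)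

      last : ∀ p q r s P Q R S → p ℕ.< n → q ℕ.< n → r ℕ.< n → s ℕ.< n → P ℕ.< n → Q ℕ.< n → R ℕ.< n → S ℕ.< n →
        Dec (X p q r s P Q R S) → (e : Measurable (Piece p q r s P Q R S)) → ℙ e ≤ fromℕ ⟦ X p q r s P Q R S ⟧ * cell-volume
      last p q r s P Q R S p<n q<n r<n s<n P<n Q<n R<n S<n (yes x) e = ≤-trans
        (ℙ-mono e (all-measurable i j i<n j<n) λ y k → cells y k)
        (≤-trans (inj₂ (all-probability i j i<n j<n))
          (inj₂ (trans (solve 1 (λ v → v := (:1 ⊕ :0) ⊗ v) refl cell-volume) (*-congʳ (fromℕ-cong (≡.sym (⟦⟧-yes x)))))))
        where
        i j : Fin 4 → ℕ
        i = p ∷ q ∷ r ∷ s ∷ []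
        j = P ∷ Q ∷ R ∷ S ∷ []
        i<n : ∀ k → i k ℕ.< n
        i<n 0F = p<n
        i<n 1F = q<n
        i<n 2F = r<n
        i<n 3F = s<n
        j<n : ∀ k → j k ℕ.< n
        j<n 0F = P<n
        j<n 1F = Q<n
        j<n 2F = R<n
        j<n 3F = S<n
        cells : ∀ {ω} → Piece p q r s P Q R S ω → ∀ k → InCell k (i k) (j k) ω
        cells y 0F = proj₁ (proj₂ (in-cells p q r s P Q R S y))
        cells y 1F = proj₁ (proj₂ (proj₂ (in-cells p q r s P Q R S y)))
        cells y 2F = proj₁ (proj₂ (proj₂ (proj₂ (in-cells p q r s P Q R S y))))
        cells y 3F = proj₂ (proj₂ (proj₂ (proj₂ (in-cells p q r s P Q R S y))))
      last p q r s P Q R S p<n q<n r<n s<n P<n Q<n R<n S<n (no ¬x) e = inj₂ (trans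
        (ℙ-cong e measurable-∅ ((λ {ω} y → ¬x (let (x , a , b , c , d) = in-cells p q r s P Q R S y in inside ω p q r s P Q R S p<n q<n r<n s<n P<n Q<n R<n S<n x a b c d)) , λ ()))
        (trans ℙ-∅ (sym (trans (*-congʳ (fromℕ-cong (⟦⟧-no ¬x))) (zeroˡ cell-volume)))))

-- Cells met by the event and by its complement

module CellCounts (em : ExcludedMiddle 0ℓ) (ℝ : CompleteOrderedField) where
  open Sums
  open Asymptotics
  open Indicators em
  open Cells em ℝ
  open CrossingCount em ℝ

  Volume Error : ℕ → ℕ
  Volume n = n ^ 4 ℕ.* n ^ 4
  Error n = n ^ 4 ℕ.* n ^ 3

  -- Bad cells are charged to both sides, so nothing needs to be known about the event on them; they
  -- are too few to matter in the limit.
  Cross? NoCross? : ℕ → (p q r s P Q R S : ℕ) → Set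
  Cross? n p q r s P Q R S = SomeGridCross p q r s P Q R S ⊎ Bad n p q r s P Q R S
  NoCross? n p q r s P Q R S = (¬ SomeGridCross p q r s P Q R S) ⊎ Bad n p q r s P Q R S

  private
    k : ℕ
    k = proj₁ someCrossings-≋

    NoCross : (p q r s P Q R S : ℕ) → Set
    NoCross p q r s P Q R S = ¬ SomeGridCross p q r s P Q R S

    complementary : ∀ n → count n NoCross ℕ.+ someCrossings n ≡ Volume n
    complementary n = ≡.trans (≡.sym (≡.trans (∑⁴-cong n λ p q r s → ∑⁴-+ n _ _) (∑⁴-+ n _ _)))
      (≡.trans (∑⁴-cong n λ p q r s → ≡.trans (∑⁴-cong n λ P Q R S → one (SomeGridCross p q r s P Q R S))
        (≡.trans (∑⁴-const n 1) (ℕₚ.*-identityʳ (n ^ 4))))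
        (∑⁴-const n (n ^ 4)))
      where
      one : ∀ P → ⟦ ¬ P ⟧ ℕ.+ ⟦ P ⟧ ≡ 1
      one P with em {P}
      ... | yes p = ≡.cong (ℕ._+ 1) (⟦⟧-no λ ¬p → ¬p p)
      ... | no ¬p = ≡.cong (ℕ._+ 0) (⟦⟧-yes ¬p)

    -- 304 is 4 · 76 from `bad-bound`; the error of the asymptotic count is enlarged by the factor M
    -- so that both merge.
    with-bad : ∀ M a X .{{_ : ℕ.NonZero M}} → let n = M ℕ.* M in
      4 ℕ.* count n X ℕ.≤ a ℕ.* Volume n ℕ.+ k ℕ.* Error n →
      4 ℕ.* count n (λ p q r s P Q R S → X p q r s P Q R S ⊎ Bad n p q r s P Q R S) ℕ.≤
      a ℕ.* Volume n ℕ.+ (k ℕ.+ 304) ℕ.* (M ℕ.* Error n)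
    with-bad M a X le = ℕₚ.≤-trans (ℕₚ.*-monoʳ-≤ 4 (count-⊎ n X (Bad n) ℕₚ.≤-refl (bad-bound M)))
      (ℕₚ.≤-trans (ℕₚ.≤-reflexive (expand (count n X) (M ℕ.* Error n)))
      (ℕₚ.≤-trans (ℕₚ.+-monoˡ-≤ (304 ℕ.* (M ℕ.* Error n)) (ℕₚ.≤-trans le (ℕₚ.+-monoʳ-≤ (a ℕ.* Volume n) (ℕₚ.*-monoʳ-≤ k (ℕₚ.m≤n*m (Error n) M)))))
        (ℕₚ.≤-reflexive (collect (a ℕ.* Volume n) k (M ℕ.* Error n)))))
      where
      n = M ℕ.* M
      expand : ∀ c e → 4 ℕ.* (c ℕ.+ 76 ℕ.* e) ≡ 4 ℕ.* c ℕ.+ 304 ℕ.* e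
      expand = solve-∀
      collect : ∀ v k e → v ℕ.+ k ℕ.* e ℕ.+ 304 ℕ.* e ≡ v ℕ.+ (k ℕ.+ 304) ℕ.* e
      collect = solve-∀

  cross-count : ∃[ K ] ∀ M .{{_ : ℕ.NonZero M}} → let n = M ℕ.* M in
    4 ℕ.* count n (Cross? n) ℕ.≤ 1 ℕ.* Volume n ℕ.+ K ℕ.* (M ℕ.* Error n)
  cross-count = k ℕ.+ 304 , λ M → with-bad M 1 SomeGridCross
    (ℕₚ.≤-trans (upper (proj₂ someCrossings-≋ (M ℕ.* M)))
      (ℕₚ.≤-reflexive (≡.cong (ℕ._+ k ℕ.* Error (M ℕ.* M)) (≡.sym (ℕₚ.*-identityˡ (Volume (M ℕ.* M)))))))

  noCross-count : ∃[ K ] ∀ M .{{_ : ℕ.NonZero M}} → let n = M ℕ.* M in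
    4 ℕ.* count n (NoCross? n) ℕ.≤ 3 ℕ.* Volume n ℕ.+ K ℕ.* (M ℕ.* Error n)
  noCross-count = k ℕ.+ 304 , λ M → with-bad M 3 NoCross (bound (M ℕ.* M))
    where
    bound : ∀ n → 4 ℕ.* count n NoCross ℕ.≤ 3 ℕ.* Volume n ℕ.+ k ℕ.* Error n
    bound n = ℕₚ.+-cancelʳ-≤ (4 ℕ.* c) _ _ (ℕₚ.≤-trans
      (ℕₚ.≤-reflexive (≡.trans (≡.sym (ℕₚ.*-distribˡ-+ 4 (count n NoCross) c)) (≡.trans (≡.cong (4 ℕ.*_) (complementary n))
        (ℕₚ.+-comm (Volume n) (3 ℕ.* Volume n)))))
      (ℕₚ.≤-trans (ℕₚ.+-monoʳ-≤ (3 ℕ.* Volume n) (lower (proj₂ someCrossings-≋ n)))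
        (ℕₚ.≤-reflexive (regroup (3 ℕ.* Volume n) (4 ℕ.* c) (k ℕ.* Error n)))))
      where
      c = someCrossings n
      regroup : ∀ v c e → v ℕ.+ (c ℕ.+ e) ≡ v ℕ.+ e ℕ.+ c
      regroup = solve-∀

-- Passage to the limit

module Conclusion (em : ExcludedMiddle 0ℓ) {ℝ : CompleteOrderedField} (𝓟 : ProbabilitySpace ℝ)
  (Z : Fin 4 → Random.RandomPoint 𝓟) (independent : Random.Independent 𝓟 Z)
  (uniform : ∀ i → Random.UniformOnUnitSquare 𝓟 (Z i)) where
  open CompleteOrderedField ℝ hiding (zero)
  open IntegerRingSolver ℝ
  open FieldProperties ℝ
  open Plane ℝ hiding (resp; complement; union)
  open Orientation ℝ
  open Segments ℝ
  open Agreement ℝ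
  open Random 𝓟
  open ProbabilitySpace 𝓟
  open Events em 𝓟
  open Rationals em ℝ
  open MeasurableCrossing em 𝓟
  open HalfPlanes em 𝓟
  open Cells em ℝ
  open CrossingCount em ℝ
  open CellCounts em ℝ
  open GridBound em 𝓟 Z independent uniform

  crossing-measurable : Measurable (MonochromaticCrossing Z)
  crossing-measurable = monochromaticCrossing-measurable λ i → randomPoint-measurable (Z i)

  private
    scale : Carrier → Point → Point
    scale k (x , y) = k * x , k * y

    slice⇒near : ∀ m i {x} → Slice m i x → Near (fromℕ (suc m) * x) i
    slice⇒near m i {x} (lo , hi) =
      ≤-respˡ-≈ (cancel (fromℕ i)) (≤-respʳ-≈ (*-comm x _) (*-monoˡ-≤ (fromℕ (suc m)) (fromℕ-nonneg (suc m)) lo)) ,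
      ≤-respʳ-≈ (cancel (fromℕ (suc i))) (≤-respˡ-≈ (*-comm x _) (*-monoˡ-≤ (fromℕ (suc m)) (fromℕ-nonneg (suc m)) hi))
      where
      cancel : ∀ k → k * ν m * fromℕ (suc m) ≈ k
      cancel k = trans (*-assoc k _ _) (trans (*-congˡ (trans (*-comm _ _) (ν-inverse m))) (*-identityʳ k))

    -- Scaling the unit square by n turns the cells into unit squares with lattice corners and
    -- multiplies every orientation and rise by n², which does not affect signs.
    descale : ∀ {k x y z} → 0# < k → x ≈ (k * k) * y → SameSign x z → SameSign y z
    descale {k} 0<k e (both-positive p q) = both-positive (*-cancel-pos (pos-resp e p) (*-pos 0<k 0<k)) q
    descale {k} {x} {y} 0<k e (both-negative p q) = both-negative (*-cancel-pos
      (pos-resp (trans (-‿cong e) (solve 2 (λ k y → ⊝ (k ⊗ y) := k ⊗ ⊝ y) refl (k * k) y)) p) (*-pos 0<k 0<k)) q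

    orient-scale : ∀ k P Q R → orient (scale k P) (scale k Q) (scale k R) ≈ (k * k) * orient P Q R
    orient-scale k (px , py) (qx , qy) (rx , ry) = solve 7 (λ k px py qx qy rx ry →
      (k ⊗ qx ⊖ k ⊗ px) ⊗ (k ⊗ ry ⊖ k ⊗ py) ⊖ (k ⊗ qy ⊖ k ⊗ py) ⊗ (k ⊗ rx ⊖ k ⊗ px) :=
      k ⊗ k ⊗ ((qx ⊖ px) ⊗ (ry ⊖ py) ⊖ (qy ⊖ py) ⊗ (rx ⊖ px))) refl k px py qx qy rx ry

    rise-scale : ∀ k P Q → rise (scale k P) (scale k Q) ≈ (k * k) * rise P Q
    rise-scale k (px , py) (qx , qy) = solve 5 (λ k px py qx qy →
      (k ⊗ qx ⊖ k ⊗ px) ⊗ (k ⊗ qy ⊖ k ⊗ py) := k ⊗ k ⊗ ((qx ⊖ px) ⊗ (qy ⊖ py))) refl k px py qx qy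

    agree-descale : ∀ {k} → 0# < k → ∀ P Q R S {P′ Q′ R′ S′} →
      Agree (scale k P) (scale k Q) (scale k R) (scale k S) P′ Q′ R′ S′ → Agree P Q R S P′ Q′ R′ S′
    agree-descale {k} 0<k P Q R S a = record
      { PQR = descale 0<k (orient-scale k P Q R) PQR ; PQS = descale 0<k (orient-scale k P Q S) PQS
      ; PRS = descale 0<k (orient-scale k P R S) PRS ; QRS = descale 0<k (orient-scale k Q R S) QRS
      ; PQ = descale 0<k (rise-scale k P Q) PQ ; PR = descale 0<k (rise-scale k P R) PR ; PS = descale 0<k (rise-scale k P S) PS
      ; QR = descale 0<k (rise-scale k Q R) QR ; QS = descale 0<k (rise-scale k Q S) QS ; RS = descale 0<k (rise-scale k R S) RS }
      where open Agree a

    cell-agree : ∀ m ω p q r s P Q R S →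
      p ℕ.< suc m → q ℕ.< suc m → r ℕ.< suc m → s ℕ.< suc m → P ℕ.< suc m → Q ℕ.< suc m → R ℕ.< suc m → S ℕ.< suc m →
      InCell m 0F p P ω → InCell m 1F q Q ω → InCell m 2F r R ω → InCell m 3F s S ω →
      ¬ Bad (suc m) p q r s P Q R S →
      Agree (value (Z 0F) ω) (value (Z 1F) ω) (value (Z 2F) ω) (value (Z 3F) ω)
            (gridPoint p P) (gridPoint q Q) (gridPoint r R) (gridPoint s S)
    cell-agree m ω p q r s P Q R S p< q< r< s< P< Q< R< S< c₀ c₁ c₂ c₃ good =
      agree-descale (fromℕ-pos {suc m} (s≤s z≤n)) _ _ _ _
        (agree-near (suc m) p< q< r< s< P< Q< R< S< (near p P c₀) (near q Q c₁) (near r R c₂) (near s S c₃) good)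
      where
      near : ∀ i j {z : Point} → Slice m i (proj₁ z) × Slice m j (proj₂ z) → NearPoint (scale (fromℕ (suc m)) z) i j
      near i j (x , y) = slice⇒near m i x , slice⇒near m j y

    decide : ∀ {A B : Set} → Dec B → (¬ B → A) → A ⊎ B
    decide (yes b) _ = inj₂ b
    decide (no ¬b) f = inj₁ (f ¬b)

    crossing-bound : ∀ m → ℙ crossing-measurable ≤ fromℕ (count (suc m) (Cross? (suc m))) * cell-volume m
    crossing-bound m = grid-bound m crossing-measurable (Cross? (suc m))
      λ ω p q r s P Q R S p< q< r< s< P< Q< R< S< crossing c₀ c₁ c₂ c₃ → decide (em {Bad (suc m) p q r s P Q R S}) λ good →
        let agree = cell-agree m ω p q r s P Q R S p< q< r< s< P< Q< R< S< c₀ c₁ c₂ c₃ good in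
        someMonoCross-agree agree (⇒someMonoCross (λ i → value (Z i) ω) (agree⇒generalPosition agree) crossing)

    no-crossing-bound : ∀ m → ℙ (complement crossing-measurable) ≤ fromℕ (count (suc m) (NoCross? (suc m))) * cell-volume m
    no-crossing-bound m = grid-bound m (complement crossing-measurable) (NoCross? (suc m))
      λ ω p q r s P Q R S p< q< r< s< P< Q< R< S< no-crossing c₀ c₁ c₂ c₃ → decide (em {Bad (suc m) p q r s P Q R S}) λ good x →
        let agree = cell-agree m ω p q r s P Q R S p< q< r< s< P< Q< R< S< c₀ c₁ c₂ c₃ good in
        no-crossing (someMonoCross⇒ (λ i → value (Z i) ω) (someMonoCross-agree (agree-sym agree) x))

    volume-one : ∀ m → fromℕ (Volume (suc m)) * cell-volume m ≈ 1#
    volume-one m = trans (*-congʳ (trans (fromℕ-* (suc m ^ 4) (suc m ^ 4)) (*-cong power power)))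
      (trans (solve 2 (λ a v → (a ⊗ (a ⊗ (a ⊗ (a ⊗ (:1 ⊕ :0))))) ⊗ (a ⊗ (a ⊗ (a ⊗ (a ⊗ (:1 ⊕ :0))))) ⊗
        ((v ⊗ v) ⊗ ((v ⊗ v) ⊗ ((v ⊗ v) ⊗ ((v ⊗ v) ⊗ :1)))) :=
        ((a ⊗ v ⊗ (a ⊗ v)) ⊗ (a ⊗ v ⊗ (a ⊗ v))) ⊗ ((a ⊗ v ⊗ (a ⊗ v)) ⊗ (a ⊗ v ⊗ (a ⊗ v)))) refl (fromℕ (suc m)) (ν m))
        (squared (squared (squared (ν-inverse m)))))
      where
      squared : ∀ {x} → x ≈ 1# → x * x ≈ 1#
      squared e = trans (*-cong e e) (*-identityˡ 1#)
      power : fromℕ (suc m ^ 4) ≈ fromℕ (suc m) * (fromℕ (suc m) * (fromℕ (suc m) * (fromℕ (suc m) * fromℕ 1)))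
      power = trans (fromℕ-* (suc m) (suc m ^ 3)) (*-congˡ (trans (fromℕ-* (suc m) (suc m ^ 2)) (*-congˡ
        (trans (fromℕ-* (suc m) (suc m ^ 1)) (*-congˡ (fromℕ-* (suc m) 1))))))

    4# : Carrier
    4# = fromℕ 4

    -- With n = M² and n · Error n = Volume n, the bound is a + K/M.
    limit : ∀ {x} a (f : ℕ → ℕ) → (∀ m → x ≤ fromℕ (f (suc m)) * cell-volume m) →
      (∃[ K ] ∀ M .{{_ : ℕ.NonZero M}} → 4 ℕ.* f (M ℕ.* M) ℕ.≤ a ℕ.* Volume (M ℕ.* M) ℕ.+ K ℕ.* (M ℕ.* Error (M ℕ.* M))) →
      4# * x ≤ fromℕ a
    limit {x} a f bound (K , le) = ≮⇒≥ λ a<4x → absurd a<4x (archimedean em (fromℕ K * (4# * x - fromℕ a) ⁻¹))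
      where
      volume-error : ∀ M → M ℕ.* (M ℕ.* Error (M ℕ.* M)) ≡ Volume (M ℕ.* M)
      volume-error M = regroup M ((M ℕ.* M) ^ 4) ((M ℕ.* M) ^ 3)
        where
        regroup : ∀ M x y → M ℕ.* (M ℕ.* (x ℕ.* y)) ≡ x ℕ.* (M ℕ.* M ℕ.* y)
        regroup = solve-∀

      scaled-le : ∀ M .{{_ : ℕ.NonZero M}} → M ℕ.* (4 ℕ.* f (M ℕ.* M)) ℕ.≤ (M ℕ.* a ℕ.+ K) ℕ.* Volume (M ℕ.* M)
      scaled-le M = ℕₚ.≤-trans (ℕₚ.*-monoʳ-≤ M (le M)) (ℕₚ.≤-reflexive (≡.trans
        (expand M a (Volume (M ℕ.* M)) K (M ℕ.* Error (M ℕ.* M)))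
        (≡.trans (≡.cong (λ v → M ℕ.* a ℕ.* Volume (M ℕ.* M) ℕ.+ K ℕ.* v) (volume-error M))
          (≡.sym (ℕₚ.*-distribʳ-+ (Volume (M ℕ.* M)) (M ℕ.* a) K)))))
        where
        expand : ∀ M a v K e → M ℕ.* (a ℕ.* v ℕ.+ K ℕ.* e) ≡ M ℕ.* a ℕ.* v ℕ.+ K ℕ.* (M ℕ.* e)
        expand = solve-∀

      real-le : ∀ j → fromℕ (suc j) * (4# * x) ≤ fromℕ (suc j) * fromℕ a + fromℕ K
      real-le j = ≤-trans
        (≤-respˡ-≈ (*-comm (4# * x) (fromℕ M)) (≤-respʳ-≈ (*-comm _ (fromℕ M)) (*-monoˡ-≤ (fromℕ M) (fromℕ-nonneg M)
          (≤-respˡ-≈ (*-comm x 4#) (≤-respʳ-≈ (*-comm _ 4#) (*-monoˡ-≤ 4# (fromℕ-nonneg 4) (bound m)))))))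
        (≤-respˡ-≈ lhs (≤-respʳ-≈ rhs (*-monoˡ-≤ (cell-volume m) (inj₁ (0<cell-volume m)) (fromℕ-mono-≤ (scaled-le M)))))
        where
        M = suc j
        -- Chosen so that `suc m` computes to `M ℕ.* M`.
        m = j ℕ.+ j ℕ.* suc j
        lhs : fromℕ (M ℕ.* (4 ℕ.* f (M ℕ.* M))) * cell-volume m ≈ fromℕ M * (4# * (fromℕ (f (M ℕ.* M)) * cell-volume m))
        lhs = trans (*-congʳ (trans (fromℕ-* M (4 ℕ.* f (M ℕ.* M))) (*-congˡ (fromℕ-* 4 (f (M ℕ.* M))))))
          (solve 4 (λ M k f v → M ⊗ (k ⊗ f) ⊗ v := M ⊗ (k ⊗ (f ⊗ v))) refl (fromℕ M) 4# (fromℕ (f (M ℕ.* M))) (cell-volume m))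
        rhs : fromℕ ((M ℕ.* a ℕ.+ K) ℕ.* Volume (M ℕ.* M)) * cell-volume m ≈ fromℕ M * fromℕ a + fromℕ K
        rhs = trans (*-congʳ (fromℕ-* (M ℕ.* a ℕ.+ K) (Volume (M ℕ.* M)))) (trans (*-assoc _ _ _)
          (trans (*-congˡ (volume-one m)) (trans (*-identityʳ _) (trans (fromℕ-+ (M ℕ.* a) K) (+-congʳ (fromℕ-* M a))))))

      -- For M = j + 1 > K/(4x - a), the inequality M(4x - a) ≤ K of `real-le` fails.
      absurd : fromℕ a < 4# * x → ∃[ j ] fromℕ K * (4# * x - fromℕ a) ⁻¹ < fromℕ j → ⊥
      absurd a<4x (j , K/e<j) = <⇒≱
        (pos-sub (pos-resp (trans
          (solve 5 (λ j K i x a → (((:1 ⊕ j) ⊖ K ⊗ i) ⊗ (x ⊖ a)) ⊕ (K ⊗ ((x ⊖ a) ⊗ i) ⊖ K) := (:1 ⊕ j) ⊗ x ⊖ ((:1 ⊕ j) ⊗ a ⊕ K))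
            refl (fromℕ j) (fromℕ K) ((4# * x - fromℕ a) ⁻¹) (4# * x) (fromℕ a)) refl)
          (+-pos-nonneg (*-pos (sub-pos (<-trans K/e<j (fromℕ-mono-< (ℕₚ.n<1+n j)))) (sub-pos a<4x))
            (inj₂ (sym (trans (+-congʳ (trans (*-congˡ (*-inverseʳ (pos⇒≉0 (sub-pos a<4x)))) (*-identityʳ _))) (-‿inverseʳ _)))))))
        (real-le j)

    four-upper : 4# * ℙ crossing-measurable ≤ fromℕ 1
    four-upper = limit 1 (λ n → count n (Cross? n)) crossing-bound cross-count

    four-complement : 4# * ℙ (complement crossing-measurable) ≤ fromℕ 3
    four-complement = limit 3 (λ n → count n (NoCross? n)) no-crossing-bound noCross-count

  crossing-probability : ℙ crossing-measurable ≈ ¼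
  crossing-probability = trans (solve 1 (λ x → x := x ⊗ :1) refl x) (trans (*-congˡ (sym (*-inverseʳ four≉0)))
    (trans (solve 2 (λ x i → x ⊗ ((:1 ⊕ :1 ⊕ :1 ⊕ :1) ⊗ i) := (:1 ⊕ (:1 ⊕ (:1 ⊕ (:1 ⊕ :0)))) ⊗ x ⊗ i) refl x ¼)
      (trans (*-congʳ (trans four-x (solve 0 (:1 ⊕ :0 := :1) refl))) (*-identityˡ ¼))))
    where
    x y : Carrier
    x = ℙ crossing-measurable
    y = ℙ (complement crossing-measurable)
    four≉0 : ¬ (1# + 1# + 1# + 1# ≈ 0#)
    four≉0 = pos⇒≉0 (+-pos (+-pos (+-pos 0<1 0<1) 0<1) 0<1)
    -- The bound on the complement, read as 4x = 4 - 4y ≥ 4 - 3.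
    four-lower : fromℕ 1 ≤ 4# * x
    four-lower = nonneg-sub (nonneg-resp (trans
      (solve 2 (λ x y → (:1 ⊕ (:1 ⊕ (:1 ⊕ :0))) ⊖ (:1 ⊕ (:1 ⊕ (:1 ⊕ (:1 ⊕ :0)))) ⊗ y :=
        (:1 ⊕ (:1 ⊕ (:1 ⊕ (:1 ⊕ :0)))) ⊗ x ⊕ ((:1 ⊕ (:1 ⊕ (:1 ⊕ :0))) ⊖ (:1 ⊕ (:1 ⊕ (:1 ⊕ (:1 ⊕ :0)))) ⊗ (x ⊕ y))) refl x y)
      (+-congˡ (trans (+-congˡ (-‿cong (*-congˡ (ℙ-complement crossing-measurable))))
        (solve 0 ((:1 ⊕ (:1 ⊕ (:1 ⊕ :0))) ⊖ (:1 ⊕ (:1 ⊕ (:1 ⊕ (:1 ⊕ :0)))) ⊗ :1 := ⊝ (:1 ⊕ :0)) refl))))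
      (sub-nonneg four-complement))
    four-x : 4# * x ≈ fromℕ 1
    four-x = ≤-antisym four-upper four-lower

theorem1 : ExcludedMiddle 0ℓ →
    (ℝ : CompleteOrderedField) (𝓟 : ProbabilitySpace ℝ) →
    let open CompleteOrderedField ℝ
        open ProbabilitySpace 𝓟
        open Random 𝓟
    in
    (Z : Fin 4 → RandomPoint) →
    Independent Z →
    (∀ i → UniformOnUnitSquare (Z i)) →
    Σ[ m ∈ Measurable (MonochromaticCrossing Z) ] (ℙ m ≈ ¼)
theorem1 em ℝ 𝓟 Z independent uniform = crossing-measurable , crossing-probability
  where
  open Conclusion em 𝓟 Z independent uniform
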